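{- Let $f[0..n]$ and $g[0..m]$ be integer arrays. Suppose convex rational arrays $F[0..n]$, $G[0..m]$ satisfy $$0\le f_i-F_i\le\Delta_f\ (0\le i\le n),\qquad 0\le g_j-G_j\le\Delta_g\ (0\le j\le m).$$ Put $D=\Delta_f+\Delta_g$ and $N=n+m+2$. Then the min-plus convolution of $f$ and $g$ can be computed in $\widetilde O(N(D+1))$ time using output-sensitive nonnegative convolution. The algorithm is deterministic when the sparse-convolution primitive is deterministic.
   Context: The min-plus convolution of $f$ and $g$ is the array indexed by $0\le k\le n+m$ whose $k$-th entry is $\min_{i+j=k}(f_i+g_j)$. A finite array is convex if its adjacent differences are nondecreasing. The arrays $F,G$ need not be supplied to the algorithm. Output-sensitive (sparse) nonnegative convolution is a primitive that, for two finite sets $A,B$ of nonnegative integers, lists $A+B$ in time nearly linear in $s'=|A+B|$: a randomized version takes expected time $O(s'\log(s'+2))$ under the usual word-size assumptions, and a deterministic version takes time $s'\operatorname{polylog}U$ where $U$ bounds the coordinate universe. The result inherits the numerical/model assumptions of the primitive used; $\widetilde O$ suppresses polylogarithmic factors. -}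

module Defs where

open import Data.Bool.Base using (if_then_else_)
open import Data.Fin.Base as Fin using (Fin; toℕ; inject₁)
open import Data.Integer.Base as ℤ using (ℤ; +_; -[1+_]; 0ℤ; 1ℤ; ∣_∣)
import Data.Integer.Properties as ℤ
open import Data.List.Base
  using (List; []; _∷_; length; map; applyUpTo; deduplicate; cartesianProductWith)
open import Data.List.Relation.Binary.Permutation.Propositional using (_↭_)
open import Data.List.Relation.Unary.All using (All)
open import Data.List.Relation.Unary.Unique.Propositional using (Unique)
open import Data.Nat.Base as ℕ using (ℕ; zero; suc; _+_; _*_; _^_)
import Data.Nat.Properties as ℕ
open import Data.Nat.Logarithm using (⌊log₂_⌋)
open import Data.Product.Base using (_×_; _,_; proj₁; proj₂; ∃; ∃₂)
open import Data.Unit.Base using (⊤)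
open import Data.Rational.Base as ℚ using (ℚ; 0ℚ; 1ℚ; ceiling)
open import Data.Vec.Functional using (Vector; toList)
open import Function.Base using (_∘_)
open import Relation.Binary.PropositionalEquality using (_≡_; _≢_)
open import Relation.Nullary.Decidable using (⌊_⌋)

ℤ→ℚ : ℤ → ℚ
ℤ→ℚ z = z ℚ./ 1

ℕ→ℚ : ℕ → ℚ
ℕ→ℚ n = ℤ→ℚ (+ n)

------------------------------------------------------------------------
-- Arrays: an array indexed by 0..n is a Vector of length suc n

diff : ∀ {n} → Vector ℚ (suc n) → Vector ℚ n
diff F i = F (Fin.suc i) ℚ.- F (inject₁ i)

Convex : ∀ {n} → Vector ℚ (suc n) → Set
Convex F = ∀ i j → i Fin.≤ j → diff F i ℚ.≤ diff F j

ApproximatedBy : ∀ {n} → Vector ℤ n → Vector ℚ n → ℚ → Set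
ApproximatedBy f F Δ =
  ∀ i → 0ℚ ℚ.≤ ℤ→ℚ (f i) ℚ.- F i × ℤ→ℚ (f i) ℚ.- F i ℚ.≤ Δ

BoundedBy : ∀ {n} → ℕ → Vector ℤ n → Set
BoundedBy M f = ∀ i → ∣ f i ∣ ℕ.≤ M

IsMinPlusConvolution : ∀ {n m} → Vector ℤ (suc n) → Vector ℤ (suc m) →
                       Vector ℤ (suc (n + m)) → Set
IsMinPlusConvolution f g h = ∀ k →
  (∀ i j → toℕ i + toℕ j ≡ toℕ k → h k ℤ.≤ f i ℤ.+ g j) ×
  (∃₂ λ i j → toℕ i + toℕ j ≡ toℕ k × h k ≡ f i ℤ.+ g j)

------------------------------------------------------------------------
-- Probability: distributions with countable support

Σ[<_] : ℕ → (ℕ → ℚ) → ℚ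
Σ[< zero  ] x = 0ℚ
Σ[< suc n ] x = Σ[< n ] x ℚ.+ x n

record Distribution (A : Set) : Set where
  field
    weight      : ℕ → ℚ
    outcome     : ℕ → A
    nonNegative : ∀ i → 0ℚ ℚ.≤ weight i
    mass≤1      : ∀ n → Σ[< n ] weight ℚ.≤ 1ℚ
    mass→1      : ∀ ε → 0ℚ ℚ.< ε → ∃ λ n → 1ℚ ℚ.- ε ℚ.≤ Σ[< n ] weight

-- A series of nonnegative terms is at most b iff all its partial sums are;
-- this avoids limits, which need not be rational.
Expectation≤ : ∀ {A} → Distribution A → (ℕ → ℚ) → ℚ → Set
Expectation≤ d X b = ∀ n → Σ[< n ] (λ i → weight i ℚ.* X i) ℚ.≤ b
  where open Distribution d

------------------------------------------------------------------------
-- Output-sensitive nonnegative convolution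

-- A + B, listed without repetitions.
sumset : List ℕ → List ℕ → List ℕ
sumset A B = deduplicate ℕ._≟_ (cartesianProductWith _+_ A B)

IsSet : List ℕ → Set
IsSet A = A ≢ [] × Unique A

-- A response of the primitive: the list it outputs and the time it took.
Response : Set
Response = List ℕ × ℕ

-- The listing order is unspecified (and may be random).  The running time is
-- only promised when the coordinates and the output size fit in a word.
record RandomizedConvolution (W c : ℕ) : Set where
  field
    respond : List ℕ → List ℕ → Distribution Response

  open module D A B = Distribution (respond A B) using (outcome) public

  field
    correct : ∀ A B → IsSet A → IsSet B → ∀ i →
              proj₁ (outcome A B i) ↭ sumset A B
    fast    : ∀ A B → IsSet A → IsSet B →
              All (ℕ._≤ W) (sumset A B) → length (sumset A B) ℕ.≤ W →
              let s′ = length (sumset A B) in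
              Expectation≤ (respond A B) (λ i → ℕ→ℚ (proj₂ (outcome A B i)))
                (ℕ→ℚ (c * (s′ * ⌊log₂ (s′ + 2) ⌋)))

record DeterministicConvolution (c e : ℕ) : Set where
  field
    respond : List ℕ → List ℕ → Response
    correct : ∀ A B → IsSet A → IsSet B → proj₁ (respond A B) ↭ sumset A B
    fast    : ∀ A B → IsSet A → IsSet B →
              ∀ U → All (ℕ._< U) A → All (ℕ._< U) B →
              proj₂ (respond A B) ℕ.≤
                c * (length (sumset A B) * ⌊log₂ (U + 2) ⌋ ^ e)

------------------------------------------------------------------------
-- A word RAM with structured control flow.  Memory is divided into arrays;
-- since a program names only finitely many of them, this is the same as one
-- interleaved memory.

infixr 6 _⨾_
infix  7 _≔_ _≼_
infixl 8 _⊕_ _⊖_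
infixl 9 _⊗_ _⊘_

data Expr : Set where
  lit                     : ℤ → Expr
  var                     : ℕ → Expr
  get                     : ℕ → Expr → Expr
  _⊕_ _⊖_ _⊗_ _⊘_ _≼_     : Expr → Expr → Expr

data Cmd : Set where
  skip  : Cmd
  _≔_   : ℕ → Expr → Cmd
  put   : ℕ → Expr → Expr → Cmd
  _⨾_   : Cmd → Cmd → Cmd
  ite   : Expr → Cmd → Cmd → Cmd
  while : Expr → Cmd → Cmd
  -- conv a l b m c x calls the convolution primitive on the first l entries
  -- of array a and the first m entries of array b; the list returned is
  -- written to the beginning of array c and its length to variable x.
  conv  : ℕ → Expr → ℕ → Expr → ℕ → ℕ → Cmd

record State : Set where
  constructor ⟨_,_⟩
  field
    vars   : ℕ → ℤ
    arrays : ℕ → ℕ → ℤ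

open State public

update : {X : Set} → (ℕ → X) → ℕ → X → ℕ → X
update s i v j = if ⌊ j ℕ.≟ i ⌋ then v else s j

overwrite : List ℤ → (ℕ → ℤ) → ℕ → ℤ
overwrite []       a i       = a i
overwrite (x ∷ xs) a zero    = x
overwrite (x ∷ xs) a (suc i) = overwrite xs (a ∘ suc) i

_div_ : ℤ → ℤ → ℤ
z div (+ zero)      = 0ℤ
z div d@(+ (suc _)) = z ℤ./ d
z div d@(-[1+ _ ])  = z ℤ./ d

⟦_⟧ : Expr → State → ℤ
⟦ lit z   ⟧ σ = z
⟦ var x   ⟧ σ = vars σ x
⟦ get a e ⟧ σ = arrays σ a ∣ ⟦ e ⟧ σ ∣
⟦ e ⊕ e′  ⟧ σ = ⟦ e ⟧ σ ℤ.+ ⟦ e′ ⟧ σ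
⟦ e ⊖ e′  ⟧ σ = ⟦ e ⟧ σ ℤ.- ⟦ e′ ⟧ σ
⟦ e ⊗ e′  ⟧ σ = ⟦ e ⟧ σ ℤ.* ⟦ e′ ⟧ σ
⟦ e ⊘ e′  ⟧ σ = ⟦ e ⟧ σ div ⟦ e′ ⟧ σ
⟦ e ≼ e′  ⟧ σ = if ⌊ ⟦ e ⟧ σ ℤ.≤? ⟦ e′ ⟧ σ ⌋ then 1ℤ else 0ℤ

size : Expr → ℕ
size (lit z)   = 1
size (var x)   = 1
size (get a e) = suc (size e)
size (e ⊕ e′)  = suc (size e + size e′)
size (e ⊖ e′)  = suc (size e + size e′)
size (e ⊗ e′)  = suc (size e + size e′)
size (e ⊘ e′)  = suc (size e + size e′)
size (e ≼ e′)  = suc (size e + size e′)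

-- The commands still to be executed, and the current state.
Config : Set
Config = List Cmd × State

-- W is the largest absolute value a machine word can hold.  An operation
-- that overflows, or uses a negative address, has no transition.
module Machine (W : ℕ) where

  mutual
    Evaluates : Expr → State → Set
    Evaluates e σ = Subterms e σ × ∣ ⟦ e ⟧ σ ∣ ℕ.≤ W

    Subterms : Expr → State → Set
    Subterms (lit z)   σ = ⊤
    Subterms (var x)   σ = ⊤
    Subterms (get a e) σ = Evaluates e σ × 0ℤ ℤ.≤ ⟦ e ⟧ σ
    Subterms (e ⊕ e′)  σ = Evaluates e σ × Evaluates e′ σ
    Subterms (e ⊖ e′)  σ = Evaluates e σ × Evaluates e′ σ
    Subterms (e ⊗ e′)  σ = Evaluates e σ × Evaluates e′ σ
    Subterms (e ⊘ e′)  σ = Evaluates e σ × Evaluates e′ σ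
    Subterms (e ≼ e′)  σ = Evaluates e σ × Evaluates e′ σ

  infix 4 _⟶⟨_⟩_ _calls⟨_⟩_,_resuming_

  -- Local steps, with their cost.
  data _⟶⟨_⟩_ : Config → ℕ → Config → Set where
    ⟶-skip : ∀ {κ σ} →
      (skip ∷ κ , σ) ⟶⟨ 1 ⟩ (κ , σ)
    ⟶-assign : ∀ {x e κ σ} → Evaluates e σ →
      (x ≔ e ∷ κ , σ) ⟶⟨ 1 + size e ⟩
      (κ , ⟨ update (vars σ) x (⟦ e ⟧ σ) , arrays σ ⟩)
    ⟶-put : ∀ {a e e′ κ σ} → Evaluates e σ → 0ℤ ℤ.≤ ⟦ e ⟧ σ → Evaluates e′ σ →
      (put a e e′ ∷ κ , σ) ⟶⟨ 1 + size e + size e′ ⟩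
      (κ , ⟨ vars σ
           , update (arrays σ) a (update (arrays σ a) ∣ ⟦ e ⟧ σ ∣ (⟦ e′ ⟧ σ)) ⟩)
    ⟶-seq : ∀ {p q κ σ} →
      (p ⨾ q ∷ κ , σ) ⟶⟨ 1 ⟩ (p ∷ q ∷ κ , σ)
    ⟶-ite-true : ∀ {e p q κ σ} → Evaluates e σ → ⟦ e ⟧ σ ≢ 0ℤ →
      (ite e p q ∷ κ , σ) ⟶⟨ 1 + size e ⟩ (p ∷ κ , σ)
    ⟶-ite-false : ∀ {e p q κ σ} → Evaluates e σ → ⟦ e ⟧ σ ≡ 0ℤ →
      (ite e p q ∷ κ , σ) ⟶⟨ 1 + size e ⟩ (q ∷ κ , σ)
    ⟶-while-true : ∀ {e p κ σ} → Evaluates e σ → ⟦ e ⟧ σ ≢ 0ℤ →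
      (while e p ∷ κ , σ) ⟶⟨ 1 + size e ⟩ (p ∷ while e p ∷ κ , σ)
    ⟶-while-false : ∀ {e p κ σ} → Evaluates e σ → ⟦ e ⟧ σ ≡ 0ℤ →
      (while e p ∷ κ , σ) ⟶⟨ 1 + size e ⟩ (κ , σ)

  -- Calls of the primitive, with their cost excluding the primitive's own
  -- running time, the two sets passed, and the configuration reached as a
  -- function of the list returned.  The arguments must really be sets:
  -- the cost of a call is not charged for repeated entries.
  data _calls⟨_⟩_,_resuming_ :
         Config → ℕ → List ℕ → List ℕ → (List ℕ → Config) → Set where
    ⟶-conv : ∀ {a l b m c x κ σ A B} →
      Evaluates l σ → ⟦ l ⟧ σ ≡ + length A →
      Evaluates m σ → ⟦ m ⟧ σ ≡ + length B →
      applyUpTo (arrays σ a) (length A) ≡ map +_ A → IsSet A →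
      applyUpTo (arrays σ b) (length B) ≡ map +_ B → IsSet B →
      All (ℕ._≤ W) (sumset A B) → length (sumset A B) ℕ.≤ W →
      (conv a l b m c x ∷ κ , σ) calls⟨ 1 + size l + size m ⟩ A , B resuming
      λ S → κ , ⟨ update (vars σ) x (+ length S)
                , update (arrays σ) c (overwrite (map +_ S) (arrays σ c)) ⟩

  -- Execution with a deterministic primitive: Run t C τ says that, started
  -- in C, the machine halts in state τ after time exactly t.
  module Deterministic (respond : List ℕ → List ℕ → Response) where

    data Run : ℕ → Config → State → Set where
      done : ∀ {σ} → Run 0 ([] , σ) σ
      step : ∀ {C C′ t u τ} →
        C ⟶⟨ t ⟩ C′ → Run u C′ τ → Run (t + u) C τ
      call : ∀ {C t A B K u τ} →
        C calls⟨ t ⟩ A , B resuming K →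
        Run u (K (proj₁ (respond A B))) τ →
        Run (t + proj₂ (respond A B) + u) C τ

  -- Execution with a randomized primitive whose calls use independent
  -- randomness: ExpectedRun Q b C says that, started in C, the machine halts
  -- in a state satisfying Q whatever the random outcomes, and that its
  -- expected running time is at most b.
  module Randomized (respond : List ℕ → List ℕ → Distribution Response) where

    data ExpectedRun (Q : State → Set) : ℚ → Config → Set where
      done : ∀ {σ b} → Q σ → 0ℚ ℚ.≤ b → ExpectedRun Q b ([] , σ)
      step : ∀ {C C′ t b b′} →
        C ⟶⟨ t ⟩ C′ → ExpectedRun Q b′ C′ → ℕ→ℚ t ℚ.+ b′ ℚ.≤ b →
        ExpectedRun Q b C
      call : ∀ {C t A B K b} (b′ : ℕ → ℚ) →
        C calls⟨ t ⟩ A , B resuming K →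
        let open Distribution (respond A B) in
        (∀ i → ExpectedRun Q (b′ i) (K (proj₁ (outcome i)))) →
        Expectation≤ (respond A B) (λ i → ℕ→ℚ (t + proj₂ (outcome i)) ℚ.+ b′ i) b →
        ExpectedRun Q b C

-- Initially variables 0 and 1 hold n and m, arrays 0 and 1 hold f and g, and
-- everything else is zero.
initial : ∀ {n m} → Vector ℤ (suc n) → Vector ℤ (suc m) → State
initial {n} {m} f g =
  ⟨ overwrite (+ n ∷ + m ∷ []) (λ _ → 0ℤ)
  , (λ { 0 → overwrite (toList f) (λ _ → 0ℤ)
       ; 1 → overwrite (toList g) (λ _ → 0ℤ)
       ; _ → λ _ → 0ℤ }) ⟩

-- The result is left in array 2.
result : ∀ {k} → State → Vector ℤ k
result σ i = arrays σ 2 (toℕ i)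

-- Õ(T) with constant C and exponent e.  The parameter U enters the logarithm
-- only, and accounts for a primitive whose time depends on log U.
softO : (C e U : ℕ) → ℚ → ℚ
softO C e U T = ℕ→ℚ (C * ⌊log₂ (∣ ceiling T ∣ + U + 2) ⌋ ^ e) ℚ.* T

module Submission where

open import Defs
open import Data.Bool.Base as Bool using (Bool; true; false; _∨_; if_then_else_)
open import Data.Bool.Properties using (∨-conicalˡ; ∨-conicalʳ)
open import Data.Fin.Base as Fin using (Fin; toℕ; fromℕ<; inject₁)
import Data.Fin.Properties as Fin
open import Data.Integer.Base as ℤ using (ℤ; +_; -[1+_]; 0ℤ; 1ℤ; ∣_∣)
import Data.Integer.DivMod as ℤ
import Data.Integer.Properties as ℤ
open import Data.Integer.Tactic.RingSolver using (solve; solve-∀)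
open import Data.List.Base
  using (List; []; _∷_; _++_; [_]; length; map; applyUpTo; upTo; cartesianProductWith)
open import Data.List.Membership.Propositional using (_∈_)
open import Data.List.Membership.Propositional.Properties
  using (∈-∃++; ∈-++⁻; ∈-++⁺ˡ; ∈-++⁺ʳ; ∈-applyUpTo⁺; ∈-applyUpTo⁻; ∈-upTo⁺;
         ∈-cartesianProductWith⁺; ∈-cartesianProductWith⁻; ∈-deduplicate⁺; ∈-deduplicate⁻)
open import Data.List.Properties using (length-++; length-map; length-applyUpTo; length-upTo)
open import Data.List.Relation.Binary.Permutation.Propositional using (_↭_; ↭-sym)
open import Data.List.Relation.Binary.Permutation.Propositional.Properties
  using (↭-length; ∈-resp-↭)
open import Data.List.Relation.Unary.All as All using (All)
import Data.List.Relation.Unary.AllPairs as AllPairs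
import Data.List.Relation.Unary.Any as Any
open import Data.List.Relation.Unary.Unique.Propositional using (Unique)
import Data.List.Relation.Unary.Unique.Propositional.Properties as Unique
open import Data.Nat.Base as ℕ using (ℕ; zero; suc; z≤n; s≤s; NonZero)
import Data.Nat.Divisibility as ℕ
import Data.Nat.DivMod as ℕ
open import Data.Nat.Induction using (<-rec)
open import Data.Nat.Logarithm
  using (⌊log₂_⌋; ⌊log₂⌋-mono-≤; ⌊log₂[2^n]⌋≡n; ⌊log₂[2*b]⌋≡1+⌊log₂b⌋)
import Data.Nat.Properties as ℕ
open import Data.List.Relation.Unary.Unique.DecPropositional.Properties ℕ._≟_
  using (deduplicate-!)
open import Data.Nat.Tactic.RingSolver using () renaming (solve-∀ to ℕ-solve-∀)
open import Data.Product.Base using (_×_; _,_; proj₁; proj₂; ∃; ∃₂)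
open import Data.Rational.Base as ℚ
  using (ℚ; 0ℚ; 1ℚ; ceiling; ↥_; ↧_; toℚᵘ)
import Data.Rational.Properties as ℚ
open import Data.Rational.Solver using (module +-*-Solver)
open import Data.Rational.Unnormalised.Base as ℚᵘ using (mkℚᵘ; *≡*; *≤*)
import Data.Rational.Unnormalised.Properties as ℚᵘ
open import Data.Sum.Base using (_⊎_; inj₁; inj₂; [_,_]′)
open import Data.Unit.Base using (tt)
open import Data.Vec.Functional using (Vector; toList)
open import Function.Base using (_∘_; id)
open import Relation.Binary.PropositionalEquality
  using (_≡_; _≢_; refl; sym; trans; cong; cong₂; cong-app; subst; subst₂;
         module ≡-Reasoning)
open import Relation.Nullary.Decidable using (Dec; yes; no; ⌊_⌋; _×-dec_; _⊎-dec_)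
open import Relation.Nullary.Negation using (¬_; contradiction)

open +-*-Solver using (_:=_; _:+_; _:*_; _:-_; :-_; con) renaming (solve to ℚ-solve)

-- The arrays F and G are unknown, but all that matters about them survives in f and g: since F is
-- convex and f stays within Δ above it, no value of f exceeds a chord of f by more than Δ. So the
-- lower convex hull of f is itself a good convex approximation. To remain integral, the hull is
-- scaled by N and its slopes are rounded down; the rounding costs at most one unit per step, and
-- lowering the whole array by N absorbs it. This gives integral convex arrays p ≤ N f and q ≤ N g
-- with errors at most some measured E ≤ N (d + 1), where d is any bound on the deviation from
-- chords.
--
-- The min-plus convolution H of p and q is read off a monotone lattice path that merges their
-- slopes. Call p i + q j - H (i + j) ≥ 0 the excess of the pair (i, j). Then N (f i + g j) lies
-- between H (i + j) and H (i + j) plus the excess plus 2E. Two facts follow. A pair whose excess is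
-- greater than 2E cannot beat the path point of its antidiagonal, whose excess is 0. The other
-- pairs form the relevant region; on each antidiagonal their scaled sums lie in a window of length
-- 4E, so f i + g j takes only O(d + 1) values there.
--
-- The region has a simple shape. The excess, negated on one side of the path, is nondecreasing in i
-- and nonincreasing in j, so the region is `lo i ≤ j < hi i` for two monotone staircases. It is
-- covered by boxes dyadically: a block of consecutive rows contains in full the columns from `lo`
-- of its last row up to `hi` of its first, and each block gets the box of those columns that are
-- full for it but not for its parent. Single rows hold every point and a block of more than n + 1
-- rows holds none, so every point lands in some box. The columns of the boxes are bracketed by
-- successive staircase values, so on each level the widths and heights telescope to O(N).
--
-- Within a box of s rows and r columns the points (i, f i) and (j, g j) are coded as integers with
-- the index as leading digit. The sumset of the codes has O((s + r)(d + 1)) elements, so one call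
-- of the primitive lists all sums of the box in nearly linear time. There are O(log n) levels,
-- which gives the bound.
--
-- The remainder realises this on the word machine. Stored numbers are at most (N + M)^11 and
-- expressions have size at most 30, so words of (N + M)^330 suffice. A run with a cost budget,
-- against any oracle that answers correctly in any order, carries over to both the deterministic
-- and the randomized primitive.

update-same : ∀ {X : Set} (s : ℕ → X) i v → update s i v i ≡ v
update-same s i v with i ℕ.≟ i
... | yes _  = refl
... | no i≢i = contradiction refl i≢i

update-other : ∀ {X : Set} (s : ℕ → X) {i j} v → j ≢ i → update s i v j ≡ s j
update-other s {i} {j} v j≢i with j ℕ.≟ i
... | yes j≡i = contradiction j≡i j≢i
... | no _    = refl


-- Lower convex hulls and their integral approximation.

module Hull where

  open import Data.Integer.Base using (_+_; _*_; _-_; -_; _≤_; _<_)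

  -- Linear arithmetic by certificate: a suitable sum of known inequalities is supplied as l ≤ r,
  -- and only a polynomial identity is left to the ring solver.
  by : ∀ {l r a b} → l ≤ r → b - a ≡ r - l → a ≤ b
  by {a = a} h e = ℤ.0≤i-j⇒j≤i (subst (0ℤ ≤_) (sym e) (ℤ.i≤j⇒0≤j-i h))

  infixl 6 _⊹_
  _⊹_ : ∀ {a b c d} → a ≤ b → c ≤ d → a + c ≤ b + d
  _⊹_ = ℤ.+-mono-≤

  infixr 7 _·_
  _·_ : ∀ {x a b} → 0ℤ ≤ x → a ≤ b → x * a ≤ x * b
  _·_ {x} h k = ℤ.*-monoˡ-≤-nonNeg x {{ℤ.nonNegative h}} k

  divide : ∀ {x a b} → 0ℤ < x → x * a ≤ x * b → a ≤ b
  divide {x} {a} {b} h = ℤ.*-cancelˡ-≤-pos a b x {{ℤ.positive h}}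

  0≤+ : ∀ {n} → 0ℤ ≤ + n
  0≤+ = ℤ.+≤+ z≤n

  <⇒+1≤ : ∀ {a b} → a < b → a + 1ℤ ≤ b
  <⇒+1≤ {a} {b} h = subst (_≤ b) (ℤ.+-comm 1ℤ a) (ℤ.i<j⇒suc[i]≤j h)

  +1≤⇒< : ∀ {a b} → a + 1ℤ ≤ b → a < b
  +1≤⇒< {a} {b} h = ℤ.suc[i]≤j⇒i<j (subst (_≤ b) (ℤ.+-comm a 1ℤ) h)

  <+1⇒≤ : ∀ {a b} → a < b + 1ℤ → a ≤ b
  <+1⇒≤ {a} {b} h = lemma a b (<⇒+1≤ h)
    where
    lemma : ∀ a b → a + 1ℤ ≤ b + 1ℤ → a ≤ b
    lemma a b h = by h (solve (a ∷ b ∷ []))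

  gap : ∀ {m n} → m ℕ.≤ n → 0ℤ ≤ + n - + m
  gap h = ℤ.i≤j⇒0≤j-i (ℤ.+≤+ h)

  gap< : ∀ {m n} → m ℕ.< n → 0ℤ < + n - + m
  gap< {m} {n} h = +1≤⇒< (lemma (+ m) (+ n) (<⇒+1≤ (ℤ.+<+ h)))
    where
    lemma : ∀ a b → a + 1ℤ ≤ b → 0ℤ + 1ℤ ≤ b - a
    lemma a b h = by h (solve (a ∷ b ∷ []))

  abs≤ : ∀ {z b} → - (+ b) ≤ z → z ≤ + b → ∣ z ∣ ℕ.≤ b
  abs≤ {+ z}                _           h = ℤ.drop‿+≤+ h
  abs≤ { -[1+ z ]} {suc b}  (ℤ.-≤- h) _ = s≤s h

  ≤abs : ∀ {z b} → ∣ z ∣ ℕ.≤ b → - (+ b) ≤ z × z ≤ + b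
  ≤abs {+ z}               h       = ℤ.≤-trans (ℤ.neg-mono-≤ 0≤+) 0≤+ , ℤ.+≤+ h
  ≤abs { -[1+ z ]} {suc b} (s≤s h) = ℤ.-≤- h , ℤ.-≤+

  -- Graham's scan

  module Scan (y : ℕ → ℤ) where

    -- The graph of y lies on or above its chord over [p, v], with denominators cleared.
    Above : ℕ → ℕ → Set
    Above p v = ∀ x → p ℕ.≤ x → x ℕ.≤ v →
      (+ v - + x) * y p + (+ x - + p) * y v ≤ (+ v - + p) * y x

    -- The slopes over [q, r] and over [p, q], both multiplied by (q - p)(r - q), so that they can
    -- be compared without division.
    rise : ℕ → ℕ → ℕ → ℤ × ℤ
    rise p q r = (y r - y q) * (+ q - + p) , (y q - y p) * (+ r - + q)

    Turn : ℕ → ℕ → ℕ → Set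
    Turn p q r = proj₂ (rise p q r) ≤ proj₁ (rise p q r)

    -- When the slope does not increase at q, the point at q is on or above the chord from p to r.
    -- That chord is then below both shorter chords, hence below the graph; on each side of q this
    -- is a weighted sum of a chord inequality and the turn.
    merge : ∀ {p q r} → p ℕ.< q → q ℕ.< r → Above p q → Above q r →
            proj₁ (rise p q r) ≤ proj₂ (rise p q r) → Above p r
    merge {p} {q} {r} p<q q<r above above′ turn x p≤x x≤r with ℕ.≤-total x q
    ... | inj₁ x≤q = divide (gap< p<q)
      (left (+ p) (+ q) (+ r) (+ x) (y p) (y q) (y r) (y x)
        (gap (ℕ.<⇒≤ (ℕ.<-trans p<q q<r)) · above x p≤x x≤q) (gap p≤x · turn))
      where
      left : ∀ p q r x yp yq yr yx →
        (r - p) * ((q - x) * yp + (x - p) * yq) ≤ (r - p) * ((q - p) * yx) →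
        (x - p) * ((yr - yq) * (q - p)) ≤ (x - p) * ((yq - yp) * (r - q)) →
        (q - p) * ((r - x) * yp + (x - p) * yr) ≤ (q - p) * ((r - p) * yx)
      left p q r x yp yq yr yx h k =
        by (h ⊹ k) (solve (p ∷ q ∷ r ∷ x ∷ yp ∷ yq ∷ yr ∷ yx ∷ []))
    ... | inj₂ q≤x = divide (gap< q<r)
      (right (+ p) (+ q) (+ r) (+ x) (y p) (y q) (y r) (y x)
        (gap (ℕ.<⇒≤ (ℕ.<-trans p<q q<r)) · above′ x q≤x x≤r) (gap x≤r · turn))
      where
      right : ∀ p q r x yp yq yr yx →
        (r - p) * ((r - x) * yq + (x - q) * yr) ≤ (r - p) * ((r - q) * yx) →
        (r - x) * ((yr - yq) * (q - p)) ≤ (r - x) * ((yq - yp) * (r - q)) →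
        (r - q) * ((r - x) * yp + (x - p) * yr) ≤ (r - q) * ((r - p) * yx)
      right p q r x yp yq yr yx h k =
        by (h ⊹ k) (solve (p ∷ q ∷ r ∷ x ∷ yp ∷ yq ∷ yr ∷ yx ∷ []))

    above-suc : ∀ p → Above p (suc p)
    above-suc p x p≤x x≤ with ℕ.m≤n⇒m<n∨m≡n x≤
    ... | inj₂ refl = ℤ.≤-reflexive (lemma (+ suc p) (+ p) (y p) (y (suc p)))
      where
      lemma : ∀ s p a b → (s - s) * a + (s - p) * b ≡ (s - p) * b
      lemma = solve-∀
    ... | inj₁ (s≤s x≤p) with ℕ.≤-antisym p≤x x≤p
    ...   | refl = ℤ.≤-reflexive (lemma (+ suc p) (+ p) (y p) (y (suc p)))
      where
      lemma : ∀ s p a b → (s - p) * a + (p - p) * b ≡ (s - p) * a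
      lemma = solve-∀

    -- Positions 1, …, t of the stack S hold the vertices of the lower hull of
    -- the indices below i; S 0 = S 1 makes the turn at the bottom vertex
    -- degenerate, so that this vertex is never popped.
    record Stack (S : ℕ → ℕ) (t i : ℕ) : Set where
      field
        bottom₀ : S 0 ≡ 0
        bottom₁ : S 1 ≡ 0
        1≤t     : 1 ℕ.≤ t
        top<    : S t ℕ.< i
        mono    : ∀ a → 1 ℕ.≤ a → a ℕ.< t → S a ℕ.< S (suc a)
        above   : ∀ a → 1 ℕ.≤ a → a ℕ.< t → Above (S a) (S (suc a))
        convex  : ∀ a → 1 ℕ.≤ a → suc a ℕ.< t → Turn (S a) (S (suc a)) (S (suc (suc a)))
        pending : Above (S t) i

    start : Stack (λ _ → 0) 1 1
    start = record
      { bottom₀ = refl ; bottom₁ = refl ; 1≤t = s≤s z≤n ; top< = s≤s z≤n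
      ; mono = λ { (suc a) _ (s≤s ()) } ; above = λ { (suc a) _ (s≤s ()) }
      ; convex = λ { (suc a) _ (s≤s ()) } ; pending = above-suc 0 }

    -- The vertex removed lies strictly above the chord joining its neighbours, so `merge` fuses the
    -- last hull edge with the pending chord into i.
    pop : ∀ {S t i} → Stack S (suc t) i →
          proj₁ (rise (S t) (S (suc t)) i) < proj₂ (rise (S t) (S (suc t)) i) → Stack S t i
    pop {S} {zero} {i} st turn = contradiction turn (ℤ.<-irrefl lemma)
      where
      open Stack st
      lemma : proj₁ (rise (S 0) (S 1) i) ≡ proj₂ (rise (S 0) (S 1) i)
      lemma rewrite bottom₀ | bottom₁ = degenerate (y i) (y 0) (+ i)
        where
        degenerate : ∀ a b c → (a - b) * (0ℤ - 0ℤ) ≡ (b - b) * (c - 0ℤ)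
        degenerate = solve-∀
    pop {S} {suc t} {i} st turn = record
      { bottom₀ = bottom₀ ; bottom₁ = bottom₁ ; 1≤t = s≤s z≤n
      ; top< = ℕ.<-trans last top<
      ; mono = λ a l h → mono a l (ℕ.m≤n⇒m≤1+n h)
      ; above = λ a l h → above a l (ℕ.m≤n⇒m≤1+n h)
      ; convex = λ a l h → convex a l (ℕ.m≤n⇒m≤1+n h)
      ; pending = merge last top< (above (suc t) (s≤s z≤n) ℕ.≤-refl) pending (ℤ.<⇒≤ turn) }
      where
      open Stack st
      last = mono (suc t) (s≤s z≤n) ℕ.≤-refl

    -- Popping stops exactly when the turn at the top is convex, which is the only new convexity
    -- condition; the next pending chord has unit length and has nothing strictly inside to check.
    push : ∀ {S t i} → Stack S (suc t) i →
           proj₂ (rise (S t) (S (suc t)) i) ≤ proj₁ (rise (S t) (S (suc t)) i) →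
           Stack (update S (suc (suc t)) i) (suc (suc t)) (suc i)
    push {S} {t} {i} st turn = record
      { bottom₀ = trans (old 0 z≤n) bottom₀
      ; bottom₁ = trans (old 1 (s≤s z≤n)) bottom₁
      ; 1≤t = s≤s z≤n
      ; top< = subst (ℕ._< suc i) (sym new) ℕ.≤-refl
      ; mono = λ a l h → consecutive (λ x z → x ℕ.< z) mono top< a l h
      ; above = λ a l h → consecutive Above above pending a l h
      ; convex = convex′
      ; pending = subst (λ z → Above z (suc i)) (sym new) (above-suc i) }
      where
      open Stack st
      S′ = update S (suc (suc t)) i
      new : S′ (suc (suc t)) ≡ i
      new = update-same S (suc (suc t)) i
      old : ∀ a → a ℕ.≤ suc t → S′ a ≡ S a
      old a h = update-other S i (ℕ.<⇒≢ (s≤s h))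
      consecutive : (R : ℕ → ℕ → Set) → (∀ a → 1 ℕ.≤ a → a ℕ.< suc t → R (S a) (S (suc a))) →
                    R (S (suc t)) i → ∀ a → 1 ℕ.≤ a → a ℕ.< suc (suc t) → R (S′ a) (S′ (suc a))
      consecutive R before now a l (s≤s h) with ℕ.m≤n⇒m<n∨m≡n h
      ... | inj₁ a< = subst₂ R (sym (old a h)) (sym (old (suc a) a<)) (before a l a<)
      ... | inj₂ refl = subst₂ R (sym (old a h)) (sym new) now
      convex′ : ∀ a → 1 ℕ.≤ a → suc a ℕ.< suc (suc t) → Turn (S′ a) (S′ (suc a)) (S′ (suc (suc a)))
      convex′ a l (s≤s h) with ℕ.m≤n⇒m<n∨m≡n h
      ... | inj₁ a<
        rewrite old a (ℕ.≤-trans (ℕ.n≤1+n a) h) | old (suc a) h | old (suc (suc a)) a< = convex a l a<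
      ... | inj₂ refl
        rewrite old a (ℕ.n≤1+n a) | old (suc a) ℕ.≤-refl | new = turn

    stack-mono : ∀ {S t i} → Stack S t i → ∀ {a c} → 1 ℕ.≤ a → a ℕ.≤ c → c ℕ.≤ t → S a ℕ.≤ S c
    stack-mono st {a} {zero}  1≤a a≤c c≤t with ℕ.≤-trans 1≤a a≤c
    ... | ()
    stack-mono st {a} {suc c} 1≤a a≤c c≤t with ℕ.m≤n⇒m<n∨m≡n a≤c
    ... | inj₂ refl = ℕ.≤-refl
    ... | inj₁ (s≤s a≤c′) = ℕ.≤-trans (stack-mono st 1≤a a≤c′ (ℕ.<⇒≤ c≤t))
                              (ℕ.<⇒≤ (Stack.mono st c (ℕ.≤-trans 1≤a a≤c′) c≤t))

    -- No point of the graph is more than d above a chord, again with denominators cleared. This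
    -- integral condition is how the existence of a convex rational array near y is felt by the hull
    -- computation.
    NearConvex : ℕ → ℕ → Set
    NearConvex len d = ∀ p x v → p ℕ.≤ x → x ℕ.≤ v → v ℕ.≤ len →
      (+ v - + p) * y x ≤ (+ v - + x) * y p + (+ x - + p) * y v + (+ v - + p) * + d

    -- A value and a chord of an array bounded by M differ by at most 2M. This keeps d, and with it
    -- all numbers, polynomial in N and M even if Δ is huge.
    bounded⇒near : ∀ {len M} → (∀ x → x ℕ.≤ len → ∣ y x ∣ ℕ.≤ M) → NearConvex len (2 ℕ.* M)
    bounded⇒near {len} {M} small p x v p≤x x≤v v≤len =
      lemma (+ p) (+ x) (+ v) (y p) (y x) (y v) (+ M) (+ (2 ℕ.* M)) (ℤ.pos-* 2 M)
        (gap (ℕ.≤-trans p≤x x≤v) · proj₂ (≤abs (small x (ℕ.≤-trans x≤v v≤len))))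
        (gap x≤v · proj₁ (≤abs (small p (ℕ.≤-trans p≤x (ℕ.≤-trans x≤v v≤len)))))
        (gap p≤x · proj₁ (≤abs (small v v≤len)))
      where
      lemma : ∀ p x v yp yx yv M M₂ → M₂ ≡ + 2 * M →
        (v - p) * yx ≤ (v - p) * M →
        (v - x) * (- M) ≤ (v - x) * yp →
        (x - p) * (- M) ≤ (x - p) * yv →
        (v - p) * yx ≤ (v - x) * yp + (x - p) * yv + (v - p) * M₂
      lemma p x v yp yx yv M M₂ refl h₁ h₂ h₃ =
        by (h₁ ⊹ h₂ ⊹ h₃) (solve (p ∷ x ∷ v ∷ yp ∷ yx ∷ yv ∷ M ∷ []))

  -- Descending along the hull with integral slopes

  module Descend (y : ℕ → ℤ) (N : ℕ) where

    abstract

      -- The floor of N times the slope of the chord. The scaling makes the rounding loss, added up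
      -- over at most N steps, worth no more than one unit of y. The value 0 for an empty interval
      -- is a mere default.
      slope : (p v : ℕ) → ℤ
      slope p v = quotient (v ℕ.∸ p)
        where
        quotient : ℕ → ℤ
        quotient zero      = 0ℤ
        quotient d@(suc _) = (+ N * (y v - y p)) ℤ./ℕ d

      slope-value : ∀ {p v} → p ℕ.< v → ∃ λ d → + v - + p ≡ + suc d ×
                    slope p v ≡ (+ N * (y v - y p)) ℤ./ℕ suc d
      slope-value {p} {v} h with v ℕ.∸ p | ℕ.m<n⇒0<n∸m h | ℤ.⊖-≥ (ℕ.<⇒≤ h)
      ... | suc d | s≤s _ | eq = d , trans (ℤ.m-n≡m⊖n v p) eq , refl

    slope-lower : ∀ {p v} → p ℕ.< v → (+ v - + p) * slope p v ≤ + N * (y v - y p)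
    slope-lower {p} {v} h = bound (slope-value h)
      where
      z = + N * (y v - y p)
      bound : (∃ λ d → + v - + p ≡ + suc d × slope p v ≡ z ℤ./ℕ suc d) →
              (+ v - + p) * slope p v ≤ z
      bound (d , e , e′) = subst₂ (λ w s → w * s ≤ z) (sym e) (sym e′)
        (subst (_≤ z) (ℤ.*-comm (z ℤ./ℕ suc d) (+ suc d)) (ℤ.[n/ℕd]*d≤n z (suc d)))

    slope-upper : ∀ {p v} → p ℕ.< v →
                  + N * (y v - y p) + 1ℤ ≤ (+ v - + p) * (slope p v + 1ℤ)
    slope-upper {p} {v} h = bound (slope-value h)
      where
      z = + N * (y v - y p)
      bound : (∃ λ d → + v - + p ≡ + suc d × slope p v ≡ z ℤ./ℕ suc d) →
              z + 1ℤ ≤ (+ v - + p) * (slope p v + 1ℤ)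
      bound (d , e , e′) = subst₂ (λ w s → z + 1ℤ ≤ w * (s + 1ℤ)) (sym e) (sym e′)
        (subst (z + 1ℤ ≤_) (trans (cong (_* + suc d) (ℤ.+-comm 1ℤ (z ℤ./ℕ suc d)))
            (ℤ.*-comm (z ℤ./ℕ suc d + 1ℤ) (+ suc d)))
          (<⇒+1≤ (ℤ.n<s[n/ℕd]*d z (suc d))))

    -- Floors are monotone, so the convexity of the hull survives the rounding.
    slope-mono : ∀ {p q r} → p ℕ.< q → q ℕ.< r → Scan.Turn y p q r → slope p q ≤ slope q r
    slope-mono {p} {q} {r} p<q q<r turn = ℤ.≮⇒≥ λ lt →
      impossible (+ p) (+ q) (+ r) (y p) (y q) (y r) (+ N) (slope p q) (slope q r)
        (gap< q<r) (gap< p<q)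
        (ℤ.<⇒≤ (gap< p<q) · slope-upper q<r) (ℤ.<⇒≤ (gap< q<r) · slope-lower p<q)
        (0≤+ {N} · turn)
        (ℤ.<⇒≤ (gap< p<q) · ℤ.<⇒≤ (gap< q<r) · <⇒+1≤ lt)
      where
      impossible : ∀ p q r yp yq yr N s s′ → 0ℤ < r - q → 0ℤ < q - p →
        (q - p) * (N * (yr - yq) + 1ℤ) ≤ (q - p) * ((r - q) * (s′ + 1ℤ)) →
        (r - q) * ((q - p) * s) ≤ (r - q) * (N * (yq - yp)) →
        N * ((yq - yp) * (r - q)) ≤ N * ((yr - yq) * (q - p)) →
        (q - p) * ((r - q) * (s′ + 1ℤ)) ≤ (q - p) * ((r - q) * s) → _
      impossible p q r yp yq yr N s s′ _ h h₁ h₂ h₃ h₄ = ℤ.<⇒≱ h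
        (by (h₁ ⊹ h₂ ⊹ h₃ ⊹ h₄) (solve (p ∷ q ∷ r ∷ yp ∷ yq ∷ yr ∷ N ∷ s ∷ s′ ∷ [])))

    -- The value z at x lies between N times the chord from p to v, lowered by
    -- N, and that plus the number of unit steps taken so far.
    record Near (len p v x : ℕ) (z : ℤ) : Set where
      constructor near
      field
        lower : + N * ((+ v - + x) * y p + (+ x - + p) * y v) ≤ (+ v - + p) * (z + + N)
        upper : (+ v - + p) * (z + + N) ≤
                + N * ((+ v - + x) * y p + (+ x - + p) * y v) + (+ v - + p) * (+ len - + x)

    near-start : ∀ p v → Near v p v v (+ N * y v - + N)
    near-start p v = near (ℤ.≤-reflexive (lemma (+ p) (+ v) (y p) (y v) (+ N)))
                          (ℤ.≤-reflexive (lemma′ (+ p) (+ v) (y p) (y v) (+ N)))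
      where
      lemma : ∀ p v yp yv N → N * ((v - v) * yp + (v - p) * yv) ≡ (v - p) * (N * yv - N + N)
      lemma = solve-∀
      lemma′ : ∀ p v yp yv N →
        (v - p) * (N * yv - N + N) ≡ N * ((v - v) * yp + (v - p) * yv) + (v - p) * (v - v)
      lemma′ = solve-∀

    -- One step to the left lowers the scaled chord by N times its slope and z by the floor of that
    -- amount. So z gains on the chord by at least 0 and less than 1, which the growth of `len - x`
    -- pays for.
    near-step : ∀ {len p v x z} → p ℕ.< v → Near len p v (suc x) z → Near len p v x (z - slope p v)
    near-step {len} {p} {v} {x} {z} p<v (near l u) = near
      (lower (+ p) (+ v) (+ x) (y p) (y v) (+ N) z (slope p v) l (slope-lower p<v))
      (upper (+ p) (+ v) (+ x) (y p) (y v) (+ N) z (slope p v) (+ len) u (slope-upper p<v))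
      where
      lower : ∀ p v x yp yv N z s →
        N * ((v - (1ℤ + x)) * yp + (1ℤ + x - p) * yv) ≤ (v - p) * (z + N) →
        (v - p) * s ≤ N * (yv - yp) →
        N * ((v - x) * yp + (x - p) * yv) ≤ (v - p) * (z - s + N)
      lower p v x yp yv N z s h k = by (h ⊹ k) (solve (p ∷ v ∷ x ∷ yp ∷ yv ∷ N ∷ z ∷ s ∷ []))
      upper : ∀ p v x yp yv N z s l →
        (v - p) * (z + N) ≤ N * ((v - (1ℤ + x)) * yp + (1ℤ + x - p) * yv) + (v - p) * (l - (1ℤ + x)) →
        N * (yv - yp) + 1ℤ ≤ (v - p) * (s + 1ℤ) →
        (v - p) * (z - s + N) ≤ N * ((v - x) * yp + (x - p) * yv) + (v - p) * (l - x)
      upper p v x yp yv N z s l h k =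
        by (h ⊹ k ⊹ 0≤+ {1}) (solve (p ∷ v ∷ x ∷ yp ∷ yv ∷ N ∷ z ∷ s ∷ l ∷ []))

    -- At the vertex p the chord on the right and the chord on the left take the same value `y p`,
    -- so the invariant passes from one to the other after cancelling the width.
    near-vertex : ∀ {len o p v z} → p ℕ.< v → o ℕ.≤ p → Near len p v p z → Near len o p p z
    near-vertex {len} {o} {p} {v} {z} p<v o≤p (near l u) = near
      (lower (+ o) (+ p) (y o) (y p) (+ N) z (gap o≤p · divide (gap< p<v) (subst (_≤ _) (shape (+ p) (+ v) (y p) (y v) (+ N)) l)))
      (upper (+ o) (+ p) (y o) (y p) (+ N) z (+ len) (gap o≤p · divide (gap< p<v) (subst (_ ≤_) (shape′ (+ p) (+ v) (y p) (y v) (+ N) (+ len)) u)))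
      where
      shape : ∀ p v yp yv N → N * ((v - p) * yp + (p - p) * yv) ≡ (v - p) * (N * yp)
      shape = solve-∀
      shape′ : ∀ p v yp yv N l →
        N * ((v - p) * yp + (p - p) * yv) + (v - p) * (l - p) ≡ (v - p) * (N * yp + (l - p))
      shape′ = solve-∀
      lower : ∀ o p yo yp N z → (p - o) * (N * yp) ≤ (p - o) * (z + N) →
        N * ((p - p) * yo + (p - o) * yp) ≤ (p - o) * (z + N)
      lower o p yo yp N z h = by h (solve (o ∷ p ∷ yo ∷ yp ∷ N ∷ z ∷ []))
      upper : ∀ o p yo yp N z l → (p - o) * (z + N) ≤ (p - o) * (N * yp + (l - p)) →
        (p - o) * (z + N) ≤ N * ((p - p) * yo + (p - o) * yp) + (p - o) * (l - p)
      upper o p yo yp N z l h = by h (solve (o ∷ p ∷ yo ∷ yp ∷ N ∷ z ∷ l ∷ []))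

    -- The accumulated gain is at most len ≤ N, which is what the initial lowering by N compensates:
    -- z is below N times the chord, and the chord is below y.
    near-below : ∀ {len p v x z} → p ℕ.< v → p ℕ.≤ x → x ℕ.≤ v → len ℕ.≤ N →
                 Scan.Above y p v → Near len p v x z → z ≤ + N * y x
    near-below {len} {p} {v} {x} {z} p<v p≤x x≤v len≤N above (near _ u) =
      divide (gap< p<v) (lemma (+ p) (+ v) (+ x) (y p) (y v) (y x) (+ N) z (+ len) u
        (0≤+ {N} · above x p≤x x≤v) (ℤ.<⇒≤ (gap< p<v) · (gap len≤N ⊹ 0≤+ {x})))
      where
      lemma : ∀ p v x yp yv yx N z l →
        (v - p) * (z + N) ≤ N * ((v - x) * yp + (x - p) * yv) + (v - p) * (l - x) →
        N * ((v - x) * yp + (x - p) * yv) ≤ N * ((v - p) * yx) →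
        (v - p) * (0ℤ + 0ℤ) ≤ (v - p) * (N - l + x) →
        (v - p) * z ≤ (v - p) * (N * yx)
      lemma p v x yp yv yx N z l h k k′ =
        by (h ⊹ k ⊹ k′) (solve (p ∷ v ∷ x ∷ yp ∷ yv ∷ yx ∷ N ∷ z ∷ l ∷ []))

    -- Here y is at most d above the chord and z at most N below N times the chord, whence N d + N.
    near-close : ∀ {len p v x z d} → p ℕ.< v → p ℕ.≤ x → x ℕ.≤ v → v ℕ.≤ len →
                 Scan.NearConvex y len d → Near len p v x z → + N * y x - z ≤ + (N ℕ.* suc d)
    near-close {len} {p} {v} {x} {z} {d} p<v p≤x x≤v v≤len nc (near l _) =
      subst (+ N * y x - z ≤_) (sym (ℤ.pos-* N (suc d))) (divide (gap< p<v)
        (lemma (+ p) (+ v) (+ x) (y p) (y v) (y x) (+ N) z (+ d) l (0≤+ {N} · nc p x v p≤x x≤v v≤len)))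
      where
      lemma : ∀ p v x yp yv yx N z d →
        N * ((v - x) * yp + (x - p) * yv) ≤ (v - p) * (z + N) →
        N * ((v - p) * yx) ≤ N * ((v - x) * yp + (x - p) * yv + (v - p) * d) →
        (v - p) * (N * yx - z) ≤ (v - p) * (N * (1ℤ + d))
      lemma p v x yp yv yx N z d h k =
        by (h ⊹ k) (solve (p ∷ v ∷ x ∷ yp ∷ yv ∷ yx ∷ N ∷ z ∷ d ∷ []))

  ConvexUpTo : (ℕ → ℤ) → ℕ → Set
  ConvexUpTo p n = ∀ x → suc x ℕ.< n → p (suc x) - p x ≤ p (suc (suc x)) - p (suc x)

  slopes-mono : ∀ {p n} → ConvexUpTo p n → ∀ {x z} → x ℕ.≤ z → z ℕ.< n →
                p (suc x) - p x ≤ p (suc z) - p z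
  slopes-mono {p} {n} cvx {x} {z} x≤z z<n with ℕ.m≤n⇒m<n∨m≡n x≤z
  ... | inj₂ refl = ℤ.≤-refl
  slopes-mono {p} {n} cvx {x} {suc z} x≤z z<n | inj₁ (s≤s x≤z′) =
    ℤ.≤-trans (slopes-mono {p} {n} cvx x≤z′ (ℕ.<-trans ℕ.≤-refl z<n)) (cvx z z<n)

open Hull

-- Convolution of two convex arrays, and the excess of a pair over it.

module LatticePath where

  open import Data.Integer.Base using (_+_; _*_; _-_; -_; _≤_; _<_)

  -- Moving away along an antidiagonal from a point where the slopes of p and q
  -- are separated does not decrease p + q.
  diagonal : ∀ (p q : ℕ → ℤ) a b t →
    (∀ s → s ℕ.< t → q (suc (b ℕ.+ s)) - q (b ℕ.+ s) ≤ p (suc (a ℕ.+ s)) - p (a ℕ.+ s)) →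
    p a + q (b ℕ.+ t) ≤ p (a ℕ.+ t) + q b
  diagonal p q a b zero h rewrite ℕ.+-identityʳ a | ℕ.+-identityʳ b = ℤ.≤-refl
  diagonal p q a b (suc t) h rewrite ℕ.+-suc a t | ℕ.+-suc b t =
    lemma (p a) (q b) (p (a ℕ.+ t)) (q (b ℕ.+ t)) (p (suc (a ℕ.+ t))) (q (suc (b ℕ.+ t)))
      (diagonal p q a b t (λ s l → h s (ℕ.m≤n⇒m≤1+n l))) (h t ℕ.≤-refl)
    where
    lemma : ∀ pa qb pt qt pt′ qt′ → pa + qt ≤ pt + qb → qt′ - qt ≤ pt′ - pt → pa + qt′ ≤ pt′ + qb
    lemma pa qb pt qt pt′ qt′ h k = by (h ⊹ k) (solve (pa ∷ qb ∷ pt ∷ qt ∷ pt′ ∷ qt′ ∷ []))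

  module Merge {n m : ℕ} (p q : ℕ → ℤ) (p-convex : ConvexUpTo p n) (q-convex : ConvexUpTo q m) where

    u v : ℕ → ℤ
    u x = p (suc x) - p x
    v z = q (suc z) - q z

    Right : ℕ → ℕ → Set
    Right a b = a ℕ.< n × (m ℕ.≤ b ⊎ u a ≤ v b)

    right? : ∀ a b → Dec (Right a b)
    right? a b = (a ℕ.<? n) ×-dec ((m ℕ.≤? b) ⊎-dec (u a ℤ.≤? v b))

    advance : ℕ × ℕ → ℕ × ℕ
    advance (a , b) = if ⌊ right? a b ⌋ then (suc a , b) else (a , suc b)

    -- The lattice path that adds the slopes of p and q in increasing order; it
    -- meets the antidiagonal k in a minimiser of p i + q j.
    path : ℕ → ℕ × ℕ
    path zero    = 0 , 0
    path (suc k) = advance (path k)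

    α β : ℕ → ℕ
    α k = proj₁ (path k)
    β k = proj₂ (path k)

    advance-right : ∀ {a b} → Right a b → advance (a , b) ≡ (suc a , b)
    advance-right {a} {b} r with right? a b
    ... | yes _ = refl
    ... | no ¬r = contradiction r ¬r

    advance-up : ∀ {a b} → ¬ Right a b → advance (a , b) ≡ (a , suc b)
    advance-up {a} {b} ¬r with right? a b
    ... | yes r = contradiction r ¬r
    ... | no _  = refl

    α+β : ∀ k → α k ℕ.+ β k ≡ k
    α+β zero = refl
    α+β (suc k) with path k | α+β k
    ... | a , b | e with right? a b
    ...   | yes _ = cong suc e
    ...   | no _  = trans (ℕ.+-suc a b) (cong suc e)

    record Separating (a b : ℕ) : Set where
      field
        a≤n  : a ℕ.≤ n
        b≤m  : b ℕ.≤ m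
        u≤v  : ∀ x z → x ℕ.< a → b ℕ.≤ z → z ℕ.< m → u x ≤ v z
        v≤u  : ∀ x z → z ℕ.< b → a ℕ.≤ x → x ℕ.< n → v z ≤ u x

    data Next (k : ℕ) : Set where
      right : path (suc k) ≡ (suc (α k) , β k) → α k ℕ.< n →
              (β k ℕ.< m → u (α k) ≤ v (β k)) → Next k
      up    : path (suc k) ≡ (α k , suc (β k)) → β k ℕ.< m →
              (α k ℕ.< n → v (β k) ≤ u (α k)) → Next k

    next : ∀ {k} → k ℕ.< n ℕ.+ m → Separating (α k) (β k) → Next k
    next {k} k< s with α+β k
    next {k} k< s | e with path k in eq
    ... | a , b with right? a b
    ...   | yes (a<n , c) = right
      (trans (cong advance eq) (trans (advance-right (a<n , c)) (cong (λ ab → suc (proj₁ ab) , proj₂ ab) (sym eq))))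
      (subst (λ ab → proj₁ ab ℕ.< n) (sym eq) a<n)
      (subst (λ ab → proj₂ ab ℕ.< m → u (proj₁ ab) ≤ v (proj₂ ab)) (sym eq)
        λ b<m → [ (λ m≤b → contradiction b<m (ℕ.≤⇒≯ m≤b)) , (λ z → z) ]′ c)
    ...   | no ¬r = up
      (trans (cong advance eq) (trans (advance-up ¬r) (cong (λ ab → proj₁ ab , suc (proj₂ ab)) (sym eq))))
      (subst (λ ab → proj₂ ab ℕ.< m) (sym eq) b<m)
      (subst (λ ab → proj₁ ab ℕ.< n → v (proj₂ ab) ≤ u (proj₁ ab)) (sym eq)
        λ a<n → ℤ.<⇒≤ (ℤ.≰⇒> λ le → ¬r (a<n , inj₂ le)))
      where
      -- On an antidiagonal before the last the two slope lists cannot both be exhausted, so if no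
      -- step to the right is allowed there is one upwards.
      b<m : b ℕ.< m
      b<m with ℕ.<-≤-connex b m | ℕ.<-≤-connex a n
      ... | inj₁ b<m | _         = b<m
      ... | inj₂ m≤b | inj₁ a<n  = contradiction (a<n , inj₁ m≤b) ¬r
      ... | inj₂ m≤b | inj₂ n≤a  = contradiction (subst (ℕ._< n ℕ.+ m) (sym e) k<)
                                     (ℕ.≤⇒≯ (ℕ.+-mono-≤ n≤a m≤b))

    separating : ∀ {k} → k ℕ.≤ n ℕ.+ m → Separating (α k) (β k)
    separating {zero} _ = record
      { a≤n = z≤n ; b≤m = z≤n ; u≤v = λ _ _ () ; v≤u = λ _ _ () }
    separating {suc k} k< with next k< (separating (ℕ.<⇒≤ k<)) | separating (ℕ.<⇒≤ k<)
    ... | right e a<n c | s rewrite e = record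
      { a≤n = a<n ; b≤m = b≤m
      ; u≤v = λ x z x<a b≤z z<m → ℤ.≤-trans
                (slopes-mono {p} p-convex (ℕ.≤-pred x<a) a<n)
                (ℤ.≤-trans (c (ℕ.≤-<-trans b≤z z<m)) (slopes-mono {q} q-convex b≤z z<m))
      ; v≤u = λ x z z<b a≤x x<n → v≤u x z z<b (ℕ.<⇒≤ a≤x) x<n }
      where open Separating s
    ... | up e b<m c | s rewrite e = record
      { a≤n = a≤n ; b≤m = b<m
      ; u≤v = λ x z x<a b≤z z<m → u≤v x z x<a (ℕ.<⇒≤ b≤z) z<m
      ; v≤u = λ x z z<b a≤x x<n → ℤ.≤-trans
                (slopes-mono {q} q-convex (ℕ.≤-pred z<b) b<m)
                (ℤ.≤-trans (c (ℕ.≤-<-trans a≤x x<n)) (slopes-mono {p} p-convex a≤x x<n)) }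
      where open Separating s

    step : ∀ {k} → k ℕ.< n ℕ.+ m → Next k
    step k< = next k< (separating (ℕ.<⇒≤ k<))

    -- By `excess≥0` this is the min-plus convolution of p and q.
    H : ℕ → ℤ
    H k = p (α k) + q (β k)

    -- The increment of H separates the slopes before the path from those after.
    record Cut (k : ℕ) : Set where
      field
        δ≤u : ∀ x → α k ℕ.≤ x → x ℕ.< n → H (suc k) - H k ≤ u x
        δ≤v : ∀ z → β k ℕ.≤ z → z ℕ.< m → H (suc k) - H k ≤ v z
        u≤δ : ∀ x → x ℕ.< α k → u x ≤ H (suc k) - H k
        v≤δ : ∀ z → z ℕ.< β k → v z ≤ H (suc k) - H k

    cut : ∀ {k} → k ℕ.< n ℕ.+ m → Cut k
    cut {k} k< with step k< | separating (ℕ.<⇒≤ k<)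
    ... | right e a<n c | s = record
      { δ≤u = λ x l h → ℤ.≤-trans (ℤ.≤-reflexive δ) (slopes-mono {p} p-convex l h)
      ; δ≤v = λ z l h → ℤ.≤-trans (ℤ.≤-reflexive δ)
                (ℤ.≤-trans (c (ℕ.≤-<-trans l h)) (slopes-mono {q} q-convex l h))
      ; u≤δ = λ x l → ℤ.≤-trans (slopes-mono {p} p-convex (ℕ.<⇒≤ l) a<n) (ℤ.≤-reflexive (sym δ))
      ; v≤δ = λ z l → ℤ.≤-trans (v≤u _ z l ℕ.≤-refl a<n) (ℤ.≤-reflexive (sym δ)) }
      where
      open Separating s
      cancel : ∀ a b c → (a + b) - (c + b) ≡ a - c
      cancel = solve-∀
      δ : H (suc k) - H k ≡ u (α k)
      δ = trans (cong (λ ab → p (proj₁ ab) + q (proj₂ ab) - H k) e)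
            (cancel (p (suc (α k))) (q (β k)) (p (α k)))
    ... | up e b<m c | s = record
      { δ≤u = λ x l h → ℤ.≤-trans (ℤ.≤-reflexive δ)
                (ℤ.≤-trans (c (ℕ.≤-<-trans l h)) (slopes-mono {p} p-convex l h))
      ; δ≤v = λ z l h → ℤ.≤-trans (ℤ.≤-reflexive δ) (slopes-mono {q} q-convex l h)
      ; u≤δ = λ x l → ℤ.≤-trans (u≤v x _ l ℕ.≤-refl b<m) (ℤ.≤-reflexive (sym δ))
      ; v≤δ = λ z l → ℤ.≤-trans (slopes-mono {q} q-convex (ℕ.<⇒≤ l) b<m) (ℤ.≤-reflexive (sym δ)) }
      where
      open Separating s
      cancel : ∀ a b c → (a + b) - (a + c) ≡ b - c
      cancel = solve-∀
      δ : H (suc k) - H k ≡ v (β k)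
      δ = trans (cong (λ ab → p (proj₁ ab) + q (proj₂ ab) - H k) e)
            (cancel (p (α k)) (q (suc (β k))) (q (β k)))

    α-mono : ∀ {k} → k ℕ.< n ℕ.+ m → α k ℕ.≤ α (suc k) × α (suc k) ℕ.≤ suc (α k)
    α-mono {k} k< with step k<
    ... | right e _ _ rewrite e = ℕ.n≤1+n _ , ℕ.≤-refl
    ... | up e _ _    rewrite e = ℕ.≤-refl , ℕ.n≤1+n _

    excess : ℕ → ℕ → ℤ
    excess i j = p i + q j - H (i ℕ.+ j)

    private
      complement : ∀ i j → i ℕ.≤ α (i ℕ.+ j) → ∃ λ t → i ℕ.+ t ≡ α (i ℕ.+ j) × β (i ℕ.+ j) ℕ.+ t ≡ j
      complement i j h = α k ℕ.∸ i , ℕ.m+[n∸m]≡n h , ℕ.+-cancelˡ-≡ i _ _ (begin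
        i ℕ.+ (β k ℕ.+ (α k ℕ.∸ i))  ≡⟨ cong (i ℕ.+_) (ℕ.+-comm (β k) _) ⟩
        i ℕ.+ ((α k ℕ.∸ i) ℕ.+ β k)  ≡⟨ ℕ.+-assoc i _ (β k) ⟨
        i ℕ.+ (α k ℕ.∸ i) ℕ.+ β k    ≡⟨ cong (ℕ._+ β k) (ℕ.m+[n∸m]≡n h) ⟩
        α k ℕ.+ β k                  ≡⟨ α+β k ⟩
        i ℕ.+ j                      ∎)
        where
        k = i ℕ.+ j
        open ≡-Reasoning
      complement′ : ∀ i j → α (i ℕ.+ j) ℕ.≤ i → ∃ λ t → α (i ℕ.+ j) ℕ.+ t ≡ i × j ℕ.+ t ≡ β (i ℕ.+ j)
      complement′ i j h = i ℕ.∸ α k , ℕ.m+[n∸m]≡n h , ℕ.+-cancelˡ-≡ (α k) _ _ (begin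
        α k ℕ.+ (j ℕ.+ (i ℕ.∸ α k))  ≡⟨ cong (α k ℕ.+_) (ℕ.+-comm j _) ⟩
        α k ℕ.+ ((i ℕ.∸ α k) ℕ.+ j)  ≡⟨ ℕ.+-assoc (α k) _ j ⟨
        α k ℕ.+ (i ℕ.∸ α k) ℕ.+ j    ≡⟨ cong (ℕ._+ j) (ℕ.m+[n∸m]≡n h) ⟩
        i ℕ.+ j                      ≡⟨ α+β k ⟨
        α k ℕ.+ β k                  ∎)
        where
        k = i ℕ.+ j
        open ≡-Reasoning

    excess≥0 : ∀ {i j} → i ℕ.≤ n → j ℕ.≤ m → 0ℤ ≤ excess i j
    excess≥0 {i} {j} i≤n j≤m with ℕ.≤-total i (α (i ℕ.+ j))
                                | separating (ℕ.+-mono-≤ i≤n j≤m)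
    ... | inj₁ i≤α | s with complement i j i≤α
    ...   | t , e , e′ = ℤ.i≤j⇒0≤j-i (subst₂ (λ a b → p a + q (β (i ℕ.+ j)) ≤ p i + q b) e e′
      (subst₂ _≤_ (ℤ.+-comm _ (p (i ℕ.+ t))) (ℤ.+-comm _ (p i))
        (diagonal q p (β (i ℕ.+ j)) i t λ s s<t →
          u≤v _ _ (ℕ.<-≤-trans (ℕ.+-monoʳ-< i s<t) (ℕ.≤-reflexive e)) (ℕ.m≤m+n _ s)
            (ℕ.<-≤-trans (ℕ.+-monoʳ-< (β (i ℕ.+ j)) s<t) (ℕ.≤-trans (ℕ.≤-reflexive e′) j≤m)))))
      where open Separating s
    excess≥0 {i} {j} i≤n j≤m | inj₂ α≤i | s with complement′ i j α≤i
    ...   | t , e , e′ = ℤ.i≤j⇒0≤j-i (subst₂ (λ a b → p (α (i ℕ.+ j)) + q b ≤ p a + q j) e e′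
      (diagonal p q (α (i ℕ.+ j)) j t λ s s<t →
          v≤u _ _ (ℕ.<-≤-trans (ℕ.+-monoʳ-< j s<t) (ℕ.≤-reflexive e′)) (ℕ.m≤m+n _ s)
            (ℕ.<-≤-trans (ℕ.+-monoʳ-< (α (i ℕ.+ j)) s<t) (ℕ.≤-trans (ℕ.≤-reflexive e) i≤n))))
      where open Separating s

    -- The excess, negated above the path.  This makes it monotone in both
    -- coordinates.
    signed : ℕ → ℕ → ℤ
    signed i j = if ⌊ i ℕ.<? α (i ℕ.+ j) ⌋ then - excess i j else excess i j

    signed-above : ∀ {i j} → i ℕ.< α (i ℕ.+ j) → signed i j ≡ - excess i j
    signed-above {i} {j} h with i ℕ.<? α (i ℕ.+ j)
    ... | yes _ = refl
    ... | no ¬h = contradiction h ¬h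

    signed-below : ∀ {i j} → α (i ℕ.+ j) ℕ.≤ i → signed i j ≡ excess i j
    signed-below {i} {j} h with i ℕ.<? α (i ℕ.+ j)
    ... | yes h′ = contradiction h′ (ℕ.≤⇒≯ h)
    ... | no _   = refl

    private
      below⇒ : ∀ i j → α (i ℕ.+ j) ℕ.≤ i → j ℕ.≤ β (i ℕ.+ j)
      below⇒ i j h = ℕ.≤-trans (ℕ.m≤m+n j _) (ℕ.≤-reflexive (proj₂ (proj₂ (complement′ i j h))))
      above⇒ : ∀ i j → i ℕ.< α (i ℕ.+ j) → β (i ℕ.+ j) ℕ.< j
      above⇒ i j h = ℕ.≰⇒> λ j≤β → ℕ.<-irrefl (sym (α+β (i ℕ.+ j))) (ℕ.+-mono-<-≤ h j≤β)
      below<⇒ : ∀ i j → α (i ℕ.+ j) ℕ.< i → j ℕ.< β (i ℕ.+ j)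
      below<⇒ i j h = ℕ.≰⇒> λ β≤j → ℕ.<-irrefl (α+β (i ℕ.+ j)) (ℕ.+-mono-<-≤ h β≤j)

      neg≤ : ∀ {a b} → 0ℤ ≤ a → 0ℤ ≤ b → - a ≤ b
      neg≤ {a} {b} h k = by (h ⊹ k) (solve (a ∷ b ∷ []))

    -- By `Cut`, the increment of H is at least the slope of p above the path and at most it below,
    -- so the negated and the plain excess both grow. A move across the path goes from a nonpositive
    -- to a nonnegative value; the opposite crossing would need `α` to grow by more than one.
    signed-right : ∀ {i j} → i ℕ.< n → j ℕ.≤ m → signed i j ≤ signed (suc i) j
    signed-right {i} {j} i<n j≤m = go (ℕ.<-≤-connex i (α (i ℕ.+ j))) (ℕ.<-≤-connex (suc i) (α (suc (i ℕ.+ j))))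
      where
      k< : i ℕ.+ j ℕ.< n ℕ.+ m
      k< = ℕ.+-mono-<-≤ i<n j≤m
      open Cut (cut k<)
      lemma : ∀ pi pi′ qj h h′ → h′ - h ≤ pi′ - pi → pi + qj - h ≤ pi′ + qj - h′
      lemma pi pi′ qj h h′ l = by l (solve (pi ∷ pi′ ∷ qj ∷ h ∷ h′ ∷ []))
      lemma′ : ∀ pi pi′ qj h h′ → pi′ - pi ≤ h′ - h → - (pi + qj - h) ≤ - (pi′ + qj - h′)
      lemma′ pi pi′ qj h h′ l = by l (solve (pi ∷ pi′ ∷ qj ∷ h ∷ h′ ∷ []))
      go : i ℕ.< α (i ℕ.+ j) ⊎ α (i ℕ.+ j) ℕ.≤ i →
           suc i ℕ.< α (suc (i ℕ.+ j)) ⊎ α (suc (i ℕ.+ j)) ℕ.≤ suc i → signed i j ≤ signed (suc i) j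
      go (inj₁ a) (inj₁ a′) = subst₂ _≤_ (sym (signed-above {i} {j} a)) (sym (signed-above {suc i} {j} a′))
        (lemma′ (p i) (p (suc i)) (q j) (H (i ℕ.+ j)) (H (suc (i ℕ.+ j))) (u≤δ i a))
      go (inj₁ a) (inj₂ b′) = subst₂ _≤_ (sym (signed-above {i} {j} a)) (sym (signed-below {suc i} {j} b′))
        (neg≤ (excess≥0 (ℕ.<⇒≤ i<n) j≤m) (excess≥0 i<n j≤m))
      go (inj₂ b) (inj₁ a′) = contradiction (ℕ.<-≤-trans a′ (proj₂ (α-mono k<))) (ℕ.≤⇒≯ (s≤s b))
      go (inj₂ b) (inj₂ b′) = subst₂ _≤_ (sym (signed-below {i} {j} b)) (sym (signed-below {suc i} {j} b′))
        (lemma (p i) (p (suc i)) (q j) (H (i ℕ.+ j)) (H (suc (i ℕ.+ j))) (δ≤u i b i<n))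

    signed-up : ∀ {i j} → i ℕ.≤ n → j ℕ.< m → signed i (suc j) ≤ signed i j
    signed-up {i} {j} i≤n j<m =
      go (ℕ.<-≤-connex i (α (i ℕ.+ j))) (ℕ.<-≤-connex i (α (i ℕ.+ suc j)))
      where
      k< : i ℕ.+ j ℕ.< n ℕ.+ m
      k< = ℕ.+-mono-≤-< i≤n j<m
      open Cut (cut k<)
      k+1 : suc (i ℕ.+ j) ≡ i ℕ.+ suc j
      k+1 = sym (ℕ.+-suc i j)
      lemma : ∀ pi qj qj′ h h′ → h′ - h ≤ qj′ - qj → - (pi + qj′ - h′) ≤ - (pi + qj - h)
      lemma pi qj qj′ h h′ l = by l (solve (pi ∷ qj ∷ qj′ ∷ h ∷ h′ ∷ []))
      lemma′ : ∀ pi qj qj′ h h′ → qj′ - qj ≤ h′ - h → pi + qj′ - h′ ≤ pi + qj - h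
      lemma′ pi qj qj′ h h′ l = by l (solve (pi ∷ qj ∷ qj′ ∷ h ∷ h′ ∷ []))
      on-path : i ≡ α (suc (i ℕ.+ j)) → p i + q (suc j) - H (suc (i ℕ.+ j)) ≡ 0ℤ
      on-path e = ℤ.i≡j⇒i-j≡0 (cong₂ (λ x z → p x + q z) e
        (ℕ.+-cancelˡ-≡ i _ _ (trans (ℕ.+-suc i j) (trans (sym (α+β (suc (i ℕ.+ j)))) (cong (ℕ._+ β (suc (i ℕ.+ j))) (sym e))))))
      go : i ℕ.< α (i ℕ.+ j) ⊎ α (i ℕ.+ j) ℕ.≤ i →
           i ℕ.< α (i ℕ.+ suc j) ⊎ α (i ℕ.+ suc j) ℕ.≤ i → signed i (suc j) ≤ signed i j
      go (inj₁ a) (inj₁ a′) = subst₂ _≤_ (sym (signed-above {i} {suc j} a′)) (sym (signed-above {i} {j} a))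
        (subst (λ k → - (p i + q (suc j) - H k) ≤ - excess i j) k+1
          (lemma (p i) (q j) (q (suc j)) (H (i ℕ.+ j)) (H (suc (i ℕ.+ j))) (δ≤v j (ℕ.<⇒≤ (above⇒ i j a)) j<m)))
      go (inj₁ a) (inj₂ b′) = contradiction (ℕ.<-≤-trans a (ℕ.≤-trans (proj₁ (α-mono k<)) (ℕ.≤-reflexive (cong α k+1)))) (ℕ.≤⇒≯ b′)
      go (inj₂ b) (inj₁ a′) = subst₂ _≤_ (sym (signed-above {i} {suc j} a′)) (sym (signed-below {i} {j} b))
        (neg≤ (excess≥0 i≤n j<m) (excess≥0 i≤n (ℕ.<⇒≤ j<m)))
      go (inj₂ b) (inj₂ b′) = subst₂ _≤_ (sym (signed-below {i} {suc j} b′)) (sym (signed-below {i} {j} b))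
        (subst (λ k → p i + q (suc j) - H k ≤ excess i j) k+1 (inner (ℕ.m≤n⇒m<n∨m≡n b)))
        where
        inner : α (i ℕ.+ j) ℕ.< i ⊎ α (i ℕ.+ j) ≡ i → p i + q (suc j) - H (suc (i ℕ.+ j)) ≤ excess i j
        inner (inj₁ b<) = lemma′ (p i) (q j) (q (suc j)) (H (i ℕ.+ j)) (H (suc (i ℕ.+ j))) (v≤δ j (below<⇒ i j b<))
        -- The boundary case, which `Cut` does not settle: (i, j) is on the path and the path goes
        -- up from it, so (i, j + 1) has excess 0.
        inner (inj₂ e) = ℤ.≤-trans (ℤ.≤-reflexive (on-path (ℕ.≤-antisym
            (ℕ.≤-trans (ℕ.≤-reflexive (sym e)) (proj₁ (α-mono k<))) (ℕ.≤-trans (ℕ.≤-reflexive (cong α k+1)) b′))))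
          (excess≥0 i≤n (ℕ.<⇒≤ j<m))

    signed-up* : ∀ {i j j′} → i ℕ.≤ n → j ℕ.≤ j′ → j′ ℕ.≤ m → signed i j′ ≤ signed i j
    signed-up* {i} {j} {j′} i≤n j≤j′ j′≤m with ℕ.m≤n⇒m<n∨m≡n j≤j′
    ... | inj₂ refl = ℤ.≤-refl
    signed-up* {i} {j} {suc j′} i≤n j≤j′ j′≤m | inj₁ (s≤s l) =
      ℤ.≤-trans (signed-up i≤n j′≤m) (signed-up* i≤n l (ℕ.<⇒≤ j′≤m))

    -- c is the number of j ≤ m with θ < signed i j.
    record Crossing (θ : ℤ) (i c : ℕ) : Set where
      constructor crossing
      field
        c≤1+m  : c ℕ.≤ suc m
        before : ∀ j → j ℕ.< c → θ < signed i j
        after  : ∀ j → c ℕ.≤ j → j ℕ.≤ m → signed i j ≤ θ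

    -- Together with `<excess` this turns the condition that the excess be at most E into a strip
    -- between two level sets of the monotone `signed`. The lower threshold is -E - 1 because
    -- crossings count strict inequalities.
    excess≤ : ∀ {i j E} → signed i j ≤ + E → -  (+ E) - 1ℤ < signed i j → excess i j ≤ + E
    excess≤ {i} {j} {E} h k with ℕ.<-≤-connex i (α (i ℕ.+ j))
    ... | inj₁ a = lemma (excess i j) (+ E) (subst (_ ≤_) (signed-above {i} {j} a) (<⇒+1≤ k))
      where
      lemma : ∀ x e → - e - 1ℤ + 1ℤ ≤ - x → x ≤ e
      lemma x e l = by l (solve (x ∷ e ∷ []))
    ... | inj₂ b = subst (_≤ + E) (signed-below {i} {j} b) h

    <excess : ∀ {i j E} → i ℕ.≤ n → j ℕ.≤ m → + E < signed i j ⊎ signed i j ≤ - (+ E) - 1ℤ → + E < excess i j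
    <excess {i} {j} {E} i≤n j≤m h with ℕ.<-≤-connex i (α (i ℕ.+ j)) | excess≥0 i≤n j≤m
    <excess {i} {j} {E} i≤n j≤m (inj₁ h) | inj₁ a | e =
      contradiction (subst (_ <_) (signed-above {i} {j} a) h)
        (ℤ.≤⇒≯ (neg≤ e 0≤+))
    <excess {i} {j} {E} i≤n j≤m (inj₁ h) | inj₂ b | e = subst (_ <_) (signed-below {i} {j} b) h
    <excess {i} {j} {E} i≤n j≤m (inj₂ h) | inj₁ a | e =
      +1≤⇒< (lemma (excess i j) (+ E) (subst (_≤ _) (signed-above {i} {j} a) h))
      where
      lemma : ∀ x e → - x ≤ - e - 1ℤ → e + 1ℤ ≤ x
      lemma x e l = by l (solve (x ∷ e ∷ []))
    <excess {i} {j} {E} i≤n j≤m (inj₂ h) | inj₂ b | e =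
      contradiction (ℤ.≤-trans e (subst (_≤ _) (signed-below {i} {j} b) h))
        (ℤ.<⇒≱ (+1≤⇒< (lemma (+ E) 0≤+)))
      where
      lemma : ∀ e → 0ℤ ≤ e → - e - 1ℤ + 1ℤ ≤ 0ℤ
      lemma e l = by l (solve (e ∷ []))

open LatticePath

-- Coding points of graphs as integers, and the size of their sumsets.

module Counting where

  open import Data.Integer.Base using (_+_; _*_; _-_; -_; _≤_; _<_)

  ∈-sumset⁺ : ∀ {A B x y} → x ∈ A → y ∈ B → x ℕ.+ y ∈ sumset A B
  ∈-sumset⁺ x∈A y∈B = ∈-deduplicate⁺ ℕ._≟_ (∈-cartesianProductWith⁺ ℕ._+_ x∈A y∈B)

  ∈-sumset⁻ : ∀ A B {z} → z ∈ sumset A B → ∃₂ λ x y → x ∈ A × y ∈ B × z ≡ x ℕ.+ y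
  ∈-sumset⁻ A B z∈ with ∈-cartesianProductWith⁻ ℕ._+_ A B
                          (∈-deduplicate⁻ ℕ._≟_ (cartesianProductWith ℕ._+_ A B) z∈)
  ... | x , y , x∈A , y∈B , eq = x , y , x∈A , y∈B , eq

  unique⊆⇒length≤ : ∀ {X : Set} {xs ys : List X} → Unique xs → (∀ {z} → z ∈ xs → z ∈ ys) →
                    length xs ℕ.≤ length ys
  unique⊆⇒length≤ {xs = []} _ _ = z≤n
  unique⊆⇒length≤ {xs = x ∷ xs} {ys} (x∉ AllPairs.∷ u) sub with ∈-∃++ (sub (Any.here refl))
  ... | l , r , refl = ℕ.≤-trans (s≤s (unique⊆⇒length≤ u sub′)) (ℕ.≤-reflexive (sym len))
    where
    len : length (l ++ [ x ] ++ r) ≡ suc (length (l ++ r))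
    len = trans (length-++ l) (trans (ℕ.+-suc (length l) (length r)) (cong suc (sym (length-++ l))))
    sub′ : ∀ {z} → z ∈ xs → z ∈ l ++ r
    sub′ z∈ with ∈-++⁻ l (sub (Any.there z∈))
    ... | inj₁ z∈l         = ∈-++⁺ˡ z∈l
    ... | inj₂ (Any.here refl) = contradiction refl (All.lookup x∉ z∈)
    ... | inj₂ (Any.there z∈r) = ∈-++⁺ʳ l z∈r

  length-cartesianProductWith : ∀ {X Y Z : Set} (f : X → Y → Z) xs ys →
    length (cartesianProductWith f xs ys) ≡ length xs ℕ.* length ys
  length-cartesianProductWith f []       ys = refl
  length-cartesianProductWith f (x ∷ xs) ys = trans (length-++ (map (f x) ys))
    (cong₂ ℕ._+_ (length-map (f x) ys) (length-cartesianProductWith f xs ys))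

  -- A point (i , x) of the graph of a function into [-M , M] is coded by a
  -- number in base K > 4M, so that the leading digit of a sum of two codes is
  -- i + i′.
  module Code (M K : ℕ) .{{_ : NonZero K}} (4M<K : (M ℕ.+ M) ℕ.+ (M ℕ.+ M) ℕ.< K) where

    code : (ℕ → ℤ) → ℕ → ℕ
    code f i = i ℕ.* K ℕ.+ ∣ f i + + M ∣

    Small : (ℕ → ℤ) → ℕ → Set
    Small f i = ∣ f i ∣ ℕ.≤ M

    module _ {f : ℕ → ℤ} {i : ℕ} (small : Small f i) where

      digit : + ∣ f i + + M ∣ ≡ f i + + M
      digit = ℤ.0≤i⇒+∣i∣≡i (lemma (f i) (+ M) (ℤ.≤-trans (ℤ.neg-mono-≤ (ℤ.+≤+ small)) (-∣∣≤ (f i))))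
        where
        lemma : ∀ x m → - m ≤ x → 0ℤ ≤ x + m
        lemma x m h = by h (solve (x ∷ m ∷ []))
        -∣∣≤ : ∀ x → - (+ ∣ x ∣) ≤ x
        -∣∣≤ (+ zero)      = ℤ.≤-refl
        -∣∣≤ (+ suc x)     = ℤ.-≤+
        -∣∣≤ ℤ.-[1+ x ]    = ℤ.≤-refl

      digit≤ : ∣ f i + + M ∣ ℕ.≤ M ℕ.+ M
      digit≤ = ℕ.≤-trans (ℤ.∣i+j∣≤∣i∣+∣j∣ (f i) (+ M)) (ℕ.+-monoˡ-≤ M small)

      code-value : + code f i ≡ + i * + K + f i + + M
      code-value = begin
        + code f i                           ≡⟨⟩
        + (i ℕ.* K) + + ∣ f i + + M ∣        ≡⟨ cong₂ _+_ (ℤ.pos-* i K) digit ⟩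
        + i * + K + (f i + + M)              ≡⟨ ℤ.+-assoc (+ i * + K) (f i) (+ M) ⟨
        + i * + K + f i + + M                ∎
        where open ≡-Reasoning

    code-mono : ∀ {f i j} → Small f i → i ℕ.< j → code f i ℕ.< code f j
    code-mono {f} {i} {j} small i<j = begin-strict
      i ℕ.* K ℕ.+ ∣ f i + + M ∣  <⟨ ℕ.+-monoʳ-< (i ℕ.* K) (ℕ.≤-<-trans (digit≤ {f} small) (ℕ.≤-<-trans (ℕ.m≤m+n _ _) 4M<K)) ⟩
      i ℕ.* K ℕ.+ K              ≡⟨ ℕ.+-comm (i ℕ.* K) K ⟩
      suc i ℕ.* K                ≤⟨ ℕ.*-monoˡ-≤ K i<j ⟩
      j ℕ.* K                    ≤⟨ ℕ.m≤m+n (j ℕ.* K) _ ⟩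
      code f j                   ∎
      where open ℕ.≤-Reasoning

    module _ {f g : ℕ → ℤ} {i j : ℕ} (sf : Small f i) (sg : Small g j) where

      -- Each digit is at most 2M, so the digits add up to less than K and no carry reaches the
      -- leading part.
      leading : + (code f i ℕ.+ code g j) ℤ./ℕ K ≡ + (i ℕ.+ j)
      leading = cong +_ (begin
        (i ℕ.* K ℕ.+ a ℕ.+ (j ℕ.* K ℕ.+ b)) ℕ./ K   ≡⟨ cong (ℕ._/ K) (shuffle (i ℕ.* K) a (j ℕ.* K) b) ⟩
        ((i ℕ.* K ℕ.+ j ℕ.* K) ℕ.+ (a ℕ.+ b)) ℕ./ K ≡⟨ cong (λ z → (z ℕ.+ (a ℕ.+ b)) ℕ./ K) (ℕ.*-distribʳ-+ K i j) ⟨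
        ((i ℕ.+ j) ℕ.* K ℕ.+ (a ℕ.+ b)) ℕ./ K       ≡⟨ ℕ.+-distrib-/-∣ˡ (a ℕ.+ b) (ℕ.n∣m*n (i ℕ.+ j)) ⟩
        (i ℕ.+ j) ℕ.* K ℕ./ K ℕ.+ (a ℕ.+ b) ℕ./ K   ≡⟨ cong₂ ℕ._+_ (ℕ.m*n/n≡m (i ℕ.+ j) K) (ℕ.m<n⇒m/n≡0 (ℕ.≤-<-trans (ℕ.+-mono-≤ (digit≤ {f} sf) (digit≤ {g} sg)) 4M<K)) ⟩
        i ℕ.+ j ℕ.+ 0                               ≡⟨ ℕ.+-identityʳ (i ℕ.+ j) ⟩
        i ℕ.+ j ∎)
        where
        open ≡-Reasoning
        a = ∣ f i + + M ∣
        b = ∣ g j + + M ∣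
        shuffle : ∀ x a y b → x ℕ.+ a ℕ.+ (y ℕ.+ b) ≡ (x ℕ.+ y) ℕ.+ (a ℕ.+ b)
        shuffle x a y b = trans (ℕ.+-assoc x a _) (trans (cong (x ℕ.+_) (trans (sym (ℕ.+-assoc a y b))
          (trans (cong (ℕ._+ b) (ℕ.+-comm a y)) (ℕ.+-assoc y a b)))) (sym (ℕ.+-assoc x y _)))

      sum-value : + (code f i ℕ.+ code g j) ≡ + (i ℕ.+ j) * + K + (f i + g j) + (+ M + + M)
      sum-value = trans (cong₂ _+_ (code-value {f} sf) (code-value {g} sg))
        (lemma (+ i) (+ j) (+ K) (f i) (g j) (+ M))
        where
        lemma : ∀ i j k x y m → (i * k + x + m) + (j * k + y + m) ≡ (i + j) * k + (x + y) + (m + m)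
        lemma = solve-∀

    codes : (ℕ → ℤ) → ℕ → ℕ → List ℕ
    codes f i₀ s = applyUpTo (λ t → code f (i₀ ℕ.+ t)) s

    codes-set : ∀ {f i₀ s} → (∀ t → t ℕ.< s → Small f (i₀ ℕ.+ t)) → 1 ℕ.≤ s → IsSet (codes f i₀ s)
    codes-set {f} {i₀} {suc s} small (s≤s _) = (λ ()) ,
      Unique.applyUpTo⁺₁ (λ t → code f (i₀ ℕ.+ t)) (suc s) λ {t} {t′} t<t′ t′< eq →
        ℕ.<-irrefl eq (code-mono {f} (small t (ℕ.<-trans t<t′ t′<)) (ℕ.+-monoʳ-< i₀ t<t′))

    module Box (f g : ℕ → ℤ) (i₀ s j₀ r : ℕ)
               (sf : ∀ t → t ℕ.< s → Small f (i₀ ℕ.+ t))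
               (sg : ∀ t → t ℕ.< r → Small g (j₀ ℕ.+ t)) where

      Sums : List ℕ
      Sums = sumset (codes f i₀ s) (codes g j₀ r)

      sums⁻ : ∀ {z} → z ∈ Sums → ∃₂ λ t t′ → t ℕ.< s × t′ ℕ.< r ×
              z ≡ code f (i₀ ℕ.+ t) ℕ.+ code g (j₀ ℕ.+ t′)
      sums⁻ z∈ with ∈-sumset⁻ (codes f i₀ s) (codes g j₀ r) z∈
      ... | x , y , x∈ , y∈ , eq with ∈-applyUpTo⁻ _ x∈ | ∈-applyUpTo⁻ _ y∈
      ...   | t , t< , refl | t′ , t′< , refl = t , t′ , t< , t′< , eq

      sums⁺ : ∀ {t t′} → t ℕ.< s → t′ ℕ.< r → code f (i₀ ℕ.+ t) ℕ.+ code g (j₀ ℕ.+ t′) ∈ Sums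
      sums⁺ t< t′< = ∈-sumset⁺ {codes f i₀ s} {codes g j₀ r} (∈-applyUpTo⁺ _ t<) (∈-applyUpTo⁺ _ t′<)

      -- There are few sums if, on each antidiagonal k of the box, they all lie
      -- in a window of width w starting at H k / N.
      sums-length : ∀ N .{{_ : NonZero N}} (H : ℕ → ℤ) w →
        (∀ t t′ → t ℕ.< s → t′ ℕ.< r → let i = i₀ ℕ.+ t; j = j₀ ℕ.+ t′ in
           H (i ℕ.+ j) ≤ + N * (f i + g j) × + N * (f i + g j) ≤ H (i ℕ.+ j) + + N * + w) →
        length Sums ℕ.≤ (s ℕ.+ r) ℕ.* suc w
      sums-length N H w window = ℕ.≤-trans
        (unique⊆⇒length≤ (deduplicate-! _) covered)
        (ℕ.≤-reflexive (trans (length-cartesianProductWith point ks (upTo (suc w)))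
          (cong₂ ℕ._*_ (length-applyUpTo (i₀ ℕ.+ j₀ ℕ.+_) (s ℕ.+ r)) (length-upTo (suc w)))))
        where
        -- The integers between H k / N and H k / N + w are among the w + 1 numbers from `base k` to
        -- `base k + w`, so (k, offset) determines a sum.
        base : ℕ → ℤ
        base k = H k ℤ./ℕ N
        point : ℕ → ℕ → ℕ
        point k x = ∣ + k * + K + (base k + + x) + (+ M + + M) ∣
        -- All antidiagonals that meet the box; there is room for one more than necessary.
        ks = applyUpTo (i₀ ℕ.+ j₀ ℕ.+_) (s ℕ.+ r)
        offset : ∀ k val → H k ≤ + N * val → + N * val ≤ H k + + N * + w →
                 ∃ λ x → x ℕ.< suc w × base k + + x ≡ val
        offset k val lo hi = ∣ val - base k ∣ , s≤s x≤w , eq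
          where
          0<N : 0ℤ < + N
          0<N = ℤ.+<+ (ℕ.>-nonZero⁻¹ N)
          base≤val : base k ≤ val
          base≤val = divide 0<N (ℤ.≤-trans (ℤ.≤-reflexive (ℤ.*-comm (+ N) (base k)))
                       (ℤ.≤-trans (ℤ.[n/ℕd]*d≤n (H k) N) lo))
          lemma : ∀ n v w b h → h + 1ℤ ≤ (1ℤ + b) * n → n * v ≤ h + n * w → n * v + 1ℤ ≤ n * (b + w + 1ℤ)
          lemma n v w b h x y = by (x ⊹ y) (solve (n ∷ v ∷ w ∷ b ∷ h ∷ []))
          val< : val < base k + + w + 1ℤ
          val< = ℤ.*-cancelˡ-<-nonNeg (+ N) (+1≤⇒< (lemma (+ N) val (+ w) (base k) (H k)
                   (<⇒+1≤ (ℤ.n<s[n/ℕd]*d (H k) N)) hi))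
          +x : + ∣ val - base k ∣ ≡ val - base k
          +x = ℤ.0≤i⇒+∣i∣≡i (ℤ.i≤j⇒0≤j-i base≤val)
          finish : ∀ v b w → v + 1ℤ ≤ b + w + 1ℤ → v - b ≤ w
          finish v b w h = by h (solve (v ∷ b ∷ w ∷ []))
          x≤w : ∣ val - base k ∣ ℕ.≤ w
          x≤w = ℤ.drop‿+≤+ (subst (_≤ + w) (sym +x) (finish val (base k) (+ w) (<⇒+1≤ val<)))
          eq : base k + + ∣ val - base k ∣ ≡ val
          eq = trans (cong (λ z → base k + z) +x) (cancel (base k) val)
            where
            cancel : ∀ b v → b + (v - b) ≡ v
            cancel = solve-∀
        covered : ∀ {z} → z ∈ Sums → z ∈ cartesianProductWith point ks (upTo (suc w))
        covered z∈ with sums⁻ z∈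
        ... | t , t′ , t< , t′< , refl with window t t′ t< t′<
        ...   | lo , hi with offset (i₀ ℕ.+ t ℕ.+ (j₀ ℕ.+ t′)) _ lo hi
        ...     | x , x< , eq = subst (_∈ _) point≡
          (∈-cartesianProductWith⁺ point (subst (_∈ ks) k≡ (∈-applyUpTo⁺ (i₀ ℕ.+ j₀ ℕ.+_) (ℕ.+-mono-<-≤ t< (ℕ.<⇒≤ t′<)))) (∈-upTo⁺ x<))
          where
          k = i₀ ℕ.+ t ℕ.+ (j₀ ℕ.+ t′)
          k≡ : i₀ ℕ.+ j₀ ℕ.+ (t ℕ.+ t′) ≡ k
          k≡ = trans (ℕ.+-assoc i₀ j₀ _) (trans (cong (i₀ ℕ.+_) (trans (sym (ℕ.+-assoc j₀ t t′))
            (trans (cong (ℕ._+ t′) (ℕ.+-comm j₀ t)) (ℕ.+-assoc t j₀ t′)))) (sym (ℕ.+-assoc i₀ t _)))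
          point≡ : point k x ≡ code f (i₀ ℕ.+ t) ℕ.+ code g (j₀ ℕ.+ t′)
          point≡ = cong ∣_∣ (trans (cong (λ v → + k * + K + v + (+ M + + M)) eq)
            (sym (sum-value {f} {g} (sf t t<) (sg t′ t′<))))

  map-applyUpTo : ∀ {X Y : Set} (h : X → Y) f s → map h (applyUpTo f s) ≡ applyUpTo (h ∘ f) s
  map-applyUpTo h f zero    = refl
  map-applyUpTo h f (suc s) = cong (h (f 0) ∷_) (map-applyUpTo h (f ∘ suc) s)

  applyUpTo-cong : ∀ {X : Set} (f g : ℕ → X) s → (∀ t → t ℕ.< s → f t ≡ g t) →
                   applyUpTo f s ≡ applyUpTo g s
  applyUpTo-cong f g zero    h = refl
  applyUpTo-cong f g (suc s) h =
    cong₂ _∷_ (h 0 (s≤s z≤n)) (applyUpTo-cong (f ∘ suc) (g ∘ suc) s (λ t l → h (suc t) (s≤s l)))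

  overwrite-∈ : ∀ S a t → t ℕ.< length S → ∃ λ z → z ∈ S × overwrite (map +_ S) a t ≡ + z
  overwrite-∈ (x ∷ S) a zero    _       = x , Any.here refl , refl
  overwrite-∈ (x ∷ S) a (suc t) (s≤s l) with overwrite-∈ S (a ∘ suc) t l
  ... | z , z∈ , eq = z , Any.there z∈ , eq

  ∈-overwrite : ∀ {S z} a → z ∈ S → ∃ λ t → t ℕ.< length S × overwrite (map +_ S) a t ≡ + z
  ∈-overwrite a (Any.here refl) = 0 , s≤s z≤n , refl
  ∈-overwrite a (Any.there z∈) with ∈-overwrite (a ∘ suc) z∈
  ... | t , l , eq = suc t , s≤s l , eq

  overwrite-bound : ∀ S a {B} → (∀ {z} → z ∈ S → z ℕ.≤ B) → (∀ t → ∣ a t ∣ ℕ.≤ B) →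
                    ∀ t → ∣ overwrite (map +_ S) a t ∣ ℕ.≤ B
  overwrite-bound []      a h k t       = k t
  overwrite-bound (x ∷ S) a h k zero    = h (Any.here refl)
  overwrite-bound (x ∷ S) a h k (suc t) = overwrite-bound S (a ∘ suc) (h ∘ Any.there) (k ∘ suc) t

open Counting

open import Data.Nat.Base using (_+_; _*_; _^_; _≤_; _<_; _≤ᵇ_)
open import Data.Integer.Base using () renaming (_≤_ to _≤ℤ_)

-- Frame conditions: what a command leaves alone.

writesVar writesArr : Cmd → ℕ → Bool
writesVar skip _             = false
writesVar (x ≔ _) y          = ⌊ y ℕ.≟ x ⌋
writesVar (put _ _ _) _      = false
writesVar (p ⨾ q) y          = writesVar p y ∨ writesVar q y
writesVar (ite _ p q) y      = writesVar p y ∨ writesVar q y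
writesVar (while _ p) y      = writesVar p y
writesVar (conv _ _ _ _ _ x) y = ⌊ y ℕ.≟ x ⌋

writesArr skip _             = false
writesArr (_ ≔ _) _          = false
writesArr (put a _ _) b      = ⌊ b ℕ.≟ a ⌋
writesArr (p ⨾ q) b          = writesArr p b ∨ writesArr q b
writesArr (ite _ p q) b      = writesArr p b ∨ writesArr q b
writesArr (while _ p) b      = writesArr p b
writesArr (conv _ _ _ _ c _) b = ⌊ b ℕ.≟ c ⌋

anyOf : (Cmd → ℕ → Bool) → List Cmd → ℕ → Bool
anyOf w [] _      = false
anyOf w (p ∷ κ) x = w p x ∨ anyOf w κ x

-- The write checks are Booleans, so that for a concrete program every side condition holds by
-- `refl`. This is how facts about untouched variables and arrays are carried across loops.
record Frame (κ : List Cmd) (σ σ′ : State) : Set where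
  constructor frame
  field
    var≡ : ∀ x → anyOf writesVar κ x ≡ false → vars σ′ x ≡ vars σ x
    arr≡ : ∀ a → anyOf writesArr κ a ≡ false → arrays σ′ a ≡ arrays σ a

open Frame public

frame-refl : ∀ {κ σ} → Frame κ σ σ
frame-refl = frame (λ _ _ → refl) (λ _ _ → refl)

frame-trans : ∀ {κ σ σ′ σ″} → Frame κ σ σ′ → Frame κ σ′ σ″ → Frame κ σ σ″
frame-trans (frame v a) (frame v′ a′) =
  frame (λ x w → trans (v′ x w) (v x w)) (λ x w → trans (a′ x w) (a x w))

-- A step never leaves commands that write something new; hence the check made on the initial
-- command list is valid for the whole run.
Fewer : List Cmd → List Cmd → Set
Fewer κ κ′ = (∀ x → anyOf writesVar κ x ≡ false → anyOf writesVar κ′ x ≡ false)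
           × (∀ x → anyOf writesArr κ x ≡ false → anyOf writesArr κ′ x ≡ false)

frame-fewer : ∀ {κ κ′ σ σ′} → Fewer κ κ′ → Frame κ′ σ σ′ → Frame κ σ σ′
frame-fewer (fv , fa) (frame v a) =
  frame (λ x w → v x (fv x w)) (λ x w → a x (fa x w))

private
  ∨-intro : ∀ {x y} → x ≡ false → y ≡ false → x ∨ y ≡ false
  ∨-intro refl q = q

  ∨-assoc⁻ : ∀ x {y z} → (x ∨ y) ∨ z ≡ false → x ∨ (y ∨ z) ≡ false
  ∨-assoc⁻ false q = q

  ∨-left ∨-right : ∀ x y {z} → (x ∨ y) ∨ z ≡ false → _
  ∨-left x y {z} q = ∨-intro {x} {z} (∨-conicalˡ x y (∨-conicalˡ (x ∨ y) z q))
                        (∨-conicalʳ (x ∨ y) z q)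
  ∨-right x y {z} q = ∨-intro {y} {z} (∨-conicalʳ x y (∨-conicalˡ (x ∨ y) z q))
                        (∨-conicalʳ (x ∨ y) z q)

  ∨-dup : ∀ x {z} → x ∨ z ≡ false → x ∨ (x ∨ z) ≡ false
  ∨-dup false q = q

  update-frame : ∀ {X : Set} (s : ℕ → X) {i} {v} j {z} →
                 ⌊ j ℕ.≟ i ⌋ ∨ z ≡ false → update s i v j ≡ s j
  update-frame s {i} j q with ⌊ j ℕ.≟ i ⌋
  ... | false = refl

  tail-fewer : ∀ p κ → Fewer (p ∷ κ) κ
  tail-fewer p κ = (λ x → ∨-conicalʳ (writesVar p x) (anyOf writesVar κ x))
                   , (λ x → ∨-conicalʳ (writesArr p x) (anyOf writesArr κ x))

-- A program logic with cost budgets and bounded words.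

record Limits : Set where
  field
    W B c L Smax : ℕ
    4≤B          : 4 ≤ B
    -- B bounds what is stored between commands. An expression of size k over such values evaluates
    -- to at most B^k, and 30 bounds the sizes of the expressions evaluated below.
    B^≤W         : ∀ k → k ≤ 30 → B ^ k ≤ W

module Logic (limits : Limits) where

  open Limits limits
  open Machine W

  Bounded : State → Set
  Bounded σ = (∀ x → ∣ vars σ x ∣ ≤ B) × (∀ a i → ∣ arrays σ a i ∣ ≤ B)

  -- Runs of bounded cost against an arbitrary primitive that answers with
  -- any listing of A + B in time c * (|A + B| * L).
  data Exec (Q : State → Set) : ℕ → Config → Set where
    done : ∀ {b σ} → Q σ → Exec Q b ([] , σ)
    step : ∀ {C C′ t b b′} → C ⟶⟨ t ⟩ C′ → Exec Q b C′ → t + b ≤ b′ →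
           Exec Q b′ C
    call : ∀ {C t A B K b b′} → C calls⟨ t ⟩ A , B resuming K →
           length (sumset A B) ≤ Smax →
           (∀ S → S ↭ sumset A B → Exec Q b (K S)) →
           t + c * (length (sumset A B) * L) + b ≤ b′ →
           Exec Q b′ C

  weaken : ∀ {Q b b′ C} → b ≤ b′ → Exec Q b C → Exec Q b′ C
  weaken l (done q)       = done q
  weaken l (step s r h)   = step s r (ℕ.≤-trans h l)
  weaken l (call s m k h) = call s m k (ℕ.≤-trans h l)

  private
    _⟫_ : Config → List Cmd → Config
    (κ , σ) ⟫ κ′ = κ ++ κ′ , σ

    extend : ∀ {C t C′} κ → C ⟶⟨ t ⟩ C′ → (C ⟫ κ) ⟶⟨ t ⟩ (C′ ⟫ κ)
    extend κ ⟶-skip              = ⟶-skip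
    extend κ (⟶-assign e)        = ⟶-assign e
    extend κ (⟶-put e z e′)      = ⟶-put e z e′
    extend κ ⟶-seq               = ⟶-seq
    extend κ (⟶-ite-true e z)    = ⟶-ite-true e z
    extend κ (⟶-ite-false e z)   = ⟶-ite-false e z
    extend κ (⟶-while-true e z)  = ⟶-while-true e z
    extend κ (⟶-while-false e z) = ⟶-while-false e z

    extend-call : ∀ {C t A B K} κ → C calls⟨ t ⟩ A , B resuming K →
                  (C ⟫ κ) calls⟨ t ⟩ A , B resuming (λ S → K S ⟫ κ)
    extend-call κ (⟶-conv a b c d e f g h i j) = ⟶-conv a b c d e f g h i j

  bind : ∀ {Q Q′ b b′ C κ} → Exec Q b C →
         (∀ {σ} → Q σ → Exec Q′ b′ (κ , σ)) → Exec Q′ (b + b′) (C ⟫ κ)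
  bind {b = b} {b′} (done q) k = weaken (ℕ.m≤n+m b′ b) (k q)
  bind {b = b} {b′} (step {t = t} {b = b₁} s r h) k =
    step (extend _ s) (bind r k)
      (ℕ.≤-trans (ℕ.≤-reflexive (sym (ℕ.+-assoc t b₁ b′))) (ℕ.+-monoˡ-≤ b′ h))
  bind {b = b} {b′} (call {t = t} {b = b₁} s m r h) k =
    call (extend-call _ s) m (λ S p → bind (r S p) k)
      (ℕ.≤-trans (ℕ.≤-reflexive (sym (ℕ.+-assoc _ b₁ b′))) (ℕ.+-monoˡ-≤ b′ h))

  private
    step-frame : ∀ {κ σ t κ′ σ′} → (κ , σ) ⟶⟨ t ⟩ (κ′ , σ′) →
                 Frame κ σ σ′ × Fewer κ κ′
    step-frame {κ′ = κ} ⟶-skip = frame-refl , tail-fewer skip κ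
    step-frame {σ = σ} {κ′ = κ} (⟶-assign {x} {e} _) =
      frame (λ y → update-frame (vars σ) y) (λ _ _ → refl) , tail-fewer (x ≔ e) κ
    step-frame {σ = σ} {κ′ = κ} (⟶-put {a} {e} {e′} _ _ _) =
      frame (λ _ _ → refl) (λ b → update-frame (arrays σ) b) , tail-fewer (put a e e′) κ
    step-frame (⟶-seq {p} {q}) = frame-refl ,
      (λ x → ∨-assoc⁻ (writesVar p x)) , (λ x → ∨-assoc⁻ (writesArr p x))
    step-frame (⟶-ite-true {p = p} {q} _ _) = frame-refl ,
      (λ x → ∨-left (writesVar p x) (writesVar q x)) ,
      (λ x → ∨-left (writesArr p x) (writesArr q x))
    step-frame (⟶-ite-false {p = p} {q} _ _) = frame-refl ,
      (λ x → ∨-right (writesVar p x) (writesVar q x)) ,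
      (λ x → ∨-right (writesArr p x) (writesArr q x))
    step-frame (⟶-while-true {p = p} _ _) = frame-refl ,
      (λ x → ∨-dup (writesVar p x)) , (λ x → ∨-dup (writesArr p x))
    step-frame {κ′ = κ} (⟶-while-false {e} {p} _ _) = frame-refl , tail-fewer (while e p) κ

    call-frame : ∀ {κ σ t A B K} → (κ , σ) calls⟨ t ⟩ A , B resuming K → ∀ S →
                 Frame κ σ (proj₂ (K S)) × Fewer κ (proj₁ (K S))
    call-frame {σ = σ} (⟶-conv {a} {l} {b} {m} {c′} {x} {κ} _ _ _ _ _ _ _ _ _ _) S =
      frame (λ y → update-frame (vars σ) y) (λ d → update-frame (arrays σ) d) ,
      tail-fewer (conv a l b m c′ x) κ

  with-frame : ∀ {Q b κ σ} → Exec Q b (κ , σ) →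
               Exec (λ σ′ → Q σ′ × Frame κ σ σ′) b (κ , σ)
  with-frame {Q} r = go r id
    where
    go : ∀ {Q′ : State → Set} {b κ σ} → Exec Q b (κ , σ) →
         (∀ {σ′} → Q σ′ × Frame κ σ σ′ → Q′ σ′) → Exec Q′ b (κ , σ)
    go (done q) k = done (k (q , frame-refl))
    go (step s r h) k with step-frame s
    ... | f , w = step s
      (go r λ { (q , f′) → k (q , frame-trans f (frame-fewer w f′)) }) h
    go (call s m r h) k = call s m
      (λ S p → go (r S p) λ { (q , f′) →
        k (q , frame-trans (proj₁ (call-frame s S))
                 (frame-fewer (proj₂ (call-frame s S)) f′)) }) h

  infix 3 _⊢_⇓_
  -- Evaluation derivations carry no overflow conditions; those are settled once, by `sound`, from
  -- the size of the expression. Literals are at most 4, the least possible B.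
  data _⊢_⇓_ (σ : State) : Expr → ℤ → Set where
    lit  : ∀ z {_ : Bool.T (∣ z ∣ ≤ᵇ 4)} → σ ⊢ lit z ⇓ z
    var  : ∀ {x z} → vars σ x ≡ z → σ ⊢ var x ⇓ z
    get  : ∀ {a e i z} → σ ⊢ e ⇓ + i → arrays σ a i ≡ z → σ ⊢ get a e ⇓ z
    add  : ∀ {e e′ u v} → σ ⊢ e ⇓ u → σ ⊢ e′ ⇓ v → σ ⊢ e ⊕ e′ ⇓ u ℤ.+ v
    sub  : ∀ {e e′ u v} → σ ⊢ e ⇓ u → σ ⊢ e′ ⇓ v → σ ⊢ e ⊖ e′ ⇓ u ℤ.- v
    mul  : ∀ {e e′ u v} → σ ⊢ e ⇓ u → σ ⊢ e′ ⇓ v → σ ⊢ e ⊗ e′ ⇓ u ℤ.* v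
    quot : ∀ {e e′ u d} .{{_ : NonZero d}} → σ ⊢ e ⇓ u → σ ⊢ e′ ⇓ + d →
           σ ⊢ e ⊘ e′ ⇓ u ℤ./ℕ d

  infix 3 _⊢_⇓≡_
  _⊢_⇓≡_ : State → Expr → ℤ → Set
  σ ⊢ e ⇓≡ z = ∃ λ z′ → σ ⊢ e ⇓ z′ × z′ ≡ z

  at : ∀ {σ e z z′} → σ ⊢ e ⇓ z → z ≡ z′ → σ ⊢ e ⇓ z′
  at ev refl = ev

  -- Rounding towards minus infinity can enlarge a negative quotient by one. For d = 1 there is no
  -- remainder, and for d ≥ 2 the quotient is small enough to have room.
  ∣/ℕ∣≤ : ∀ z d .{{_ : NonZero d}} → ∣ z ℤ./ℕ d ∣ ≤ ∣ z ∣
  ∣/ℕ∣≤ (+ n) d = ℕ.m/n≤m n d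
  ∣/ℕ∣≤ -[1+ n ] (suc zero) with suc n ℕ.% 1 in eq
  ... | zero  = subst (_≤ suc n) (sym (ℤ.∣-i∣≡∣i∣ (+ (suc n ℕ./ 1)))) (ℕ.m/n≤m (suc n) 1)
  ... | suc r = contradiction (trans (sym eq) (ℕ.n%1≡0 (suc n))) λ ()
  ∣/ℕ∣≤ -[1+ n ] d@(suc (suc _)) with suc n ℕ.% d
  ... | zero  = subst (_≤ suc n) (sym (ℤ.∣-i∣≡∣i∣ (+ (suc n ℕ./ d)))) (ℕ.m/n≤m (suc n) d)
  ... | suc r = ℕ.m/n<m (suc n) d (s≤s (s≤s z≤n))

  private
    instance
      B≢0 : NonZero B
      B≢0 = ℕ.>-nonZero (ℕ.≤-trans (s≤s z≤n) 4≤B)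

    B^0<  : ∀ k → 1 ≤ B ^ k
    B^0< k = ℕ.>-nonZero⁻¹ (B ^ k) {{ℕ.m^n≢0 B k}}

    one : ∀ {x} → x ≤ B → x ≤ B ^ 1
    one h = ℕ.≤-trans h (ℕ.≤-reflexive (sym (ℕ.*-identityʳ B)))

    sumBound : ∀ {x y} m n → x ≤ B ^ m → y ≤ B ^ n → x + y ≤ B ^ suc (m + n)
    sumBound {x} {y} m n p q = begin
      x + y                       ≤⟨ ℕ.+-mono-≤ p q ⟩
      B ^ m + B ^ n               ≤⟨ ℕ.+-mono-≤ (ℕ.^-monoʳ-≤ B (ℕ.m≤m+n m n)) (ℕ.^-monoʳ-≤ B (ℕ.m≤n+m n m)) ⟩
      B ^ (m + n) + B ^ (m + n)   ≤⟨ ℕ.+-monoʳ-≤ (B ^ (m + n)) (ℕ.m≤m+n _ 0) ⟩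
      2 * B ^ (m + n)             ≤⟨ ℕ.*-monoˡ-≤ (B ^ (m + n)) (ℕ.≤-trans (s≤s (s≤s z≤n)) 4≤B) ⟩
      B ^ suc (m + n)             ∎
      where open ℕ.≤-Reasoning

    prodBound : ∀ {x y} m n → x ≤ B ^ m → y ≤ B ^ n → x * y ≤ B ^ suc (m + n)
    prodBound {x} {y} m n p q = begin
      x * y           ≤⟨ ℕ.*-mono-≤ p q ⟩
      B ^ m * B ^ n   ≡⟨ ℕ.^-distribˡ-+-* B m n ⟨
      B ^ (m + n)     ≤⟨ ℕ.^-monoʳ-≤ B (ℕ.n≤1+n (m + n)) ⟩
      B ^ suc (m + n) ∎
      where open ℕ.≤-Reasoning

    -- Induction on the derivation. The extra factor B for each operation absorbs the 2 of a sum,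
    -- and a product needs no extra factor.
    sound : ∀ {σ e z} → Bounded σ → σ ⊢ e ⇓ z → size e ≤ 30 →
            Subterms e σ × ⟦ e ⟧ σ ≡ z × ∣ z ∣ ≤ B ^ size e
    eval : ∀ {σ e z} → Bounded σ → σ ⊢ e ⇓ z → size e ≤ 30 → Evaluates e σ
    eval bd ev s with sound bd ev s
    ... | sub′ , eq , le = sub′ ,
      ℕ.≤-trans (ℕ.≤-trans (ℕ.≤-reflexive (cong ∣_∣ eq)) le) (B^≤W _ s)

    sizeˡ : ∀ {k} m n → suc (m + n) ≤ k → m ≤ k
    sizeˡ m n h = ℕ.≤-trans (ℕ.m≤m+n m n) (ℕ.≤-trans (ℕ.n≤1+n _) h)
    sizeʳ : ∀ {k} m n → suc (m + n) ≤ k → n ≤ k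
    sizeʳ m n h = ℕ.≤-trans (ℕ.m≤n+m n m) (ℕ.≤-trans (ℕ.n≤1+n _) h)

    sound bd (lit z {h}) s = tt , refl , one (ℕ.≤-trans (ℕ.≤ᵇ⇒≤ _ _ h) 4≤B)
    sound bd (var {x} refl) s = tt , refl , one (proj₁ bd x)
    sound {σ} bd (get {a} {e} {i} ev refl) s with sound bd ev (ℕ.≤-trans (ℕ.n≤1+n _) s)
    ... | _ , eq , le =
      (eval bd ev (ℕ.≤-trans (ℕ.n≤1+n _) s) , subst (0ℤ ℤ.≤_) (sym eq) (ℤ.+≤+ z≤n)) ,
      cong (arrays σ a ∘ ∣_∣) eq ,
      ℕ.≤-trans (one (proj₂ bd a i)) (ℕ.^-monoʳ-≤ B {1} {suc (size e)} (s≤s z≤n))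
    sound bd (add {e} {e′} {u} {v} ev ev′) s
      with sound bd ev (sizeˡ (size e) (size e′) s) | sound bd ev′ (sizeʳ (size e) (size e′) s)
    ... | _ , eq , le | _ , eq′ , le′ =
      (eval bd ev (sizeˡ (size e) (size e′) s) , eval bd ev′ (sizeʳ (size e) (size e′) s)) ,
      cong₂ ℤ._+_ eq eq′ ,
      ℕ.≤-trans (ℤ.∣i+j∣≤∣i∣+∣j∣ u v) (sumBound (size e) (size e′) le le′)
    sound bd (sub {e} {e′} {u} {v} ev ev′) s
      with sound bd ev (sizeˡ (size e) (size e′) s) | sound bd ev′ (sizeʳ (size e) (size e′) s)
    ... | _ , eq , le | _ , eq′ , le′ =
      (eval bd ev (sizeˡ (size e) (size e′) s) , eval bd ev′ (sizeʳ (size e) (size e′) s)) ,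
      cong₂ ℤ._-_ eq eq′ ,
      ℕ.≤-trans (ℤ.∣i-j∣≤∣i∣+∣j∣ u v) (sumBound (size e) (size e′) le le′)
    sound bd (mul {e} {e′} {u} {v} ev ev′) s
      with sound bd ev (sizeˡ (size e) (size e′) s) | sound bd ev′ (sizeʳ (size e) (size e′) s)
    ... | _ , eq , le | _ , eq′ , le′ =
      (eval bd ev (sizeˡ (size e) (size e′) s) , eval bd ev′ (sizeʳ (size e) (size e′) s)) ,
      cong₂ ℤ._*_ eq eq′ ,
      ℕ.≤-trans (ℕ.≤-reflexive (ℤ.abs-* u v)) (prodBound (size e) (size e′) le le′)
    sound {σ} bd (quot {e} {e′} {u} {d} ev ev′) s
      with sound bd ev (sizeˡ (size e) (size e′) s) | sound bd ev′ (sizeʳ (size e) (size e′) s)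
    ... | _ , eq , le | _ , eq′ , le′ =
      (eval bd ev (sizeˡ (size e) (size e′) s) , eval bd ev′ (sizeʳ (size e) (size e′) s)) ,
      trans (cong₂ _div_ eq eq′) (div-pos u d) ,
      ℕ.≤-trans (∣/ℕ∣≤ u d) (ℕ.≤-trans le (ℕ.^-monoʳ-≤ B (ℕ.≤-trans (ℕ.m≤m+n (size e) (size e′)) (ℕ.n≤1+n _))))
      where
      div-pos : ∀ u d .{{_ : NonZero d}} → u div (+ d) ≡ u ℤ./ℕ d
      div-pos u (suc d) = ℤ.*-identityˡ _

    value : ∀ {σ e z} → Bounded σ → σ ⊢ e ⇓ z → size e ≤ 30 → ⟦ e ⟧ σ ≡ z
    value bd ev s = proj₁ (proj₂ (sound bd ev s))

  -- Runs between bounded states.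
  record Safe (Q : State → Set) (b : ℕ) (κ : List Cmd) (σ : State) : Set where
    constructor safe
    field
      exec : Bounded σ → Exec (λ σ′ → Bounded σ′ × Q σ′) b (κ , σ)

  open Safe public

  bounds : ∀ {Q b κ σ} → (Bounded σ → Safe Q b κ σ) → Safe Q b κ σ
  bounds r = safe λ bd → exec (r bd) bd

  Fits : Expr → Set
  Fits e = Bool.T (size e ≤ᵇ 30)

  private
    fits : ∀ e → Fits e → size e ≤ 30
    fits e = ℕ.≤ᵇ⇒≤ (size e) 30

  end : ∀ {Q b σ} → Q σ → Safe Q b [] σ
  end q = safe λ bd → done (bd , q)

  seq : ∀ {Q b p q κ σ} → Safe Q b (p ∷ q ∷ κ) σ → Safe Q (suc b) (p ⨾ q ∷ κ) σ
  seq r = safe λ bd → step ⟶-seq (exec r bd) ℕ.≤-refl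

  pass : ∀ {Q b κ σ} → Safe Q b κ σ → Safe Q (suc b) (skip ∷ κ) σ
  pass r = safe λ bd → step ⟶-skip (exec r bd) ℕ.≤-refl

  assign : ∀ {Q b x e z κ vs as} {f : Fits e} → ⟨ vs , as ⟩ ⊢ e ⇓ z → ∣ z ∣ ≤ B →
           Safe Q b κ ⟨ update vs x z , as ⟩ →
           Safe Q (suc (size e) + b) (x ≔ e ∷ κ) ⟨ vs , as ⟩
  assign {Q} {b} {x} {e} {z} {κ} {vs} {as} {f} ev le r = safe λ bd →
    step (⟶-assign (eval bd ev (fits e f)))
      (subst (λ v → Exec _ b (κ , ⟨ update (vars σ) x v , arrays σ ⟩))
        (sym (value bd ev (fits e f))) (exec r (bd′ bd))) ℕ.≤-refl
    where
    σ = ⟨ vs , as ⟩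
    bd′ : Bounded σ → Bounded ⟨ update (vars σ) x z , arrays σ ⟩
    bd′ bd = (λ y → lemma y) , proj₂ bd
      where
      lemma : ∀ y → ∣ update (vars σ) x z y ∣ ≤ B
      lemma y with ⌊ y ℕ.≟ x ⌋
      ... | true  = le
      ... | false = proj₁ bd y

  store : ∀ {Q b a e e′ i z κ vs as} {f : Fits e} {f′ : Fits e′} →
          ⟨ vs , as ⟩ ⊢ e ⇓ + i → ⟨ vs , as ⟩ ⊢ e′ ⇓ z → ∣ z ∣ ≤ B →
          Safe Q b κ ⟨ vs , update as a (update (as a) i z) ⟩ →
          Safe Q (suc (size e + size e′) + b) (put a e e′ ∷ κ) ⟨ vs , as ⟩
  store {Q} {b} {a} {e} {e′} {i} {z} {κ} {vs} {as} {f} {f′} ev ev′ le r = safe λ bd →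
    step (⟶-put (eval bd ev (fits e f))
           (subst (0ℤ ℤ.≤_) (sym (value bd ev (fits e f))) (ℤ.+≤+ z≤n))
           (eval bd ev′ (fits e′ f′)))
      (subst₂ (λ u v → Exec _ b (κ , ⟨ vars σ , update (arrays σ) a (update (arrays σ a) u v) ⟩))
        (sym (cong ∣_∣ (value bd ev (fits e f)))) (sym (value bd ev′ (fits e′ f′))) (exec r (bd′ bd)))
      ℕ.≤-refl
    where
    σ = ⟨ vs , as ⟩
    bd′ : Bounded σ → Bounded ⟨ vars σ , update (arrays σ) a (update (arrays σ a) i z) ⟩
    bd′ bd = proj₁ bd , lemma
      where
      lemma : ∀ a′ i′ → ∣ update (arrays σ) a (update (arrays σ a) i z) a′ i′ ∣ ≤ B
      lemma a′ i′ with ⌊ a′ ℕ.≟ a ⌋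
      ... | false = proj₂ bd a′ i′
      ... | true with ⌊ i′ ℕ.≟ i ⌋
      ...   | true  = le
      ...   | false = proj₂ bd a i′

  private
    compare-true : ∀ {u v} → u ℤ.≤ v → (if ⌊ u ℤ.≤? v ⌋ then 1ℤ else 0ℤ) ≢ 0ℤ
    compare-true {u} {v} h with u ℤ.≤? v
    ... | yes _ = λ ()
    ... | no ¬h = contradiction h ¬h

    compare-false : ∀ {u v} → v ℤ.< u → (if ⌊ u ℤ.≤? v ⌋ then 1ℤ else 0ℤ) ≡ 0ℤ
    compare-false {u} {v} h with u ℤ.≤? v
    ... | yes h′ = contradiction h′ (ℤ.<⇒≱ h)
    ... | no _   = refl

    compare-bit : ∀ u v → ∣ if ⌊ u ℤ.≤? v ⌋ then 1ℤ else 0ℤ ∣ ≤ 1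
    compare-bit u v with ⌊ u ℤ.≤? v ⌋
    ... | true  = s≤s z≤n
    ... | false = z≤n

    module Compare {σ : State} {e e′ : Expr} {u v : ℤ} (bd : Bounded σ) (f : Fits e) (f′ : Fits e′)
                   (ev : σ ⊢ e ⇓ u) (ev′ : σ ⊢ e′ ⇓ v) where
      evaluates : Evaluates (e ≼ e′) σ
      evaluates = (eval bd ev (fits e f) , eval bd ev′ (fits e′ f′)) ,
        ℕ.≤-trans (compare-bit (⟦ e ⟧ σ) (⟦ e′ ⟧ σ)) (B^≤W 0 z≤n)
      yes! : u ℤ.≤ v → ⟦ e ≼ e′ ⟧ σ ≢ 0ℤ
      yes! h = compare-true
        (subst₂ ℤ._≤_ (sym (value bd ev (fits e f))) (sym (value bd ev′ (fits e′ f′))) h)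
      no! : v ℤ.< u → ⟦ e ≼ e′ ⟧ σ ≡ 0ℤ
      no! h = compare-false
        (subst₂ ℤ._<_ (sym (value bd ev′ (fits e′ f′))) (sym (value bd ev (fits e f))) h)

  branch : ∀ {Q b e e′ u v p q κ σ} {f : Fits e} {f′ : Fits e′} →
           σ ⊢ e ⇓ u → σ ⊢ e′ ⇓ v →
           (u ℤ.≤ v → Safe Q b (p ∷ κ) σ) → (v ℤ.< u → Safe Q b (q ∷ κ) σ) →
           Safe Q (suc (suc (size e + size e′)) + b) (ite (e ≼ e′) p q ∷ κ) σ
  branch {e = e} {e′} {u} {v} {σ = σ} {f} {f′} ev ev′ k k′ with u ℤ.≤? v
  ... | yes h = safe λ bd → let open Compare {σ} {e} {e′} bd f f′ ev ev′ in
    step (⟶-ite-true evaluates (yes! h)) (exec (k h) bd) ℕ.≤-refl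
  ... | no ¬h = safe λ bd → let open Compare {σ} {e} {e′} bd f f′ ev ev′ in
    step (⟶-ite-false evaluates (no! (ℤ.≰⇒> ¬h))) (exec (k′ (ℤ.≰⇒> ¬h)) bd) ℕ.≤-refl

  run : ∀ {Q Q′ b b′ κ₀ κ σ} → Safe Q b κ₀ σ →
        (∀ {σ′} → Q σ′ → Frame κ₀ σ σ′ → Bounded σ′ → Safe Q′ b′ κ σ′) →
        Safe Q′ (b + b′) (κ₀ ++ κ) σ
  run r k = safe λ bd → bind (with-frame (exec r bd)) λ { ((bd′ , q) , f) → exec (k q f bd′) bd′ }

  weaken-safe : ∀ {Q b b′ κ σ} → b ≤ b′ → Safe Q b κ σ → Safe Q b′ κ σ
  weaken-safe h r = safe λ bd → weaken h (exec r bd)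

  -- The recursion is on the budget: each round spends at least the positive cost of the test, so
  -- the cost bound also proves termination. The invariant may mention the remaining budget, which
  -- allows amortised accounting.
  loop : ∀ {e e′ p σ₀ b₀} {f : Fits e} {f′ : Fits e′} (I : ℕ → State → Set) {Q : State → Set} →
         let cost = suc (suc (size e + size e′)) in
         (∀ {b σ} → I b σ → Frame (p ∷ []) σ₀ σ → Bounded σ →
            ∃₂ λ u v → σ ⊢ e ⇓ u × σ ⊢ e′ ⇓ v ×
            (u ℤ.≤ v → ∃₂ λ b₁ b₂ → cost + (b₁ + b₂) ≤ b × Safe (I b₂) b₁ (p ∷ []) σ) ×
            (v ℤ.< u → cost ≤ b × Q σ)) →
         I b₀ σ₀ → Safe Q b₀ (while (e ≼ e′) p ∷ []) σ₀
  loop {e} {e′} {p} {σ₀} {b₀} {f} {f′} I {Q} body i₀ = safe (go b₀ i₀ frame-refl)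
    where
    Goal : ℕ → Set
    Goal b = ∀ {σ} → I b σ → Frame (p ∷ []) σ₀ σ → Bounded σ →
             Exec (λ σ′ → Bounded σ′ × Q σ′) b (while (e ≼ e′) p ∷ [] , σ)
    go : ∀ b → Goal b
    go = <-rec Goal λ b rec i fr bd → turn b rec i fr bd (body i fr bd)
      where
      turn : ∀ b → (∀ {b′} → b′ < b → Goal b′) → ∀ {σ} → I b σ → Frame (p ∷ []) σ₀ σ →
             Bounded σ → _ → Exec (λ σ′ → Bounded σ′ × Q σ′) b (while (e ≼ e′) p ∷ [] , σ)
      turn b rec {σ} i fr bd (u , v , ev , ev′ , k , k′) with u ℤ.≤? v
      ... | no ¬h = step (⟶-while-false evaluates (no! (ℤ.≰⇒> ¬h)))
                      (done {b = 0} (bd , proj₂ (k′ (ℤ.≰⇒> ¬h))))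
                      (ℕ.≤-trans (ℕ.≤-reflexive (ℕ.+-identityʳ _)) (proj₁ (k′ (ℤ.≰⇒> ¬h))))
        where open Compare {σ} {e} {e′} bd f f′ ev ev′
      ... | yes h with k h
      ...   | b₁ , b₂ , le , r =
        step (⟶-while-true evaluates (yes! h))
          (bind (with-frame (exec r bd)) λ { ((bd′ , i′) , fr′) →
            rec (ℕ.≤-trans (s≤s (ℕ.≤-trans (ℕ.m≤n+m b₂ b₁) (ℕ.m≤n+m (b₁ + b₂) (suc (size e + size e′))))) le)
              i′ (frame-trans fr fr′) bd′ })
          le
        where open Compare {σ} {e} {e′} bd f f′ ev ev′

  -- A loop whose measure μ drops in every round and whose body costs at most k.
  count : ∀ {e e′ p σ₀} {f : Fits e} {f′ : Fits e′} k (I : ℕ → State → Set) {Q : State → Set} μ₀ →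
          let cost = suc (suc (size e + size e′)) in
          (∀ {μ σ} → I μ σ → Frame (p ∷ []) σ₀ σ → Bounded σ →
             ∃₂ λ u v → σ ⊢ e ⇓ u × σ ⊢ e′ ⇓ v ×
             (u ℤ.≤ v → ∃ λ μ′ → suc μ′ ≤ μ × Safe (I μ′) k (p ∷ []) σ) ×
             (v ℤ.< u → Q σ)) →
          I μ₀ σ₀ → Safe Q (suc μ₀ * (cost + k)) (while (e ≼ e′) p ∷ []) σ₀
  count {e} {e′} {p} {f = f} {f′} k I {Q} μ₀ body i₀ =
    loop {f = f} {f′} (λ b σ → ∃ λ μ → I μ σ × suc μ * (cost + k) ≤ b)
      (λ { {b} {σ} (μ , i , le) fr bd → convert b le (body i fr bd) })
      (μ₀ , i₀ , ℕ.≤-refl)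
    where
    cost = suc (suc (size e + size e′))
    convert : ∀ b {μ σ} → suc μ * (cost + k) ≤ b →
      (∃₂ λ u v → σ ⊢ e ⇓ u × σ ⊢ e′ ⇓ v ×
        (u ℤ.≤ v → ∃ λ μ′ → suc μ′ ≤ μ × Safe (I μ′) k (p ∷ []) σ) ×
        (v ℤ.< u → Q σ)) →
      (∃₂ λ u v → σ ⊢ e ⇓ u × σ ⊢ e′ ⇓ v ×
        (u ℤ.≤ v → ∃₂ λ b₁ b₂ → cost + (b₁ + b₂) ≤ b ×
           Safe (λ σ → ∃ λ μ → I μ σ × suc μ * (cost + k) ≤ b₂) b₁ (p ∷ []) σ) ×
        (v ℤ.< u → cost ≤ b × Q σ))
    convert b {μ} le (u , v , ev , ev′ , t , f) = u , v , ev , ev′ ,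
      (λ h → let μ′ , lt , r = t h in
        k , suc μ′ * (cost + k) ,
        ℕ.≤-trans (ℕ.≤-reflexive (sym (ℕ.+-assoc cost k _)))
          (ℕ.≤-trans (ℕ.+-monoʳ-≤ (cost + k) (ℕ.*-monoˡ-≤ (cost + k) lt)) le) ,
        safe λ bd → map-post (λ { (bd′ , i) → bd′ , μ′ , i , ℕ.≤-refl }) (exec r bd)) ,
      (λ h → ℕ.≤-trans (ℕ.≤-trans (ℕ.m≤m+n cost k) (ℕ.m≤m+n (cost + k) (μ * (cost + k)))) le , f h)
      where
      map-post : ∀ {Q Q′ : State → Set} {b C} → (∀ {σ} → Q σ → Q′ σ) → Exec Q b C → Exec Q′ b C
      map-post g (done q)       = done (g q)
      map-post g (step s r h)   = step s (map-post g r) h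
      map-post g (call s m r h) = call s m (λ S p → map-post g (r S p)) h

  -- The answer may be listed in any order, so the bound on the cells and the continuation are
  -- required for every permutation of the sumset.
  convolve : ∀ {Q b a l a′ m r x κ vs as A A′} {f : Fits l} {f′ : Fits m} →
    ⟨ vs , as ⟩ ⊢ l ⇓ + length A → ⟨ vs , as ⟩ ⊢ m ⇓ + length A′ →
    applyUpTo (as a) (length A) ≡ map +_ A → IsSet A →
    applyUpTo (as a′) (length A′) ≡ map +_ A′ → IsSet A′ →
    All (ℕ._≤ W) (sumset A A′) → length (sumset A A′) ≤ W → length (sumset A A′) ≤ Smax →
    length (sumset A A′) ≤ B →
    (∀ S → S ↭ sumset A A′ → ∀ i → ∣ overwrite (map +_ S) (as r) i ∣ ≤ B) →
    (∀ S → S ↭ sumset A A′ →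
       Safe Q b κ ⟨ update vs x (+ length S) , update as r (overwrite (map +_ S) (as r)) ⟩) →
    Safe Q (suc (size l + size m) + c * (length (sumset A A′) * L) + b)
      (conv a l a′ m r x ∷ κ) ⟨ vs , as ⟩
  convolve {b = b} {l = l} {m = m} {r = r} {x} {vs = vs} {as} {A} {A′} {f} {f′}
    ev ev′ eA sA eA′ sA′ small len≤W len≤S len≤B cells k = safe λ bd →
    call (⟶-conv (eval bd ev (fits l f)) (value bd ev (fits l f))
                 (eval bd ev′ (fits m f′)) (value bd ev′ (fits m f′))
                 eA sA eA′ sA′ small len≤W)
      len≤S (λ S p → exec (k S p) (bd₁ bd S p , bd₂ bd S p)) ℕ.≤-refl
    where
    σ = ⟨ vs , as ⟩
    bd₁ : Bounded σ → ∀ S → S ↭ sumset A A′ → ∀ y → ∣ update (vars σ) x (+ length S) y ∣ ≤ B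
    bd₁ bd S p y with ⌊ y ℕ.≟ x ⌋
    ... | true  = ℕ.≤-trans (ℕ.≤-reflexive (↭-length p)) len≤B
    ... | false = proj₁ bd y
    bd₂ : Bounded σ → ∀ S → S ↭ sumset A A′ → ∀ a i → ∣ update (arrays σ) r (overwrite (map +_ S) (arrays σ r)) a i ∣ ≤ B
    bd₂ bd S p a i with ⌊ a ℕ.≟ r ⌋
    ... | true  = cells S p i
    ... | false = proj₂ bd a i

-- Integers inside the rationals, floors and ceilings.

neg-involutive : ∀ p → ℚ.- (ℚ.- p) ≡ p
neg-involutive = ℚ-solve 1 (λ x → :- (:- x) := x) refl

toℚᵘ-ℤ→ℚ : ∀ z → toℚᵘ (ℤ→ℚ z) ℚᵘ.≃ mkℚᵘ z 0
toℚᵘ-ℤ→ℚ z = ℚ.toℚᵘ-fromℚᵘ (mkℚᵘ z 0)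

ℤ→ℚ-+ : ∀ a b → ℤ→ℚ (a ℤ.+ b) ≡ ℤ→ℚ a ℚ.+ ℤ→ℚ b
ℤ→ℚ-+ a b = ℚ.toℚᵘ-injective (begin
  toℚᵘ (ℤ→ℚ (a ℤ.+ b))             ≈⟨ toℚᵘ-ℤ→ℚ (a ℤ.+ b) ⟩
  mkℚᵘ (a ℤ.+ b) 0                 ≈⟨ *≡* (cong (ℤ._* + 1) (cong₂ ℤ._+_ (sym (ℤ.*-identityʳ a)) (sym (ℤ.*-identityʳ b)))) ⟩
  mkℚᵘ a 0 ℚᵘ.+ mkℚᵘ b 0           ≈⟨ ℚᵘ.+-cong (toℚᵘ-ℤ→ℚ a) (toℚᵘ-ℤ→ℚ b) ⟨
  toℚᵘ (ℤ→ℚ a) ℚᵘ.+ toℚᵘ (ℤ→ℚ b)   ≈⟨ ℚ.toℚᵘ-homo-+ (ℤ→ℚ a) (ℤ→ℚ b) ⟨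
  toℚᵘ (ℤ→ℚ a ℚ.+ ℤ→ℚ b)           ∎)
  where open ℚᵘ.≃-Reasoning

ℤ→ℚ-* : ∀ a b → ℤ→ℚ (a ℤ.* b) ≡ ℤ→ℚ a ℚ.* ℤ→ℚ b
ℤ→ℚ-* a b = ℚ.toℚᵘ-injective (begin
  toℚᵘ (ℤ→ℚ (a ℤ.* b))             ≈⟨ toℚᵘ-ℤ→ℚ (a ℤ.* b) ⟩
  mkℚᵘ a 0 ℚᵘ.* mkℚᵘ b 0           ≈⟨ ℚᵘ.*-cong (toℚᵘ-ℤ→ℚ a) (toℚᵘ-ℤ→ℚ b) ⟨
  toℚᵘ (ℤ→ℚ a) ℚᵘ.* toℚᵘ (ℤ→ℚ b)   ≈⟨ ℚ.toℚᵘ-homo-* (ℤ→ℚ a) (ℤ→ℚ b) ⟨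
  toℚᵘ (ℤ→ℚ a ℚ.* ℤ→ℚ b)           ∎)
  where open ℚᵘ.≃-Reasoning

ℤ→ℚ-mono : ∀ {a b} → a ℤ.≤ b → ℤ→ℚ a ℚ.≤ ℤ→ℚ b
ℤ→ℚ-mono {a} {b} h = ℚ.toℚᵘ-cancel-≤ (begin
  toℚᵘ (ℤ→ℚ a) ≃⟨ toℚᵘ-ℤ→ℚ a ⟩
  mkℚᵘ a 0     ≤⟨ *≤* (ℤ.*-monoʳ-≤-nonNeg (+ 1) h) ⟩
  mkℚᵘ b 0     ≃⟨ toℚᵘ-ℤ→ℚ b ⟨
  toℚᵘ (ℤ→ℚ b) ∎)
  where open ℚᵘ.≤-Reasoning

ℤ→ℚ-cancel : ∀ {a b} → ℤ→ℚ a ℚ.≤ ℤ→ℚ b → a ℤ.≤ b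
ℤ→ℚ-cancel {a} {b} h = lemma (begin
  mkℚᵘ a 0     ≃⟨ toℚᵘ-ℤ→ℚ a ⟨
  toℚᵘ (ℤ→ℚ a) ≤⟨ ℚ.toℚᵘ-mono-≤ h ⟩
  toℚᵘ (ℤ→ℚ b) ≃⟨ toℚᵘ-ℤ→ℚ b ⟩
  mkℚᵘ b 0     ∎)
  where
  open ℚᵘ.≤-Reasoning
  lemma : mkℚᵘ a 0 ℚᵘ.≤ mkℚᵘ b 0 → a ℤ.≤ b
  lemma (*≤* h) = ℤ.*-cancelʳ-≤-pos a b (+ 1) h

ℤ→ℚ-neg : ∀ a → ℤ→ℚ (ℤ.- a) ≡ ℚ.- ℤ→ℚ a
ℤ→ℚ-neg a = ℚ.toℚᵘ-injective (begin
  toℚᵘ (ℤ→ℚ (ℤ.- a))  ≈⟨ toℚᵘ-ℤ→ℚ (ℤ.- a) ⟩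
  ℚᵘ.- mkℚᵘ a 0       ≈⟨ ℚᵘ.-‿cong (toℚᵘ-ℤ→ℚ a) ⟨
  ℚᵘ.- toℚᵘ (ℤ→ℚ a)   ≈⟨ ℚ.toℚᵘ-homo‿- (ℤ→ℚ a) ⟨
  toℚᵘ (ℚ.- ℤ→ℚ a)    ∎)
  where open ℚᵘ.≃-Reasoning

ℤ→ℚ-- : ∀ a b → ℤ→ℚ (a ℤ.- b) ≡ ℤ→ℚ a ℚ.- ℤ→ℚ b
ℤ→ℚ-- a b = trans (ℤ→ℚ-+ a (ℤ.- b)) (cong (ℤ→ℚ a ℚ.+_) (ℤ→ℚ-neg b))

ℕ→ℚ-+ : ∀ a b → ℕ→ℚ (a ℕ.+ b) ≡ ℕ→ℚ a ℚ.+ ℕ→ℚ b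
ℕ→ℚ-+ a b = ℤ→ℚ-+ (+ a) (+ b)

ℕ→ℚ-* : ∀ a b → ℕ→ℚ (a ℕ.* b) ≡ ℕ→ℚ a ℚ.* ℕ→ℚ b
ℕ→ℚ-* a b = trans (cong ℤ→ℚ (ℤ.pos-* a b)) (ℤ→ℚ-* (+ a) (+ b))

ℕ→ℚ-mono : ∀ {a b} → a ℕ.≤ b → ℕ→ℚ a ℚ.≤ ℕ→ℚ b
ℕ→ℚ-mono h = ℤ→ℚ-mono (ℤ.+≤+ h)

0≤ℕ→ℚ : ∀ a → 0ℚ ℚ.≤ ℕ→ℚ a
0≤ℕ→ℚ a = ℕ→ℚ-mono (ℕ.z≤n {a})

floor≤ : ∀ p → ℤ→ℚ (ℚ.floor p) ℚ.≤ p
floor≤ p@record{} = ℚ.toℚᵘ-cancel-≤ (begin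
  toℚᵘ (ℤ→ℚ (ℚ.floor p)) ≃⟨ toℚᵘ-ℤ→ℚ (ℚ.floor p) ⟩
  mkℚᵘ (ℚ.floor p) 0     ≤⟨ *≤* (ℤ.≤-trans (ℤ.[n/d]*d≤n (↥ p) (↧ p)) (ℤ.≤-reflexive (sym (ℤ.*-identityʳ (↥ p))))) ⟩
  toℚᵘ p               ∎)
  where open ℚᵘ.≤-Reasoning

≤1+floor : ∀ p → p ℚ.≤ ℤ→ℚ (ℤ.suc (ℚ.floor p))
≤1+floor p@record{} = ℚ.toℚᵘ-cancel-≤ (begin
  toℚᵘ p                     ≤⟨ *≤* (ℤ.≤-trans (ℤ.≤-reflexive (ℤ.*-identityʳ (↥ p))) (ℤ.≤-trans (ℤ.<⇒≤ (ℤ.n<s[n/ℕd]*d (↥ p) (ℚ.↧ₙ p))) (ℤ.≤-reflexive (cong (λ z → ℤ.suc z ℤ.* ↧ p) (sym (ℤ.div-pos-is-/ℕ (↥ p) (ℚ.↧ₙ p))))))) ⟩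
  mkℚᵘ (ℤ.suc (ℚ.floor p)) 0   ≃⟨ toℚᵘ-ℤ→ℚ (ℤ.suc (ℚ.floor p)) ⟨
  toℚᵘ (ℤ→ℚ (ℤ.suc (ℚ.floor p))) ∎)
  where open ℚᵘ.≤-Reasoning

≤ceiling : ∀ p → p ℚ.≤ ℤ→ℚ (ceiling p)
≤ceiling p@record{} = subst₂ ℚ._≤_ (neg-involutive p) (sym (ℤ→ℚ-neg (ℚ.floor (ℚ.- p))))
  (ℚ.neg-antimono-≤ (floor≤ (ℚ.- p)))

ceiling≤1+ : ∀ p → ℤ→ℚ (ceiling p) ℚ.≤ p ℚ.+ 1ℚ
ceiling≤1+ p@record{} = begin
  ℤ→ℚ (ceiling p)                     ≡⟨ ℤ→ℚ-neg (ℚ.floor (ℚ.- p)) ⟩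
  ℚ.- ℤ→ℚ (ℚ.floor (ℚ.- p))             ≡⟨ lemma (ℤ→ℚ (ℚ.floor (ℚ.- p))) ⟩
  ℚ.- (1ℚ ℚ.+ ℤ→ℚ (ℚ.floor (ℚ.- p))) ℚ.+ 1ℚ ≡⟨ cong (λ z → ℚ.- z ℚ.+ 1ℚ) (ℤ→ℚ-+ (+ 1) (ℚ.floor (ℚ.- p))) ⟨
  ℚ.- ℤ→ℚ (ℤ.suc (ℚ.floor (ℚ.- p))) ℚ.+ 1ℚ ≤⟨ ℚ.+-monoˡ-≤ 1ℚ (ℚ.neg-antimono-≤ (≤1+floor (ℚ.- p))) ⟩
  ℚ.- (ℚ.- p) ℚ.+ 1ℚ                  ≡⟨ cong (ℚ._+ 1ℚ) (neg-involutive p) ⟩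
  p ℚ.+ 1ℚ                            ∎
  where
  open ℚ.≤-Reasoning
  lemma : ∀ x → ℚ.- x ≡ ℚ.- (1ℚ ℚ.+ x) ℚ.+ 1ℚ
  lemma = ℚ-solve 1 (λ x → :- x := :- (con 1ℚ :+ x) :+ con 1ℚ) refl

-- From runs against an abstract oracle to the two primitives.

module Transfer (W B c Smax : ℕ) (4≤B : 4 ≤ B) (B^≤W : ∀ k → k ≤ 30 → B ^ k ≤ W) where

  open Machine W

  module Deterministically {e : ℕ} (conv : DeterministicConvolution c e) where

    open DeterministicConvolution conv
    open Deterministic respond
    open Logic using (done; step; call)

    Exec : (State → Set) → ℕ → Config → Set
    Exec = Logic.Exec (record { W = W ; B = B ; c = c ; L = ⌊log₂ (suc W + 2) ⌋ ^ e ; Smax = Smax ; 4≤B = 4≤B ; B^≤W = B^≤W })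

    private
      -- An element is at most its sum with any element of the other, nonempty set, and sums fit in
      -- a word. So W + 1 is a legitimate universe bound for the primitive.
      sets : ∀ {C t A B K} → C calls⟨ t ⟩ A , B resuming K →
             IsSet A × IsSet B × All (ℕ._< suc W) A × All (ℕ._< suc W) B
      sets (⟶-conv {A = []} _ _ _ _ _ sA _ sB _ _) = contradiction refl (proj₁ sA)
      sets (⟶-conv {A = _ ∷ _} {[]} _ _ _ _ _ sA _ sB _ _) = contradiction refl (proj₁ sB)
      sets (⟶-conv {A = A@(x ∷ _)} {B@(y ∷ _)} _ _ _ _ _ sA _ sB small _) = sA , sB ,
        All.tabulate (λ {a} a∈A → s≤s (ℕ.≤-trans (ℕ.m≤m+n a y) (All.lookup small (∈-sumset⁺ {A} {B} a∈A (Any.here refl))))) ,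
        All.tabulate (λ {b} b∈B → s≤s (ℕ.≤-trans (ℕ.m≤n+m b x) (All.lookup small (∈-sumset⁺ {A} {B} (Any.here refl) b∈B))))

    halts : ∀ {Q b C} → Exec Q b C → ∃₂ λ t σ → Run t C σ × Q σ × t ≤ b
    halts (done {σ = σ} q) = 0 , σ , done , q , ℕ.z≤n
    halts (step {t = t} s r h) with halts r
    ... | u , σ , run , q , le =
      t + u , σ , step s run , q , ℕ.≤-trans (ℕ.+-monoʳ-≤ t le) h
    halts (call {t = t} {A} {B} s m r h) with sets s
    ... | sA , sB , smallA , smallB with halts (r (proj₁ (respond A B)) (correct A B sA sB))
    ...   | u , σ , run , q , le =
      t + proj₂ (respond A B) + u , σ , call s run , q ,
      ℕ.≤-trans (ℕ.+-mono-≤ (ℕ.+-monoʳ-≤ t (fast A B sA sB (suc W) smallA smallB)) le) h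

  module Randomly (conv : RandomizedConvolution W c) where

    open RandomizedConvolution conv
    open Randomized respond
    open Logic using (done; step; call)

    Exec : (State → Set) → ℕ → Config → Set
    Exec = Logic.Exec (record { W = W ; B = B ; c = c ; L = ⌊log₂ (Smax + 2) ⌋ ; Smax = Smax ; 4≤B = 4≤B ; B^≤W = B^≤W })

    private
      Σ-mono : ∀ {x y : ℕ → ℚ} → (∀ i → x i ℚ.≤ y i) → ∀ n → Σ[< n ] x ℚ.≤ Σ[< n ] y
      Σ-mono h zero    = ℚ.≤-refl
      Σ-mono h (suc n) = ℚ.+-mono-≤ (Σ-mono h n) (h n)

      Σ-affine : ∀ (w X : ℕ → ℚ) a n →
        Σ[< n ] (λ i → w i ℚ.* (X i ℚ.+ a)) ≡ Σ[< n ] (λ i → w i ℚ.* X i) ℚ.+ Σ[< n ] w ℚ.* a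
      Σ-affine w X a zero    = sym (trans (ℚ.+-identityˡ _) (ℚ.*-zeroˡ a))
      Σ-affine w X a (suc n) = trans (cong (ℚ._+ w n ℚ.* (X n ℚ.+ a)) (Σ-affine w X a n))
        (ℚ-solve 5 (λ p q a w x → (p :+ q :* a) :+ w :* (x :+ a) := (p :+ w :* x) :+ (q :+ w) :* a)
          refl (Σ[< n ] (λ i → w i ℚ.* X i)) (Σ[< n ] w) a (w n) (X n))

    -- The budget b of the continuation is the same for all outcomes, so the expectation splits into
    -- that of the response time and the constant t + b. As this constant is nonnegative, total
    -- weight at most 1 suffices.
    expected : ∀ {Q b C} → Exec Q b C → ExpectedRun Q (ℕ→ℚ b) C
    expected {b = b} (done q) = done q (0≤ℕ→ℚ b)
    expected (step {t = t} {b} s r h) =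
      step s (expected r) (ℚ.≤-trans (ℚ.≤-reflexive (sym (ℕ→ℚ-+ t b))) (ℕ→ℚ-mono h))
    expected (call {t = t} {A} {B} {b = b} {b″} s m r h) with s
    ... | ⟶-conv _ _ _ _ _ sA _ sB small len =
      call (λ _ → ℕ→ℚ b) s (λ i → expected (r _ (correct A B sA sB i))) bound
      where
      open Distribution (respond A B) using (weight; mass≤1)
      s′ = length (sumset A B)
      time = λ i → proj₂ (outcome A B i)
      a = ℕ→ℚ (t + b)
      instance
        a≥0 : ℚ.NonNegative a
        a≥0 = ℚ.nonNegative (0≤ℕ→ℚ (t + b))
      regroup : ∀ i → ℕ→ℚ (t + time i) ℚ.+ ℕ→ℚ b ≡ ℕ→ℚ (time i) ℚ.+ a
      regroup i = trans (sym (ℕ→ℚ-+ (t + time i) b)) (trans (cong ℕ→ℚ lemma) (ℕ→ℚ-+ (time i) (t + b)))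
        where
        lemma : t + time i + b ≡ time i + (t + b)
        lemma = trans (cong (_+ b) (ℕ.+-comm t (time i))) (ℕ.+-assoc (time i) t b)
      total : c * (s′ * ⌊log₂ (s′ + 2) ⌋) + (t + b) ≤ b″
      total = ℕ.≤-trans (ℕ.+-monoˡ-≤ (t + b) (ℕ.*-monoʳ-≤ c (ℕ.*-monoʳ-≤ s′ (⌊log₂⌋-mono-≤ (ℕ.+-monoˡ-≤ 2 m)))))
        (ℕ.≤-trans (ℕ.≤-reflexive lemma) h)
        where
        x = c * (s′ * ⌊log₂ (Smax + 2) ⌋)
        lemma : x + (t + b) ≡ t + x + b
        lemma = trans (sym (ℕ.+-assoc x t b)) (cong (_+ b) (ℕ.+-comm x t))
      bound : Expectation≤ (respond A B) (λ i → ℕ→ℚ (t + time i) ℚ.+ ℕ→ℚ b) (ℕ→ℚ b″)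
      bound n = begin
        Σ[< n ] (λ i → weight i ℚ.* (ℕ→ℚ (t + time i) ℚ.+ ℕ→ℚ b))
          ≤⟨ Σ-mono (λ i → ℚ.≤-reflexive (cong (weight i ℚ.*_) (regroup i))) n ⟩
        Σ[< n ] (λ i → weight i ℚ.* (ℕ→ℚ (time i) ℚ.+ a))
          ≡⟨ Σ-affine weight (ℕ→ℚ ∘ time) a n ⟩
        Σ[< n ] (λ i → weight i ℚ.* ℕ→ℚ (time i)) ℚ.+ Σ[< n ] weight ℚ.* a
          ≤⟨ ℚ.+-mono-≤ (fast A B sA sB small len n) (ℚ.*-monoʳ-≤-nonNeg a (mass≤1 n)) ⟩
        ℕ→ℚ (c * (s′ * ⌊log₂ (s′ + 2) ⌋)) ℚ.+ 1ℚ ℚ.* a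
          ≡⟨ cong (ℕ→ℚ (c * (s′ * ⌊log₂ (s′ + 2) ⌋)) ℚ.+_) (ℚ.*-identityˡ a) ⟩
        ℕ→ℚ (c * (s′ * ⌊log₂ (s′ + 2) ⌋)) ℚ.+ a
          ≡⟨ ℕ→ℚ-+ (c * (s′ * ⌊log₂ (s′ + 2) ⌋)) (t + b) ⟨
        ℕ→ℚ (c * (s′ * ⌊log₂ (s′ + 2) ⌋) + (t + b))
          ≤⟨ ℕ→ℚ-mono total ⟩
        ℕ→ℚ b″ ∎
        where open ℚ.≤-Reasoning

-- The program.

vn vm vN vo vM vK vE vt vb vl vtop vz va vβ vθ vj vx vy vs vc vi vk vr vlen : ℕ
vn   = 0
vm   = 1
vN   = 2
vo   = 3
vM   = 4
vK   = 5
vE   = 6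
vt   = 7
vb   = 8
vl   = 9
vtop = 10
vz   = 11
va   = 12
vβ   = 13
vθ   = 14
vj   = 15
vx   = 16
vy   = 17
vs   = 18
vc   = 19
vi   = 20
vk   = 21
vr   = 22
vlen = 23

aF aG aOut aX aS aP aα aH aA aB aU aV aZ : ℕ
aF   = 0
aG   = 1
aOut = 2
aX   = 3
aS   = 4
aP   = 5
aα   = 6
aH   = 7
aA   = 8
aB   = 9
aU   = 10
aV   = 11
aZ   = 12

incr : ℕ → Cmd
incr x = x ≔ var x ⊕ lit (+ 1)

-- Store f followed by g in X.  M bounds the entries in absolute value.
copyBody copyAll : Cmd
copyBody =
  ite (var vt ≼ var vn) (put aX (var vt) (get aF (var vt)))
                        (put aX (var vt) (get aG (var vt ⊖ var vo))) ⨾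
  vM ≔ var vM ⊕ get aX (var vt) ⊗ get aX (var vt) ⨾
  incr vt
copyAll =
  vN ≔ var vn ⊕ var vm ⊕ lit (+ 2) ⨾
  vo ≔ var vn ⊕ lit (+ 1) ⨾
  while (var vt ⊕ lit (+ 1) ≼ var vN) copyBody ⨾
  vK ≔ lit (+ 4) ⊗ var vM ⊕ lit (+ 1) ⨾
  -- The error starts at N because the right end of each array is lowered by exactly N and is not
  -- measured later.
  vE ≔ var vN

Y : ℕ → Expr
Y x = get aX (var vb ⊕ var x)

scanBody scan descendBody descendStep descend segment : Cmd
scanBody =
  vx ≔ get aS (var vtop ⊖ lit (+ 1)) ⨾
  vy ≔ get aS (var vtop) ⨾
  -- Adding 1 makes the comparison strict: the top is popped only at a strictly concave turn.
  ite ((Y vt ⊖ Y vy) ⊗ (var vy ⊖ var vx) ⊕ lit (+ 1) ≼ (Y vy ⊖ Y vx) ⊗ (var vt ⊖ var vy))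
    (vtop ≔ var vtop ⊖ lit (+ 1))
    (incr vtop ⨾ put aS (var vtop) (var vt) ⨾ incr vt)
scan =
  put aS (lit (+ 0)) (lit (+ 0)) ⨾
  put aS (lit (+ 1)) (lit (+ 0)) ⨾
  vtop ≔ lit (+ 1) ⨾
  vt ≔ lit (+ 1) ⨾
  while (var vt ≼ var vl) scanBody
descendBody =
  vt ≔ var vt ⊖ lit (+ 1) ⨾
  -- Once the position has passed the left vertex of the current chord, the next chord of the hull
  -- takes over.
  ite (var vt ⊕ lit (+ 1) ≼ get aS (var vtop ⊖ lit (+ 1))) (vtop ≔ var vtop ⊖ lit (+ 1)) skip ⨾
  descendStep
descendStep =
  vx ≔ get aS (var vtop ⊖ lit (+ 1)) ⨾
  vy ≔ get aS (var vtop) ⨾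
  vz ≔ var vz ⊖ (var vN ⊗ (Y vy ⊖ Y vx)) ⊘ (var vy ⊖ var vx) ⨾
  put aP (var vb ⊕ var vt) (var vz) ⨾
  vx ≔ var vN ⊗ Y vt ⊖ var vz ⨾
  ite (var vE ⊕ lit (+ 1) ≼ var vx) (vE ≔ var vx) skip
descend =
  vz ≔ var vN ⊗ Y vl ⊖ var vN ⨾
  put aP (var vb ⊕ var vl) (var vz) ⨾
  vt ≔ var vl ⨾
  while (lit (+ 1) ≼ var vt) descendBody
segment = scan ⨾ descend

convexify : Cmd
convexify =
  vb ≔ lit (+ 0) ⨾ vl ≔ var vn ⨾ segment ⨾
  vb ≔ var vo ⨾ vl ≔ var vm ⨾ segment

Q : ℕ → Expr → Expr
Q a e = get a (var vo ⊕ e)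

mergeBody merge : Cmd
mergeBody =
  put aα (var vt) (var va) ⨾
  put aH (var vt) (get aP (var va) ⊕ Q aP (var vβ)) ⨾
  put aOut (var vt) (get aX (var va) ⊕ Q aX (var vβ)) ⨾
  ite (var vn ≼ var va) (incr vβ)
    (ite (var vm ≼ var vβ) (incr va)
      (ite (get aP (var va ⊕ lit (+ 1)) ⊖ get aP (var va)
            ≼ Q aP (var vβ ⊕ lit (+ 1)) ⊖ Q aP (var vβ))
        (incr va) (incr vβ))) ⨾
  incr vt
merge =
  vt ≔ lit (+ 0) ⨾
  va ≔ lit (+ 0) ⨾
  vβ ≔ lit (+ 0) ⨾
  while (var vt ≼ var vn ⊕ var vm) mergeBody

stairBody stair : ℕ → Cmd
stairBody d =
  ite (var vj ≼ var vm)
    (vx ≔ get aP (var vt) ⊕ Q aP (var vj) ⊖ get aH (var vt ⊕ var vj) ⨾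
     ite (var vt ⊕ lit (+ 1) ≼ get aα (var vt ⊕ var vj)) (vx ≔ lit (+ 0) ⊖ var vx) skip)
    -- Past the last column the value is set equal to the threshold, so that the following test
    -- always closes the row.
    (vx ≔ var vθ) ⨾
  ite (var vx ≼ var vθ)
    (put d (var vt) (var vj ⊖ (var vm ⊕ lit (+ 1))) ⨾ incr vt)
    (incr vj)
stair d =
  vt ≔ lit (+ 0) ⨾
  vj ≔ lit (+ 0) ⨾
  while (var vt ≼ var vn) (stairBody d)

stairs : Cmd
stairs =
  vθ ≔ lit (+ 2) ⊗ var vE ⨾ stair aA ⨾
  vθ ≔ lit (+ 0) ⊖ lit (+ 2) ⊗ var vE ⊖ lit (+ 1) ⨾ stair aB

fillBody readBody boxWork box : Cmd
fillBody =
  put aU (var vt) ((var vi ⊕ var vt) ⊗ var vK ⊕ get aX (var vi ⊕ var vt) ⊕ var vM) ⨾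
  put aV (var vt) ((var vj ⊕ var vt) ⊗ var vK ⊕ Q aX (var vj ⊕ var vt) ⊕ var vM) ⨾
  incr vt
readBody =
  vk ≔ get aZ (var vt) ⊘ var vK ⨾
  -- Both summands were shifted by M to make their digits nonnegative.
  vx ≔ get aZ (var vt) ⊖ var vk ⊗ var vK ⊖ (var vM ⊕ var vM) ⨾
  ite (var vx ⊕ lit (+ 1) ≼ get aOut (var vk)) (put aOut (var vk) (var vx)) skip ⨾
  incr vt
boxWork =
  vt ≔ lit (+ 0) ⨾
  -- A single loop of s + r rounds serves both arrays; the cells beyond s in one and beyond r in the
  -- other are not passed to the primitive.
  while (var vt ⊕ lit (+ 1) ≼ var vs ⊕ var vr) fillBody ⨾
  conv aU (var vs) aV (var vr) aZ vlen ⨾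
  vt ≔ lit (+ 0) ⨾
  while (var vt ⊕ lit (+ 1) ≼ var vlen) readBody
box = ite (lit (+ 1) ≼ var vr) boxWork skip

-- For the parent block of 2s rows from c: `lo` at the last row of its left half and of the whole
-- block, and `hi` at the first row of the block and of its right half, all shifted by m + 1.
A₁ A₂ B₀ B₁ : Expr
A₁ = get aA (var vc ⊕ (var vs ⊖ lit (+ 1)))
A₂ = get aA (var vc ⊕ var vs ⊕ (var vs ⊖ lit (+ 1)))
B₀ = get aB (var vc)
B₁ = get aB (var vc ⊕ var vs)

-- The left half is full on columns from A₁ to B₀, the right half from A₂ to B₁, their parent from
-- A₂ to B₀. What each half has beyond its parent is the interval from A₁ to min(B₀, A₂),
-- respectively from max(A₂, B₀) to B₁.
leftBox rightBox parentBody levelBody levels : Cmd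
leftBox =
  vi ≔ var vc ⨾
  vj ≔ A₁ ⨾
  vr ≔ A₂ ⨾
  ite (B₀ ≼ var vr) (vr ≔ B₀) skip ⨾
  vr ≔ var vr ⊖ var vj ⨾
  vj ≔ var vj ⊕ (var vm ⊕ lit (+ 1)) ⨾
  box
rightBox =
  vi ≔ var vc ⊕ var vs ⨾
  vj ≔ A₂ ⨾
  ite (var vj ≼ B₀) (vj ≔ B₀) skip ⨾
  vr ≔ B₁ ⊖ var vj ⨾
  vj ≔ var vj ⊕ (var vm ⊕ lit (+ 1)) ⨾
  box
parentBody = leftBox ⨾ rightBox ⨾ vc ≔ var vc ⊕ (var vs ⊕ var vs)
levelBody =
  vc ≔ lit (+ 0) ⨾
  while (var vc ≼ var vn) parentBody ⨾
  vs ≔ var vs ⊕ var vs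
levels =
  vs ≔ lit (+ 1) ⨾
  while (var vs ≼ var vn ⊕ lit (+ 1)) levelBody

program : Cmd
program = copyAll ⨾ convexify ⨾ merge ⨾ stairs ⨾ levels

-- Correctness and cost of the program: parameters and copying.

record Setting : Set where
  field
    limits : Limits
  open Limits limits public
  field
    n m M dev : ℕ
    -- The three groups bound, in order, a sum of two codes, the values derived from p, q and H, and
    -- the size of a sumset.
    large     : 2 * ((2 * (n + m + 2)) * suc (4 * ((n + m + 2) * (M * M))) + M + (n + m + 2) * (M * M)) +
                (16 * ((n + m + 2) * suc (3 * M)) + (n + m + 2) * suc (4 * suc (2 * M))) ≤ B
    fA gA     : ℕ → ℤ
    fA≤M      : ∀ i → ∣ fA i ∣ ≤ M
    gA≤M      : ∀ j → ∣ gA j ∣ ≤ M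
    dev≤2M    : dev ≤ 2 * M
    f-near    : Scan.NearConvex fA n dev
    g-near    : Scan.NearConvex gA m dev
    Nw≤Smax   : (n + m + 2) * suc (4 * suc dev) ≤ Smax

module Algorithm (setting : Setting) where

  open Setting setting
  open Logic limits

  N : ℕ
  N = n + m + 2

  Solved : State → Set
  Solved σ =
    (∀ k → k ≤ n + m → ∃₂ λ i j → i ≤ n × j ≤ m × i + j ≡ k × arrays σ aOut k ≡ fA i ℤ.+ gA j) ×
    (∀ i j → i ≤ n → j ≤ m → arrays σ aOut (i + j) ≤ℤ fA i ℤ.+ gA j)

  -- Since E ≤ N (dev + 1), a window of length 4E has length at most N ω. `κ′` is the price of one
  -- unit of height plus width of a box, and G is, up to a constant, that price summed over all
  -- levels.
  ω κ′ G : ℕ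
  ω  = 4 * suc dev
  κ′ = suc ω * (230 + c * L)
  G  = (2 + ⌊log₂ suc n ⌋) * (N * κ′)

  private
    2≤N : 2 ≤ N
    2≤N = ℕ.m≤n+m 2 (n + m)

    sum-parts : ∀ a b c → a + (b + c) ≤ B → a ≤ B × b ≤ B × c ≤ B
    sum-parts a b c h = ℕ.≤-trans (ℕ.m≤m+n a (b + c)) h , ℕ.≤-trans (ℕ.≤-trans (ℕ.m≤m+n b c) (ℕ.m≤n+m (b + c) a)) h ,
                    ℕ.≤-trans (ℕ.≤-trans (ℕ.m≤n+m c b) (ℕ.m≤n+m (b + c) a)) h

    parts : 2 * ((2 * N) * suc (4 * (N * (M * M))) + M + N * (M * M)) ≤ B × 16 * (N * suc (3 * M)) ≤ B ×
            N * suc (4 * suc (2 * M)) ≤ B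
    parts = sum-parts (2 * ((2 * N) * suc (4 * (N * (M * M))) + M + N * (M * M))) (16 * (N * suc (3 * M))) (N * suc (4 * suc (2 * M))) large

    code-part = proj₁ parts
    R≤B = proj₁ (proj₂ parts)

    Nw≤B : N * suc ω ≤ B
    Nw≤B = ℕ.≤-trans (ℕ.*-monoʳ-≤ N (s≤s (ℕ.*-monoʳ-≤ 4 (s≤s dev≤2M)))) (proj₂ (proj₂ parts))

    inner : (2 * N) * suc (4 * (N * (M * M))) + M + N * (M * M) ≤ B
    inner = ℕ.≤-trans (ℕ.m≤m+n _ _) code-part

    K≤B : suc (4 * (N * (M * M))) ≤ B
    K≤B = ℕ.≤-trans (ℕ.m≤n*m _ (2 * N) {{ℕ.>-nonZero (ℕ.≤-trans (s≤s z≤n) (ℕ.≤-trans 2≤N (ℕ.m≤m+n N _)))}})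
            (ℕ.≤-trans (ℕ.≤-trans (ℕ.m≤m+n _ M) (ℕ.m≤m+n _ _)) inner)

    M≤B : M ≤ B
    M≤B = ℕ.≤-trans (ℕ.≤-trans (ℕ.m≤n+m M ((2 * N) * suc (4 * (N * (M * M))))) (ℕ.m≤m+n _ _)) inner

    N≤B₀ : N ≤ B
    N≤B₀ = ℕ.≤-trans (ℕ.≤-trans (ℕ.≤-trans (ℕ.m≤m+n N _) (ℕ.m≤m*n (2 * N) (suc (4 * (N * (M * M)))))) (ℕ.≤-trans (ℕ.m≤m+n _ M) (ℕ.m≤m+n _ _))) inner

  Blank : State → Set
  Blank σ = (∀ i → arrays σ aA i ≡ 0ℤ) × (∀ i → arrays σ aB i ≡ 0ℤ)

  blank-frame : ∀ {κ σ σ′} → Frame κ σ σ′ → anyOf writesArr κ aA ≡ false → anyOf writesArr κ aB ≡ false →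
    Blank σ → Blank σ′
  blank-frame fr wA wB (a , b) = (λ i → trans (cong-app (arr≡ fr aA wA) i) (a i)) , λ i → trans (cong-app (arr≡ fr aB wB) i) (b i)

  Inputs : State → Set
  Inputs σ = vars σ vn ≡ + n × vars σ vm ≡ + m × arrays σ aF ≡ fA × arrays σ aG ≡ gA

  Ready : State → Set
  Ready σ = vars σ vN ≡ + N × vars σ vo ≡ + suc n

  -- The machine is not told M, so it bounds the entries by M₀, their sum of squares, using a ≤ a *
  -- a. The bound by M concerns all cells, including those still zero, and serves only to keep the
  -- numbers small.
  Copied : ℕ → ℕ → (ℕ → ℤ) → Set
  Copied t M₀ X = (∀ i → i < t → i ≤ n → X i ≡ fA i) × (∀ j → suc n + j < t → X (suc n + j) ≡ gA j) ×
    (∀ i → i < t → ∣ X i ∣ ≤ M₀) × (∀ i → ∣ X i ∣ ≤ M) × M₀ ≤ t * (M * M)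

  CopyInv : ℕ → State → Set
  CopyInv μ σ = ∃ λ t → ∃ λ M₀ → vars σ vt ≡ + t × vars σ vM ≡ + M₀ × t + μ ≡ N × Copied t M₀ (arrays σ aX)

  square : ∀ x → x ℤ.* x ≡ + (∣ x ∣ * ∣ x ∣)
  square (+ x)      = sym (ℤ.pos-* x x)
  square ℤ.-[1+ x ] = refl

  copy-step : ∀ {μ σ} → CopyInv μ σ → Inputs σ → Ready σ →
    ∃₂ λ u v → σ ⊢ var vt ⊕ lit 1ℤ ⇓ u × σ ⊢ var vN ⇓ v ×
    (u ≤ℤ v → ∃ λ μ′ → suc μ′ ≤ μ × Safe (CopyInv μ′) 50 (copyBody ∷ []) σ) ×
    (v ℤ.< u → ∃ λ M₀ → vars σ vM ≡ + M₀ × Copied N M₀ (arrays σ aX))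
  copy-step {zero} {σ} (t , M₀ , et , eM , e , copied) _ (eN , _) = _ , _ , add (var et) (lit 1ℤ) , var eN ,
    (λ h → contradiction (ℕ.≤-trans (ℕ.≤-reflexive (ℕ.+-comm 1 t)) (ℤ.drop‿+≤+ h)) (ℕ.<⇒≱ (s≤s (ℕ.≤-reflexive (sym t≡))))) ,
    λ _ → M₀ , eM , subst (λ t → Copied t M₀ (arrays σ aX)) t≡ copied
    where
    t≡ : t ≡ N
    t≡ = trans (sym (ℕ.+-identityʳ t)) e
  copy-step {suc μ} {⟨ vs , as ⟩} (t , M₀ , et , eM , e , cf , cg , small , all≤ , M₀≤) (en , em , eF , eG) (eN , eo) =
    _ , _ , add (var et) (lit 1ℤ) , var eN , (λ _ → μ , ℕ.≤-refl , body) ,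
    λ h → contradiction (ℤ.drop‿+<+ h) (ℕ.≤⇒≯ (ℕ.≤-trans (ℕ.≤-reflexive (ℕ.+-comm t 1)) t<))
    where
    e′ : suc t + μ ≡ N
    e′ = trans (sym (ℕ.+-suc t μ)) e
    t< : t < N
    t< = ℕ.≤-trans (ℕ.m≤m+n (suc t) μ) (ℕ.≤-reflexive e′)
    tail : ∀ {x} → ∣ x ∣ ≤ M → (t ≤ n → x ≡ fA t) → (∀ j → suc n + j ≡ t → x ≡ gA j) →
      Safe (CopyInv μ) 14 (vM ≔ var vM ⊕ get aX (var vt) ⊗ get aX (var vt) ⨾ incr vt ∷ [])
        ⟨ vs , update as aX (update (as aX) t x) ⟩
    tail {x} x≤ ef eg =
      seq (assign {z = + M₁} (at (add (var eM) (mul (get (var et) Xt) (get (var et) Xt))) (cong (λ z → + M₀ ℤ.+ z) (square x)))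
            (ℕ.≤-trans M₁≤ (ℕ.≤-trans (ℕ.*-monoˡ-≤ (M * M) t<) (ℕ.≤-trans (ℕ.≤-trans (ℕ.m≤n*m (N * (M * M)) 4) (ℕ.n≤1+n _)) K≤B)))
      (assign {z = + suc t} (at (add (var et) (lit 1ℤ)) (cong +_ (ℕ.+-comm t 1))) (ℕ.≤-trans t< N≤B₀)
      (end (suc t , M₁ , refl , refl , e′ ,
        (λ i h i≤n → split i h (λ z → z ≡ fA i) (λ lt → cf i lt i≤n) (λ { refl → ef i≤n })) ,
        (λ j h → split (suc n + j) h (λ z → z ≡ gA j) (λ lt → cg j lt) (λ eq → eg j eq)) ,
        (λ i h → split i h (λ z → ∣ z ∣ ≤ M₁) (λ lt → ℕ.≤-trans (small i lt) (ℕ.m≤m+n M₀ _)) (λ _ → x≤M₁)) ,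
        (λ i → any i) , M₁≤))))
      where
      M₁ : ℕ
      M₁ = M₀ + ∣ x ∣ * ∣ x ∣
      Xt : update (as aX) t x t ≡ x
      Xt = update-same (as aX) t x
      M₁≤ : M₁ ≤ suc t * (M * M)
      M₁≤ = ℕ.≤-trans (ℕ.+-mono-≤ M₀≤ (ℕ.*-mono-≤ x≤ x≤)) (ℕ.≤-reflexive (ℕ.+-comm (t * (M * M)) (M * M)))
      x≤M₁ : ∣ x ∣ ≤ M₁
      x≤M₁ = ℕ.≤-trans (self ∣ x ∣) (ℕ.m≤n+m _ M₀)
        where
        self : ∀ a → a ≤ a * a
        self zero    = z≤n
        self (suc a) = ℕ.m≤m*n (suc a) (suc a)
      split : ∀ i → i < suc t → (P : ℤ → Set) → (i < t → P (as aX i)) → (i ≡ t → P x) → P (update (as aX) t x i)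
      split i (s≤s h) P old new = [ (λ lt → subst P (sym (update-other (as aX) x (ℕ.<⇒≢ lt))) (old lt)) ,
                                    (λ eq → subst P (sym (trans (cong (update (as aX) t x) eq) Xt)) (new eq)) ]′ (ℕ.m≤n⇒m<n∨m≡n h)
      any : ∀ i → ∣ update (as aX) t x i ∣ ≤ M
      any i = go (i ℕ.≟ t)
        where
        go : Dec (i ≡ t) → ∣ update (as aX) t x i ∣ ≤ M
        go (yes refl) = subst (λ z → ∣ z ∣ ≤ M) (sym Xt) x≤
        go (no ne)    = subst (λ z → ∣ z ∣ ≤ M) (sym (update-other (as aX) x ne)) (all≤ i)
    body : Safe (CopyInv μ) 50 (copyBody ∷ []) ⟨ vs , as ⟩
    body = weaken-safe {b = 25} (auto 25 50) (seq (branch (var et) (var en)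
      (λ h → let t≤n = ℤ.drop‿+≤+ h in
        weaken-safe {b = 18} (auto 18 20) (store {i = t} {z = fA t} (var et) (get (var et) (cong-app eF t)) (ℕ.≤-trans (fA≤M t) M≤B)
          (tail (fA≤M t) (λ _ → refl) (λ j eq → contradiction (ℕ.≤-trans (ℕ.m≤m+n (suc n) j) (ℕ.≤-trans (ℕ.≤-reflexive eq) t≤n)) (ℕ.<-irrefl refl)))))
      (λ h → let n<t = ℤ.drop‿+<+ h in
        store {i = t} {z = gA (t ℕ.∸ suc n)} (var et)
          (get (at (sub (var et) (var eo)) (trans (ℤ.m-n≡m⊖n t (suc n)) (ℤ.⊖-≥ n<t))) (cong-app eG (t ℕ.∸ suc n))) (ℕ.≤-trans (gA≤M _) M≤B)
          (tail (gA≤M _) (λ t≤n → contradiction t≤n (ℕ.<⇒≱ n<t)) (λ j eq → cong gA (trans (cong (λ z → z ℕ.∸ suc n) (sym eq)) (ℕ.m+n∸m≡n (suc n) j)))))))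
      where
      auto : ∀ a b {h : Bool.T (a ℕ.≤ᵇ b)} → a ≤ b
      auto a b {h} = ℕ.≤ᵇ⇒≤ a b h

  CopyPost : State → Set
  CopyPost σ = ∃ λ M₀ → Copied N M₀ (arrays σ aX) × vars σ vn ≡ + n × vars σ vm ≡ + m × Ready σ ×
    vars σ vM ≡ + M₀ × vars σ vK ≡ + suc (4 * M₀) × vars σ vE ≡ + N

  copy-ok : ∀ {σ} → Inputs σ → vars σ vt ≡ 0ℤ → vars σ vM ≡ 0ℤ → (∀ i → arrays σ aX i ≡ 0ℤ) →
    Safe CopyPost (20 + (suc N * 56 + 20)) (copyAll ∷ []) σ
  copy-ok {⟨ vs , as ⟩} (en , em , eF , eG) et eM blank = weaken-safe (ℕ.+-mono-≤ (ℕ.≤ᵇ⇒≤ 13 20 _) (ℕ.+-monoʳ-≤ (suc N * 56) (ℕ.≤ᵇ⇒≤ 11 20 _)))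
    (seq (assign {z = + N} (add (add (var en) (var em)) (lit (+ 2))) N≤B₀
    (seq (assign {z = + suc n} (at (add (var en) (lit 1ℤ)) (cong +_ (ℕ.+-comm n 1))) (ℕ.≤-trans n<N N≤B₀)
    (seq (run (count 50 CopyInv N
        (λ { {σ = σ₁} inv fr _ → copy-step {σ = σ₁} inv
          (trans (var≡ fr vn refl) en , trans (var≡ fr vm refl) em , trans (arr≡ fr aF refl) eF , trans (arr≡ fr aG refl) eG)
          (var≡ fr vN refl , var≡ fr vo refl) })
        (0 , 0 , et , eM , refl , (λ _ ()) , (λ _ ()) , (λ _ ()) , (λ i → ℕ.≤-trans (ℕ.≤-reflexive (cong ∣_∣ (blank i))) z≤n) , z≤n))
      finish))))))
    where
    n<N : suc n ≤ N
    n<N = ℕ.≤-trans (s≤s (ℕ.m≤m+n n m)) (ℕ.m<m+n (n + m) (s≤s z≤n))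
    finish : ∀ {σ₁} → (∃ λ M₀ → vars σ₁ vM ≡ + M₀ × Copied N M₀ (arrays σ₁ aX)) →
      Frame (while (var vt ⊕ lit 1ℤ ≼ var vN) copyBody ∷ []) ⟨ update (update vs vN (+ N)) vo (+ suc n) , as ⟩ σ₁ → Bounded σ₁ →
      Safe CopyPost 11 (vK ≔ lit (+ 4) ⊗ var vM ⊕ lit 1ℤ ⨾ vE ≔ var vN ∷ []) σ₁
    finish {⟨ vs₁ , as₁ ⟩} (M₀ , eM₁ , copied) fr _ =
      weaken-safe (ℕ.≤ᵇ⇒≤ 9 11 _)
      (seq (assign {z = + suc (4 * M₀)} (at (add (mul (lit (+ 4)) (var eM₁)) (lit 1ℤ)) (trans (cong (λ z → z ℤ.+ 1ℤ) (sym (ℤ.pos-* 4 M₀))) (cong +_ (ℕ.+-comm (4 * M₀) 1))))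
          (ℕ.≤-trans (s≤s (ℕ.*-monoʳ-≤ 4 (proj₂ (proj₂ (proj₂ (proj₂ copied)))))) K≤B)
      (assign {z = + N} (var (var≡ fr vN refl)) N≤B₀
      (end (M₀ , copied , trans (var≡ fr vn refl) en , trans (var≡ fr vm refl) em , (var≡ fr vN refl , var≡ fr vo refl) , eM₁ , refl , refl)))))


  module After (M₀ : ℕ) (X : ℕ → ℤ) (copied : Copied N M₀ X) where

    K : ℕ
    K = suc (4 * M₀)

    X≤M : ∀ i → ∣ X i ∣ ≤ M
    X≤M = proj₁ (proj₂ (proj₂ (proj₂ copied)))

    X≤M₀ : ∀ i → i < N → ∣ X i ∣ ≤ M₀
    X≤M₀ = proj₁ (proj₂ (proj₂ copied))

    M₀≤ : M₀ ≤ N * (M * M)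
    M₀≤ = proj₂ (proj₂ (proj₂ (proj₂ copied)))

    4M<K : (M₀ + M₀) + (M₀ + M₀) < K
    4M<K = s≤s (ℕ.≤-reflexive (four M₀))
      where
      four : ∀ a → (a + a) + (a + a) ≡ 4 * a
      four = ℕ-solve-∀

    code≤B : 2 * ((2 * N) * K + M + M₀) ≤ B
    code≤B = ℕ.≤-trans (ℕ.*-monoʳ-≤ 2 (ℕ.+-mono-≤ (ℕ.+-monoˡ-≤ M (ℕ.*-monoʳ-≤ (2 * N) (s≤s (ℕ.*-monoʳ-≤ 4 M₀≤)))) M₀≤)) code-part

    R : ℕ
    R = N * suc (3 * M)

    R≤ : ∀ k → k ≤ 16 → k * R ≤ B
    R≤ k h = ℕ.≤-trans (ℕ.*-monoˡ-≤ R h) R≤B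

    N≤R : N ≤ R
    N≤R = ℕ.m≤m*n N (suc (3 * M))

    NM≤B : R ≤ B
    NM≤B = ℕ.≤-trans (ℕ.m≤m+n R 0) (R≤ 1 (s≤s z≤n))

    N≤B : suc (suc N) ≤ B
    N≤B = ℕ.≤-trans (ℕ.+-mono-≤ (ℕ.≤-trans 2≤N N≤R) (ℕ.≤-trans N≤R (ℕ.m≤m+n R 0))) (R≤ 2 (s≤s (s≤s z≤n)))

    auto : ∀ a b {h : Bool.T (a ℕ.≤ᵇ b)} → a ≤ b
    auto a b {h} = ℕ.≤ᵇ⇒≤ a b h

    overhead : ∀ {a k k′} x → a ≤ k′ → k ≤ k′ → a + x * k ≤ suc x * k′
    overhead x a≤ k≤ = ℕ.+-mono-≤ a≤ (ℕ.*-monoʳ-≤ x k≤)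


    Base : State → Set
    Base σ = vars σ vn ≡ + n × vars σ vm ≡ + m × vars σ vN ≡ + N × vars σ vo ≡ + suc n ×
             vars σ vM ≡ + M₀ × vars σ vK ≡ + K × arrays σ aX ≡ X

    Leaves : List Cmd → Set
    Leaves κ = unwritten vn × unwritten vm × unwritten vN × unwritten vo × unwritten vM × unwritten vK ×
               anyOf writesArr κ aX ≡ false
      where unwritten = λ x → anyOf writesVar κ x ≡ false

    base-frame : ∀ {κ σ σ′} → Frame κ σ σ′ → Leaves κ → Base σ → Base σ′
    base-frame fr (w₀ , w₁ , w₂ , w₃ , w₄ , w₅ , w₆) (e₀ , e₁ , e₂ , e₃ , e₄ , e₅ , e₆) =
      trans (var≡ fr vn w₀) e₀ , trans (var≡ fr vm w₁) e₁ , trans (var≡ fr vN w₂) e₂ ,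
      trans (var≡ fr vo w₃) e₃ , trans (var≡ fr vM w₄) e₄ , trans (var≡ fr vK w₅) e₅ ,
      trans (arr≡ fr aX w₆) e₆

    -- The hull of one array and its integral convex minorant.

    module _ (b len : ℕ) (fits : b + len < N) where

      y : ℕ → ℤ
      y x = X (b + x)

      open Scan y

      Here : State → Set
      Here σ = vars σ vb ≡ + b × vars σ vl ≡ + len

      Cells : (ℕ → ℕ) → ℕ → State → Set
      Cells S t σ = ∀ a → a ≤ t → arrays σ aS a ≡ + S a

      -- The amortisation of Graham's scan: in the measure t + 2r a pop lowers t by one, while a
      -- push raises t by one but lowers the number r of unread indices. The disjunction ensures
      -- that the last index ends up on top, also when len = 0.
      ScanInv : ℕ → State → Set
      ScanInv μ σ = ∃ λ S → ∃ λ t → ∃ λ i → ∃ λ r →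
        vars σ vtop ≡ + suc t × vars σ vt ≡ + i × Cells S (suc t) σ × Stack S (suc t) i ×
        i + r ≡ suc len × (i ≤ len ⊎ S (suc t) ≡ len) × μ ≡ t + (r + r) × suc t ≤ i

      Hull : State → Set
      Hull σ = ∃ λ S → ∃ λ t → vars σ vtop ≡ + suc t × Cells S (suc t) σ ×
               Stack S (suc t) (suc len) × S (suc t) ≡ len × suc t ≤ suc len

      Yat : ∀ {σ x i} → vars σ vb ≡ + b → arrays σ aX ≡ X → vars σ x ≡ + i → σ ⊢ Y x ⇓ y i
      Yat {i = i} eb eX ex = get (add (var eb) (var ex)) (cong-app eX (b + i))

      len<N : len < N
      len<N = ℕ.≤-<-trans (ℕ.m≤n+m len b) fits

      scan-step : ∀ {μ σ} → ScanInv μ σ → Base σ → Here σ →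
        ∃₂ λ u v → σ ⊢ var vt ⇓ u × σ ⊢ var vl ⇓ v ×
        (u ≤ℤ v → ∃ λ μ′ → suc μ′ ≤ μ × Safe (ScanInv μ′) 60 (scanBody ∷ []) σ) ×
        (v ℤ.< u → Hull σ)
      scan-step {σ = σ} (S , t , i , zero , etop , et , cells , st , er , top , refl , t≤) _ (eb , el) =
        + i , + len , var et , var el ,
        (λ i≤len → contradiction (ℤ.drop‿+≤+ i≤len) i≰len) ,
        λ _ → S , t , etop , cells , subst (Stack S (suc t)) i≡ st , bottom top , subst (suc t ≤_) i≡ t≤
        where
        i≡ : i ≡ suc len
        i≡ = trans (sym (ℕ.+-identityʳ i)) er
        i≰len : ¬ i ≤ len
        i≰len i≤ = ℕ.<-irrefl i≡ (s≤s i≤)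
        bottom : i ≤ len ⊎ S (suc t) ≡ len → S (suc t) ≡ len
        bottom (inj₁ i≤) = contradiction i≤ i≰len
        bottom (inj₂ e)  = e
      scan-step {σ = σ} (S , t , i , suc r , etop , et , cells , st , er , _ , refl , t≤) (_ , _ , _ , _ , _ , _ , eX) (eb , el) =
        + i , + len , var et , var el ,
        (λ _ → t + (r + suc r) , ℕ.≤-reflexive (sym (ℕ.+-suc t (r + suc r))) , body) ,
        λ len<i → contradiction (ℤ.drop‿+<+ len<i) (ℕ.≤⇒≯ i≤len)
        where
        p = S t
        q = S (suc t)
        i≤len : i ≤ len
        i≤len = ℕ.≤-trans (ℕ.m≤m+n i r) (ℕ.≤-pred (ℕ.≤-reflexive (trans (sym (ℕ.+-suc i r)) er)))
        small : ∀ {x} → x ≤ suc i → x ≤ B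
        small h = ℕ.≤-trans h (ℕ.≤-trans (s≤s (ℕ.≤-trans i≤len (ℕ.<⇒≤ len<N))) (ℕ.≤-trans (ℕ.n≤1+n _) N≤B))
        popped : Stack S t i → ScanInv (t + (r + suc r)) ⟨ update (update (update (vars σ) vx (+ p)) vy (+ q)) vtop (+ t) , arrays σ ⟩
        popped st′ = lemma t refl st′
          where
          lemma : ∀ t₁ → t ≡ t₁ → Stack S t₁ i →
            ScanInv (t + (r + suc r)) ⟨ update (update (update (vars σ) vx (+ p)) vy (+ q)) vtop (+ t) , arrays σ ⟩
          lemma zero    refl st₁ = contradiction (Stack.1≤t st₁) λ ()
          lemma (suc t₁) refl st₁ = S , t₁ , i , suc r , refl , et ,
            (λ a h → cells a (ℕ.≤-trans h (ℕ.n≤1+n _))) , st₁ , er , inj₁ i≤len ,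
            sym (ℕ.+-suc t₁ (r + suc r)) , ℕ.≤-trans (ℕ.n≤1+n _) t≤
        new-cells : ∀ a → a ≤ suc (suc t) → update (arrays σ aS) (suc (suc t)) (+ i) a ≡ + update S (suc (suc t)) i a
        new-cells a h with ℕ.m≤n⇒m<n∨m≡n h
        ... | inj₂ refl = trans (update-same (arrays σ aS) a (+ i)) (cong +_ (sym (update-same S a i)))
        ... | inj₁ (s≤s h′) = trans (update-other (arrays σ aS) (+ i) (ℕ.<⇒≢ (s≤s h′)))
                        (trans (cells a h′) (cong +_ (sym (update-other S i (ℕ.<⇒≢ (s≤s h′))))))
        fewer : t + (r + suc r) ≡ suc t + (r + r)
        fewer = trans (cong (λ z → t + z) (ℕ.+-suc r r)) (ℕ.+-suc t (r + r))
        last : suc i ≤ len ⊎ update S (suc (suc t)) i (suc (suc t)) ≡ len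
        last with ℕ.m≤n⇒m<n∨m≡n i≤len
        ... | inj₁ i<  = inj₁ i<
        ... | inj₂ i≡ = inj₂ (trans (update-same S (suc (suc t)) i) i≡)
        body : Safe (ScanInv (t + (r + suc r))) 60 (scanBody ∷ []) σ
        body = bounds λ bd →
          seq (assign (get (sub (var etop) (lit 1ℤ)) (cells t (ℕ.n≤1+n t))) (subst (λ z → ∣ z ∣ ≤ B) (cells t (ℕ.n≤1+n t)) (proj₂ bd aS t))
          (seq (assign (get (var etop) (cells (suc t) ℕ.≤-refl)) (subst (λ z → ∣ z ∣ ≤ B) (cells (suc t) ℕ.≤-refl) (proj₂ bd aS (suc t)))
          (branch
            (add (mul (sub (Yat eb eX et) (Yat eb eX refl)) (sub (var refl) (var refl))) (lit 1ℤ))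
            (mul (sub (Yat eb eX refl) (Yat eb eX refl)) (sub (var et) (var refl)))
            (λ h → assign (sub (var etop) (lit 1ℤ)) (small (ℕ.≤-trans (ℕ.n≤1+n t) (ℕ.≤-trans t≤ (ℕ.n≤1+n i))))
              (end (popped (pop st (+1≤⇒< h)))))
            (λ h → seq (assign (at (add (var etop) (lit 1ℤ)) (cong +_ (ℕ.+-comm (suc t) 1))) (small (s≤s t≤))
              (seq (store (var refl) (var et) (small (ℕ.n≤1+n i))
              (assign (at (add (var et) (lit 1ℤ)) (cong +_ (ℕ.+-comm i 1))) (small ℕ.≤-refl)
              (end (update S (suc (suc t)) i , suc t , suc i , r , refl , refl , new-cells , push st (<+1⇒≤ h) ,
                    trans (sym (ℕ.+-suc i r)) er , last , fewer , s≤s t≤)))))))))))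

      scan-cost : ℕ
      scan-cost = suc (suc (len + len)) * 70

      scan-ok : ∀ {σ} → Base σ → Here σ → Safe Hull (scan-cost) (scan ∷ []) σ
      scan-ok {σ} base here = weaken-safe (overhead {14} {64} (suc (len + len)) (auto 14 70) (auto 64 70))
        (seq (store (lit 0ℤ) (lit 0ℤ) z≤n
        (seq (store (lit 1ℤ) (lit 0ℤ) z≤n
        (seq (assign (lit 1ℤ) (ℕ.≤-trans (s≤s z≤n) 4≤B)
        (seq (assign (lit 1ℤ) (ℕ.≤-trans (s≤s z≤n) 4≤B)
        (count 60 ScanInv (len + len) (λ { {σ = σ′} inv fr bd → scan-step inv (base′ fr) (here′ fr) })
          ((λ _ → 0) , 0 , 1 , len , refl , refl , cells , start , refl , first , refl , s≤s z≤n))))))))))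
        where
        base′ : ∀ {σ′} → Frame (scanBody ∷ []) _ σ′ → Base σ′
        base′ fr = base-frame fr (refl , refl , refl , refl , refl , refl , refl) base
        here′ : ∀ {σ′} → Frame (scanBody ∷ []) _ σ′ → Here σ′
        here′ fr = trans (var≡ fr vb refl) (proj₁ here) , trans (var≡ fr vl refl) (proj₂ here)
        first : 1 ≤ len ⊎ 0 ≡ len
        first = [ inj₁ , (λ e → inj₂ e) ]′ (ℕ.m≤n⇒m<n∨m≡n z≤n)
        cells : ∀ a → a ≤ 1 → _
        cells zero       _ = refl
        cells (suc zero) _ = refl
        cells (suc (suc _)) (s≤s ())

      open Descend y N

      Good : ℕ → ℕ → (ℕ → ℤ) → Set
      Good E x P =
        (∀ z → x ≤ z → z ≤ len → P z ≤ℤ + N ℤ.* y z × + N ℤ.* y z ℤ.- P z ≤ℤ + E) ×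
        (∀ z → x ≤ z → suc z < len → P (suc z) ℤ.- P z ≤ℤ P (suc (suc z)) ℤ.- P (suc z))

      extend : ∀ {E E′ x P P′} → Good E (suc x) P → (∀ z → suc x ≤ z → P′ z ≡ P z) → E ≤ E′ →
        P′ x ≤ℤ + N ℤ.* y x → + N ℤ.* y x ℤ.- P′ x ≤ℤ + E′ →
        (suc x < len → P′ (suc x) ℤ.- P′ x ≤ℤ P′ (suc (suc x)) ℤ.- P′ (suc x)) → Good E′ x P′
      extend {E} {E′} {x} {P} {P′} (close , cvx) old E≤E′ below above slope-ok = close′ , cvx′
        where
        close′ : ∀ z → x ≤ z → z ≤ len → P′ z ≤ℤ + N ℤ.* y z × + N ℤ.* y z ℤ.- P′ z ≤ℤ + E′
        close′ z x≤z z≤ with ℕ.m≤n⇒m<n∨m≡n x≤z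
        ... | inj₂ refl = below , above
        ... | inj₁ x<z rewrite old z x<z =
          proj₁ (close z x<z z≤) , ℤ.≤-trans (proj₂ (close z x<z z≤)) (ℤ.+≤+ E≤E′)
        cvx′ : ∀ z → x ≤ z → suc z < len → P′ (suc z) ℤ.- P′ z ≤ℤ P′ (suc (suc z)) ℤ.- P′ (suc z)
        cvx′ z x≤z z< with ℕ.m≤n⇒m<n∨m≡n x≤z
        ... | inj₂ refl = slope-ok z<
        ... | inj₁ x<z rewrite old z x<z | old (suc z) (ℕ.m≤n⇒m≤1+n x<z) | old (suc (suc z)) (ℕ.m≤n⇒m≤1+n (ℕ.m≤n⇒m≤1+n x<z)) =
          cvx z x<z z<

      NC : ℕ → Set
      NC = NearConvex len

      near-2M : NC (2 * M)
      near-2M = bounded⇒near λ x h → X≤M (b + x)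

      -- Between N y - N (2M + 1) and N y, with y at most M in absolute value, there are only
      -- numbers of absolute value at most N (3M + 1); hence the form of `R`.
      value-bound : ∀ {x z} → x ≤ len → z ≤ℤ + N ℤ.* y x → + N ℤ.* y x ℤ.- z ≤ℤ + (N * suc (2 * M)) → ∣ z ∣ ≤ R
      value-bound {x} {z} x≤ hi lo = abs≤
          (subst (λ e → ℤ.- e ≤ℤ z) (sym (expand 3)) (low (+ N) (+ M) (y x) z
            (0≤+ {N} · proj₁ bound) (subst (+ N ℤ.* y x ℤ.- z ≤ℤ_) (expand 2) lo)))
          (subst (z ≤ℤ_) (sym (expand 3)) (high (+ N) (+ M) (y x) z hi (0≤+ {N} · proj₂ bound) (0≤+ {N} · 0≤+ {M}) (0≤+ {N})))
        where
        bound = ≤abs (X≤M (b + x))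
        expand : ∀ a → + (N * suc (a * M)) ≡ + N ℤ.* (1ℤ ℤ.+ + a ℤ.* + M)
        expand a = trans (ℤ.pos-* N (suc (a * M))) (cong (λ e → + N ℤ.* (1ℤ ℤ.+ e)) (ℤ.pos-* a M))
        low : ∀ N M y z → N ℤ.* (ℤ.- M) ≤ℤ N ℤ.* y → N ℤ.* y ℤ.- z ≤ℤ N ℤ.* (1ℤ ℤ.+ + 2 ℤ.* M) →
              ℤ.- (N ℤ.* (1ℤ ℤ.+ + 3 ℤ.* M)) ≤ℤ z
        low N M y z h k = by (h ⊹ k) (solve (N ∷ M ∷ y ∷ z ∷ []))
        high : ∀ N M y z → z ≤ℤ N ℤ.* y → N ℤ.* y ≤ℤ N ℤ.* M → N ℤ.* 0ℤ ≤ℤ N ℤ.* M → 0ℤ ≤ℤ N →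
               z ≤ℤ N ℤ.* (1ℤ ℤ.+ + 3 ℤ.* M)
        high N M y z h k l o = by (h ⊹ k ⊹ l ⊹ l ⊹ o) (solve (N ∷ M ∷ y ∷ z ∷ []))

      module Descent (S : ℕ → ℕ) (T : ℕ) (hull : Stack S (suc T) (suc len)) (top : S (suc T) ≡ len) (T≤len : T ≤ len)
                     (E₀ : ℕ) (N≤E₀ : N ≤ E₀) (E₀≤ : E₀ ≤ N * suc (2 * M)) (P₀ : ℕ → ℤ) where

        open Stack hull

        -- The program knows no deviation d, so E is a running maximum of observed errors. Its upper
        -- bound is therefore demanded for every d that is admissible for the array.
        Measured : ℕ → Set
        Measured E = E₀ ≤ E × (∀ d → NC d → E₀ ≤ N * suc d → E ≤ N * suc d)

        DescentInv : ℕ → State → Set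
        DescentInv x σ = ∃ λ t → ∃ λ z → ∃ λ E →
          (vars σ vtop ≡ + suc t × vars σ vt ≡ + x × vars σ vz ≡ z × vars σ vE ≡ + E) ×
          (Cells S (suc T) σ × t ≤ T × S t ≤ x × x ≤ S (suc t)) ×
          Near len (S t) (S (suc t)) x z ×
          arrays σ aP (b + x) ≡ z × Good E x (λ x → arrays σ aP (b + x)) × Measured E ×
          (x < len → slope (S t) (S (suc t)) ≤ℤ arrays σ aP (b + suc x) ℤ.- arrays σ aP (b + x)) ×
          (∀ i → i < b → arrays σ aP i ≡ P₀ i)

        S≤len : ∀ {t} → t ≤ T → S (suc t) ≤ len
        S≤len t≤T = ℕ.≤-trans (stack-mono hull (s≤s z≤n) (s≤s t≤T) ℕ.≤-refl) (ℕ.≤-reflexive top)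

        positive : ∀ {t} → 1 ≤ S (suc t) → 1 ≤ t
        positive {zero}  h = contradiction (subst (1 ≤_) bottom₁ h) λ ()
        positive {suc t} h = s≤s z≤n

        module Step {σ : State} {t x : ℕ} {z : ℤ} {E : ℕ} (base : Base σ) (here : Here σ)
          (etop : vars σ vtop ≡ + suc t) (et : vars σ vt ≡ + x) (ez : vars σ vz ≡ z) (eE : vars σ vE ≡ + E)
          (cells : Cells S (suc T) σ) (t≤T : t ≤ T) (p≤x : S t ≤ x) (x<v : x < S (suc t))
          (nr : Near len (S t) (S (suc t)) (suc x) z)
          (eP : arrays σ aP (b + suc x) ≡ z) (good : Good E (suc x) (λ x → arrays σ aP (b + x)))
          (measured : Measured E)
          (last : suc x < len → slope (S t) (S (suc t)) ≤ℤ
                    arrays σ aP (b + suc (suc x)) ℤ.- arrays σ aP (b + suc x))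
          (same : ∀ i → i < b → arrays σ aP i ≡ P₀ i) where

          p v : ℕ
          p = S t
          v = S (suc t)

          1≤t′ : 1 ≤ t
          1≤t′ = positive (ℕ.≤-trans (s≤s z≤n) x<v)

          p<v : p < v
          p<v = mono t 1≤t′ (s≤s t≤T)

          v≤len : v ≤ len
          v≤len = S≤len t≤T

          x≤len : x ≤ len
          x≤len = ℕ.≤-trans (ℕ.<⇒≤ x<v) v≤len

          small : ∀ {x} → x ≤ len → x ≤ B
          small h = ℕ.≤-trans h (ℕ.≤-trans (ℕ.<⇒≤ len<N) (ℕ.≤-trans (ℕ.≤-trans (ℕ.n≤1+n _) (ℕ.n≤1+n _)) N≤B))

          z′ w : ℤ
          z′ = z ℤ.- slope p v
          w  = + N ℤ.* y x ℤ.- z′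

          near′ : Near len p v x z′
          near′ = near-step p<v nr

          below : z′ ≤ℤ + N ℤ.* y x
          below = near-below p<v p≤x (ℕ.<⇒≤ x<v) (ℕ.<⇒≤ len<N) (above t 1≤t′ (s≤s t≤T)) near′

          close : ∀ d → NC d → w ≤ℤ + (N * suc d)
          close d nc = near-close p<v p≤x (ℕ.<⇒≤ x<v) v≤len nc near′

          z′≤B : ∣ z′ ∣ ≤ B
          z′≤B = ℕ.≤-trans (value-bound x≤len below (close (2 * M) near-2M)) NM≤B

          0≤w : 0ℤ ≤ℤ w
          0≤w = ℤ.i≤j⇒0≤j-i below

          w≡ : + ∣ w ∣ ≡ w
          w≡ = ℤ.0≤i⇒+∣i∣≡i 0≤w

          w≤ : ∣ w ∣ ≤ N * suc (2 * M)
          w≤ = ℤ.drop‿+≤+ (subst (_≤ℤ + (N * suc (2 * M))) (sym w≡) (close (2 * M) near-2M))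

          2M≤B : N * suc (2 * M) ≤ B
          2M≤B = ℕ.≤-trans (ℕ.*-monoʳ-≤ N (s≤s (ℕ.*-monoˡ-≤ M (auto 2 3)))) NM≤B

          P P′ : ℕ → ℤ
          P  = λ x → arrays σ aP (b + x)
          P′ = λ x′ → update (arrays σ aP) (b + x) z′ (b + x′)

          P′-x : P′ x ≡ z′
          P′-x = update-same (arrays σ aP) (b + x) z′

          P′-old : ∀ x′ → suc x ≤ x′ → P′ x′ ≡ P x′
          P′-old x′ x<x′ = update-other (arrays σ aP) z′ λ e → ℕ.<-irrefl (sym (ℕ.+-cancelˡ-≡ b _ _ e)) x<x′

          new-slope : P′ (suc x) ℤ.- P′ x ≡ slope p v
          new-slope = trans (cong₂ ℤ._-_ (trans (P′-old (suc x) ℕ.≤-refl) eP) P′-x) (cancel z (slope p v))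
            where
            cancel : ∀ z s → z ℤ.- (z ℤ.- s) ≡ s
            cancel = solve-∀

          good′ : ∀ {E′} → E ≤ E′ → w ≤ℤ + E′ → Good E′ x P′
          good′ E≤ w≤ = extend good P′-old E≤ (subst (_≤ℤ + N ℤ.* y x) (sym P′-x) below)
            (subst (λ z → + N ℤ.* y x ℤ.- z ≤ℤ _) (sym P′-x) w≤)
            λ h → ℤ.≤-trans (ℤ.≤-reflexive new-slope) (subst (slope p v ≤ℤ_)
              (sym (cong₂ ℤ._-_ (P′-old (suc (suc x)) (ℕ.n≤1+n _)) (P′-old (suc x) ℕ.≤-refl))) (last h))

          same′ : ∀ i → i < b → update (arrays σ aP) (b + x) z′ i ≡ P₀ i
          same′ i i<b = trans (update-other (arrays σ aP) z′ λ e → ℕ.<-irrefl e (ℕ.<-≤-trans i<b (ℕ.m≤m+n b x))) (same i i<b)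

          grown : + E ℤ.+ 1ℤ ≤ℤ w → Measured ∣ w ∣
          grown h = ℕ.≤-trans (proj₁ measured) (E≤w h) ,
            λ d nc _ → ℤ.drop‿+≤+ (subst (_≤ℤ _) (sym w≡) (close d nc))
            where
            E≤w : + E ℤ.+ 1ℤ ≤ℤ w → E ≤ ∣ w ∣
            E≤w h = ℤ.drop‿+≤+ (subst (+ E ≤ℤ_) (sym w≡) (ℤ.<⇒≤ (+1≤⇒< h)))

          E≤∣w∣ : + E ℤ.+ 1ℤ ≤ℤ w → E ≤ ∣ w ∣
          E≤∣w∣ h = ℤ.drop‿+≤+ (subst (+ E ≤ℤ_) (sym w≡) (ℤ.<⇒≤ (+1≤⇒< h)))

          eb : vars σ vb ≡ + b
          eb = proj₁ here
          eN : vars σ vN ≡ + N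
          eN = proj₁ (proj₂ (proj₂ base))
          eX : arrays σ aX ≡ X
          eX = proj₂ (proj₂ (proj₂ (proj₂ (proj₂ (proj₂ base)))))

          step-ok : Safe (DescentInv x) 70 (descendStep ∷ []) σ
          step-ok = go (slope-value p<v)
            where
            go : (∃ λ d → + v ℤ.- + p ≡ + suc d × slope p v ≡ (+ N ℤ.* (y v ℤ.- y p)) ℤ./ℕ suc d) →
                 Safe (DescentInv x) 70 (descendStep ∷ []) σ
            go (d , width , value) =
              seq (assign (get (sub (var etop) (lit 1ℤ)) (cells t (ℕ.≤-trans t≤T (ℕ.n≤1+n T)))) (small (ℕ.≤-trans p≤x x≤len))
              (seq (assign (get (var etop) (cells (suc t) (s≤s t≤T))) (small v≤len)
              (seq (assign {z = z′} (at (sub (var ez) (quot {d = suc d}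
                      (mul (var eN) (sub (Yat eb eX refl) (Yat eb eX refl)))
                      (at (sub (var refl) (var refl)) width)))
                    (cong (λ s → z ℤ.- s) (sym value)))
                  z′≤B
              (seq (store {i = b + x} {z = z′} (add (var eb) (var et)) (var refl) z′≤B
              (seq (assign {z = w} (sub (mul (var eN) (Yat eb eX et)) (var refl)) (ℕ.≤-trans w≤ 2M≤B)
              (branch (add (var eE) (lit 1ℤ)) (var refl)
                (λ h → assign (at (var refl) (sym w≡)) (ℕ.≤-trans w≤ 2M≤B)
                  (end (t , z′ , ∣ w ∣ , (etop , et , refl , refl) , (cells , t≤T , p≤x , ℕ.<⇒≤ x<v) , near′ , P′-x ,
                        good′ (E≤∣w∣ h) (ℤ.≤-reflexive (sym w≡)) , grown h , (λ _ → ℤ.≤-reflexive (sym new-slope)) , same′)))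
                (λ h → pass
                  (end (t , z′ , E , (etop , et , refl , eE) , (cells , t≤T , p≤x , ℕ.<⇒≤ x<v) , near′ , P′-x ,
                        good′ ℕ.≤-refl (<+1⇒≤ h) , measured , (λ _ → ℤ.≤-reflexive (sym new-slope)) , same′)))))))))))))
    
        descent-step : ∀ {x σ} → DescentInv x σ → Base σ → Here σ →
          ∃₂ λ u v → σ ⊢ lit 1ℤ ⇓ u × σ ⊢ var vt ⇓ v ×
          (u ≤ℤ v → ∃ λ x′ → suc x′ ≤ x × Safe (DescentInv x′) 100 (descendBody ∷ []) σ) ×
          (v ℤ.< u → ∃ λ E → vars σ vE ≡ + E × Good E 0 (λ x → arrays σ aP (b + x)) × Measured E ×
                     (∀ i → i < b → arrays σ aP i ≡ P₀ i))
        descent-step {zero} (t , z , E , (etop , et , ez , eE) , _ , _ , _ , good , measured , _ , same) base here =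
          _ , _ , lit 1ℤ , var et , (λ { (ℤ.+≤+ ()) }) , λ _ → E , eE , good , measured , same
        descent-step {suc x} {σ} (t , z , E , (etop , et , ez , eE) , (cells , t≤T , p≤x , x≤v) , nr , eP , good , measured , last , same) base here =
          _ , _ , lit 1ℤ , var et , (λ _ → x , ℕ.≤-refl , body) , λ { (ℤ.+<+ (s≤s ())) }
          where
          x<N : suc x < N
          x<N = ℕ.≤-<-trans (ℕ.≤-trans x≤v (S≤len t≤T)) len<N
          small : ∀ {x} → x < N → x ≤ B
          small h = ℕ.≤-trans (ℕ.<⇒≤ h) (ℕ.≤-trans (ℕ.≤-trans (ℕ.n≤1+n _) (ℕ.n≤1+n _)) N≤B)
          body : Safe (DescentInv x) 100 (descendBody ∷ []) σ
          body = weaken-safe (auto 89 100)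
            (seq (assign {z = + x} (sub (var et) (lit 1ℤ)) (small (ℕ.<-trans ℕ.≤-refl x<N))
            (seq (branch (add (var refl) (lit 1ℤ))
                         (get (sub (var etop) (lit 1ℤ)) (cells t (ℕ.≤-trans t≤T (ℕ.n≤1+n T))))
              (λ h → vertex t refl (ℕ.≤-antisym p≤x (ℕ.≤-trans (ℕ.≤-reflexive (ℕ.+-comm 1 x)) (ℤ.drop‿+≤+ h))))
              (λ h → weaken-safe (auto 71 74) (pass (Step.step-ok base here etop refl ez eE cells t≤T
                 (ℕ.≤-pred (ℕ.≤-trans (ℤ.drop‿+<+ h) (ℕ.≤-reflexive (ℕ.+-comm x 1)))) x≤v nr eP good measured last same)))))))
            where
            vertex : ∀ t₁ → t ≡ t₁ → S t ≡ suc x →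
              Safe (DescentInv x) 74 (vtop ≔ var vtop ⊖ lit 1ℤ ∷ descendStep ∷ []) ⟨ update (vars σ) vt (+ x) , arrays σ ⟩
            -- Position 0 of the stack holds index 0, so the bottom is not left while the position
            -- is positive.
            vertex zero refl e = contradiction (trans (sym bottom₀) e) λ ()
            vertex (suc t₁) refl e = assign {z = + t} (sub (var etop) (lit 1ℤ)) (small (ℕ.≤-<-trans (ℕ.≤-trans t≤T T≤len) len<N))
              (Step.step-ok base here refl refl ez eE cells t₁≤T (ℕ.≤-pred (ℕ.≤-trans o<p (ℕ.≤-reflexive e))) (ℕ.≤-reflexive (sym e))
                (subst (λ x → Near len (S t₁) (S t) x z) e (near-vertex p<v (ℕ.<⇒≤ o<p) (subst (λ x → Near len (S t) (S (suc t)) x z) (sym e) nr)))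
                eP good measured
                (λ h → ℤ.≤-trans (slope-mono o<p p<v (convex t₁ (positive {t₁} (subst (1 ≤_) (sym e) (s≤s z≤n))) (s≤s t≤T))) (last h)) same)
              where
              t₁≤T : t₁ ≤ T
              t₁≤T = ℕ.≤-trans (ℕ.n≤1+n t₁) t≤T
              1≤t₁ : 1 ≤ t₁
              1≤t₁ = positive {t₁} (subst (1 ≤_) (sym e) (s≤s z≤n))
              o<p : S t₁ < S t
              o<p = mono t₁ 1≤t₁ (s≤s t₁≤T)
              p<v : S t < S (suc t)
              p<v = mono t (s≤s z≤n) (s≤s t≤T)

      SegmentPost : ℕ → (ℕ → ℤ) → State → Set
      SegmentPost E₀ P₀ σ = ∃ λ E → vars σ vE ≡ + E × Good E 0 (λ x → arrays σ aP (b + x)) ×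
        (E₀ ≤ E × (∀ d → NC d → E₀ ≤ N * suc d → E ≤ N * suc d)) ×
        (∀ i → i < b → arrays σ aP i ≡ P₀ i)

      descend-ok : ∀ {σ E₀} → Base σ → Here σ → Hull σ → vars σ vE ≡ + E₀ → N ≤ E₀ → E₀ ≤ N * suc (2 * M) →
        Safe (SegmentPost E₀ (arrays σ aP)) (suc (suc len) * 110) (descend ∷ []) σ
      descend-ok {σ} {E₀} base here (S , T , etop , cells , hull , top , T≤) eE N≤E₀ E₀≤ =
        weaken-safe (overhead {40} {104} (suc len) (auto 40 110) (auto 104 110))
        (seq (assign {z = z} (sub (mul (var eN) (Yat eb eX el)) (var eN)) z≤B
        (seq (store {i = b + len} {z = z} (add (var eb) (var el)) (var refl) z≤B
        (seq (assign {z = + len} (var el) (ℕ.≤-trans (ℕ.<⇒≤ len<N) (ℕ.≤-trans (ℕ.≤-trans (ℕ.n≤1+n _) (ℕ.n≤1+n _)) N≤B))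
        (weaken-safe (ℕ.m≤n+m (suc len * 104) 21)
        (count 100 DescentInv len (λ { {σ = σ′} inv fr bd → descent-step inv (base′ fr) (here′ fr) })
          (T , z , E₀ , (etop , refl , refl , eE) , (cells , ℕ.≤-refl , S≤ , ℕ.≤-reflexive (sym top)) , nr , P′-len ,
           (close , λ w l h → contradiction h (ℕ.≤⇒≯ (ℕ.≤-trans l (ℕ.n≤1+n w)))) , (ℕ.≤-refl , λ _ _ h → h) ,
           (λ h → contradiction h (ℕ.<-irrefl refl)) , same)))))))))
        where
        open Descent S T hull top (ℕ.≤-pred T≤) E₀ N≤E₀ E₀≤ (arrays σ aP)
        eb = proj₁ here
        el = proj₂ here
        eN = proj₁ (proj₂ (proj₂ base))
        eX = proj₂ (proj₂ (proj₂ (proj₂ (proj₂ (proj₂ base)))))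
        z = + N ℤ.* y len ℤ.- + N
        below : z ≤ℤ + N ℤ.* y len
        below = lemma (+ N ℤ.* y len) (+ N) 0≤+
          where
          lemma : ∀ a n → 0ℤ ≤ℤ n → a ℤ.- n ≤ℤ a
          lemma a n h = by h (solve (a ∷ n ∷ []))
        N≡ : + N ℤ.* y len ℤ.- z ≡ + N
        N≡ = lemma (+ N ℤ.* y len) (+ N)
          where
          lemma : ∀ a n → a ℤ.- (a ℤ.- n) ≡ n
          lemma = solve-∀
        z≤B : ∣ z ∣ ≤ B
        z≤B = ℕ.≤-trans (value-bound ℕ.≤-refl below (ℤ.≤-trans (ℤ.≤-reflexive N≡) (ℤ.+≤+ (ℕ.≤-trans N≤E₀ E₀≤)))) NM≤B
        S≤ : S T ≤ len
        S≤ = lemma T refl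
          where
          lemma : ∀ T₁ → T ≡ T₁ → S T ≤ len
          lemma zero refl = subst (_≤ len) (sym (Stack.bottom₀ hull)) z≤n
          lemma (suc T₁) refl = ℕ.≤-trans (stack-mono hull (s≤s z≤n) (ℕ.n≤1+n _) ℕ.≤-refl) (ℕ.≤-reflexive top)
        P′ : ℕ → ℤ
        P′ = λ x → update (arrays σ aP) (b + len) z (b + x)
        P′-len : P′ len ≡ z
        P′-len = update-same (arrays σ aP) (b + len) z
        nr : Near len (S T) (S (suc T)) len z
        nr = subst (λ v → Near len (S T) v len z) (sym top) (near-start (S T) len)
        close : ∀ x → len ≤ x → x ≤ len → P′ x ≤ℤ + N ℤ.* y x × + N ℤ.* y x ℤ.- P′ x ≤ℤ + E₀
        close x l h = lemma (ℕ.≤-antisym l h)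
          where
          lemma : len ≡ x → P′ x ≤ℤ + N ℤ.* y x × + N ℤ.* y x ℤ.- P′ x ≤ℤ + E₀
          lemma refl = ℤ.≤-trans (ℤ.≤-reflexive P′-len) below ,
            ℤ.≤-trans (ℤ.≤-reflexive (trans (cong (λ p → + N ℤ.* y len ℤ.- p) P′-len) N≡)) (ℤ.+≤+ N≤E₀)
        same : ∀ i → i < b → update (arrays σ aP) (b + len) z i ≡ arrays σ aP i
        same i i<b = update-other (arrays σ aP) z λ e → ℕ.<-irrefl e (ℕ.<-≤-trans i<b (ℕ.m≤m+n b len))
        base′ : ∀ {σ′} → Frame (descendBody ∷ []) _ σ′ → Base σ′
        base′ fr = base-frame fr (refl , refl , refl , refl , refl , refl , refl) base
        here′ : ∀ {σ′} → Frame (descendBody ∷ []) _ σ′ → Here σ′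
        here′ fr = trans (var≡ fr vb refl) eb , trans (var≡ fr vl refl) el

      abstract

        segment-cost : ℕ
        segment-cost = 1 + (scan-cost + suc (suc len) * 110)

        segment-cost≤ : segment-cost ≤ N * 361
        segment-cost≤ = begin
          1 + (suc (suc (len + len)) * 70 + suc (suc len) * 110)
            ≤⟨ ℕ.+-mono-≤ (ℕ.≤-trans (s≤s z≤n) N⁺) (ℕ.+-mono-≤ (ℕ.*-monoˡ-≤ 70 double) (ℕ.*-monoˡ-≤ 110 (ℕ.≤-trans (s≤s len<N) (ℕ.+-monoˡ-≤ N (ℕ.≤-trans (s≤s z≤n) N⁺))))) ⟩
          N + ((N + N) * 70 + (N + N) * 110)
            ≡⟨ arith N ⟩
          N * 361 ∎
          where
          open ℕ.≤-Reasoning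
          N⁺ : 1 ≤ N
          N⁺ = ℕ.≤-trans (s≤s z≤n) 2≤N
          double : suc (suc (len + len)) ≤ N + N
          double = ℕ.≤-trans (ℕ.≤-reflexive (cong suc (sym (ℕ.+-suc len len)))) (ℕ.+-mono-≤ len<N len<N)
          arith : ∀ N → N + ((N + N) * 70 + (N + N) * 110) ≡ N * 361
          arith = ℕ-solve-∀

        segment-ok : ∀ {σ E₀} → Base σ → Here σ → vars σ vE ≡ + E₀ → N ≤ E₀ → E₀ ≤ N * suc (2 * M) →
          Safe (SegmentPost E₀ (arrays σ aP)) segment-cost (segment ∷ []) σ
        segment-ok {σ} {E₀} base here eE N≤E₀ E₀≤ = seq (run (scan-ok base here) λ {σ′} hull fr _ →
          subst (λ P₀ → Safe (SegmentPost E₀ P₀) (suc (suc len) * 110) (descend ∷ []) σ′) (arr≡ fr aP refl)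
            (descend-ok (base-frame fr (refl , refl , refl , refl , refl , refl , refl) base)
              (trans (var≡ fr vb refl) (proj₁ here) , trans (var≡ fr vl refl) (proj₂ here)) hull
              (trans (var≡ fr vE refl) eE) N≤E₀ E₀≤))

    f g : ℕ → ℤ
    f i = X i
    g j = X (suc n + j)

    f-fits : n < N
    f-fits = ℕ.≤-trans (s≤s (ℕ.m≤m+n n m)) (ℕ.m<m+n (n + m) (s≤s z≤n))

    g-fits : suc n + m < N
    g-fits = ℕ.≤-reflexive (trans (cong suc (ℕ.+-comm 1 (n + m))) (sym (ℕ.+-suc (n + m) 1)))

    -- Convex integral minorants of N f and N g with a common error. `E-small` is the only link
    -- between this error and the quality of the input.
    record Approximation (p q : ℕ → ℤ) (E : ℕ) : Set where
      field
        p-convex : ConvexUpTo p n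
        q-convex : ConvexUpTo q m
        p-close  : ∀ i → i ≤ n → p i ≤ℤ + N ℤ.* f i × + N ℤ.* f i ℤ.- p i ≤ℤ + E
        q-close  : ∀ j → j ≤ m → q j ≤ℤ + N ℤ.* g j × + N ℤ.* g j ℤ.- q j ≤ℤ + E
        E-small  : ∀ d → Scan.NearConvex f n d → Scan.NearConvex g m d → E ≤ N * suc d

      E≤ : E ≤ N * suc (2 * M)
      E≤ = E-small (2 * M) (near-2M 0 n f-fits) (near-2M (suc n) m g-fits)

      p≤R : ∀ {i} → i ≤ n → ∣ p i ∣ ≤ R
      p≤R {i} h = value-bound 0 n f-fits {i} h (proj₁ (p-close i h)) (ℤ.≤-trans (proj₂ (p-close i h)) (ℤ.+≤+ E≤))

      q≤R : ∀ {j} → j ≤ m → ∣ q j ∣ ≤ R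
      q≤R {j} h = value-bound (suc n) m g-fits {j} h (proj₁ (q-close j h)) (ℤ.≤-trans (proj₂ (q-close j h)) (ℤ.+≤+ E≤))

    ConvexifyPost : State → Set
    ConvexifyPost σ = ∃ λ E → vars σ vE ≡ + E ×
      Approximation (arrays σ aP) (λ j → arrays σ aP (suc n + j)) E

    convexify-cost : ℕ
    convexify-cost = 7 + (segment-cost 0 n f-fits + (6 + (segment-cost (suc n) m g-fits + 0)))

    convexify-ok : ∀ {σ} → Base σ → vars σ vE ≡ + N →
      Safe ConvexifyPost convexify-cost (convexify ∷ []) σ
    convexify-ok {⟨ vs , as ⟩} base@(e₀ , e₁ , eN , eo , eM , eK , eX) eE =
      (seq (assign {z = 0ℤ} (lit 0ℤ) z≤n
      (seq (assign {z = + n} (var e₀) n≤B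
      (seq (run (segment-ok 0 n f-fits base (refl , refl) eE ℕ.≤-refl (ℕ.m≤m*n N (suc (2 * M)))) second))))))
      where
      n≤B : n ≤ B
      n≤B = ℕ.≤-trans (ℕ.<⇒≤ f-fits) (ℕ.≤-trans (ℕ.m≤n+m N 2) N≤B)
      n+1≤B : suc n ≤ B
      n+1≤B = ℕ.≤-trans f-fits (ℕ.≤-trans (ℕ.m≤n+m N 2) N≤B)
      m≤B : m ≤ B
      m≤B = ℕ.≤-trans (ℕ.≤-trans (ℕ.m≤n+m m (suc n)) (ℕ.<⇒≤ g-fits)) (ℕ.≤-trans (ℕ.m≤n+m N 2) N≤B)
      second : ∀ {σ′} → SegmentPost 0 n f-fits N (as aP) σ′ → Frame (segment ∷ []) _ σ′ → Bounded σ′ →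
        Safe ConvexifyPost (6 + (segment-cost (suc n) m g-fits + 0)) (vb ≔ var vo ⨾ vl ≔ var vm ⨾ segment ∷ []) σ′
      second {⟨ vs′ , as′ ⟩} (E , eE′ , (close , cvx) , (N≤E , small) , _) fr _ =
        (seq (assign {z = + suc n} (var (proj₁ (proj₂ (proj₂ (proj₂ base′))))) n+1≤B
        (seq (assign {z = + m} (var (proj₁ (proj₂ base′))) m≤B
        (run {κ = []} (segment-ok (suc n) m g-fits base′ (refl , refl) eE′ N≤E
                (small (2 * M) (near-2M 0 n f-fits) (ℕ.m≤m*n N (suc (2 * M))))) λ {σ″} post fr′ _ → end (finish σ″ post))))))
        where
        base′ : Base ⟨ vs′ , as′ ⟩
        base′ = base-frame fr (refl , refl , refl , refl , refl , refl , refl) base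
        finish : ∀ σ″ → SegmentPost (suc n) m g-fits E (as′ aP) σ″ → ConvexifyPost σ″
        finish σ″ (E′ , e , (close′ , cvx′) , (E≤E′ , small′) , same) = E′ , e , record
          { p-convex = λ x h → subst₂ (λ a b → a ≤ℤ b)
              (sym (cong₂ ℤ._-_ (same (suc x) (ℕ.m≤n⇒m≤1+n h)) (same x (ℕ.m≤n⇒m≤1+n (ℕ.<-trans ℕ.≤-refl h)))))
              (sym (cong₂ ℤ._-_ (same (suc (suc x)) (s≤s h)) (same (suc x) (ℕ.m≤n⇒m≤1+n h)))) (cvx x z≤n h)
          ; q-convex = λ x h → cvx′ x z≤n h
          ; p-close = λ i h → subst (λ z → z ≤ℤ + N ℤ.* f i × + N ℤ.* f i ℤ.- z ≤ℤ + E′) (sym (same i (s≤s h)))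
              (proj₁ (close i z≤n h) , ℤ.≤-trans (proj₂ (close i z≤n h)) (ℤ.+≤+ E≤E′))
          ; q-close = λ j h → close′ j z≤n h
          ; E-small = λ d nf ng → small′ d ng (small d nf (ℕ.m≤m*n N (suc d))) }

    -- Merging, and the staircases that bound the relevant region.

    module Relevant (p q : ℕ → ℤ) (E : ℕ) (approx : Approximation p q E) where

      open Approximation approx
      open Merge {n} {m} p q p-convex q-convex public

      Convexified : State → Set
      Convexified σ = (∀ i → arrays σ aP i ≡ p i) × (∀ j → arrays σ aP (suc n + j) ≡ q j)

      Merged : ℕ → State → Set
      Merged k σ = ∀ k′ → k′ < k → arrays σ aα k′ ≡ + α k′ × arrays σ aH k′ ≡ H k′ ×
                                    arrays σ aOut k′ ≡ f (α k′) ℤ.+ g (β k′)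

      MergeInv : ℕ → State → Set
      MergeInv μ σ = ∃ λ k → vars σ vt ≡ + k × vars σ va ≡ + α k × vars σ vβ ≡ + β k ×
                     Merged k σ × k + μ ≡ suc (n + m)

      n≤B : suc n ≤ B
      n≤B = ℕ.≤-trans f-fits (ℕ.≤-trans (ℕ.m≤n+m N 2) N≤B)

      m≤B : suc m ≤ B
      m≤B = ℕ.≤-trans (s≤s (ℕ.m≤n+m m n)) (ℕ.≤-trans (ℕ.≤-trans (ℕ.≤-reflexive (ℕ.+-comm 1 (n + m))) (ℕ.+-monoʳ-≤ (n + m) (s≤s z≤n))) (ℕ.≤-trans (ℕ.m≤n+m N 2) N≤B))

      twice : ∀ a b → ∣ a ∣ ≤ R → ∣ b ∣ ≤ R → ∣ a ℤ.+ b ∣ ≤ 2 * R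
      twice a b h k = ℕ.≤-trans (ℤ.∣i+j∣≤∣i∣+∣j∣ a b) (ℕ.+-mono-≤ h (ℕ.≤-trans k (ℕ.m≤m+n R 0)))

      M≤R : M ≤ R
      M≤R = ℕ.≤-trans (ℕ.≤-trans (ℕ.m≤m+n M _) (ℕ.n≤1+n _)) (ℕ.m≤n*m (suc (3 * M)) N {{ℕ.>-nonZero (ℕ.≤-trans (s≤s z≤n) 2≤N)}})

      f≤M : ∀ {i} → i ≤ n → ∣ f i ∣ ≤ M
      f≤M {i} _ = X≤M i

      g≤M : ∀ {j} → j ≤ m → ∣ g j ∣ ≤ M
      g≤M {j} _ = X≤M (suc n + j)

      merge-step : ∀ {μ σ} → MergeInv μ σ → Base σ → Convexified σ →
        ∃₂ λ u v → σ ⊢ var vt ⇓ u × σ ⊢ var vn ⊕ var vm ⇓ v ×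
        (u ≤ℤ v → ∃ λ μ′ → suc μ′ ≤ μ × Safe (MergeInv μ′) 100 (mergeBody ∷ []) σ) ×
        (v ℤ.< u → Merged (suc (n + m)) σ)
      merge-step {zero} {σ} (k , et , ea , eβ , merged , e) (e₀ , e₁ , _) _ = _ , _ , var et , add (var e₀) (var e₁) ,
        (λ h → contradiction (ℤ.drop‿+≤+ h) (ℕ.<⇒≱ (ℕ.≤-reflexive (sym k≡)))) ,
        λ _ → subst (λ k → Merged k σ) k≡ merged
        where
        k≡ : k ≡ suc (n + m)
        k≡ = trans (sym (ℕ.+-identityʳ k)) e
      merge-step {suc μ} {⟨ vs , as ⟩} (k , et , ea , eβ , merged , e) (e₀ , e₁ , eN , eo , eM , eK , eX) (ep , eq) =
        _ , _ , var et , add (var e₀) (var e₁) , (λ _ → μ , ℕ.≤-refl , body) ,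
        λ h → contradiction (ℤ.drop‿+<+ h) (ℕ.≤⇒≯ k≤)
        where
        k≤ : k ≤ n + m
        k≤ = ℕ.≤-pred (ℕ.≤-trans (ℕ.m≤m+n (suc k) μ) (ℕ.≤-reflexive (trans (sym (ℕ.+-suc k μ)) e)))
        open Separating (separating k≤) renaming (a≤n to α≤n; b≤m to β≤m)
        as₃ : ℕ → ℕ → ℤ
        as₃ = update (update (update as aα (update (as aα) k (+ α k))) aH (update (as aH) k (H k)))
                     aOut (update (as aOut) k (f (α k) ℤ.+ g (β k)))
        merged′ : ∀ k′ → k′ < suc k → as₃ aα k′ ≡ + α k′ × as₃ aH k′ ≡ H k′ × as₃ aOut k′ ≡ f (α k′) ℤ.+ g (β k′)
        merged′ k′ (s≤s h) = go (ℕ.m≤n⇒m<n∨m≡n h)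
          where
          go : k′ < k ⊎ k′ ≡ k → as₃ aα k′ ≡ + α k′ × as₃ aH k′ ≡ H k′ × as₃ aOut k′ ≡ f (α k′) ℤ.+ g (β k′)
          go (inj₂ refl) = update-same (as aα) k _ , update-same (as aH) k _ , update-same (as aOut) k _
          go (inj₁ lt) = trans (update-other (as aα) _ (ℕ.<⇒≢ lt)) (proj₁ (merged k′ lt)) ,
                         trans (update-other (as aH) _ (ℕ.<⇒≢ lt)) (proj₁ (proj₂ (merged k′ lt))) ,
                         trans (update-other (as aOut) _ (ℕ.<⇒≢ lt)) (proj₂ (proj₂ (merged k′ lt)))
        k≤B : suc k ≤ B
        k≤B = ℕ.≤-trans (ℕ.≤-trans (s≤s k≤) (ℕ.≤-trans (ℕ.≤-reflexive (ℕ.+-comm 1 (n + m))) (ℕ.+-monoʳ-≤ (n + m) (s≤s z≤n)))) (ℕ.≤-trans (ℕ.m≤n+m N 2) N≤B)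
        2R≤B : 2 * R ≤ B
        2R≤B = R≤ 2 (auto 2 16)
        e′ : suc k + μ ≡ suc (n + m)
        e′ = trans (sym (ℕ.+-suc k μ)) e
        tail : ∀ {vs₁} → vs₁ vt ≡ + k → vs₁ va ≡ + α (suc k) → vs₁ vβ ≡ + β (suc k) →
               Safe (MergeInv μ) 4 (incr vt ∷ []) ⟨ vs₁ , as₃ ⟩
        tail et₁ ea₁ eβ₁ = assign {z = + suc k} (at (add (var et₁) (lit 1ℤ)) (cong +_ (ℕ.+-comm k 1))) k≤B
          (end (suc k , refl , ea₁ , eβ₁ , merged′ , e′))
        up′ : ∀ {vs₁} → vs₁ vt ≡ + k → vs₁ va ≡ + α k → vs₁ vβ ≡ + β k → ¬ Right (α k) (β k) →
              Safe (MergeInv μ) 8 (incr vβ ∷ incr vt ∷ []) ⟨ vs₁ , as₃ ⟩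
        up′ et₁ ea₁ eβ₁ ¬r = assign {z = + suc (β k)} (at (add (var eβ₁) (lit 1ℤ)) (cong +_ (ℕ.+-comm (β k) 1))) (ℕ.≤-trans (s≤s β≤m) m≤B)
          (tail et₁ (trans ea₁ (cong (λ ab → + proj₁ ab) (sym (advance-up ¬r)))) (cong (λ ab → + proj₂ ab) (sym (advance-up ¬r))))
        right′ : ∀ {vs₁} → vs₁ vt ≡ + k → vs₁ va ≡ + α k → vs₁ vβ ≡ + β k → Right (α k) (β k) →
              Safe (MergeInv μ) 8 (incr va ∷ incr vt ∷ []) ⟨ vs₁ , as₃ ⟩
        right′ et₁ ea₁ eβ₁ r = assign {z = + suc (α k)} (at (add (var ea₁) (lit 1ℤ)) (cong +_ (ℕ.+-comm (α k) 1))) (ℕ.≤-trans (s≤s α≤n) n≤B)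
          (tail et₁ (cong (λ ab → + proj₁ ab) (sym (advance-right r))) (trans eβ₁ (cong (λ ab → + proj₂ ab) (sym (advance-right r)))))
        body : Safe (MergeInv μ) 100 (mergeBody ∷ []) ⟨ vs , as ⟩
        body = weaken-safe {b = 61} (auto 61 100)
          (seq (store {i = k} {z = + α k} (var et) (var ea) (ℕ.≤-trans α≤n (ℕ.≤-trans (ℕ.n≤1+n n) n≤B))
          (seq (store {i = k} {z = H k} (var et) (add (get (var ea) (ep (α k))) (get (add (var eo) (var eβ)) (eq (β k))))
                  (ℕ.≤-trans (twice (p (α k)) (q (β k)) (p≤R α≤n) (q≤R β≤m)) 2R≤B)
          (seq (store {i = k} {z = f (α k) ℤ.+ g (β k)} (var et)
                  (add (get (var ea) (cong-app eX (α k))) (get (add (var eo) (var eβ)) (cong-app eX (suc n + β k))))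
                  (ℕ.≤-trans (twice (f (α k)) (g (β k)) (ℕ.≤-trans (f≤M α≤n) M≤R) (ℕ.≤-trans (g≤M β≤m) M≤R)) 2R≤B)
          (seq (branch (var e₀) (var ea)
            (λ n≤α → weaken-safe {b = 8} (auto 8 32) (up′ et ea eβ λ r → ℕ.<⇒≱ (proj₁ r) (ℤ.drop‿+≤+ n≤α)))
            (λ α<n → branch (var e₁) (var eβ)
              (λ m≤β → weaken-safe {b = 8} (auto 8 28) (right′ et ea eβ (ℤ.drop‿+<+ α<n , inj₁ (ℤ.drop‿+≤+ m≤β))))
              (λ β<m → branch
                (sub (get (add (var ea) (lit 1ℤ)) (trans (cong (as aP) (ℕ.+-comm (α k) 1)) (ep (suc (α k))))) (get (var ea) (ep (α k))))
                (sub (get (add (var eo) (add (var eβ) (lit 1ℤ))) (trans (cong (λ j → as aP (suc n + j)) (ℕ.+-comm (β k) 1)) (eq (suc (β k)))))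
                     (get (add (var eo) (var eβ)) (eq (β k))))
                (λ u≤v → right′ et ea eβ (ℤ.drop‿+<+ α<n , inj₂ u≤v))
                (λ v<u → up′ et ea eβ λ r → [ ℕ.<⇒≱ (ℤ.drop‿+<+ β<m) , ℤ.<⇒≱ v<u ]′ (proj₂ r))))))))))))


      merge-ok : ∀ {σ} → Base σ → Convexified σ →
        Safe (Merged (suc (n + m))) (9 + suc (suc (n + m)) * 106) (merge ∷ []) σ
      merge-ok {σ} base (ep , eq) =
        (seq (assign {z = 0ℤ} (lit 0ℤ) z≤n
        (seq (assign {z = 0ℤ} (lit 0ℤ) z≤n
        (seq (assign {z = 0ℤ} (lit 0ℤ) z≤n
        (count 100 MergeInv (suc (n + m)) (λ { inv fr bd → merge-step inv (base-frame fr (refl , refl , refl , refl , refl , refl , refl) base)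
            ((λ i → trans (cong-app (arr≡ fr aP refl) i) (ep i)) , λ j → trans (cong-app (arr≡ fr aP refl) (suc n + j)) (eq j)) })
          (0 , refl , refl , refl , (λ _ ()) , refl))))))))

      -- The staircase array at d holds C i - (m + 1), so that untouched cells
      -- stand for C i = m + 1.
      Staircase : ℕ → (ℕ → ℕ) → State → Set
      Staircase d C σ = ∀ i → arrays σ d i ≡ + C i ℤ.- + suc m

      -- The value m + 1 in all later rows, past row n too, lets dyadic blocks overhang the array:
      -- such a block has no full columns.
      Crossings : ℤ → (ℕ → ℕ) → ℕ → Set
      Crossings θ C i = (∀ i′ → i′ < i → Crossing θ i′ (C i′)) × (∀ i′ → i ≤ i′ → C i′ ≡ suc m)

      module Stair (δ : ℕ) (θ : ℤ) (θ≤B : ∣ θ ∣ ≤ B) where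

        private
          d : ℕ
          -- The staircases are arrays 8 and 9; in this form the frame checks against smaller
          -- numbers compute although δ is a variable.
          d = 8 + δ

        -- A walk along the boundary of the level set: each round advances i or j, so n + m + 2
        -- rounds suffice and j never returns to 0.
        StairInv : ℕ → State → Set
        StairInv μ σ = ∃ λ i → ∃ λ j → ∃ λ C → vars σ vt ≡ + i × vars σ vj ≡ + j ×
          Staircase d C σ × Crossings θ C i × j ≤ suc m × i ≤ suc n ×
          (i ≤ n → ∀ j′ → j′ < j → θ ℤ.< signed i j′) × i + j + μ ≡ suc n + suc m

        stair-step : ∀ {μ σ} → StairInv μ σ → Base σ → Convexified σ → Merged (suc (n + m)) σ → vars σ vθ ≡ θ →
          ∃₂ λ u v → σ ⊢ var vt ⇓ u × σ ⊢ var vn ⇓ v ×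
          (u ≤ℤ v → ∃ λ μ′ → suc μ′ ≤ μ × Safe (StairInv μ′) 100 (stairBody d ∷ []) σ) ×
          (v ℤ.< u → ∃ λ C → Staircase d C σ × Crossings θ C (suc n))
        stair-step {μ} {⟨ vs , as ⟩} (i , j , C , et , ej , cells , (crossed , rest) , j≤ , i≤ , before , eμ)
                   (e₀ , e₁ , eN , eo , eM , eK , eX) (ep , eq) merged eθ =
          _ , _ , var et , var e₀ , (λ i≤n → go μ refl (ℤ.drop‿+≤+ i≤n)) ,
          λ n<i → C , cells , subst (Crossings θ C) (ℕ.≤-antisym i≤ (ℤ.drop‿+<+ n<i)) (crossed , rest)
          where
          go : ∀ μ₀ → μ ≡ μ₀ → i ≤ n → ∃ λ μ′ → suc μ′ ≤ μ × Safe (StairInv μ′) 100 (stairBody d ∷ []) ⟨ vs , as ⟩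
          go zero refl i≤n = contradiction (trans (sym (ℕ.+-identityʳ (i + j))) eμ) (ℕ.<⇒≢ (ℕ.+-mono-<-≤ (s≤s i≤n) j≤))
          go (suc μ₁) refl i≤n = μ₁ , ℕ.≤-refl , body
            where
            eμ₁ : suc (i + j) + μ₁ ≡ suc n + suc m
            eμ₁ = trans (sym (ℕ.+-suc (i + j) μ₁)) eμ
            iB : suc i ≤ B
            iB = ℕ.≤-trans (s≤s i≤n) n≤B
            C′ : ℕ → ℕ
            C′ = update C i j
            s : ℤ
            s = + j ℤ.- (+ m ℤ.+ 1ℤ)
            m+1 : + m ℤ.+ 1ℤ ≡ + suc m
            m+1 = cong +_ (ℕ.+-comm m 1)
            s≤B : ∣ s ∣ ≤ B
            s≤B = ℕ.≤-trans (abs≤ {s} {suc m}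
                    (subst (λ e → ℤ.- (+ suc m) ≤ℤ + j ℤ.- e) (sym m+1) (low (+ j) (+ suc m) 0≤+))
                    (subst (λ e → + j ℤ.- e ≤ℤ + suc m) (sym m+1) (high (+ j) (+ suc m) (ℤ.+≤+ j≤) 0≤+))) m≤B
              where
              low : ∀ j m → 0ℤ ≤ℤ j → ℤ.- m ≤ℤ j ℤ.- m
              low j m h = by h (solve (j ∷ m ∷ []))
              high : ∀ j m → j ≤ℤ m → 0ℤ ≤ℤ m → j ℤ.- m ≤ℤ m
              high j m h k = by (h ⊹ k) (solve (j ∷ m ∷ []))
            cells′ : ∀ i′ → update (as d) i s i′ ≡ + C′ i′ ℤ.- + suc m
            cells′ i′ = split (i′ ℕ.≟ i)
              where
              split : Dec (i′ ≡ i) → update (as d) i s i′ ≡ + C′ i′ ℤ.- + suc m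
              split (yes refl) = trans (update-same (as d) i s) (cong₂ (λ a b → + a ℤ.- b) (sym (update-same C i j)) m+1)
              split (no ne) = trans (update-other (as d) s ne) (trans (cells i′) (cong (λ a → + a ℤ.- + suc m) (sym (update-other C j ne))))
            crossed′ : (j ≤ m → signed i j ≤ℤ θ) → ∀ i′ → i′ < suc i → Crossing θ i′ (C′ i′)
            crossed′ h i′ (s≤s i′≤i) = split (ℕ.m≤n⇒m<n∨m≡n i′≤i)
              where
              split : i′ < i ⊎ i′ ≡ i → Crossing θ i′ (C′ i′)
              split (inj₁ lt) = subst (Crossing θ i′) (sym (update-other C j (ℕ.<⇒≢ lt))) (crossed i′ lt)
              split (inj₂ refl) = subst (Crossing θ i) (sym (update-same C i j)) (crossing j≤ (before i≤n)
                λ j′ l l′ → ℤ.≤-trans (signed-up* i≤n l l′) (h (ℕ.≤-trans l l′)))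
            rest′ : ∀ i′ → suc i ≤ i′ → C′ i′ ≡ suc m
            rest′ i′ h = trans (update-other C j (λ e → ℕ.<-irrefl (sym e) h)) (rest i′ (ℕ.<⇒≤ h))
            decide : ∀ {vs₁ x} → vs₁ vt ≡ + i → vs₁ vj ≡ + j → vs₁ vm ≡ + m → vs₁ vx ≡ x → vs₁ vθ ≡ θ →
              (x ≤ℤ θ → j ≤ m → signed i j ≤ℤ θ) → (θ ℤ.< x → j ≤ m × θ ℤ.< signed i j) →
              Safe (StairInv μ₁) 20 (ite (var vx ≼ var vθ) (put d (var vt) (var vj ⊖ (var vm ⊕ lit 1ℤ)) ⨾ incr vt) (incr vj) ∷ [])
                ⟨ vs₁ , as ⟩
            decide et₁ ej₁ em₁ ex₁ eθ₁ k k′ = branch {b = 16} (var ex₁) (var eθ₁)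
              (λ h → weaken-safe {b = 12} (auto 12 16) (seq (store {i = i} {z = s} (var et₁) (sub (var ej₁) (add (var em₁) (lit 1ℤ))) s≤B
                (assign {z = + suc i} (at (add (var et₁) (lit 1ℤ)) (cong +_ (ℕ.+-comm i 1))) iB
                (end (suc i , j , C′ , refl , ej₁ , (λ i′ → trans (cong-app (update-same as d _) i′) (cells′ i′)) ,
                   (crossed′ (k h) , rest′) , j≤ , s≤s i≤n ,
                   -- Columns passed in row i stay above the threshold in the next row because
                   -- `signed` grows with i.
                   (λ i<n j′ j′<j → ℤ.<-≤-trans (before i≤n j′ j′<j) (signed-right i<n (ℕ.≤-pred (ℕ.≤-trans j′<j j≤)))) , eμ₁))))))
              (λ h → weaken-safe {b = 4} (auto 4 16) (assign {z = + suc j} (at (add (var ej₁) (lit 1ℤ)) (cong +_ (ℕ.+-comm j 1))) (ℕ.≤-trans (s≤s (proj₁ (k′ h))) m≤B)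
                (end (i , suc j , C , et₁ , refl , cells , (crossed , rest) , s≤s (proj₁ (k′ h)) , i≤ ,
                  (λ _ j′ j′<j → [ (λ lt → before i≤n j′ lt) , (λ { refl → proj₂ (k′ h) }) ]′ (ℕ.m≤n⇒m<n∨m≡n (ℕ.≤-pred j′<j))) ,
                  trans (cong (λ z → z + μ₁) (ℕ.+-suc i j)) eμ₁))))
            body : Safe (StairInv μ₁) 100 (stairBody d ∷ []) ⟨ vs , as ⟩
            body = weaken-safe {b = 52} (auto 52 100) (seq (branch (var ej) (var e₁)
              (λ j≤m → compute (ℤ.drop‿+≤+ j≤m))
              (λ m<j → weaken-safe {b = 22} (auto 22 47) (assign {z = θ} (var eθ) θ≤B
                (decide et ej e₁ refl eθ (λ _ j≤m → contradiction (ℤ.drop‿+<+ m<j) (ℕ.≤⇒≯ j≤m)) (λ lt → contradiction lt (ℤ.<-irrefl refl)))))))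
              where
              compute : j ≤ m → Safe (StairInv μ₁) 47 _ ⟨ vs , as ⟩
              compute j≤m = seq (assign {z = excess i j}
                (sub (add (get (var et) (ep i)) (get (add (var eo) (var ej)) (eq j)))
                     (get (add (var et) (var ej)) (proj₁ (proj₂ (merged (i + j) k<)))))
                small
                (branch (add (var et) (lit 1ℤ)) (get (add (var et) (var ej)) (proj₁ (merged (i + j) k<)))
                  (λ h → let i<α = ℕ.≤-trans (ℕ.≤-reflexive (ℕ.+-comm 1 i)) (ℤ.drop‿+≤+ h) in
                    assign {z = ℤ.- excess i j} (at (sub (lit 0ℤ) (var refl)) (ℤ.+-identityˡ _)) (ℕ.≤-trans (ℕ.≤-reflexive (ℤ.∣-i∣≡∣i∣ (excess i j))) small)
                      (decide et ej e₁ (sym (signed-above {i} {j} i<α)) eθ (λ h _ → h) (λ h → j≤m , h)))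
                  (λ h → let α≤i = ℕ.≤-pred (ℕ.≤-trans (ℤ.drop‿+<+ h) (ℕ.≤-reflexive (ℕ.+-comm i 1))) in
                    weaken-safe {b = 21} (auto 21 24) (pass
                      (decide et ej e₁ (sym (signed-below {i} {j} α≤i)) eθ (λ h _ → h) (λ h → j≤m , h))))))
                where
                k< : i + j < suc (n + m)
                k< = s≤s (ℕ.+-mono-≤ i≤n j≤m)
                small : ∣ excess i j ∣ ≤ B
                small = ℕ.≤-trans (ℤ.∣i-j∣≤∣i∣+∣j∣ (p i ℤ.+ q j) (H (i + j)))
                  (ℕ.≤-trans (ℕ.+-mono-≤ (twice (p i) (q j) (p≤R i≤n) (q≤R j≤m))
                      (twice (p (α (i + j))) (q (β (i + j))) (p≤R (Separating.a≤n (separating (ℕ.≤-pred k<)))) (q≤R (Separating.b≤m (separating (ℕ.≤-pred k<))))))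
                    (ℕ.≤-trans (ℕ.≤-reflexive (sym (ℕ.*-distribʳ-+ R 2 2))) (R≤ 4 (auto 4 16))))

        stair-ok : ∀ {σ} → Base σ → Convexified σ → Merged (suc (n + m)) σ → vars σ vθ ≡ θ →
          (∀ i → arrays σ d i ≡ 0ℤ) →
          Safe (λ σ′ → ∃ λ C → Staircase d C σ′ × Crossings θ C (suc n))
            (6 + suc (suc n + suc m) * 104) (stair d ∷ []) σ
        stair-ok {σ} base (ep , eq) merged eθ blank =
          (seq (assign {z = 0ℤ} (lit 0ℤ) z≤n
          (seq (assign {z = 0ℤ} (lit 0ℤ) z≤n
          (count 100 StairInv (suc n + suc m) (λ { inv fr bd → stair-step inv
              (base-frame fr (refl , refl , refl , refl , refl , refl , refl) base)
              ((λ i → trans (cong-app (arr≡ fr aP refl) i) (ep i)) , λ j → trans (cong-app (arr≡ fr aP refl) (suc n + j)) (eq j))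
              (λ k h → trans (cong-app (arr≡ fr aα refl) k) (proj₁ (merged k h)) ,
                       trans (cong-app (arr≡ fr aH refl) k) (proj₁ (proj₂ (merged k h))) ,
                       trans (cong-app (arr≡ fr aOut refl) k) (proj₂ (proj₂ (merged k h))))
              (trans (var≡ fr vθ refl) eθ) })
            (0 , 0 , (λ _ → suc m) , refl , refl , (λ i → trans (blank i) (sym (ℤ.i≡j⇒i-j≡0 {+ suc m} refl))) ,
             ((λ _ ()) , λ _ _ → refl) , z≤n , z≤n , (λ _ _ ()) , refl))))))

      θ₁ θ₂ : ℤ
      θ₁ = + (2 * E)
      θ₂ = ℤ.- (+ (2 * E)) ℤ.- 1ℤ

      private
        2E≤2R : 2 * E ≤ 2 * R
        2E≤2R = ℕ.*-monoʳ-≤ 2 (ℕ.≤-trans E≤ (ℕ.*-monoʳ-≤ N (s≤s (ℕ.*-monoˡ-≤ M (auto 2 3)))))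

        θ₁≤B : ∣ θ₁ ∣ ≤ B
        θ₁≤B = ℕ.≤-trans 2E≤2R (R≤ 2 (auto 2 16))

        θ₂≤B : ∣ θ₂ ∣ ≤ B
        θ₂≤B = ℕ.≤-trans (ℤ.∣i-j∣≤∣i∣+∣j∣ (ℤ.- (+ (2 * E))) 1ℤ)
          (ℕ.≤-trans (ℕ.≤-reflexive (cong (λ z → z + 1) (ℤ.∣-i∣≡∣i∣ (+ (2 * E)))))
            (ℕ.≤-trans (ℕ.+-mono-≤ 2E≤2R (ℕ.≤-trans (ℕ.≤-trans (s≤s z≤n) 2≤N) N≤R)) (ℕ.≤-trans (ℕ.≤-reflexive (ℕ.+-comm (2 * R) R)) (R≤ 3 (auto 3 16)))))

      stair-cost : ℕ
      stair-cost = 6 + suc (suc n + suc m) * 104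

      StairsPost : State → Set
      StairsPost σ = ∃₂ λ lo hi → Staircase aA lo σ × Staircase aB hi σ × Crossings θ₁ lo (suc n) × Crossings θ₂ hi (suc n)

      stairs-ok : ∀ {σ} → Base σ → Convexified σ → Merged (suc (n + m)) σ → vars σ vE ≡ + E →
        (∀ i → arrays σ aA i ≡ 0ℤ) → (∀ i → arrays σ aB i ≡ 0ℤ) →
        Safe StairsPost
          (6 + (stair-cost + (9 + (stair-cost + 0)))) (stairs ∷ []) σ
      stairs-ok {⟨ vs , as ⟩} base cvx@(ep , eq) merged eE blankA blankB =
        seq (assign {z = θ₁} (at (mul (lit (+ 2)) (var eE)) (sym (ℤ.pos-* 2 E))) θ₁≤B
        (seq (run (Stair.stair-ok 0 θ₁ θ₁≤B base cvx merged refl blankA) second)))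
        where
        second : ∀ {σ₁} → (∃ λ C → Staircase aA C σ₁ × Crossings θ₁ C (suc n)) → Frame (stair aA ∷ []) ⟨ update vs vθ θ₁ , as ⟩ σ₁ → Bounded σ₁ →
          Safe StairsPost (9 + (stair-cost + 0)) (vθ ≔ lit 0ℤ ⊖ lit (+ 2) ⊗ var vE ⊖ lit 1ℤ ⨾ stair aB ∷ []) σ₁
        second {⟨ vs₁ , as₁ ⟩} (lo , stored , crossings) fr _ =
          seq (assign {z = θ₂} (at (sub (sub (lit 0ℤ) (mul (lit (+ 2)) (var (trans (var≡ fr vE refl) eE)))) (lit 1ℤ))
                 (cong (λ z → z ℤ.- 1ℤ) (trans (ℤ.+-identityˡ _) (cong ℤ.-_ (sym (ℤ.pos-* 2 E)))))) θ₂≤B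
          (run {κ = []} (Stair.stair-ok 1 θ₂ θ₂≤B
                (base-frame fr (refl , refl , refl , refl , refl , refl , refl) base)
                ((λ i → trans (cong-app (arr≡ fr aP refl) i) (ep i)) , λ j → trans (cong-app (arr≡ fr aP refl) (suc n + j)) (eq j))
                (λ k h → trans (cong-app (arr≡ fr aα refl) k) (proj₁ (merged k h)) ,
                       trans (cong-app (arr≡ fr aH refl) k) (proj₁ (proj₂ (merged k h))) ,
                       trans (cong-app (arr≡ fr aOut refl) k) (proj₂ (proj₂ (merged k h))))
                refl (λ i → trans (cong-app (arr≡ fr aB refl) i) (blankB i)))
            λ { {σ₂} (hi , stored′ , crossings′) fr′ _ → end (lo , hi , (λ i → trans (cong-app (arr≡ fr′ aA refl) i) (stored i)) , stored′ , crossings , crossings′) }))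

      module Crossed {θ : ℤ} {C : ℕ → ℕ} (crossings : Crossings θ C (suc n)) where

        at-most : ∀ i → C i ≤ suc m
        at-most i = [ (λ h → Crossing.c≤1+m (proj₁ crossings i h)) , (λ h → ℕ.≤-reflexive (proj₂ crossings i h)) ]′ (ℕ.<-≤-connex i (suc n))

        far : ∀ i → n < i → C i ≡ suc m
        far = proj₂ crossings

        -- If the count dropped, then in the column where the next row crosses, `signed` would
        -- exceed θ in row i but not in row i + 1, against its monotonicity.
        one-step : ∀ i → C i ≤ C (suc i)
        one-step i = [ inside , (λ h → ℕ.≤-trans (at-most i) (ℕ.≤-reflexive (sym (far (suc i) h)))) ]′ (ℕ.<-≤-connex (suc i) (suc n))
          where
          inside : suc i < suc n → C i ≤ C (suc i)
          inside h = ℕ.≮⇒≥ λ lt →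
            let j≤m = ℕ.≤-pred (ℕ.≤-trans lt (at-most i)) in
            contradiction (ℤ.<-≤-trans (Crossing.before (proj₁ crossings i (ℕ.<-trans ℕ.≤-refl h)) _ lt)
                (ℤ.≤-trans (signed-right (ℕ.≤-pred h) j≤m) (Crossing.after (proj₁ crossings (suc i) h) _ ℕ.≤-refl j≤m)))
              (ℤ.<-irrefl refl)

        mono : ∀ {i i′} → i ≤ i′ → C i ≤ C i′
        mono {i} {i′} h = [ climb , (λ { refl → ℕ.≤-refl }) ]′ (ℕ.m≤n⇒m<n∨m≡n h)
          where
          climb : i < i′ → C i ≤ C i′
          climb (s≤s {n = i″} h′) = ℕ.≤-trans (mono h′) (one-step i″)

      module Region {lo hi : ℕ → ℕ} (lo-crossings : Crossings θ₁ lo (suc n)) (hi-crossings : Crossings θ₂ hi (suc n)) where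

        open Crossed lo-crossings using () renaming (at-most to lo≤; far to lo-far)
        open Crossed hi-crossings using () renaming (at-most to hi≤)

        in-range : ∀ {i j} → lo i ≤ j → j < hi i → i ≤ n × j ≤ m
        in-range {i} {j} l h = ℕ.≮⇒≥ (λ n<i → ℕ.<-irrefl refl
            (ℕ.<-≤-trans (ℕ.<-≤-trans h (hi≤ i)) (ℕ.≤-trans (ℕ.≤-reflexive (sym (lo-far i n<i))) l))) ,
          ℕ.≤-pred (ℕ.≤-trans h (hi≤ i))

        private
          scaled : ∀ i j p q x e N f g → p ℤ.+ q ℤ.- x ≤ℤ e → N ℤ.* f ℤ.- p ≤ℤ i → N ℤ.* g ℤ.- q ≤ℤ j →
                   N ℤ.* (f ℤ.+ g) ≤ℤ x ℤ.+ (e ℤ.+ i ℤ.+ j)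
          scaled i j p q x e N f g h k l = by (h ⊹ k ⊹ l) (solve (i ∷ j ∷ p ∷ q ∷ x ∷ e ∷ N ∷ f ∷ g ∷ []))

          base-le : ∀ p q x N f g → 0ℤ ≤ℤ p ℤ.+ q ℤ.- x → p ≤ℤ N ℤ.* f → q ≤ℤ N ℤ.* g → x ≤ℤ N ℤ.* (f ℤ.+ g)
          base-le p q x N f g h k l = by (h ⊹ k ⊹ l) (solve (p ∷ q ∷ x ∷ N ∷ f ∷ g ∷ []))

        -- In the region p i + q j is between H and H + 2E, and N (f i + g j) exceeds p i + q j by
        -- at least 0 and at most 2E.
        window : ∀ w → 4 * E ≤ N * w → ∀ i j → lo i ≤ j → j < hi i →
          H (i + j) ≤ℤ + N ℤ.* (f i ℤ.+ g j) × + N ℤ.* (f i ℤ.+ g j) ≤ℤ H (i + j) ℤ.+ + N ℤ.* + w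
        window w 4E≤ i j l h =
          base-le (p i) (q j) (H (i + j)) (+ N) (f i) (g j) (excess≥0 i≤n j≤m) (proj₁ (p-close i i≤n)) (proj₁ (q-close j j≤m)) ,
          ℤ.≤-trans (scaled (+ E) (+ E) (p i) (q j) (H (i + j)) (+ (2 * E)) (+ N) (f i) (g j)
              (excess≤ {i} {j} {2 * E} (Crossing.after (proj₁ lo-crossings i (s≤s i≤n)) j l j≤m) (Crossing.before (proj₁ hi-crossings i (s≤s i≤n)) j h))
              (proj₂ (p-close i i≤n)) (proj₂ (q-close j j≤m)))
            (ℤ.+-monoʳ-≤ (H (i + j)) (ℤ.≤-trans (ℤ.≤-reflexive (cong +_ (four E))) (subst (+ (4 * E) ≤ℤ_) (ℤ.pos-* N w) (ℤ.+≤+ 4E≤))))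
          where
          i≤n = proj₁ (in-range l h)
          j≤m = proj₂ (in-range l h)
          four : ∀ E → 2 * E + E + E ≡ 4 * E
          four = ℕ-solve-∀

        outside : ∀ {i j} → i ≤ n → j ≤ m → j < lo i ⊎ hi i ≤ j → + (2 * E) ℤ.< excess i j
        outside {i} {j} i≤n j≤m o = <excess i≤n j≤m
          ([ (λ lt → inj₁ (Crossing.before (proj₁ lo-crossings i (s≤s i≤n)) j lt)) ,
             (λ ge → inj₂ (Crossing.after (proj₁ hi-crossings i (s≤s i≤n)) j ge j≤m)) ]′ o)

        located : ∀ i j → (lo i ≤ j × j < hi i) ⊎ (j < lo i ⊎ hi i ≤ j)
        located i j = [ (λ lt → inj₂ (inj₁ lt)) ,
                        (λ ge → [ (λ lt → inj₁ (ge , lt)) , (λ ge′ → inj₂ (inj₂ ge′)) ]′ (ℕ.<-≤-connex j (hi i))) ]′ (ℕ.<-≤-connex j (lo i))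

        -- Path points have excess 0, whereas points outside have excess greater than 2E. Hence
        -- covering the region also treats the path points, with which `path-wins` compares every
        -- pair outside.
        path-inside : ∀ {k} → k ≤ n + m → lo (α k) ≤ β k × β k < hi (α k)
        path-inside {k} k≤ = [ (λ r → r) , (λ o → contradiction (outside a≤n b≤m o) (ℤ.≤⇒≯ (ℤ.≤-trans (ℤ.≤-reflexive zero-excess) 0≤+))) ]′ (located (α k) (β k))
          where
          open Separating (separating k≤)
          zero-excess : excess (α k) (β k) ≡ 0ℤ
          zero-excess = trans (cong (λ k′ → p (α k) ℤ.+ q (β k) ℤ.- H k′) (α+β k)) (ℤ.i≡j⇒i-j≡0 {H k} refl)

        -- The path beats every pair of excess greater than 2E.
        path-wins : ∀ {i j} → i ≤ n → j ≤ m → + (2 * E) ℤ.< excess i j → f (α (i + j)) ℤ.+ g (β (i + j)) ≤ℤ f i ℤ.+ g j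
        path-wins {i} {j} i≤n j≤m h = divide {+ N} (ℤ.+<+ (ℕ.≤-trans (s≤s z≤n) 2≤N))
          (lemma (+ N) (p i) (q j) (H k) (p (α k)) (q (β k)) (f i) (g j) (f (α k)) (g (β k)) (+ (2 * E)) (+ E) (cong +_ (two E)) refl
            (ℤ.<⇒≤ h) (proj₁ (p-close i i≤n)) (proj₁ (q-close j j≤m)) (proj₂ (p-close (α k) a≤n)) (proj₂ (q-close (β k) b≤m)))
          where
          k = i + j
          open Separating (separating (ℕ.+-mono-≤ i≤n j≤m))
          two : ∀ E → 2 * E ≡ E + E
          two = ℕ-solve-∀
          lemma : ∀ N p q x pa qb f g fa gb e₂ e → e₂ ≡ e ℤ.+ e → x ≡ pa ℤ.+ qb →
            e₂ ≤ℤ p ℤ.+ q ℤ.- x → p ≤ℤ N ℤ.* f → q ≤ℤ N ℤ.* g → N ℤ.* fa ℤ.- pa ≤ℤ e → N ℤ.* gb ℤ.- qb ≤ℤ e →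
            N ℤ.* (fa ℤ.+ gb) ≤ℤ N ℤ.* (f ℤ.+ g)
          lemma N p q _ pa qb f g fa gb _ e refl refl h k l o r =
            by (h ⊹ k ⊹ l ⊹ o ⊹ r) (solve (N ∷ p ∷ q ∷ pa ∷ qb ∷ f ∷ g ∷ fa ∷ gb ∷ e ∷ []))

    -- One box: a call of the primitive and the decoding of its answer.

    open Code M₀ K 4M<K

    -- Holds from the merge on, where the output contains the sums along the path, and is kept
    -- because only sums of actual pairs are written. Minimality is gained separately, as boxes are
    -- covered and entries only decrease.
    Achieved : State → Set
    Achieved σ = ∀ k → k ≤ n + m → ∃₂ λ i j → i ≤ n × j ≤ m × i + j ≡ k × arrays σ aOut k ≡ f i ℤ.+ g j

    Lower : (ℕ → ℤ) → State → Set
    Lower out σ = ∀ k → arrays σ aOut k ≤ℤ out k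

    B≤W : B ≤ W
    B≤W = ℕ.≤-trans (ℕ.≤-reflexive (sym (ℕ.*-identityʳ B))) (B^≤W 1 (auto 1 30))

    n+m+2 : suc n + suc m ≡ N
    n+m+2 = trans (cong suc (ℕ.+-suc n m)) (ℕ.+-comm 2 (n + m))

    most-sums work-cost : ℕ → ℕ → ℕ
    most-sums s r = (s + r) * suc ω
    work-cost s r = 4 + (suc (s + r) * 48 + (1 + (3 + c * (most-sums s r * L) + (1 + (2 + (suc (most-sums s r) * 56 + 0))))))

    module _ (i₀ s j₀ r : ℕ) (1≤s : 1 ≤ s) (1≤r : 1 ≤ r) (i-fits : i₀ + s ≤ suc n) (j-fits : j₀ + r ≤ suc m)
      (H : ℕ → ℤ)
      (window : ∀ t t′ → t < s → t′ < r →
         H (i₀ + t + (j₀ + t′)) ≤ℤ + N ℤ.* (f (i₀ + t) ℤ.+ g (j₀ + t′)) ×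
         + N ℤ.* (f (i₀ + t) ℤ.+ g (j₀ + t′)) ≤ℤ H (i₀ + t + (j₀ + t′)) ℤ.+ + N ℤ.* + ω) where

      i≤n : ∀ {t} → t < s → i₀ + t ≤ n
      i≤n h = ℕ.≤-pred (ℕ.≤-trans (ℕ.≤-reflexive (sym (ℕ.+-suc i₀ _))) (ℕ.≤-trans (ℕ.+-monoʳ-≤ i₀ h) i-fits))

      j≤m : ∀ {t} → t < r → j₀ + t ≤ m
      j≤m h = ℕ.≤-pred (ℕ.≤-trans (ℕ.≤-reflexive (sym (ℕ.+-suc j₀ _))) (ℕ.≤-trans (ℕ.+-monoʳ-≤ j₀ h) j-fits))

      sf : ∀ t → t < s → Small f (i₀ + t)
      sf t h = X≤M₀ (i₀ + t) (ℕ.≤-trans (s≤s (i≤n h)) (ℕ.≤-trans (ℕ.m≤m+n (suc n) (suc m)) (ℕ.≤-reflexive n+m+2)))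

      sg : ∀ t → t < r → Small g (j₀ + t)
      sg t h = X≤M₀ (suc n + (j₀ + t)) (ℕ.≤-trans (ℕ.≤-reflexive (sym (ℕ.+-suc (suc n) _))) (ℕ.≤-trans (ℕ.+-monoʳ-≤ (suc n) (s≤s (j≤m h))) (ℕ.≤-reflexive n+m+2)))

      open Box f g i₀ s j₀ r sf sg

      s+r≤N : s + r ≤ N
      s+r≤N = ℕ.≤-trans (ℕ.+-mono-≤ (ℕ.≤-trans (ℕ.m≤n+m s i₀) i-fits) (ℕ.≤-trans (ℕ.m≤n+m r j₀) j-fits)) (ℕ.≤-reflexive n+m+2)

      codeℤ : (ℕ → ℤ) → ℕ → ℤ
      codeℤ h i = + i ℤ.* + K ℤ.+ h i ℤ.+ + M₀

      -- The index may reach 2N, not just N, since the filling loop overruns both sides of the box.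
      codeℤ≤ : ∀ h i → ∣ h i ∣ ≤ M → i ≤ 2 * N → ∣ codeℤ h i ∣ ≤ B
      codeℤ≤ h i hi i≤ = begin
        ∣ + i ℤ.* + K ℤ.+ h i ℤ.+ + M₀ ∣       ≤⟨ ℤ.∣i+j∣≤∣i∣+∣j∣ (+ i ℤ.* + K ℤ.+ h i) (+ M₀) ⟩
        ∣ + i ℤ.* + K ℤ.+ h i ∣ + M₀           ≤⟨ ℕ.+-monoˡ-≤ M₀ (ℤ.∣i+j∣≤∣i∣+∣j∣ (+ i ℤ.* + K) (h i)) ⟩
        ∣ + i ℤ.* + K ∣ + ∣ h i ∣ + M₀         ≡⟨ cong (λ z → z + ∣ h i ∣ + M₀) (ℤ.abs-* (+ i) (+ K)) ⟩
        i * K + ∣ h i ∣ + M₀                   ≤⟨ ℕ.+-monoˡ-≤ M₀ (ℕ.+-mono-≤ (ℕ.*-monoˡ-≤ K i≤) hi) ⟩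
        2 * N * K + M + M₀                     ≤⟨ ℕ.m≤m+n _ _ ⟩
        2 * (2 * N * K + M + M₀)               ≤⟨ code≤B ⟩
        B                                      ∎
        where open ℕ.≤-Reasoning

      FillInv : ℕ → State → Set
      FillInv μ σ = ∃ λ t → vars σ vt ≡ + t × t + μ ≡ s + r ×
        (∀ t′ → t′ < t → arrays σ aU t′ ≡ codeℤ f (i₀ + t′) × arrays σ aV t′ ≡ codeℤ g (j₀ + t′))

      Corner : State → Set
      Corner σ = vars σ vs ≡ + s × vars σ vr ≡ + r × vars σ vi ≡ + i₀ × vars σ vj ≡ + j₀

      Filled : State → Set
      Filled σ = ∀ t′ → t′ < s + r → arrays σ aU t′ ≡ codeℤ f (i₀ + t′) × arrays σ aV t′ ≡ codeℤ g (j₀ + t′)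

      fill-step : ∀ {μ σ} → FillInv μ σ → Base σ → Corner σ →
        ∃₂ λ u v → σ ⊢ var vt ⊕ lit 1ℤ ⇓ u × σ ⊢ var vs ⊕ var vr ⇓ v ×
        (u ≤ℤ v → ∃ λ μ′ → suc μ′ ≤ μ × Safe (FillInv μ′) 40 (fillBody ∷ []) σ) ×
        (v ℤ.< u → Filled σ)
      fill-step {zero} (t , et , e , filled) base (es , er , _) = _ , _ , add (var et) (lit 1ℤ) , add (var es) (var er) ,
        (λ h → contradiction (ℕ.≤-trans (ℕ.≤-reflexive (ℕ.+-comm 1 t)) (ℤ.drop‿+≤+ h)) (ℕ.<⇒≱ (s≤s (ℕ.≤-reflexive (trans (sym e) (ℕ.+-identityʳ t)))))) ,
        λ _ t′ h → filled t′ (ℕ.≤-trans h (ℕ.≤-reflexive (trans (sym e) (ℕ.+-identityʳ t))))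
      fill-step {suc μ} {⟨ vs₀ , as ⟩} (t , et , e , filled) (e₀ , e₁ , eN , eo , eM , eK , eX) (es , er , ei , ej) =
        _ , _ , add (var et) (lit 1ℤ) , add (var es) (var er) , (λ _ → μ , ℕ.≤-refl , body) ,
        λ h → contradiction (ℤ.drop‿+<+ h) (ℕ.≤⇒≯ (ℕ.≤-trans (ℕ.≤-reflexive (ℕ.+-comm t 1)) t<))
        where
        e′ : suc t + μ ≡ s + r
        e′ = trans (sym (ℕ.+-suc t μ)) e
        t< : t < s + r
        t< = ℕ.≤-trans (ℕ.m≤m+n (suc t) μ) (ℕ.≤-reflexive e′)
        2N : ∀ {i} → i ≤ N → i + t ≤ 2 * N
        2N h = ℕ.+-mono-≤ h (ℕ.≤-trans (ℕ.≤-trans (ℕ.<⇒≤ t<) s+r≤N) (ℕ.m≤m+n N 0))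
        i₀≤ : i₀ ≤ N
        i₀≤ = ℕ.≤-trans (ℕ.≤-trans (ℕ.m≤m+n i₀ s) i-fits) (ℕ.≤-trans (ℕ.m≤m+n (suc n) (suc m)) (ℕ.≤-reflexive n+m+2))
        j₀≤ : j₀ ≤ N
        j₀≤ = ℕ.≤-trans (ℕ.≤-trans (ℕ.m≤m+n j₀ r) j-fits) (ℕ.≤-trans (ℕ.m≤n+m (suc m) (suc n)) (ℕ.≤-reflexive n+m+2))
        t+1≤B : suc t ≤ B
        t+1≤B = ℕ.≤-trans t< (ℕ.≤-trans s+r≤N (ℕ.≤-trans (ℕ.m≤n+m N 2) N≤B))
        filled′ : ∀ t′ → t′ < suc t → update (as aU) t (codeℤ f (i₀ + t)) t′ ≡ codeℤ f (i₀ + t′) ×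
                                      update (as aV) t (codeℤ g (j₀ + t)) t′ ≡ codeℤ g (j₀ + t′)
        filled′ t′ (s≤s h) = split (ℕ.m≤n⇒m<n∨m≡n h)
          where
          split : t′ < t ⊎ t′ ≡ t → update (as aU) t (codeℤ f (i₀ + t)) t′ ≡ codeℤ f (i₀ + t′) ×
                                    update (as aV) t (codeℤ g (j₀ + t)) t′ ≡ codeℤ g (j₀ + t′)
          split (inj₁ lt) = trans (update-other (as aU) _ (ℕ.<⇒≢ lt)) (proj₁ (filled t′ lt)) ,
                            trans (update-other (as aV) _ (ℕ.<⇒≢ lt)) (proj₂ (filled t′ lt))
          split (inj₂ refl) = update-same (as aU) t _ , update-same (as aV) t _
        body : Safe (FillInv μ) 40 (fillBody ∷ []) ⟨ vs₀ , as ⟩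
        body = weaken-safe {b = 36} (auto 36 40)
          (seq (store {i = t} {z = codeℤ f (i₀ + t)} (var et)
            (add (add (mul (add (var ei) (var et)) (var eK)) (get (add (var ei) (var et)) (cong-app eX (i₀ + t)))) (var eM))
            (codeℤ≤ f (i₀ + t) (X≤M _) (2N i₀≤))
          (seq (store {i = t} {z = codeℤ g (j₀ + t)} (var et)
            (add (add (mul (add (var ej) (var et)) (var eK)) (get (add (var eo) (add (var ej) (var et))) (cong-app eX (suc n + (j₀ + t))))) (var eM))
            (codeℤ≤ g (j₀ + t) (X≤M _) (2N j₀≤))
          (assign {z = + suc t} (at (add (var et) (lit 1ℤ)) (cong +_ (ℕ.+-comm t 1))) t+1≤B
          (end (suc t , refl , e′ , filled′)))))))

      module Read (S : List ℕ) (S↭ : S ↭ Sums) (out₀ : ℕ → ℤ) where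

        len : ℕ
        len = length S

        Z : State → Set
        Z σ = ∃ λ a → ∀ t → arrays σ aZ t ≡ overwrite (map +_ S) a t

        -- Stated through the codes because one listed number can stem from many pairs; they all
        -- have the same antidiagonal and the same sum, so one update serves them all.
        Seen : ℕ → State → Set
        Seen t σ = ∀ t′ → t′ < t → ∀ a b → a < s → b < r →
          arrays σ aZ t′ ≡ + (code f (i₀ + a) + code g (j₀ + b)) →
          arrays σ aOut (i₀ + a + (j₀ + b)) ≤ℤ f (i₀ + a) ℤ.+ g (j₀ + b)

        ReadInv : ℕ → State → Set
        ReadInv μ σ = ∃ λ t → vars σ vt ≡ + t × t + μ ≡ len × Achieved σ × Lower out₀ σ × Seen t σ

        read-step : ∀ {μ σ} → ReadInv μ σ → Base σ → Z σ → vars σ vlen ≡ + len → len ≤ B →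
          ∃₂ λ u v → σ ⊢ var vt ⊕ lit 1ℤ ⇓ u × σ ⊢ var vlen ⇓ v ×
          (u ≤ℤ v → ∃ λ μ′ → suc μ′ ≤ μ × Safe (ReadInv μ′) 50 (readBody ∷ []) σ) ×
          (v ℤ.< u → Achieved σ × Lower out₀ σ × Seen len σ)
        read-step {zero} {σ} (t , et , e , achieved , lower , seen) base z el _ = _ , _ , add (var et) (lit 1ℤ) , var el ,
          (λ h → contradiction (ℕ.≤-trans (ℕ.≤-reflexive (ℕ.+-comm 1 t)) (ℤ.drop‿+≤+ h)) (ℕ.<⇒≱ (s≤s (ℕ.≤-reflexive (sym t≡))))) ,
          λ _ → achieved , lower , subst (λ t → Seen t σ) t≡ seen
          where
          t≡ : t ≡ len
          t≡ = trans (sym (ℕ.+-identityʳ t)) e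
        read-step {suc μ} {⟨ vs₀ , as ⟩} (t , et , e , achieved , lower , seen) (e₀ , e₁ , eN , eo , eM , eK , eX) (a₀ , eZ) el len≤B =
          _ , _ , add (var et) (lit 1ℤ) , var el , (λ _ → μ , ℕ.≤-refl , body (overwrite-∈ S a₀ t t<)) ,
          λ h → contradiction (ℤ.drop‿+<+ h) (ℕ.≤⇒≯ (ℕ.≤-trans (ℕ.≤-reflexive (ℕ.+-comm t 1)) t<))
          where
          e′ : suc t + μ ≡ len
          e′ = trans (sym (ℕ.+-suc t μ)) e
          t< : t < len
          t< = ℕ.≤-trans (ℕ.m≤m+n (suc t) μ) (ℕ.≤-reflexive e′)
          body : (∃ λ z → z ∈ S × overwrite (map +_ S) a₀ t ≡ + z) → Safe (ReadInv μ) 50 (readBody ∷ []) ⟨ vs₀ , as ⟩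
          body (z , z∈ , ez) = go (sums⁻ (∈-resp-↭ S↭ z∈))
            where
            go : (∃₂ λ a b → a < s × b < r × z ≡ code f (i₀ + a) + code g (j₀ + b)) → Safe (ReadInv μ) 50 (readBody ∷ []) ⟨ vs₀ , as ⟩
            go (a , b , a< , b< , refl) = weaken-safe {b = 33} (auto 33 50)
              (seq (assign {z = + k} (at (quot {d = K} (get (var et) Zt) (var eK)) lead) k≤B
              (seq (assign {z = v} (at (sub (sub (get (var et) Zt) (mul (var refl) (var eK))) (add (var eM) (var eM))) value≡) v≤B
              (seq (branch (add (var refl) (lit 1ℤ)) (get (var refl) refl)
                (λ h → store {i = k} {z = v} (var refl) (var refl) v≤B
                  (assign {z = + suc t} (at (add (var et) (lit 1ℤ)) (cong +_ (ℕ.+-comm t 1))) (ℕ.≤-trans t< len≤B)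
                  (end (suc t , refl , e′ , achieved′ , (λ k′ → ℤ.≤-trans (drop (ℤ.<⇒≤ (+1≤⇒< h)) k′) (lower k′)) ,
                    seen′ (drop (ℤ.<⇒≤ (+1≤⇒< h))) (ℤ.≤-reflexive (update-same (as aOut) k v))))))
                (λ h → weaken-safe {b = 5} (auto 5 7) (pass
                  (assign {z = + suc t} (at (add (var et) (lit 1ℤ)) (cong +_ (ℕ.+-comm t 1))) (ℕ.≤-trans t< len≤B)
                  (end (suc t , refl , e′ , achieved , lower , seen′ (λ _ → ℤ.≤-refl) (<+1⇒≤ h))))))))))))
              where
              i j k : ℕ
              i = i₀ + a
              j = j₀ + b
              k = i + j
              v : ℤ
              v = f i ℤ.+ g j
              Zt : as aZ t ≡ + (code f i + code g j)
              Zt = trans (eZ t) ez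
              lead : + (code f i + code g j) ℤ./ℕ K ≡ + k
              lead = leading {f} {g} (sf a a<) (sg b b<)
              value≡ : + (code f i + code g j) ℤ.- + k ℤ.* + K ℤ.- (+ M₀ ℤ.+ + M₀) ≡ v
              value≡ = trans (cong (λ z → z ℤ.- + k ℤ.* + K ℤ.- (+ M₀ ℤ.+ + M₀)) (sum-value {f} {g} (sf a a<) (sg b b<)))
                (cancel (+ k ℤ.* + K) v (+ M₀ ℤ.+ + M₀))
                where
                cancel : ∀ a v c → a ℤ.+ v ℤ.+ c ℤ.- a ℤ.- c ≡ v
                cancel = solve-∀
              M≤R : M ≤ R
              M≤R = ℕ.≤-trans (ℕ.≤-trans (ℕ.m≤m+n M _) (ℕ.n≤1+n _)) (ℕ.m≤n*m (suc (3 * M)) N {{ℕ.>-nonZero (ℕ.≤-trans (s≤s z≤n) 2≤N)}})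
              v≤B : ∣ v ∣ ≤ B
              v≤B = ℕ.≤-trans (ℤ.∣i+j∣≤∣i∣+∣j∣ (f i) (g j)) (ℕ.≤-trans (ℕ.+-mono-≤ (ℕ.≤-trans (X≤M _) M≤R) (ℕ.≤-trans (X≤M _) (ℕ.≤-trans M≤R (ℕ.m≤m+n R 0)))) (R≤ 2 (auto 2 16)))
              k≤ : k ≤ n + m
              k≤ = ℕ.+-mono-≤ (i≤n a<) (j≤m b<)
              k≤B : k ≤ B
              k≤B = ℕ.≤-trans k≤ (ℕ.≤-trans (ℕ.m≤m+n (n + m) 2) (ℕ.≤-trans (ℕ.m≤n+m N 2) N≤B))
              drop : v ≤ℤ as aOut k → ∀ k′ → update (as aOut) k v k′ ≤ℤ as aOut k′
              drop h k′ = split (k′ ℕ.≟ k)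
                where
                split : Dec (k′ ≡ k) → update (as aOut) k v k′ ≤ℤ as aOut k′
                split (yes refl) = ℤ.≤-trans (ℤ.≤-reflexive (update-same (as aOut) k v)) h
                split (no ne)    = ℤ.≤-reflexive (update-other (as aOut) v ne)
              achieved′ : ∀ k′ → k′ ≤ n + m → ∃₂ λ i j → i ≤ n × j ≤ m × i + j ≡ k′ × update (as aOut) k v k′ ≡ f i ℤ.+ g j
              achieved′ k′ h = split (k′ ℕ.≟ k)
                where
                split : Dec (k′ ≡ k) → ∃₂ λ i j → i ≤ n × j ≤ m × i + j ≡ k′ × update (as aOut) k v k′ ≡ f i ℤ.+ g j
                split (yes refl) = i , j , i≤n a< , j≤m b< , refl , update-same (as aOut) k v
                split (no ne) with achieved k′ h
                ... | i′ , j′ , hi , hj , e , eq = i′ , j′ , hi , hj , e , trans (update-other (as aOut) v ne) eq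
              seen′ : ∀ {out : ℕ → ℤ} → (∀ k′ → out k′ ≤ℤ as aOut k′) → out k ≤ℤ v →
                ∀ t′ → t′ < suc t → ∀ a b → a < s → b < r →
                as aZ t′ ≡ + (code f (i₀ + a) + code g (j₀ + b)) →
                out (i₀ + a + (j₀ + b)) ≤ℤ f (i₀ + a) ℤ.+ g (j₀ + b)
              seen′ {out} dec here t′ (s≤s h) a′ b′ a′< b′< eq = split (ℕ.m≤n⇒m<n∨m≡n h)
                where
                i′ = i₀ + a′
                j′ = j₀ + b′
                same-sum : as aZ t ≡ + (code f i′ + code g j′) → out (i′ + j′) ≤ℤ f i′ ℤ.+ g j′
                same-sum eq′ = subst₂ _≤ℤ_ (cong out (sym k′≡)) (sym v′≡) here
                  where
                  codes≡ : + (code f i′ + code g j′) ≡ + (code f i + code g j)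
                  codes≡ = trans (sym eq′) Zt
                  k′≡ : i′ + j′ ≡ k
                  k′≡ = ℤ.+-injective (trans (sym (leading {f} {g} (sf a′ a′<) (sg b′ b′<))) (trans (cong (λ z → z ℤ./ℕ K) codes≡) lead))
                  v′≡ : f i′ ℤ.+ g j′ ≡ v
                  v′≡ = extract (+ k ℤ.* + K) (f i′ ℤ.+ g j′) v (+ M₀ ℤ.+ + M₀)
                    (trans (cong (λ k → + k ℤ.* + K ℤ.+ (f i′ ℤ.+ g j′) ℤ.+ (+ M₀ ℤ.+ + M₀)) (sym k′≡))
                      (trans (sym (sum-value {f} {g} (sf a′ a′<) (sg b′ b′<))) (trans codes≡ (sum-value {f} {g} (sf a a<) (sg b b<)))))
                    where
                    extract : ∀ a x y c → a ℤ.+ x ℤ.+ c ≡ a ℤ.+ y ℤ.+ c → x ≡ y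
                    extract a x y c e = trans (cancel a x c) (trans (cong (λ z → z ℤ.- a ℤ.- c) e) (sym (cancel a y c)))
                      where
                      cancel : ∀ a x c → x ≡ a ℤ.+ x ℤ.+ c ℤ.- a ℤ.- c
                      cancel = solve-∀
                split : t′ < t ⊎ t′ ≡ t → out (i′ + j′) ≤ℤ f i′ ℤ.+ g j′
                split (inj₁ lt) = ℤ.≤-trans (dec (i′ + j′)) (seen t′ lt a′ b′ a′< b′< eq)
                split (inj₂ refl) = same-sum eq

      BoxPost : (ℕ → ℤ) → State → Set
      BoxPost out₀ σ = Achieved σ × Lower out₀ σ ×
        (∀ a b → a < s → b < r → arrays σ aOut (i₀ + a + (j₀ + b)) ≤ℤ f (i₀ + a) ℤ.+ g (j₀ + b))

      size≤ : ℕ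
      size≤ = most-sums s r

      sums≤ : length Sums ≤ size≤
      sums≤ = sums-length N {{ℕ.>-nonZero (ℕ.≤-trans (s≤s z≤n) 2≤N)}} H ω window

      size≤Nw : size≤ ≤ N * suc ω
      size≤Nw = ℕ.*-monoˡ-≤ (suc ω) s+r≤N

      code≤ : ∀ {h i} → Small h i → i ≤ N → code h i ≤ 2 * N * K + M + M₀
      code≤ {h} {i} small i≤N = begin
        i * K + ∣ h i ℤ.+ + M₀ ∣  ≤⟨ ℕ.+-mono-≤ (ℕ.*-monoˡ-≤ K i≤N) (digit≤ {h} small) ⟩
        N * K + (M₀ + M₀)         ≤⟨ ℕ.+-monoʳ-≤ (N * K) (ℕ.≤-trans (ℕ.m≤m+n (M₀ + M₀) (M₀ + M₀)) (ℕ.<⇒≤ 4M<K)) ⟩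
        N * K + K                 ≤⟨ ℕ.+-monoʳ-≤ (N * K) (ℕ.m≤n*m K N {{ℕ.>-nonZero (ℕ.≤-trans (s≤s z≤n) 2≤N)}}) ⟩
        N * K + N * K             ≡⟨ double N K ⟩
        2 * N * K                 ≤⟨ ℕ.≤-trans (ℕ.m≤m+n _ M) (ℕ.m≤m+n _ M₀) ⟩
        2 * N * K + M + M₀        ∎
        where
        open ℕ.≤-Reasoning
        double : ∀ N K → N * K + N * K ≡ 2 * N * K
        double = ℕ-solve-∀

      sum≤B : ∀ {z} → z ∈ Sums → z ≤ B
      sum≤B z∈ = go (sums⁻ z∈)
        where
        go : ∀ {z} → (∃₂ λ a b → a < s × b < r × z ≡ code f (i₀ + a) + code g (j₀ + b)) → z ≤ B
        go (a , b , a< , b< , refl) = ℕ.≤-trans (ℕ.+-mono-≤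
            (code≤ {f} (sf a a<) (ℕ.≤-trans (i≤n a<) (ℕ.≤-trans (ℕ.m≤m+n n m) (ℕ.m≤m+n _ 2))))
            (ℕ.≤-trans (code≤ {g} (sg b b<) (ℕ.≤-trans (j≤m b<) (ℕ.≤-trans (ℕ.m≤n+m m n) (ℕ.m≤m+n _ 2)))) (ℕ.m≤m+n _ 0)))
          code≤B

      work-ok : ∀ {σ} → Base σ → Corner σ → Achieved σ → Safe (BoxPost (arrays σ aOut)) (work-cost s r) (boxWork ∷ []) σ
      work-ok {⟨ vs₀ , as ⟩} base corner achieved =
        seq (assign {z = 0ℤ} (lit 0ℤ) z≤n
        (seq (run (count 40 FillInv (s + r)
                    (λ { inv fr bd → fill-step inv (base-frame fr (refl , refl , refl , refl , refl , refl , refl) base) (corner-frame fr refl refl refl refl) })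
                    (0 , refl , refl , λ _ ()))
              rest)))
        where
        corner-frame : ∀ {κ σ′} → Frame κ ⟨ update vs₀ vt 0ℤ , as ⟩ σ′ →
          anyOf writesVar κ vs ≡ false → anyOf writesVar κ vr ≡ false →
          anyOf writesVar κ vi ≡ false → anyOf writesVar κ vj ≡ false → Corner σ′
        corner-frame fr a b c d =
          trans (var≡ fr vs a) (proj₁ corner) , trans (var≡ fr vr b) (proj₁ (proj₂ corner)) ,
          trans (var≡ fr vi c) (proj₁ (proj₂ (proj₂ corner))) , trans (var≡ fr vj d) (proj₂ (proj₂ (proj₂ corner)))
        rest : ∀ {σ₂} → Filled σ₂ → Frame (while (var vt ⊕ lit 1ℤ ≼ var vs ⊕ var vr) fillBody ∷ []) ⟨ update vs₀ vt 0ℤ , as ⟩ σ₂ → Bounded σ₂ →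
          Safe (BoxPost (as aOut)) (1 + (3 + c * (size≤ * L) + (1 + (2 + (suc size≤ * 56 + 0))))) (conv aU (var vs) aV (var vr) aZ vlen ⨾ vt ≔ lit 0ℤ ⨾ while (var vt ⊕ lit 1ℤ ≼ var vlen) readBody ∷ []) σ₂
        rest {⟨ vs₂ , as₂ ⟩} filled fr bd =
          seq (weaken-safe (ℕ.+-monoˡ-≤ _ (ℕ.+-monoʳ-≤ 3 (ℕ.*-monoʳ-≤ c (ℕ.*-monoˡ-≤ L sums≤))))
            (convolve {A = codes f i₀ s} {A′ = codes g j₀ r}
              (at (var (proj₁ corner₂)) (cong +_ (sym (length-applyUpTo _ s))))
              (at (var (proj₁ (proj₂ corner₂))) (cong +_ (sym (length-applyUpTo _ r))))
              (listed aU f i₀ s (λ t h → trans (proj₁ (filled t (ℕ.≤-trans h (ℕ.m≤m+n s r)))) (sym (code-value {f} (sf t h)))))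
              (codes-set {f} {i₀} sf 1≤s)
              (listed aV g j₀ r (λ t h → trans (proj₂ (filled t (ℕ.≤-trans h (ℕ.m≤n+m r s)))) (sym (code-value {g} (sg t h)))))
              (codes-set {g} {j₀} sg 1≤r)
              (All.tabulate (λ z∈ → ℕ.≤-trans (sum≤B z∈) B≤W))
              (ℕ.≤-trans len≤B B≤W) (ℕ.≤-trans sums≤ (ℕ.≤-trans size≤Nw Nw≤Smax)) len≤B
              (λ S p i → overwrite-bound S (as₂ aZ) (λ z∈ → sum≤B (∈-resp-↭ p z∈)) (λ t → proj₂ bd aZ t) i)
              reading))
          where
          base₂ : Base ⟨ vs₂ , as₂ ⟩
          base₂ = base-frame fr (refl , refl , refl , refl , refl , refl , refl) base
          corner₂ : Corner ⟨ vs₂ , as₂ ⟩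
          corner₂ = corner-frame fr refl refl refl refl
          len≤B : length Sums ≤ B
          len≤B = ℕ.≤-trans sums≤ (ℕ.≤-trans size≤Nw Nw≤B)
          listed : ∀ a h i₀ s → (∀ t → t < s → as₂ a t ≡ + code h (i₀ + t)) →
            applyUpTo (as₂ a) (length (codes h i₀ s)) ≡ map +_ (codes h i₀ s)
          listed a h i₀ s eq = trans (cong (applyUpTo (as₂ a)) (length-applyUpTo _ s))
            (trans (applyUpTo-cong (as₂ a) (λ t → + code h (i₀ + t)) s eq) (sym (map-applyUpTo +_ _ s)))
          out≡ : as₂ aOut ≡ as aOut
          out≡ = arr≡ fr aOut refl
          reading : ∀ S → S ↭ Sums → Safe (BoxPost (as aOut)) (1 + (2 + (suc size≤ * 56 + 0)))
            (vt ≔ lit 0ℤ ⨾ while (var vt ⊕ lit 1ℤ ≼ var vlen) readBody ∷ [])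
            ⟨ update vs₂ vlen (+ length S) , update as₂ aZ (overwrite (map +_ S) (as₂ aZ)) ⟩
          reading S S↭ = seq (assign {z = 0ℤ} (lit 0ℤ) z≤n
            (run {κ = []} (weaken-safe (ℕ.*-monoˡ-≤ 56 (s≤s len≤size))
              (count 50 ReadInv len
                (λ { inv fr′ _ → read-step inv (base-frame fr′ (refl , refl , refl , refl , refl , refl , refl) base₂)
                   (as₂ aZ , λ t → cong-app (arr≡ fr′ aZ refl) t) (var≡ fr′ vlen refl)
                   (ℕ.≤-trans (ℕ.≤-reflexive (↭-length S↭)) len≤B) })
                (0 , refl , refl ,
                 (λ k h → subst (λ out → ∃₂ λ i j → i ≤ n × j ≤ m × i + j ≡ k × out k ≡ f i ℤ.+ g j) (sym out≡) (achieved k h)) ,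
                 (λ k → ℤ.≤-reflexive (cong-app out≡ k)) , λ _ ())))
              λ { {σ′} (ach , low , seen) fr′ _ → end (ach , low , λ a b a< b< → finish σ′ seen (cong-app (arr≡ fr′ aZ refl)) a b a< b<) }))
            where
            open Read S S↭ (as aOut)
            len≤size : len ≤ size≤
            len≤size = ℕ.≤-trans (ℕ.≤-reflexive (↭-length S↭)) sums≤
            finish : ∀ σ′ → Seen len σ′ → (∀ t → arrays σ′ aZ t ≡ overwrite (map +_ S) (as₂ aZ) t) → ∀ a b → a < s → b < r →
              arrays σ′ aOut (i₀ + a + (j₀ + b)) ≤ℤ f (i₀ + a) ℤ.+ g (j₀ + b)
            finish σ′ seen eZ a b a< b< with ∈-overwrite (as₂ aZ) (∈-resp-↭ (↭-sym S↭) (sums⁺ a< b<))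
            ... | t , t< , eq = seen t t< a b a< b< (trans (eZ t) eq)

    abstract

      κ : ℕ
      κ = suc ω * (230 + c * L)

      κ-value : κ ≡ suc ω * (230 + c * L)
      κ-value = refl

      230≤κ : 230 ≤ κ
      230≤κ = ℕ.≤-trans (ℕ.m≤m+n 230 (c * L)) (ℕ.m≤m+n (230 + c * L) _)

      work-cost≤ : ∀ s r → 1 ≤ s → 4 + work-cost s r ≤ (s + r) * κ
      work-cost≤ s r 1≤s = begin
        4 + (4 + (suc x * 48 + (1 + (3 + c * (z * L) + (1 + (2 + (suc z * 56 + 0)))))))
          ≡⟨ collect x z (c * (z * L)) ⟩
        119 + x * 48 + z * 56 + c * (z * L)
          ≤⟨ ℕ.+-monoˡ-≤ (c * (z * L)) (ℕ.+-monoˡ-≤ (z * 56) (ℕ.+-mono-≤ (ℕ.*-monoʳ-≤ 119 1≤z) (ℕ.*-monoˡ-≤ 48 x≤z))) ⟩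
        119 * z + z * 48 + z * 56 + c * (z * L)
          -- Rounds 119 + 48 + 56 = 223 up to the 230 in `κ`.
          ≤⟨ ℕ.m≤m+n _ (z * 7) ⟩
        119 * z + z * 48 + z * 56 + c * (z * L) + z * 7
          ≡⟨ expand x ω c L ⟩
        x * κ ∎
        where
        open ℕ.≤-Reasoning
        x z : ℕ
        x = s + r
        z = x * suc ω
        x≤z : x ≤ z
        x≤z = ℕ.m≤m*n x (suc ω)
        1≤z : 1 ≤ z
        1≤z = ℕ.≤-trans 1≤s (ℕ.≤-trans (ℕ.m≤m+n s r) x≤z)
        collect : ∀ x z t → 4 + (4 + (suc x * 48 + (1 + (3 + t + (1 + (2 + (suc z * 56 + 0))))))) ≡ 119 + x * 48 + z * 56 + t
        collect = ℕ-solve-∀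
        expand : ∀ y ω c L → 119 * (y * suc ω) + y * suc ω * 48 + y * suc ω * 56 + c * (y * suc ω * L) + y * suc ω * 7
          ≡ y * (suc ω * (230 + c * L))
        expand = ℕ-solve-∀

    Fits-box : (ℕ → ℤ) → ℕ → ℕ → ℕ → ℕ → Set
    Fits-box H i₀ s j₀ r = i₀ + s ≤ suc n × j₀ + r ≤ suc m ×
      (∀ t t′ → t < s → t′ < r → let i = i₀ + t; j = j₀ + t′ in
         H (i + j) ≤ℤ + N ℤ.* (f i ℤ.+ g j) × + N ℤ.* (f i ℤ.+ g j) ≤ℤ H (i + j) ℤ.+ + N ℤ.* + ω)

    Cleared : ℕ → ℕ → ℕ → ℕ → (ℕ → ℤ) → State → Set
    Cleared i₀ s j₀ r out₀ σ = Achieved σ × Lower out₀ σ ×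
        (∀ a b → a < s → b < r → arrays σ aOut (i₀ + a + (j₀ + b)) ≤ℤ f (i₀ + a) ℤ.+ g (j₀ + b))

    box-ok : ∀ {σ} H i₀ s j₀ lo hi → 1 ≤ s → Base σ →
      vars σ vs ≡ + s → vars σ vr ≡ + hi ℤ.- + lo → vars σ vi ≡ + i₀ → vars σ vj ≡ + j₀ → Achieved σ →
      (lo < hi → Fits-box H i₀ s j₀ (hi ℕ.∸ lo)) →
      Safe (Cleared i₀ s j₀ (hi ℕ.∸ lo) (arrays σ aOut)) ((s + (hi ℕ.∸ lo)) * κ) (box ∷ []) σ
    box-ok {σ} H i₀ s j₀ lo hi 1≤s base es er ei ej achieved fits = weaken-safe (work-cost≤ s r 1≤s)
      (branch (lit 1ℤ) (var er)
        (λ h → let lo<hi = positive h in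
          work-ok i₀ s j₀ r 1≤s (ℕ.m<n⇒0<n∸m lo<hi) (proj₁ (fits lo<hi)) (proj₁ (proj₂ (fits lo<hi))) H (proj₂ (proj₂ (fits lo<hi)))
            base (es , trans er (trans (ℤ.m-n≡m⊖n hi lo) (ℤ.⊖-≥ (ℕ.<⇒≤ lo<hi))) , ei , ej) achieved)
        (λ h → weaken-safe (s≤s z≤n) (pass (end (achieved , (λ _ → ℤ.≤-refl) ,
          λ a b _ b<r → contradiction b<r (subst (λ r → ¬ b < r) (sym (ℕ.m≤n⇒m∸n≡0 (negative h))) λ ()))))))
      where
      r = hi ℕ.∸ lo
      positive : 1ℤ ≤ℤ + hi ℤ.- + lo → lo < hi
      positive h = ℤ.drop‿+<+ (+1≤⇒< (lemma (+ hi) (+ lo) h))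
        where
        lemma : ∀ a b → 1ℤ ≤ℤ a ℤ.- b → b ℤ.+ 1ℤ ≤ℤ a
        lemma a b h = by h (solve (a ∷ b ∷ []))
      negative : + hi ℤ.- + lo ℤ.< 1ℤ → hi ≤ lo
      negative h = ℤ.drop‿+≤+ (lemma (+ hi) (+ lo) (<⇒+1≤ h))
        where
        lemma : ∀ a b → a ℤ.- b ℤ.+ 1ℤ ≤ℤ 1ℤ → a ≤ℤ b
        lemma a b h = by h (solve (a ∷ b ∷ []))

    -- Dyadic covering of the region between two monotone staircases.

    module Cover (H : ℕ → ℤ) (lo hi : ℕ → ℕ)
      (lo-mono : ∀ {i i′} → i ≤ i′ → lo i ≤ lo i′) (hi-mono : ∀ {i i′} → i ≤ i′ → hi i ≤ hi i′)
      (lo≤ : ∀ i → lo i ≤ suc m) (hi≤ : ∀ i → hi i ≤ suc m) (lo-far : ∀ i → n < i → lo i ≡ suc m)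
      (window : ∀ i j → lo i ≤ j → j < hi i →
         H (i + j) ≤ℤ + N ℤ.* (f i ℤ.+ g j) × + N ℤ.* (f i ℤ.+ g j) ≤ℤ H (i + j) ℤ.+ + N ℤ.* + ω) where

      near : ∀ {i j} → lo i ≤ j → j < hi i → i ≤ n
      near {i} {j} l h = ℕ.≮⇒≥ λ n<i → ℕ.<-irrefl refl
        (ℕ.<-≤-trans (ℕ.<-≤-trans h (hi≤ i)) (ℕ.≤-trans (ℕ.≤-reflexive (sym (lo-far i n<i))) l))

      Stored : State → Set
      Stored σ = (∀ i → arrays σ aA i ≡ + lo i ℤ.- + suc m) × (∀ i → arrays σ aB i ≡ + hi i ℤ.- + suc m)

      Covered : State → ℕ → ℕ → Set
      Covered σ i j = arrays σ aOut (i + j) ≤ℤ f i ℤ.+ g j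

      -- The dyadic block of size s = s′ + 1 around i lies in row j of the region.
      Held : ℕ → ℕ → ℕ → Set
      Held s′ i j = ∃ λ q → q * suc s′ ≤ i × i < q * suc s′ + suc s′ × lo (q * suc s′ + s′) ≤ j × j < hi (q * suc s′)

      difference : ∀ a b c → a ℤ.- c ℤ.- (b ℤ.- c) ≡ a ℤ.- b
      difference = solve-∀

      back : ∀ a c → a ℤ.- c ℤ.+ c ≡ a
      back = solve-∀

      m+1 : + m ℤ.+ 1ℤ ≡ + suc m
      m+1 = cong +_ (ℕ.+-comm m 1)

      m+1≤B : suc m ≤ B
      m+1≤B = ℕ.≤-trans (ℕ.m≤n+m (suc m) (suc n)) (ℕ.≤-trans (ℕ.≤-reflexive n+m+2) (ℕ.≤-trans (ℕ.m≤n+m N 2) N≤B))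

      cell≤B : ∀ {a} → a ≤ suc m → ∣ + a ℤ.- + suc m ∣ ≤ B
      cell≤B {a} h = ℕ.≤-trans (abs≤ {_} {suc m} (low (+ a) (+ suc m) 0≤+) (high (+ a) (+ suc m) (ℤ.+≤+ h) 0≤+)) m+1≤B
        where
        low : ∀ j m → 0ℤ ≤ℤ j → ℤ.- m ≤ℤ j ℤ.- m
        low j m h = by h (solve (j ∷ m ∷ []))
        high : ∀ j m → j ≤ℤ m → 0ℤ ≤ℤ m → j ℤ.- m ≤ℤ m
        high j m h k = by (h ⊹ k) (solve (j ∷ m ∷ []))

      diff≤B : ∀ {a b} → a ≤ suc m → b ≤ suc m → ∣ + a ℤ.- + b ∣ ≤ B
      diff≤B {a} {b} h k = ℕ.≤-trans (abs≤ {_} {suc m} (low (+ a) (+ b) (+ suc m) 0≤+ (ℤ.+≤+ k)) (high (+ a) (+ b) (+ suc m) (ℤ.+≤+ h) 0≤+)) m+1≤B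
        where
        low : ∀ a b m → 0ℤ ≤ℤ a → b ≤ℤ m → ℤ.- m ≤ℤ a ℤ.- b
        low a b m h k = by (h ⊹ k) (solve (a ∷ b ∷ m ∷ []))
        high : ∀ a b m → a ≤ℤ m → 0ℤ ≤ℤ b → a ℤ.- b ≤ℤ m
        high a b m h k = by (h ⊹ k) (solve (a ∷ b ∷ m ∷ []))

      cell-mono : ∀ {a b} → + a ℤ.- + suc m ≤ℤ + b ℤ.- + suc m → a ≤ b
      cell-mono {a} {b} h = ℤ.drop‿+≤+ (lemma (+ a) (+ b) (+ suc m) h)
        where
        lemma : ∀ a b c → a ℤ.- c ≤ℤ b ℤ.- c → a ≤ℤ b
        lemma a b c h = by h (solve (a ∷ b ∷ c ∷ []))

      cell-mono< : ∀ {a b} → + a ℤ.- + suc m ℤ.< + b ℤ.- + suc m → a ≤ b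
      cell-mono< h = cell-mono (ℤ.<⇒≤ h)

      module Parent (s′ x : ℕ) (x≤n : x ≤ n) (s≤ : suc s′ ≤ suc n) where

        s = suc s′
        end₁ = x + s′
        end₂ = x + s + s′

        bound₁ bound₂ r₁ r₂ : ℕ
        bound₁ = hi x ℕ.⊓ lo end₂
        bound₂ = lo end₂ ℕ.⊔ hi x
        r₁ = bound₁ ℕ.∸ lo end₁
        r₂ = hi (x + s) ℕ.∸ bound₂

        x≤B : ∀ {k} → k ≤ N + (N + N) → k ≤ B
        x≤B h = ℕ.≤-trans h (ℕ.≤-trans (ℕ.+-mono-≤ N≤R (ℕ.+-mono-≤ N≤R (ℕ.≤-trans N≤R (ℕ.m≤m+n R 0)))) (R≤ 3 (auto 3 16)))

        n<N : suc n ≤ N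
        n<N = ℕ.≤-trans (ℕ.m≤m+n (suc n) (suc m)) (ℕ.≤-reflexive n+m+2)

        -- Being nonempty keeps the box inside the array: a block reaching past row n has `lo` equal
        -- to m + 1 at its last row, so no column is left. By monotonicity every row of the block
        -- contains the columns that are full for its last `lo` and its first `hi`.
        fits₁ : lo end₁ < bound₁ → Fits-box H x s (lo end₁) r₁
        fits₁ h = ℕ.≤-trans (ℕ.≤-reflexive (ℕ.+-suc x s′)) (s≤s end₁≤n) ,
          ℕ.≤-trans (ℕ.≤-reflexive (ℕ.m+[n∸m]≡n (ℕ.<⇒≤ h))) (ℕ.≤-trans (ℕ.m⊓n≤m (hi x) (lo end₂)) (hi≤ x)) ,
          λ t t′ t< t′< → window (x + t) (lo end₁ + t′)
            (ℕ.≤-trans (lo-mono (ℕ.+-monoʳ-≤ x (ℕ.≤-pred t<))) (ℕ.m≤m+n _ t′))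
            (ℕ.<-≤-trans (ℕ.<-≤-trans (ℕ.+-monoʳ-< (lo end₁) t′<) (ℕ.≤-reflexive (ℕ.m+[n∸m]≡n (ℕ.<⇒≤ h))))
              (ℕ.≤-trans (ℕ.m⊓n≤m (hi x) (lo end₂)) (hi-mono (ℕ.m≤m+n x t))))
          where
          end₁≤n : end₁ ≤ n
          end₁≤n = ℕ.≮⇒≥ λ n< → ℕ.<-irrefl (lo-far end₁ n<) (ℕ.<-≤-trans h (ℕ.≤-trans (ℕ.m⊓n≤m (hi x) (lo end₂)) (hi≤ x)))

        fits₂ : bound₂ < hi (x + s) → Fits-box H (x + s) s bound₂ r₂
        fits₂ h = ℕ.≤-trans (ℕ.≤-reflexive (ℕ.+-suc (x + s) s′)) (s≤s end₂≤n) ,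
          ℕ.≤-trans (ℕ.≤-reflexive (ℕ.m+[n∸m]≡n (ℕ.<⇒≤ h))) (hi≤ (x + s)) ,
          λ t t′ t< t′< → window (x + s + t) (bound₂ + t′)
            (ℕ.≤-trans (lo-mono (ℕ.+-monoʳ-≤ (x + s) (ℕ.≤-pred t<))) (ℕ.≤-trans (ℕ.m≤m⊔n (lo end₂) (hi x)) (ℕ.m≤m+n _ t′)))
            (ℕ.<-≤-trans (ℕ.<-≤-trans (ℕ.+-monoʳ-< bound₂ t′<) (ℕ.≤-reflexive (ℕ.m+[n∸m]≡n (ℕ.<⇒≤ h)))) (hi-mono (ℕ.m≤m+n (x + s) t)))
          where
          end₂≤n : end₂ ≤ n
          end₂≤n = ℕ.≮⇒≥ λ n< → ℕ.<-irrefl (lo-far end₂ n<) (ℕ.≤-<-trans (ℕ.m≤m⊔n (lo end₂) (hi x)) (ℕ.<-≤-trans h (hi≤ (x + s))))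

        min₁ : hi x ≤ lo end₂ → hi x ≡ bound₁
        min₁ h = sym (ℕ.m≤n⇒m⊓n≡m h)
        min₂ : lo end₂ ≤ hi x → lo end₂ ≡ bound₁
        min₂ h = sym (ℕ.m≥n⇒m⊓n≡n h)
        max₁ : lo end₂ ≤ hi x → hi x ≡ bound₂
        max₁ h = sym (ℕ.m≤n⇒m⊔n≡n h)
        max₂ : hi x ≤ lo end₂ → lo end₂ ≡ bound₂
        max₂ h = sym (ℕ.m≥n⇒m⊔n≡m h)

        At : State → Set
        At σ = vars σ vs ≡ + s × vars σ vc ≡ + x

        A₁⇓ : ∀ {σ} → Stored σ → At σ → σ ⊢ A₁ ⇓ + lo end₁ ℤ.- + suc m
        A₁⇓ st at′ = get (add (var (proj₂ at′)) (sub (var (proj₁ at′)) (lit 1ℤ))) (proj₁ st end₁)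

        A₂⇓ : ∀ {σ} → Stored σ → At σ → σ ⊢ A₂ ⇓ + lo end₂ ℤ.- + suc m
        A₂⇓ st at′ = get (add (add (var (proj₂ at′)) (var (proj₁ at′))) (sub (var (proj₁ at′)) (lit 1ℤ))) (proj₁ st end₂)

        B₀⇓ : ∀ {σ} → Stored σ → At σ → σ ⊢ B₀ ⇓ + hi x ℤ.- + suc m
        B₀⇓ st at′ = get (var (proj₂ at′)) (proj₂ st x)

        B₁⇓ : ∀ {σ} → Stored σ → At σ → σ ⊢ B₁ ⇓ + hi (x + s) ℤ.- + suc m
        B₁⇓ st at′ = get (add (var (proj₂ at′)) (var (proj₁ at′))) (proj₂ st (x + s))

        left-ok : ∀ {σ} → Base σ → Stored σ → At σ → Achieved σ →
          Safe (Cleared x s (lo end₁) r₁ (arrays σ aOut)) (50 + (s + r₁) * κ) (leftBox ∷ []) σ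
        left-ok {⟨ vs₀ , as ⟩} base@(_ , em , _) st here achieved = weaken-safe (ℕ.+-monoˡ-≤ ((s + r₁) * κ) (auto 42 50))
          (seq (assign {z = + x} (var (proj₂ here)) (x≤B (ℕ.≤-trans x≤n (ℕ.≤-trans (ℕ.n≤1+n n) (ℕ.≤-trans n<N (ℕ.m≤m+n N _)))))
          (seq (assign {z = + lo end₁ ℤ.- + suc m} (A₁⇓ st here) (cell≤B (lo≤ end₁))
          (seq (assign {z = + lo end₂ ℤ.- + suc m} (A₂⇓ st here) (cell≤B (lo≤ end₂))
          (seq (branch (B₀⇓ st here) (var refl)
            (λ h → assign {z = + bound₁ ℤ.- + suc m} (at (B₀⇓ st here) (cong (λ z → + z ℤ.- + suc m) (min₁ (cell-mono h))))
                (cell≤B bound₁≤) (tail base (proj₁ here) refl refl refl))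
            (λ h → weaken-safe (ℕ.+-monoˡ-≤ _ (auto 1 3)) (pass (tail base (proj₁ here) refl refl (cong (λ z → + z ℤ.- + suc m) (min₂ (cell-mono< h))))))))))))))
          where
          bound₁≤ : bound₁ ≤ suc m
          bound₁≤ = ℕ.≤-trans (ℕ.m⊓n≤m (hi x) (lo end₂)) (hi≤ x)
          tail : ∀ {vs₁} → Base ⟨ vs₁ , as ⟩ → vs₁ vs ≡ + s → vs₁ vi ≡ + x → vs₁ vj ≡ + lo end₁ ℤ.- + suc m →
            vs₁ vr ≡ + bound₁ ℤ.- + suc m →
            Safe (Cleared x s (lo end₁) r₁ (as aOut)) (12 + (s + r₁) * κ)
              (vr ≔ var vr ⊖ var vj ⨾ vj ≔ var vj ⊕ (var vm ⊕ lit 1ℤ) ⨾ box ∷ []) ⟨ vs₁ , as ⟩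
          tail base₁@(_ , em₁ , _) es₁ ei₁ ej₁ er₁ =
            seq (assign {z = + bound₁ ℤ.- + lo end₁} (at (sub (var er₁) (var ej₁)) (difference (+ bound₁) (+ lo end₁) (+ suc m)))
              (diff≤B bound₁≤ (lo≤ end₁))
            (seq (assign {z = + lo end₁} (at (add (var ej₁) (add (var em₁) (lit 1ℤ))) (trans (cong (λ z → + lo end₁ ℤ.- + suc m ℤ.+ z) m+1) (back (+ lo end₁) (+ suc m))))
              (ℕ.≤-trans (lo≤ end₁) m+1≤B)
            (box-ok H x s (lo end₁) (lo end₁) bound₁ (s≤s z≤n) base₁ es₁ refl ei₁ refl achieved fits₁))))

        right-ok : ∀ {σ} → Base σ → Stored σ → At σ → Achieved σ →
          Safe (Cleared (x + s) s bound₂ r₂ (arrays σ aOut)) (50 + (s + r₂) * κ) (rightBox ∷ []) σ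
        right-ok {⟨ vs₀ , as ⟩} base@(_ , em , _) st here achieved = weaken-safe (ℕ.+-monoˡ-≤ ((s + r₂) * κ) (auto 39 50))
          (seq (assign {z = + (x + s)} (add (var (proj₂ here)) (var (proj₁ here)))
                (x≤B (ℕ.+-mono-≤ (ℕ.≤-trans x≤n (ℕ.≤-trans (ℕ.n≤1+n n) n<N)) (ℕ.≤-trans s≤ (ℕ.≤-trans n<N (ℕ.m≤m+n N N)))))
          (seq (assign {z = + lo end₂ ℤ.- + suc m} (A₂⇓ st here) (cell≤B (lo≤ end₂))
          (seq (branch (var refl) (B₀⇓ st here)
            (λ h → assign {z = + bound₂ ℤ.- + suc m} (at (B₀⇓ st here) (cong (λ z → + z ℤ.- + suc m) (max₁ (cell-mono h))))
                (cell≤B bound₂≤) (tail base (proj₁ here) (proj₂ here) refl refl st))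
            (λ h → weaken-safe (ℕ.+-monoˡ-≤ _ (auto 1 3)) (pass (tail base (proj₁ here) (proj₂ here) refl
                (cong (λ z → + z ℤ.- + suc m) (max₂ (cell-mono< h))) st)))))))))
          where
          bound₂≤ : bound₂ ≤ suc m
          bound₂≤ = ℕ.⊔-lub (lo≤ end₂) (hi≤ x)
          tail : ∀ {vs₁} → Base ⟨ vs₁ , as ⟩ → vs₁ vs ≡ + s → vs₁ vc ≡ + x → vs₁ vi ≡ + (x + s) →
            vs₁ vj ≡ + bound₂ ℤ.- + suc m → Stored ⟨ vs₁ , as ⟩ →
            Safe (Cleared (x + s) s bound₂ r₂ (as aOut)) (15 + (s + r₂) * κ)
              (vr ≔ B₁ ⊖ var vj ⨾ vj ≔ var vj ⊕ (var vm ⊕ lit 1ℤ) ⨾ box ∷ []) ⟨ vs₁ , as ⟩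
          tail base₁@(_ , em₁ , _) es₁ ec₁ ei₁ ej₁ st₁ =
            seq (assign {z = + hi (x + s) ℤ.- + bound₂} (at (sub (B₁⇓ st₁ (es₁ , ec₁)) (var ej₁)) (difference (+ hi (x + s)) (+ bound₂) (+ suc m)))
              (diff≤B (hi≤ (x + s)) bound₂≤)
            (seq (assign {z = + bound₂} (at (add (var ej₁) (add (var em₁) (lit 1ℤ))) (trans (cong (λ z → + bound₂ ℤ.- + suc m ℤ.+ z) m+1) (back (+ bound₂) (+ suc m))))
              (ℕ.≤-trans bound₂≤ m+1≤B)
            (box-ok H (x + s) s bound₂ bound₂ (hi (x + s)) (s≤s z≤n) base₁ es₁ refl ei₁ refl achieved fits₂))))

        parent-cost : ℕ
        parent-cost = 1 + ((50 + (s + r₁) * κ) + (1 + ((50 + (s + r₂) * κ) + (6 + 0))))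

        ParentPost : (ℕ → ℤ) → State → Set
        ParentPost out₀ σ = vars σ vc ≡ + (x + (s + s)) × Achieved σ × Lower out₀ σ ×
          (∀ a b → a < s → b < r₁ → Covered σ (x + a) (lo end₁ + b)) ×
          (∀ a b → a < s → b < r₂ → Covered σ (x + s + a) (bound₂ + b))

        parent-ok : ∀ {σ} → Base σ → Stored σ → At σ → Achieved σ →
          Safe (ParentPost (arrays σ aOut)) parent-cost (parentBody ∷ []) σ
        parent-ok {σ} base st here achieved = seq (run (left-ok base st here achieved) second)
          where
          second : ∀ {σ₁} → Cleared x s (lo end₁) r₁ (arrays σ aOut) σ₁ → Frame (leftBox ∷ []) σ σ₁ → Bounded σ₁ →
            Safe (ParentPost (arrays σ aOut)) (1 + ((50 + (s + r₂) * κ) + (6 + 0))) (rightBox ⨾ vc ≔ var vc ⊕ (var vs ⊕ var vs) ∷ []) σ₁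
          second {σ₁} (ach₁ , low₁ , cov₁) fr₁ _ = seq (run (right-ok base₁ st₁ here₁ ach₁) third)
            where
            base₁ : Base σ₁
            base₁ = base-frame fr₁ (refl , refl , refl , refl , refl , refl , refl) base
            st₁ : Stored σ₁
            st₁ = (λ i → trans (cong-app (arr≡ fr₁ aA refl) i) (proj₁ st i)) , (λ i → trans (cong-app (arr≡ fr₁ aB refl) i) (proj₂ st i))
            here₁ : At σ₁
            here₁ = trans (var≡ fr₁ vs refl) (proj₁ here) , trans (var≡ fr₁ vc refl) (proj₂ here)
            third : ∀ {σ₂} → Cleared (x + s) s bound₂ r₂ (arrays σ₁ aOut) σ₂ → Frame (rightBox ∷ []) σ₁ σ₂ → Bounded σ₂ →
              Safe (ParentPost (arrays σ aOut)) (6 + 0) (vc ≔ var vc ⊕ (var vs ⊕ var vs) ∷ []) σ₂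
            third {⟨ vs₂ , as₂ ⟩} (ach₂ , low₂ , cov₂) fr₂ _ =
              assign {z = + (x + (s + s))} (add (var (trans (var≡ fr₂ vc refl) (proj₂ here₁))) (add (var es₂) (var es₂)))
                (x≤B (ℕ.+-mono-≤ (ℕ.≤-trans x≤n (ℕ.≤-trans (ℕ.n≤1+n n) n<N)) (ℕ.+-mono-≤ (ℕ.≤-trans s≤ n<N) (ℕ.≤-trans s≤ n<N))))
              (end (refl , ach₂ , (λ k → ℤ.≤-trans (low₂ k) (low₁ k)) , (λ a b a< b< → ℤ.≤-trans (low₂ _) (cov₁ a b a< b<)) , cov₂))
              where
              es₂ = trans (var≡ fr₂ vs refl) (proj₁ here₁)

        budget : ℕ
        budget = (4 * s + (r₁ + r₂)) * κ

        parent-cost≤ : 4 + parent-cost ≤ budget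
        parent-cost≤ = begin
          4 + parent-cost                                 ≡⟨ collect (s * κ) (r₁ * κ) (r₂ * κ) ((s + r₁) * κ) ((s + r₂) * κ) (ℕ.*-distribʳ-+ κ s r₁) (ℕ.*-distribʳ-+ κ s r₂) ⟩
          112 + (s * κ + r₁ * κ + (s * κ + r₂ * κ))       ≤⟨ ℕ.+-monoˡ-≤ _ (ℕ.≤-trans (auto 112 230) (ℕ.≤-trans 230≤κ (ℕ.m≤n*m κ (2 * s)))) ⟩
          2 * s * κ + (s * κ + r₁ * κ + (s * κ + r₂ * κ)) ≡⟨ regroup s r₁ r₂ κ ⟩
          budget                                          ∎
          where
          open ℕ.≤-Reasoning
          collect : ∀ a b c d e → d ≡ a + b → e ≡ a + c →
            4 + (1 + ((50 + d) + (1 + ((50 + e) + (6 + 0))))) ≡ 112 + (a + b + (a + c))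
          collect a b c _ _ refl refl = lemma (a + b) (a + c)
            where
            lemma : ∀ d e → 4 + (1 + ((50 + d) + (1 + ((50 + e) + (6 + 0))))) ≡ 112 + (d + e)
            lemma = ℕ-solve-∀
          regroup : ∀ s r r′ k → 2 * s * k + (s * k + r * k + (s * k + r′ * k)) ≡ (4 * s + (r + r′)) * k
          regroup = ℕ-solve-∀

      -- Each call is paid for by the advance of the position and of the two
      -- staircases.
      Φ : ℕ → ℕ → ℕ
      Φ s′ x = 2 * x + (lo (x + s′) + hi x)

      ∸+≤ : ∀ {a b z} → a ≤ z → b ≤ z → (a ℕ.∸ b) + b ≤ z
      ∸+≤ {a} {b} a≤z b≤z = [ (λ a≤b → ℕ.≤-trans (ℕ.≤-reflexive (cong (λ y → y + b) (ℕ.m≤n⇒m∸n≡0 a≤b))) b≤z) ,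
                              (λ b≤a → ℕ.≤-trans (ℕ.≤-reflexive (ℕ.m∸n+n≡m b≤a)) a≤z) ]′ (ℕ.≤-total a b)

      module _ (s′ x : ℕ) (x≤n : x ≤ n) (s≤ : suc s′ ≤ suc n) where

        open Parent s′ x x≤n s≤

        -- The left box lies between `lo` at the end of the left half and `lo` at the end of the
        -- parent, the right box between `hi` at the starts of parent and right half. These
        -- intervals advance with the position, so the widths telescope; 4s is twice the advance 2s.
        Φ-step : (4 * s + (r₁ + r₂)) + Φ s′ x ≤ Φ s′ (x + (s + s))
        Φ-step = begin
          (4 * s + (r₁ + r₂)) + (2 * x + (lo end₁ + hi x))    ≡⟨ shuffle s x r₁ r₂ (lo end₁) (hi x) ⟩
          2 * (x + (s + s)) + ((r₁ + lo end₁) + (r₂ + hi x))  ≤⟨ ℕ.+-monoʳ-≤ (2 * (x + (s + s))) (ℕ.+-mono-≤ low high) ⟩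
          Φ s′ (x + (s + s))                                  ∎
          where
          open ℕ.≤-Reasoning
          shuffle : ∀ s x r r′ a b → (4 * s + (r + r′)) + (2 * x + (a + b)) ≡ 2 * (x + (s + s)) + ((r + a) + (r′ + b))
          shuffle = ℕ-solve-∀
          up : x + s + s′ ≤ x + (s + s) + s′
          up = ℕ.+-monoˡ-≤ s′ (ℕ.+-monoʳ-≤ x (ℕ.m≤m+n s s))
          low : r₁ + lo end₁ ≤ lo (x + (s + s) + s′)
          low = ∸+≤ (ℕ.≤-trans (ℕ.m⊓n≤n (hi x) (lo end₂)) (lo-mono up))
                    (lo-mono (ℕ.≤-trans (ℕ.+-monoˡ-≤ s′ (ℕ.m≤m+n x s)) up))
          high : r₂ + hi x ≤ hi (x + (s + s))
          high = ℕ.≤-trans (ℕ.+-monoˡ-≤ (hi x) (ℕ.∸-monoʳ-≤ (hi (x + s)) (ℕ.m≤n⊔m (lo end₂) (hi x))))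
                   (∸+≤ (hi-mono (ℕ.+-monoʳ-≤ x (ℕ.m≤m+n s s))) (hi-mono (ℕ.m≤m+n x _)))

        Φ-bound : Φ s′ (x + (s + s)) ≤ 6 * N
        Φ-bound = begin
          2 * (x + (s + s)) + (lo (x + (s + s) + s′) + hi (x + (s + s)))
            ≤⟨ ℕ.+-mono-≤ (ℕ.*-monoʳ-≤ 2 (ℕ.+-mono-≤ x≤n (ℕ.+-mono-≤ s≤ s≤))) (ℕ.+-mono-≤ (lo≤ _) (hi≤ _)) ⟩
          2 * (n + (suc n + suc n)) + (suc m + suc m)  ≤⟨ ℕ.m≤m+n _ (6 + 4 * m) ⟩
          2 * (n + (suc n + suc n)) + (suc m + suc m) + (6 + 4 * m)  ≡⟨ total n m ⟩
          6 * N                                        ∎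
          where
          open ℕ.≤-Reasoning
          total : ∀ n m → 2 * (n + (suc n + suc n)) + (suc m + suc m) + (6 + 4 * m) ≡ 6 * (n + m + 2)
          total = ℕ-solve-∀

        -- The small block that holds the point is the left or the right half of the parent at x. If
        -- the column is full for the parent too, the point is handed on to the next level;
        -- otherwise it is in the box of that half, which has just been cleared.
        advance-cover : ∀ {σ₀ σ} q → x ≡ q * (s + s) →
          (∀ i j → lo i ≤ j → j < hi i → Covered σ₀ i j ⊎ Held s′ i j) →
          ParentPost (arrays σ₀ aOut) σ → ∀ i j → lo i ≤ j → j < hi i → x ≤ i → i < x + (s + s) → Covered σ i j ⊎ Held (s′ + s) i j
        advance-cover {σ₀} {σ} q ex held (_ , _ , low , cov₁ , cov₂) i j l h x≤i i< with held i j l h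
        ... | inj₁ c₀ = inj₁ (ℤ.≤-trans (low (i + j)) c₀)
        ... | inj₂ (q′ , b≤i , i<b , lo≤j , j<hi) = block (start q′ b≤i i<b) b≤i i<b lo≤j j<hi
          where
          ex′ : x ≡ (q + q) * s
          ex′ = trans ex (trans (ℕ.*-distribˡ-+ q s s) (sym (ℕ.*-distribʳ-+ s q q)))
          start : ∀ q′ → q′ * s ≤ i → i < q′ * s + s → q′ * s ≡ x ⊎ q′ * s ≡ x + s
          start q′ b≤i i<b = [ (λ lt → inj₁ (trans (cong (λ z → z * s) (ℕ.≤-antisym (ℕ.≤-pred lt) 2q≤q′)) (sym ex′))) ,
                               (λ ge → inj₂ (trans (cong (λ z → z * s) (ℕ.≤-antisym (ℕ.≤-pred q′<) ge))
                                         (trans (ℕ.+-comm s _) (cong (λ z → z + s) (sym ex′))))) ]′ (ℕ.<-≤-connex q′ (suc (q + q)))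
            where
            2q≤q′ : q + q ≤ q′
            2q≤q′ = ℕ.≤-pred (ℕ.*-cancelʳ-< s (q + q) (suc q′)
              (ℕ.≤-<-trans (ℕ.≤-reflexive (sym ex′)) (ℕ.≤-<-trans x≤i (ℕ.<-≤-trans i<b (ℕ.≤-reflexive (ℕ.+-comm (q′ * s) s))))))
            q′< : q′ < suc (suc (q + q))
            q′< = ℕ.*-cancelʳ-< s q′ (suc (suc (q + q))) (ℕ.≤-<-trans b≤i (ℕ.<-≤-trans i<
              (ℕ.≤-reflexive (trans (cong (λ z → z + (s + s)) ex′) (trans (ℕ.+-comm _ (s + s)) (ℕ.+-assoc s s _))))))
          end₂≡ : q * (s + s) + (s′ + s) ≡ end₂
          end₂≡ = trans (cong (λ z → z + (s′ + s)) (sym ex)) (trans (cong (λ z → x + z) (ℕ.+-comm s′ s)) (sym (ℕ.+-assoc x s s′)))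
          hold : lo end₂ ≤ j → j < hi x → Held (s′ + s) i j
          hold a b = q , subst (_≤ i) ex x≤i , subst (λ z → i < z + (s + s)) ex i< ,
            subst (λ z → lo z ≤ j) (sym end₂≡) a , subst (λ z → j < hi z) ex b
          sub-< : ∀ {a b k} → a ≤ k → k < b → k ℕ.∸ a < b ℕ.∸ a
          sub-< a≤k k<b = ℕ.∸-monoˡ-< k<b a≤k
          covered : ∀ {i₁ j₁} → i₁ ≤ i → j₁ ≤ j → Covered σ (i₁ + (i ℕ.∸ i₁)) (j₁ + (j ℕ.∸ j₁)) → Covered σ i j
          covered a b = subst₂ (Covered σ) (ℕ.m+[n∸m]≡n a) (ℕ.m+[n∸m]≡n b)
          within : ∀ {a} → a ≤ i → i < a + s → i ℕ.∸ a < s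
          within {a} a≤i i<a = ℕ.<-≤-trans (sub-< a≤i i<a) (ℕ.≤-reflexive (ℕ.m+n∸m≡n a s))
          block : ∀ {bs} → bs ≡ x ⊎ bs ≡ x + s → bs ≤ i → i < bs + s → lo (bs + s′) ≤ j → j < hi bs → Covered σ i j ⊎ Held (s′ + s) i j
          block (inj₁ refl) b≤i i<b lo≤j j<hi = [ (λ j< → inj₁ (covered b≤i lo≤j (cov₁ _ _ (within b≤i i<b) (sub-< lo≤j (ℕ.⊓-glb j<hi j<))))) ,
                                                  (λ ≤j → inj₂ (hold ≤j j<hi)) ]′ (ℕ.<-≤-connex j (lo end₂))
          block (inj₂ refl) b≤i i<b lo≤j j<hi = [ (λ j< → inj₂ (hold lo≤j j<)) ,
                                                  (λ ≤j → inj₁ (covered b≤i (ℕ.⊔-lub lo≤j ≤j) (cov₂ _ _ (within b≤i i<b) (sub-< (ℕ.⊔-lub lo≤j ≤j) j<hi)))) ]′ (ℕ.<-≤-connex j (hi x))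

      abstract

        -- The budget of one level: 6Nκ pays for all parents, by `Φ-bound`, and the extra κ for the
        -- final test of the loop.
        T : ℕ
        T = κ + 6 * N * κ

        T-value : T ≡ κ + 6 * N * κ
        T-value = refl

      Pending : ℕ → State → Set
      Pending s′ σ = ∀ i j → lo i ≤ j → j < hi i → Covered σ i j ⊎ Held s′ i j

      -- The remaining budget together with the potential spent so far always makes up T. Points in
      -- rows already passed are covered or held by a block of double size; the others are still
      -- referred to their blocks of the present size.
      ParentInv : ℕ → ℕ → State → Set
      ParentInv s′ b σ = ∃ λ q → let x = q * (suc s′ + suc s′) in
        vars σ vc ≡ + x × Achieved σ × Pending s′ σ ×
        (∀ i j → lo i ≤ j → j < hi i → i < x → Covered σ i j ⊎ Held (s′ + suc s′) i j) ×
        Φ s′ x ≤ 6 * N × T ≤ b + Φ s′ x * κ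

      parent-step : ∀ s′ → suc s′ ≤ suc n → ∀ {b σ} → ParentInv s′ b σ → Base σ → Stored σ → vars σ vs ≡ + suc s′ →
        ∃₂ λ u v → σ ⊢ var vc ⇓ u × σ ⊢ var vn ⇓ v ×
        (u ≤ℤ v → ∃₂ λ b₁ b₂ → 4 + (b₁ + b₂) ≤ b × Safe (ParentInv s′ b₂) b₁ (parentBody ∷ []) σ) ×
        (v ℤ.< u → 4 ≤ b × (Achieved σ × Pending (s′ + suc s′) σ))
      parent-step s′ s≤ {b} {σ} (q , ec , achieved , pending , held , Φ≤ , T≤) base st es =
        _ , _ , var ec , var (proj₁ base) ,
        (λ h → more (ℤ.drop‿+≤+ h)) ,
        λ h → ℕ.≤-trans (auto 4 230) (ℕ.≤-trans 230≤κ κ≤b) , achieved ,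
              λ i j l h′ → held i j l h′ (ℕ.≤-<-trans (near l h′) (ℤ.drop‿+<+ h))
        where
        s = suc s′
        x = q * (s + s)
        κ≤b : κ ≤ b
        κ≤b = ℕ.+-cancelʳ-≤ (6 * N * κ) κ b (ℕ.≤-trans (ℕ.≤-reflexive (sym T-value))
          (ℕ.≤-trans T≤ (ℕ.+-monoʳ-≤ b (ℕ.*-monoˡ-≤ κ Φ≤))))
        more : x ≤ n → ∃₂ λ b₁ b₂ → 4 + (b₁ + b₂) ≤ b × Safe (ParentInv s′ b₂) b₁ (parentBody ∷ []) σ
        more x≤n = parent-cost + 0 , b ℕ.∸ budget ,
          ℕ.≤-trans (ℕ.≤-reflexive (drop-zero parent-cost (b ℕ.∸ budget)))
           (ℕ.≤-trans (ℕ.+-monoˡ-≤ (b ℕ.∸ budget) parent-cost≤) (ℕ.≤-reflexive (ℕ.m+[n∸m]≡n budget≤b))) ,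
          run {κ = []} (parent-ok base st (es , ec) achieved) λ {σ′} post _ _ → end (next σ′ post)
          where
          open Parent s′ x x≤n s≤ hiding (s)
          x′ = x + (s + s)
          drop-zero : ∀ a b → 4 + (a + 0 + b) ≡ 4 + (a + b)
          drop-zero = ℕ-solve-∀
          x′≡ : x′ ≡ suc q * (s + s)
          x′≡ = ℕ.+-comm x (s + s)
          spent : budget + Φ s′ x * κ ≤ Φ s′ x′ * κ
          spent = ℕ.≤-trans (ℕ.≤-reflexive (sym (ℕ.*-distribʳ-+ κ (4 * s + (r₁ + r₂)) (Φ s′ x)))) (ℕ.*-monoˡ-≤ κ (Φ-step s′ x x≤n s≤))
          budget≤b : budget ≤ b
          budget≤b = ℕ.+-cancelʳ-≤ (Φ s′ x * κ) budget b (ℕ.≤-trans spent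
            (ℕ.≤-trans (ℕ.*-monoˡ-≤ κ (Φ-bound s′ x x≤n s≤)) (ℕ.≤-trans (ℕ.m≤n+m (6 * N * κ) κ)
              (ℕ.≤-trans (ℕ.≤-reflexive (sym T-value)) T≤))))
          next : ∀ σ′ → ParentPost (arrays σ aOut) σ′ → ParentInv s′ (b ℕ.∸ budget) σ′
          next σ′ post@(ec′ , ach , low , _) = suc q , trans ec′ (cong +_ x′≡) , ach ,
            (λ i j l h → [ (λ c₀ → inj₁ (ℤ.≤-trans (low (i + j)) c₀)) , inj₂ ]′ (pending i j l h)) ,
            (λ i j l h i< → [ (λ i<x → [ (λ c₀ → inj₁ (ℤ.≤-trans (low (i + j)) c₀)) , inj₂ ]′ (held i j l h i<x)) ,
                              (λ x≤i → advance-cover s′ x x≤n s≤ {σ} {σ′} q refl pending post i j l h x≤i (ℕ.<-≤-trans i< (ℕ.≤-reflexive (sym x′≡)))) ]′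
                            (ℕ.<-≤-connex i x)) ,
            subst (λ z → Φ s′ z ≤ 6 * N) x′≡ (Φ-bound s′ x x≤n s≤) ,
            subst (λ z → T ≤ b ℕ.∸ budget + Φ s′ z * κ) x′≡ enough
            where
            enough : T ≤ b ℕ.∸ budget + Φ s′ x′ * κ
            enough = ℕ.≤-trans T≤ (ℕ.≤-trans (ℕ.≤-reflexive
                (trans (cong (λ z → z + Φ s′ x * κ) (sym (ℕ.m∸n+n≡m budget≤b))) (ℕ.+-assoc (b ℕ.∸ budget) budget _)))
              (ℕ.+-monoʳ-≤ (b ℕ.∸ budget) spent))

      LevelInv : ℕ → State → Set
      LevelInv μ σ = ∃ λ l → ∃ λ s′ → 2 ^ l ≡ suc s′ × vars σ vs ≡ + suc s′ × Achieved σ × Pending s′ σ ×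
                     suc ⌊log₂ suc n ⌋ ≤ l + μ

      level-step : ∀ {μ σ} → LevelInv μ σ → Base σ → Stored σ →
        ∃₂ λ u v → σ ⊢ var vs ⇓ u × σ ⊢ var vn ⊕ lit 1ℤ ⇓ v ×
        (u ≤ℤ v → ∃ λ μ′ → suc μ′ ≤ μ × Safe (LevelInv μ′) (4 + (T + (4 + 0))) (levelBody ∷ []) σ) ×
        (v ℤ.< u → Achieved σ × (∀ i j → lo i ≤ j → j < hi i → Covered σ i j))
      level-step {μ} {⟨ vs₀ , as ⟩} (l , s′ , el , es , achieved , pending , eμ) base@(e₀ , _) st =
        _ , _ , var es , add (var e₀) (lit 1ℤ) ,
        (λ h → more (ℕ.≤-trans (ℤ.drop‿+≤+ h) (ℕ.≤-reflexive (ℕ.+-comm n 1))) μ refl) ,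
        λ h → achieved , λ i j l h′ → [ (λ c₀ → c₀) , (λ held → contradiction (all-held (ℕ.≤-trans (s≤s (ℕ.≤-reflexive (ℕ.+-comm 1 n))) (ℤ.drop‿+<+ h)) held) λ ()) ]′ (pending i j l h′)
        where
        -- The last row of a block of more than n + 1 rows is beyond n, where `lo` is m + 1, so no
        -- column is full and nothing is left to hold.
        all-held : suc n < suc s′ → ∀ {i j} → Held s′ i j → 1 ≤ 0
        all-held n<s {i} {j} (q , _ , _ , lo≤j , j<hi) = contradiction
          (ℕ.<-≤-trans (ℕ.<-≤-trans j<hi (hi≤ _)) (ℕ.≤-trans (ℕ.≤-reflexive (sym (lo-far _ (ℕ.≤-trans (ℕ.≤-pred n<s) (ℕ.m≤n+m s′ _))))) lo≤j)) (ℕ.<-irrefl refl)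
        more : suc s′ ≤ suc n → ∀ μ₀ → μ ≡ μ₀ → ∃ λ μ′ → suc μ′ ≤ μ × Safe (LevelInv μ′) (4 + (T + (4 + 0))) (levelBody ∷ []) ⟨ vs₀ , as ⟩
        more s≤ zero refl = contradiction (ℕ.≤-trans (ℕ.≤-trans eμ (ℕ.≤-reflexive (ℕ.+-identityʳ l)))
          (ℕ.≤-trans (ℕ.≤-reflexive (trans (sym (⌊log₂[2^n]⌋≡n l)) (cong ⌊log₂_⌋ el))) (⌊log₂⌋-mono-≤ s≤))) (ℕ.<-irrefl refl)
        more s≤ (suc μ₁) refl = μ₁ , ℕ.≤-refl ,
          seq (assign {z = 0ℤ} (lit 0ℤ) z≤n
          (seq (run (loop (ParentInv s′)
              (λ {b₁} {σ₁} inv fr _ → parent-step s′ s≤ {b₁} {σ₁} inv (base-frame fr (refl , refl , refl , refl , refl , refl , refl) base) (stored fr) (trans (var≡ fr vs refl) es))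
              (0 , refl , achieved , pending , (λ _ _ _ _ ()) , Φ₀ , ℕ.m≤m+n T _))
            doubled)))
          where
          stored : ∀ {σ₁} → Frame (parentBody ∷ []) ⟨ update vs₀ vc 0ℤ , as ⟩ σ₁ → Stored σ₁
          stored fr = (λ i → trans (cong-app (arr≡ fr aA refl) i) (proj₁ st i)) , (λ i → trans (cong-app (arr≡ fr aB refl) i) (proj₂ st i))
          Φ₀ : Φ s′ 0 ≤ 6 * N
          Φ₀ = ℕ.≤-trans (ℕ.+-mono-≤ (lo≤ s′) (hi≤ 0)) (ℕ.≤-trans (ℕ.+-mono-≤ m+1≤N m+1≤N)
            (ℕ.≤-trans (ℕ.m≤m+n (N + N) (4 * N)) (ℕ.≤-reflexive (six N))))
            where
            m+1≤N : suc m ≤ N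
            m+1≤N = ℕ.≤-trans (ℕ.m≤n+m (suc m) (suc n)) (ℕ.≤-reflexive n+m+2)
            six : ∀ N → N + N + 4 * N ≡ 6 * N
            six = ℕ-solve-∀
          doubled : ∀ {σ′} → Achieved σ′ × Pending (s′ + suc s′) σ′ → Frame (while (var vc ≼ var vn) parentBody ∷ []) ⟨ update vs₀ vc 0ℤ , as ⟩ σ′ →
            Bounded σ′ → Safe (LevelInv μ₁) (4 + 0) (vs ≔ var vs ⊕ var vs ∷ []) σ′
          doubled {⟨ vs₂ , as₂ ⟩} (ach , pend) fr _ = assign {z = + suc (s′ + suc s′)} (add (var es₂) (var es₂))
            (ℕ.≤-trans (ℕ.+-mono-≤ s≤N (ℕ.≤-trans s≤N (ℕ.m≤m+n R 0))) (R≤ 2 (auto 2 16)))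
            (end (suc l , s′ + suc s′ , trans (cong (λ z → 2 * z) el) (cong (λ z → suc s′ + z) (ℕ.+-identityʳ (suc s′))) , refl , ach , pend ,
                  ℕ.≤-trans eμ (ℕ.≤-reflexive (ℕ.+-suc l μ₁))))
            where
            es₂ : vs₂ vs ≡ + suc s′
            es₂ = trans (var≡ fr vs refl) es
            s≤N : suc s′ ≤ R
            s≤N = ℕ.≤-trans s≤ (ℕ.≤-trans (ℕ.m≤m+n (suc n) (suc m)) (ℕ.≤-trans (ℕ.≤-reflexive n+m+2) N≤R))

      levels-ok : ∀ {σ} → Base σ → Stored σ → Achieved σ →
        Safe (λ σ′ → Achieved σ′ × (∀ i j → lo i ≤ j → j < hi i → Covered σ′ i j))
          (3 + suc (suc ⌊log₂ suc n ⌋) * (6 + (4 + (T + (4 + 0))))) (levels ∷ []) σ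
      levels-ok {⟨ vs₀ , as ⟩} base st achieved =
        seq (assign {z = 1ℤ} (lit 1ℤ) (ℕ.≤-trans (s≤s z≤n) 4≤B)
        (count (4 + (T + (4 + 0))) LevelInv (suc ⌊log₂ suc n ⌋)
          (λ { {σ = σ₁} inv fr _ → level-step {σ = σ₁} inv (base-frame fr (refl , refl , refl , refl , refl , refl , refl) base)
             ((λ i → trans (cong-app (arr≡ fr aA refl) i) (proj₁ st i)) , (λ i → trans (cong-app (arr≡ fr aB refl) i) (proj₂ st i))) })
          (0 , 0 , refl , refl , achieved ,
            -- With blocks of size one, every point of the region is held by its own row.
            (λ i j l h → inj₂ (i , ℕ.≤-reflexive (ℕ.*-identityʳ i) , ℕ.≤-reflexive (trans (cong suc (sym (ℕ.*-identityʳ i))) (ℕ.+-comm 1 _)) ,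
               subst (λ z → lo z ≤ j) (sym (trans (ℕ.+-identityʳ _) (ℕ.*-identityʳ i))) l , subst (λ z → j < hi z) (sym (ℕ.*-identityʳ i)) h)) ,
            ℕ.≤-refl)))

    f≡ : ∀ {i} → i ≤ n → f i ≡ fA i
    f≡ {i} h = proj₁ copied i (ℕ.≤-trans (s≤s h) f-fits) h

    g≡ : ∀ {j} → j ≤ m → g j ≡ gA j
    g≡ {j} h = proj₁ (proj₂ copied) j (ℕ.≤-<-trans (ℕ.+-monoʳ-≤ (suc n) h) g-fits)

    transport : ∀ {y y′ len} → (∀ {i} → i ≤ len → y i ≡ y′ i) → Scan.NearConvex y′ len dev → Scan.NearConvex y len dev
    transport eq nc p x v p≤x x≤v v≤len
      rewrite eq (ℕ.≤-trans p≤x (ℕ.≤-trans x≤v v≤len)) | eq (ℕ.≤-trans x≤v v≤len) | eq v≤len = nc p x v p≤x x≤v v≤len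

    convexify-cost≤ : convexify-cost ≤ N * 735
    convexify-cost≤ = ℕ.≤-trans
      (ℕ.+-monoʳ-≤ 7 (ℕ.+-mono-≤ (segment-cost≤ 0 n f-fits) (ℕ.+-monoʳ-≤ 6 (ℕ.+-monoˡ-≤ 0 (segment-cost≤ (suc n) m g-fits)))))
      (ℕ.≤-trans (ℕ.≤-reflexive (collect (N * 361))) (ℕ.≤-trans (ℕ.+-monoˡ-≤ _ (ℕ.*-monoʳ-≤ 13 (ℕ.≤-trans (s≤s z≤n) 2≤N))) (ℕ.≤-reflexive (total N))))
      where
      collect : ∀ a → 7 + (a + (6 + (a + 0))) ≡ 13 * 1 + 2 * a
      collect = ℕ-solve-∀
      total : ∀ N → 13 * N + 2 * (N * 361) ≡ N * 735
      total = ℕ-solve-∀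

    stairs-part merge-part : ℕ
    merge-part  = 9 + suc (suc (n + m)) * 106
    stairs-part = 6 + ((6 + suc (suc n + suc m) * 104) + (9 + ((6 + suc (suc n + suc m) * 104) + 0)))

    finish : ∀ {σ} → Base σ → vars σ vE ≡ + N → Blank σ →
      Safe Solved (convexify-cost + (1 + (merge-part + (1 + (stairs-part + (8 * G + 0)))))) (convexify ∷ merge ⨾ stairs ⨾ levels ∷ []) σ
    finish base eE blank = run (convexify-ok base eE) merging
      where
      merging : ∀ {σ₂} → ConvexifyPost σ₂ → Frame (convexify ∷ []) _ σ₂ → Bounded σ₂ →
        Safe Solved (1 + (merge-part + (1 + (stairs-part + (8 * G + 0))))) (merge ⨾ stairs ⨾ levels ∷ []) σ₂
      merging {σ₂} (E , eE₂ , approx) fr₂ _ = seq (run (merge-ok base₂ ((λ _ → refl) , λ _ → refl)) stairing)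
        where
        base₂ : Base σ₂
        base₂ = base-frame fr₂ (refl , refl , refl , refl , refl , refl , refl) base
        blank₂ : Blank σ₂
        blank₂ = blank-frame fr₂ refl refl blank
        p q : ℕ → ℤ
        p = arrays σ₂ aP
        q = λ j → arrays σ₂ aP (suc n + j)
        open Approximation approx
        open Relevant p q E approx
        4E≤ : 4 * E ≤ N * ω
        4E≤ = ℕ.≤-trans (ℕ.*-monoʳ-≤ 4 (E-small dev (transport f≡ f-near) (transport g≡ g-near))) (ℕ.≤-reflexive (swap N (suc dev)))
          where
          swap : ∀ N d → 4 * (N * d) ≡ N * (4 * d)
          swap = ℕ-solve-∀
        stairing : ∀ {σ₃} → Merged (suc (n + m)) σ₃ → Frame (merge ∷ []) σ₂ σ₃ → Bounded σ₃ →
          Safe Solved (1 + (stairs-part + (8 * G + 0))) (stairs ⨾ levels ∷ []) σ₃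
        stairing {σ₃} merged fr₃ _ = seq (run (stairs-ok base₃
            ((λ i → cong-app (arr≡ fr₃ aP refl) i) , λ j → cong-app (arr≡ fr₃ aP refl) (suc n + j)) merged
            (trans (var≡ fr₃ vE refl) eE₂) (proj₁ blank₃) (proj₂ blank₃)) levelling)
          where
          base₃ : Base σ₃
          base₃ = base-frame fr₃ (refl , refl , refl , refl , refl , refl , refl) base₂
          blank₃ : Blank σ₃
          blank₃ = blank-frame fr₃ refl refl blank₂
          levelling : ∀ {σ₄} → StairsPost σ₄ → Frame (stairs ∷ []) σ₃ σ₄ → Bounded σ₄ → Safe Solved (8 * G + 0) (levels ∷ []) σ₄
          levelling {σ₄} (lo , hi , stored-lo , stored-hi , lo-crossings , hi-crossings) fr₄ _ =
            run {κ = []} (weaken-safe level-cost (levels-ok base₄ (stored-lo , stored-hi) achieved))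
              λ {σ₅} (ach , covered) _ _ → end (solved σ₅ ach covered)
            where
            open Region lo-crossings hi-crossings
            module Lo = Crossed lo-crossings
            module Hi = Crossed hi-crossings
            open Cover H lo hi Lo.mono Hi.mono Lo.at-most Hi.at-most Lo.far (window ω 4E≤) using (Covered; levels-ok; T; T-value)
            base₄ : Base σ₄
            base₄ = base-frame fr₄ (refl , refl , refl , refl , refl , refl , refl) base₃
            achieved : Achieved σ₄
            achieved k k≤ = α k , β k , Separating.a≤n (separating k≤) , Separating.b≤m (separating k≤) , α+β k ,
              trans (cong-app (arr≡ fr₄ aOut refl) k) (proj₂ (proj₂ (merged k (s≤s k≤))))
            level-cost : 3 + suc (suc ⌊log₂ suc n ⌋) * (6 + (4 + (T + (4 + 0)))) ≤ 8 * G
            level-cost = begin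
              3 + l * (6 + (4 + (T + (4 + 0))))          ≡⟨ cong (λ t → 3 + l * (6 + (4 + (t + (4 + 0))))) (trans T-value (cong (λ k → k + 6 * N * k) κ-value)) ⟩
              3 + l * (6 + (4 + (κ′ + 6 * N * κ′ + 4)))  ≤⟨ ℕ.+-monoˡ-≤ _ (ℕ.*-monoʳ-≤ 3 {1} {l} (s≤s z≤n)) ⟩
              3 * l + l * (6 + (4 + (κ′ + 6 * N * κ′ + 4))) ≡⟨ collect l κ′ N ⟩
              l * (17 + (κ′ + 6 * N * κ′))               ≤⟨ ℕ.*-monoʳ-≤ l (ℕ.+-monoˡ-≤ _ (ℕ.≤-trans (ℕ.≤ᵇ⇒≤ 17 230 _) 230≤κ′)) ⟩
              l * (κ′ + (κ′ + 6 * N * κ′))               ≤⟨ ℕ.*-monoʳ-≤ l (ℕ.+-mono-≤ κ≤Nκ (ℕ.+-monoˡ-≤ (6 * N * κ′) κ≤Nκ)) ⟩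
              l * (N * κ′ + (N * κ′ + 6 * N * κ′))       ≡⟨ total l κ′ N ⟩
              8 * G                                      ∎
              where
              open ℕ.≤-Reasoning
              l : ℕ
              l = 2 + ⌊log₂ suc n ⌋
              230≤κ′ : 230 ≤ κ′
              230≤κ′ = ℕ.≤-trans (ℕ.m≤m+n 230 (c * L)) (ℕ.m≤m+n (230 + c * L) _)
              κ≤Nκ : κ′ ≤ N * κ′
              κ≤Nκ = ℕ.m≤n*m κ′ N {{ℕ.>-nonZero (ℕ.≤-trans (s≤s z≤n) 2≤N)}}
              collect : ∀ l k N → 3 * l + l * (6 + (4 + (k + 6 * N * k + 4))) ≡ l * (17 + (k + 6 * N * k))
              collect = ℕ-solve-∀
              total : ∀ l k N → l * (N * k + (N * k + 6 * N * k)) ≡ 8 * (l * (N * k))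
              total = ℕ-solve-∀
            solved : ∀ σ₅ → Achieved σ₅ → (∀ i j → lo i ≤ j → j < hi i → Covered σ₅ i j) → Solved σ₅
            solved σ₅ ach covered = reached , minimal
              where
              reached : ∀ k → k ≤ n + m → ∃₂ λ i j → i ≤ n × j ≤ m × i + j ≡ k × arrays σ₅ aOut k ≡ fA i ℤ.+ gA j
              reached k k≤ with ach k k≤
              ... | i , j , i≤n , j≤m , e , eq = i , j , i≤n , j≤m , e , trans eq (cong₂ ℤ._+_ (f≡ i≤n) (g≡ j≤m))
              minimal : ∀ i j → i ≤ n → j ≤ m → arrays σ₅ aOut (i + j) ≤ℤ fA i ℤ.+ gA j
              minimal i j i≤n j≤m = subst (arrays σ₅ aOut (i + j) ≤ℤ_) (cong₂ ℤ._+_ (f≡ i≤n) (g≡ j≤m))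
                ([ (λ { (l , h) → covered i j l h }) ,
                   (λ o → ℤ.≤-trans (subst (λ k → arrays σ₅ aOut k ≤ℤ f (α (i + j)) ℤ.+ g (β (i + j))) (α+β (i + j))
                              (covered (α (i + j)) (β (i + j)) (proj₁ (path-inside k≤)) (proj₂ (path-inside k≤))))
                            (path-wins i≤n j≤m (outside i≤n j≤m o))) ]′ (located i j))
                where
                k≤ : i + j ≤ n + m
                k≤ = ℕ.+-mono-≤ i≤n j≤m

  program-ok : ∀ {σ} → Inputs σ → vars σ vt ≡ 0ℤ → vars σ vM ≡ 0ℤ → (∀ i → arrays σ aX i ≡ 0ℤ) → Blank σ →
    Safe Solved (15 * G) (program ∷ []) σ
  program-ok {σ} inputs et eM blankX blank = weaken-safe cost (seq (run (copy-ok inputs et eM blankX) continue))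
    where
    open ℕ.≤-Reasoning
    1≤N : 1 ≤ N
    1≤N = ℕ.≤-trans (s≤s z≤n) 2≤N
    continue : ∀ {σ₁} → CopyPost σ₁ → Frame (copyAll ∷ []) σ σ₁ → Bounded σ₁ →
      Safe Solved (1 + (N * 735 + (1 + ((9 + suc (suc (n + m)) * 106) + (1 +
        ((6 + ((6 + suc (suc n + suc m) * 104) + (9 + ((6 + suc (suc n + suc m) * 104) + 0)))) + (8 * G + 0)))))))
        (convexify ⨾ merge ⨾ stairs ⨾ levels ∷ []) σ₁
    continue {σ₁} (M₀ , copied , en , em , (eN , eo) , eM₁ , eK , eE) fr _ =
      seq (weaken-safe (ℕ.+-monoˡ-≤ _ (After.convexify-cost≤ M₀ X copied)) (After.finish M₀ X copied (en , em , eN , eo , eM₁ , eK , refl) eE (blank-frame fr refl refl blank)))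
      where X = arrays σ₁ aX
    cost : _ ≤ 15 * G
    cost = begin
      1 + ((20 + (suc N * 56 + 20)) + (1 + (N * 735 + (1 + ((9 + suc (suc (n + m)) * 106) + (1 +
        ((6 + ((6 + suc (suc n + suc m) * 104) + (9 + ((6 + suc (suc n + suc m) * 104) + 0)))) + (8 * G + 0))))))))
        ≡⟨ cong₂ (λ a b → 1 + ((20 + (suc N * 56 + 20)) + (1 + (N * 735 + (1 + ((9 + a * 106) + (1 +
        ((6 + ((6 + suc b * 104) + (9 + ((6 + suc b * 104) + 0)))) + (8 * G + 0))))))))) {suc (suc (n + m))} {N} {suc n + suc m} {N} (ℕ.+-comm 2 (n + m)) (trans (cong suc (ℕ.+-suc n m)) (ℕ.+-comm 2 (n + m))) ⟩
      1 + ((20 + (suc N * 56 + 20)) + (1 + (N * 735 + (1 + ((9 + N * 106) + (1 +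
        ((6 + ((6 + suc N * 104) + (9 + ((6 + suc N * 104) + 0)))) + (8 * G + 0))))))))
        ≡⟨ collect N G ⟩
      344 * 1 + N * 1105 + 8 * G  ≤⟨ ℕ.+-monoˡ-≤ (8 * G) (ℕ.+-monoˡ-≤ (N * 1105) (ℕ.*-monoʳ-≤ 344 1≤N)) ⟩
      344 * N + N * 1105 + 8 * G  ≡⟨ cong (λ z → z + 8 * G) (total N) ⟩
      -- Everything before the levels is linear in N; enlarging 1449 to 1610 = 7 * 230 puts it under
      -- 7G.
      N * 1449 + 8 * G            ≤⟨ ℕ.+-monoˡ-≤ (8 * G) (ℕ.*-monoʳ-≤ N (ℕ.≤ᵇ⇒≤ 1449 1610 _)) ⟩
      N * 1610 + 8 * G            ≡⟨ cong (λ z → z + 8 * G) (seven N) ⟩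
      7 * (1 * (N * 230)) + 8 * G ≤⟨ ℕ.+-monoˡ-≤ (8 * G) (ℕ.*-monoʳ-≤ 7 (ℕ.*-mono-≤ {1} {2 + ⌊log₂ suc n ⌋} (s≤s z≤n) (ℕ.*-monoʳ-≤ N 230≤κ′))) ⟩
      7 * G + 8 * G               ≡⟨ fifteen G ⟩
      15 * G                      ∎
      where
      230≤κ′ : 230 ≤ κ′
      230≤κ′ = ℕ.≤-trans (ℕ.m≤m+n 230 (c * L)) (ℕ.m≤m+n (230 + c * L) _)
      collect : ∀ N G → 1 + ((20 + (suc N * 56 + 20)) + (1 + (N * 735 + (1 + ((9 + N * 106) + (1 +
        ((6 + ((6 + suc N * 104) + (9 + ((6 + suc N * 104) + 0)))) + (8 * G + 0)))))))) ≡ 344 * 1 + N * 1105 + 8 * G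
      collect = ℕ-solve-∀
      total : ∀ N → 344 * N + N * 1105 ≡ N * 1449
      total = ℕ-solve-∀
      seven : ∀ N → N * 1610 ≡ 7 * (1 * (N * 230))
      seven = ℕ-solve-∀
      fifteen : ∀ G → 7 * G + 8 * G ≡ 15 * G
      fifteen = ℕ-solve-∀

-- From convex rational approximations to near convexity.

extend : ∀ {n} → Vector ℤ n → ℕ → ℤ
extend f = overwrite (toList f) (λ _ → 0ℤ)

extend-toℕ : ∀ {n} (f : Vector ℤ n) i → extend f (toℕ i) ≡ f i
extend-toℕ f Fin.zero    = refl
extend-toℕ f (Fin.suc i) = extend-toℕ (λ j → f (Fin.suc j)) i

extend-bounded : ∀ {n M} (f : Vector ℤ n) → BoundedBy M f → ∀ t → ∣ extend f t ∣ ≤ M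
extend-bounded {zero}  f h t       = z≤n
extend-bounded {suc n} f h zero    = h Fin.zero
extend-bounded {suc n} f h (suc t) = extend-bounded (λ j → f (Fin.suc j)) (λ j → h (Fin.suc j)) t

by-ℚ : ∀ {l r a b} → l ℚ.≤ r → b ℚ.- a ≡ r ℚ.- l → a ℚ.≤ b
by-ℚ {l} {r} {a} {b} h e = ℚ.≤-trans (ℚ.≤-reflexive (split a l)) (ℚ.≤-trans (ℚ.+-monoʳ-≤ (a ℚ.- l) h)
  (ℚ.≤-reflexive (trans (join a l r) (trans (cong (λ z → a ℚ.+ z) (sym e)) (cancel a b)))))
  where
  split : ∀ a l → a ≡ (a ℚ.- l) ℚ.+ l
  split = ℚ-solve 2 (λ a l → a := (a :- l) :+ l) refl
  join : ∀ a l r → (a ℚ.- l) ℚ.+ r ≡ a ℚ.+ (r ℚ.- l)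
  join = ℚ-solve 3 (λ a l r → (a :- l) :+ r := a :+ (r :- l)) refl
  cancel : ∀ a b → a ℚ.+ (b ℚ.- a) ≡ b
  cancel = ℚ-solve 2 (λ a b → a :+ (b :- a) := b) refl

scale : ∀ n {a b} → a ℚ.≤ b → ℕ→ℚ n ℚ.* a ℚ.≤ ℕ→ℚ n ℚ.* b
scale n h = ℚ.*-monoˡ-≤-nonNeg (ℕ→ℚ n) {{ℚ.nonNegative (0≤ℕ→ℚ n)}} h

module Chord (F : ℕ → ℚ) where

  rise≤ : ∀ p a δ → (∀ z → z < a → F (suc (p + z)) ℚ.- F (p + z) ℚ.≤ δ) →
          F (p + a) ℚ.- F p ℚ.≤ ℕ→ℚ a ℚ.* δ
  rise≤ p zero δ h rewrite ℕ.+-identityʳ p = ℚ.≤-reflexive (trans (ℚ.+-inverseʳ (F p)) (sym (ℚ.*-zeroˡ δ)))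
  rise≤ p (suc a) δ h rewrite ℕ.+-suc p a | ℕ→ℚ-+ 1 a =
    by-ℚ (ℚ.+-mono-≤ (rise≤ p a δ (λ z l → h z (ℕ.m≤n⇒m≤1+n l))) (h a ℕ.≤-refl))
       (ℚ-solve 5 (λ x y z a δ → (con 1ℚ :+ a) :* δ :- (x :- z) := (a :* δ :+ δ) :- ((y :- z) :+ (x :- y))) refl
          (F (suc (p + a))) (F (p + a)) (F p) (ℕ→ℚ a) δ)

  ≤rise : ∀ p a δ → (∀ z → z < a → δ ℚ.≤ F (suc (p + z)) ℚ.- F (p + z)) →
          ℕ→ℚ a ℚ.* δ ℚ.≤ F (p + a) ℚ.- F p
  ≤rise p zero δ h rewrite ℕ.+-identityʳ p = ℚ.≤-reflexive (trans (ℚ.*-zeroˡ δ) (sym (ℚ.+-inverseʳ (F p))))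
  ≤rise p (suc a) δ h rewrite ℕ.+-suc p a | ℕ→ℚ-+ 1 a =
    by-ℚ (ℚ.+-mono-≤ (≤rise p a δ (λ z l → h z (ℕ.m≤n⇒m≤1+n l))) (h a ℕ.≤-refl))
       (ℚ-solve 5 (λ x y z a δ → (x :- z) :- (con 1ℚ :+ a) :* δ := ((y :- z) :+ (x :- y)) :- (a :* δ :+ δ)) refl
          (F (suc (p + a))) (F (p + a)) (F p) (ℕ→ℚ a) δ)

  module _ {n : ℕ} (convex : ∀ x z → x ≤ z → z < n → F (suc x) ℚ.- F x ℚ.≤ F (suc z) ℚ.- F z) where

    -- The increment just before p + a is at least every earlier and at most every later increment.
    -- Summing them on both sides and weighting the two sums with b and a cancels it.
    chord : ∀ p a b → p + a + b ≤ n →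
      ℕ→ℚ (a + b) ℚ.* F (p + a) ℚ.≤ ℕ→ℚ b ℚ.* F p ℚ.+ ℕ→ℚ a ℚ.* F (p + a + b)
    chord p zero b h rewrite ℕ.+-identityʳ p = ℚ.≤-reflexive
      (ℚ-solve 3 (λ b x y → b :* x := b :* x :+ con 0ℚ :* y) refl (ℕ→ℚ b) (F p) (F (p + b)))
    chord p (suc a) b h = subst (λ w → w ℚ.* F (p + suc a) ℚ.≤ ℕ→ℚ b ℚ.* F p ℚ.+ ℕ→ℚ (suc a) ℚ.* F (p + suc a + b))
        (sym (ℕ→ℚ-+ (suc a) b))
      (by-ℚ (ℚ.+-mono-≤ (scale b (rise≤ p (suc a) δ before)) (scale (suc a) (≤rise (p + suc a) b δ after)))
        (ℚ-solve 6 (λ a b δ x y z → (b :* y :+ a :* z) :- (a :+ b) :* x := (b :* (a :* δ) :+ a :* (z :- x)) :- (b :* (x :- y) :+ a :* (b :* δ))) refl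
          (ℕ→ℚ (suc a)) (ℕ→ℚ b) δ (F (p + suc a)) (F p) (F (p + suc a + b))))
      where
      δ = F (suc (p + a)) ℚ.- F (p + a)
      p+a<n : p + a < n
      p+a<n = ℕ.≤-trans (ℕ.≤-reflexive (sym (ℕ.+-suc p a))) (ℕ.≤-trans (ℕ.m≤m+n _ b) h)
      before : ∀ z → z < suc a → F (suc (p + z)) ℚ.- F (p + z) ℚ.≤ δ
      before z (s≤s l) = convex (p + z) (p + a) (ℕ.+-monoʳ-≤ p l) p+a<n
      after : ∀ z → z < b → δ ℚ.≤ F (suc (p + suc a + z)) ℚ.- F (p + suc a + z)
      after z l = convex (p + a) (p + suc a + z) (ℕ.≤-trans (ℕ.+-monoʳ-≤ p (ℕ.n≤1+n a)) (ℕ.m≤m+n _ z))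
        (ℕ.<-≤-trans (ℕ.+-monoʳ-< (p + suc a) l) h)

module Arrays {n : ℕ} (f : Vector ℤ (suc n)) (F : Vector ℚ (suc n)) (Δ : ℚ)
              (convex : Convex F) (approx : ApproximatedBy f F Δ) where

  index : ∀ {i} → i ≤ n → Fin (suc n)
  index i≤n = fromℕ< (s≤s i≤n)

  F̂ : ℕ → ℚ
  F̂ i with i ℕ.≤? n
  ... | yes i≤n = F (index i≤n)
  -- A filler outside 0..n; convexity and closeness are claimed only inside.
  ... | no _    = 0ℚ

  F̂-toℕ : ∀ k → F̂ (toℕ k) ≡ F k
  F̂-toℕ k with toℕ k ℕ.≤? n
  ... | yes le = cong F (Fin.fromℕ<-toℕ k (s≤s le))
  ... | no ¬le = contradiction (ℕ.≤-pred (Fin.toℕ<n k)) ¬le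

  F̂-convex : ∀ x z → x ≤ z → z < n → F̂ (suc x) ℚ.- F̂ x ℚ.≤ F̂ (suc z) ℚ.- F̂ z
  F̂-convex x z x≤z z<n = subst₂ ℚ._≤_ (slope x<n) (slope z<n)
    (convex (fromℕ< x<n) (fromℕ< z<n) (subst₂ _≤_ (sym (Fin.toℕ-fromℕ< x<n)) (sym (Fin.toℕ-fromℕ< z<n)) x≤z))
    where
    x<n = ℕ.≤-<-trans x≤z z<n
    slope : ∀ {x} (h : x < n) → diff F (fromℕ< h) ≡ F̂ (suc x) ℚ.- F̂ x
    slope {x} h = cong₂ ℚ._-_
      (trans (sym (F̂-toℕ (Fin.suc (fromℕ< h)))) (cong (λ i → F̂ (suc i)) (Fin.toℕ-fromℕ< h)))
      (trans (sym (F̂-toℕ (inject₁ (fromℕ< h)))) (cong F̂ (trans (Fin.toℕ-inject₁ (fromℕ< h)) (Fin.toℕ-fromℕ< h))))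

  y : ℕ → ℤ
  y = extend f

  close : ∀ {i} → i ≤ n → F̂ i ℚ.≤ ℤ→ℚ (y i) × ℤ→ℚ (y i) ℚ.≤ F̂ i ℚ.+ Δ
  close {i} h = subst (λ i → F̂ i ℚ.≤ ℤ→ℚ (y i) × ℤ→ℚ (y i) ℚ.≤ F̂ i ℚ.+ Δ) (Fin.toℕ-fromℕ< (s≤s h))
    (subst₂ (λ a b → a ℚ.≤ ℤ→ℚ b × ℤ→ℚ b ℚ.≤ a ℚ.+ Δ) (sym (F̂-toℕ k)) (sym (extend-toℕ f k))
      (by-ℚ (proj₁ (approx k)) (ℚ-solve 2 (λ x y → x :- y := (x :- y) :- con 0ℚ) refl (ℤ→ℚ (f k)) (F k)) ,
       by-ℚ (proj₂ (approx k)) (ℚ-solve 3 (λ x y d → (y :+ d) :- x := d :- (x :- y)) refl (ℤ→ℚ (f k)) (F k) Δ)))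
    where k = index h

  -- The value is at most F + Δ, F is below its chord, and the chord of F is below the chord of f
  -- because F ≤ f. The denominators are then cleared and the inequality pulled back to the
  -- integers.
  near-convex : ∀ d → Δ ℚ.≤ ℕ→ℚ d → Scan.NearConvex y n d
  near-convex d Δ≤d p x v p≤x x≤v v≤n = subst₂ Goal (ℕ.m+[n∸m]≡n p≤x)
    (trans (cong (λ z → z + b) (ℕ.m+[n∸m]≡n p≤x)) (ℕ.m+[n∸m]≡n x≤v)) goal
    where
    a = x ℕ.∸ p
    b = v ℕ.∸ x
    Goal : ℕ → ℕ → Set
    Goal x v = (+ v ℤ.- + p) ℤ.* y x ℤ.≤ (+ v ℤ.- + x) ℤ.* y p ℤ.+ (+ x ℤ.- + p) ℤ.* y v ℤ.+ (+ v ℤ.- + p) ℤ.* + d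
    x≡ : p + a ≡ x
    x≡ = ℕ.m+[n∸m]≡n p≤x
    v≡ : p + a + b ≡ v
    v≡ = trans (cong (λ z → z + b) x≡) (ℕ.m+[n∸m]≡n x≤v)
    minus : ∀ p a → + (p + a) ℤ.- + p ≡ + a
    minus p a = trans (cong (λ z → z ℤ.- + p) (ℤ.+-comm (+ p) (+ a))) (trans (ℤ.+-assoc (+ a) (+ p) (ℤ.- (+ p))) (trans (cong (λ z → + a ℤ.+ z) (ℤ.+-inverseʳ (+ p))) (ℤ.+-identityʳ (+ a))))
    x′ = p + a
    v′ = p + a + b
    core : ℕ→ℚ (a + b) ℚ.* ℤ→ℚ (y x′) ℚ.≤
           ℕ→ℚ b ℚ.* ℤ→ℚ (y p) ℚ.+ ℕ→ℚ a ℚ.* ℤ→ℚ (y v′) ℚ.+ ℕ→ℚ (a + b) ℚ.* ℕ→ℚ d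
    core = begin
      ℕ→ℚ (a + b) ℚ.* ℤ→ℚ (y x′)               ≤⟨ scale (a + b) (proj₂ (close x′≤n)) ⟩
      ℕ→ℚ (a + b) ℚ.* (F̂ x′ ℚ.+ Δ)             ≡⟨ ℚ.*-distribˡ-+ (ℕ→ℚ (a + b)) (F̂ x′) Δ ⟩
      ℕ→ℚ (a + b) ℚ.* F̂ x′ ℚ.+ ℕ→ℚ (a + b) ℚ.* Δ
        ≤⟨ ℚ.+-mono-≤ (Chord.chord F̂ F̂-convex p a b v′≤n) (scale (a + b) Δ≤d) ⟩
      ℕ→ℚ b ℚ.* F̂ p ℚ.+ ℕ→ℚ a ℚ.* F̂ v′ ℚ.+ ℕ→ℚ (a + b) ℚ.* ℕ→ℚ d
        ≤⟨ ℚ.+-monoˡ-≤ (ℕ→ℚ (a + b) ℚ.* ℕ→ℚ d) (ℚ.+-mono-≤ (scale b (proj₁ (close p≤n))) (scale a (proj₁ (close v′≤n)))) ⟩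
      ℕ→ℚ b ℚ.* ℤ→ℚ (y p) ℚ.+ ℕ→ℚ a ℚ.* ℤ→ℚ (y v′) ℚ.+ ℕ→ℚ (a + b) ℚ.* ℕ→ℚ d ∎
      where
      open ℚ.≤-Reasoning
      v′≤n : v′ ≤ n
      v′≤n = ℕ.≤-trans (ℕ.≤-reflexive v≡) v≤n
      x′≤n : x′ ≤ n
      x′≤n = ℕ.≤-trans (ℕ.m≤m+n x′ b) v′≤n
      p≤n : p ≤ n
      p≤n = ℕ.≤-trans (ℕ.m≤m+n p a) x′≤n
    goal : Goal x′ v′
    goal = subst₂ (λ w s → w ℤ.* y x′ ℤ.≤ (+ v′ ℤ.- + x′) ℤ.* y p ℤ.+ s ℤ.* y v′ ℤ.+ w ℤ.* + d)
      (sym (trans (cong (λ z → + z ℤ.- + p) (ℕ.+-assoc p a b)) (minus p (a + b)))) (sym (minus p a))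
      (subst (λ t → + (a + b) ℤ.* y x′ ℤ.≤ t ℤ.* y p ℤ.+ + a ℤ.* y v′ ℤ.+ + (a + b) ℤ.* + d) (sym (minus x′ b))
        (ℤ→ℚ-cancel (subst₂ ℚ._≤_ (sym (ℤ→ℚ-* (+ (a + b)) (y x′)))
          (sym (trans (ℤ→ℚ-+ (+ b ℤ.* y p ℤ.+ + a ℤ.* y v′) (+ (a + b) ℤ.* + d))
            (cong₂ ℚ._+_ (trans (ℤ→ℚ-+ (+ b ℤ.* y p) (+ a ℤ.* y v′)) (cong₂ ℚ._+_ (ℤ→ℚ-* (+ b) (y p)) (ℤ→ℚ-* (+ a) (y v′))))
              (ℤ→ℚ-* (+ (a + b)) (+ d))))) core)))

  Δ≥0 : 0ℚ ℚ.≤ Δ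
  Δ≥0 = ℚ.≤-trans (proj₁ (approx Fin.zero)) (proj₂ (approx Fin.zero))

-- Logarithms and the total running time.

<2^1+log : ∀ n → n < 2 ^ suc ⌊log₂ n ⌋
<2^1+log n = ℕ.≰⇒> λ le → ℕ.<-irrefl refl
  (ℕ.≤-trans (ℕ.≤-reflexive (sym (⌊log₂[2^n]⌋≡n (suc ⌊log₂ n ⌋)))) (⌊log₂⌋-mono-≤ le))

log-^ : ∀ n k → ⌊log₂ (n ^ k) ⌋ ≤ suc ⌊log₂ n ⌋ * k
log-^ n k = begin
  ⌊log₂ (n ^ k) ⌋                       ≤⟨ ⌊log₂⌋-mono-≤ (ℕ.^-monoˡ-≤ k (ℕ.<⇒≤ (<2^1+log n))) ⟩
  ⌊log₂ ((2 ^ suc ⌊log₂ n ⌋) ^ k) ⌋     ≡⟨ cong ⌊log₂_⌋ (ℕ.^-*-assoc 2 (suc ⌊log₂ n ⌋) k) ⟩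
  ⌊log₂ (2 ^ (suc ⌊log₂ n ⌋ * k)) ⌋     ≡⟨ ⌊log₂[2^n]⌋≡n (suc ⌊log₂ n ⌋ * k) ⟩
  suc ⌊log₂ n ⌋ * k                     ∎
  where open ℕ.≤-Reasoning

log-double : ∀ k n → .{{_ : NonZero n}} → ⌊log₂ (2 ^ k * n) ⌋ ≡ k + ⌊log₂ n ⌋
log-double zero    n = cong ⌊log₂_⌋ (ℕ.+-identityʳ n)
log-double (suc k) n = trans (cong ⌊log₂_⌋ (ℕ.*-assoc 2 (2 ^ k) n))
  (trans (⌊log₂[2*b]⌋≡1+⌊log₂b⌋ (2 ^ k * n) {{ℕ.m*n≢0 (2 ^ k) n {{ℕ.m^n≢0 2 k}}}}) (cong suc (log-double k n)))

^-distribʳ-* : ∀ a b k → (a * b) ^ k ≡ a ^ k * b ^ k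
^-distribʳ-* a b zero    = refl
^-distribʳ-* a b (suc k) = trans (cong (λ z → a * b * z) (^-distribʳ-* a b k)) (interchange a b (a ^ k) (b ^ k))
  where
  interchange : ∀ a b c d → a * b * (c * d) ≡ a * c * (b * d)
  interchange = ℕ-solve-∀

-- After replacing N and M by V the left side is at most 128 V^4 for V ≥ 1, and 128 = 2^7 ≤ V^7.
large≤V^11 : ∀ N M V → N ≤ V → M ≤ V → 2 ≤ V →
  2 * ((2 * N) * suc (4 * (N * (M * M))) + M + N * (M * M)) +
    (16 * (N * suc (3 * M)) + N * suc (4 * suc (2 * M))) ≤ V ^ 11
large≤V^11 N M V N≤V M≤V 2≤V = begin
  2 * ((2 * N) * suc (4 * (N * (M * M))) + M + N * (M * M)) + (16 * (N * suc (3 * M)) + N * suc (4 * suc (2 * M)))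
    ≤⟨ ℕ.+-mono-≤ (ℕ.*-monoʳ-≤ 2 (ℕ.+-mono-≤ (ℕ.+-mono-≤ (ℕ.*-mono-≤ (ℕ.*-monoʳ-≤ 2 N≤V) (s≤s (ℕ.*-monoʳ-≤ 4 cube))) M≤V) cube))
                  (ℕ.+-mono-≤ (ℕ.*-monoʳ-≤ 16 (ℕ.*-mono-≤ N≤V (s≤s (ℕ.*-monoʳ-≤ 3 M≤V)))) (ℕ.*-mono-≤ N≤V (s≤s (ℕ.*-monoʳ-≤ 4 (s≤s (ℕ.*-monoʳ-≤ 2 M≤V)))))) ⟩
  2 * ((2 * V) * suc (4 * (V * (V * V))) + V + V * (V * V)) + (16 * (V * suc (3 * V)) + V * suc (4 * suc (2 * V)))
    ≤⟨ quartic V (ℕ.≤-trans (s≤s z≤n) 2≤V) ⟩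
  128 * V ^ 4     ≤⟨ ℕ.*-monoˡ-≤ (V ^ 4) (ℕ.^-monoˡ-≤ 7 2≤V) ⟩
  V ^ 7 * V ^ 4   ≡⟨ ℕ.^-distribˡ-+-* V 7 4 ⟨
  V ^ 11          ∎
  where
  open ℕ.≤-Reasoning
  cube : N * (M * M) ≤ V * (V * V)
  cube = ℕ.*-mono-≤ N≤V (ℕ.*-mono-≤ M≤V M≤V)
  quartic : ∀ V → 1 ≤ V → 2 * ((2 * V) * suc (4 * (V * (V * V))) + V + V * (V * V)) + (16 * (V * suc (3 * V)) + V * suc (4 * suc (2 * V))) ≤ 128 * V ^ 4
  -- In terms of t = V - 1 the difference of the two sides has nonnegative coefficients, listed
  -- here.
  quartic (suc t) _ = ℕ.≤-trans (ℕ.m≤m+n _ (27 + t * 303 + t * t * 610 + t * t * t * 446 + t * t * t * t * 112)) (ℕ.≤-reflexive (expand t))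
    where
    expand : ∀ t → 2 * ((2 * suc t) * suc (4 * (suc t * (suc t * suc t))) + suc t + suc t * (suc t * suc t)) +
      (16 * (suc t * suc (3 * suc t)) + suc t * suc (4 * suc (2 * suc t))) + (27 + t * 303 + t * t * 610 + t * t * t * 446 + t * t * t * t * 112)
      ≡ 128 * (suc t * (suc t * (suc t * (suc t * 1))))
    expand = ℕ-solve-∀

∣⌈⌉∣≥ : ∀ {x} k → ℕ→ℚ k ℚ.≤ x → k ≤ ∣ ceiling x ∣
∣⌈⌉∣≥ {x} k h = ℤ.drop‿+≤+ (ℤ.≤-trans k≤ (ℤ.≤-reflexive (sym (ℤ.0≤i⇒+∣i∣≡i (ℤ.≤-trans (ℤ.+≤+ z≤n) k≤)))))
  where
  k≤ : + k ℤ.≤ ceiling x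
  k≤ = ℤ→ℚ-cancel (ℚ.≤-trans h (≤ceiling x))

∣⌈⌉∣-bounds : ∀ {x} → 0ℚ ℚ.≤ x → x ℚ.≤ ℕ→ℚ ∣ ceiling x ∣ × ℕ→ℚ ∣ ceiling x ∣ ℚ.≤ x ℚ.+ 1ℚ
∣⌈⌉∣-bounds {x} 0≤x = subst (λ z → x ℚ.≤ ℤ→ℚ z × ℤ→ℚ z ℚ.≤ x ℚ.+ 1ℚ) (sym (ℤ.0≤i⇒+∣i∣≡i 0≤⌈x⌉)) (≤ceiling x , ceiling≤1+ x)
  where
  0≤⌈x⌉ : 0ℤ ℤ.≤ ceiling x
  0≤⌈x⌉ = ℤ→ℚ-cancel (ℚ.≤-trans 0≤x (≤ceiling x))

module Cost (c e U N d : ℕ) (T : ℚ) (2≤N : 2 ≤ N) (N≤T : ℕ→ℚ N ℚ.≤ T) (τ≤2T : ℕ→ℚ (N * suc d) ℚ.≤ ℕ→ℚ 2 ℚ.* T) where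

  Z ℓ τ κ₀ : ℕ
  Z  = ∣ ceiling T ∣ + U + 2
  ℓ  = ⌊log₂ Z ⌋
  τ  = N * suc d
  -- Includes the factors of both primitives, so that one constant serves the randomized and the
  -- deterministic claim.
  κ₀ = 230 + 5 * c + c * 662 ^ e

  N≤⌈T⌉ : N ≤ ∣ ceiling T ∣
  N≤⌈T⌉ = ∣⌈⌉∣≥ N N≤T

  1≤ℓ : 1 ≤ ℓ
  1≤ℓ = ⌊log₂⌋-mono-≤ {2} (ℕ.m≤n+m 2 (∣ ceiling T ∣ + U))

  1≤ℓ^ : ∀ k → 1 ≤ ℓ ^ k
  1≤ℓ^ k = ℕ.≤-trans (ℕ.≤-reflexive (sym (ℕ.^-zeroˡ k))) (ℕ.^-monoˡ-≤ k 1≤ℓ)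

  τ≤ : τ ≤ 2 * ∣ ceiling T ∣
  τ≤ = ℤ.drop‿+≤+ (ℤ→ℚ-cancel (begin
    ℕ→ℚ τ                           ≤⟨ τ≤2T ⟩
    ℕ→ℚ 2 ℚ.* T                     ≤⟨ scale 2 (proj₁ (∣⌈⌉∣-bounds {T} (ℚ.≤-trans (0≤ℕ→ℚ N) N≤T))) ⟩
    ℕ→ℚ 2 ℚ.* ℕ→ℚ ∣ ceiling T ∣     ≡⟨ ℕ→ℚ-* 2 ∣ ceiling T ∣ ⟨
    ℕ→ℚ (2 * ∣ ceiling T ∣)         ∎))
    where open ℚ.≤-Reasoning

  -- The sumset size plus 2 is at most 5τ + 2 ≤ 16 Z, which adds 4 to the logarithm of Z, and 4 ≤
  -- 4ℓ.
  random-log : ⌊log₂ (N * suc (4 * suc d) + 2) ⌋ ≤ 5 * ℓ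
  random-log = begin
    ⌊log₂ (N * suc (4 * suc d) + 2) ⌋   ≤⟨ ⌊log₂⌋-mono-≤ within ⟩
    ⌊log₂ (2 ^ 4 * Z) ⌋                 ≡⟨ log-double 4 Z {{ℕ.>-nonZero (ℕ.≤-trans (s≤s z≤n) (ℕ.m≤n+m 2 (∣ ceiling T ∣ + U)))}} ⟩
    4 + ℓ                               ≤⟨ ℕ.+-monoˡ-≤ ℓ (ℕ.*-monoʳ-≤ 4 1≤ℓ) ⟩
    4 * ℓ + ℓ                           ≡⟨ five ℓ ⟩
    5 * ℓ                               ∎
    where
    open ℕ.≤-Reasoning
    five : ∀ l → 4 * l + l ≡ 5 * l
    five = ℕ-solve-∀
    within : N * suc (4 * suc d) + 2 ≤ 2 ^ 4 * Z
    within = begin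
      N * suc (4 * suc d) + 2        ≤⟨ ℕ.+-monoˡ-≤ 2 (ℕ.*-monoʳ-≤ N (ℕ.+-monoˡ-≤ (4 * suc d) (s≤s z≤n))) ⟩
      N * (suc d + 4 * suc d) + 2    ≡⟨ regroup N (suc d) ⟩
      5 * τ + 2                      ≤⟨ ℕ.+-monoˡ-≤ 2 (ℕ.*-monoʳ-≤ 5 τ≤) ⟩
      5 * (2 * ∣ ceiling T ∣) + 2    ≤⟨ ℕ.m≤m+n _ (6 * ∣ ceiling T ∣ + 16 * U + 30) ⟩
      5 * (2 * ∣ ceiling T ∣) + 2 + (6 * ∣ ceiling T ∣ + 16 * U + 30) ≡⟨ total ∣ ceiling T ∣ U ⟩
      16 * Z                         ∎
      where
      regroup : ∀ N d → N * (d + 4 * d) + 2 ≡ 5 * (N * d) + 2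
      regroup = ℕ-solve-∀
      total : ∀ t U → 5 * (2 * t) + 2 + (6 * t + 16 * U + 30) ≡ 16 * (t + U + 2)
      total = ℕ-solve-∀

  -- From W ≤ Z^330 the logarithm of W is at most 330 (1 + ℓ) ≤ 660 ℓ; the universe term W + 3 ≤ 4W
  -- adds 2 ≤ 2ℓ.
  deterministic-log : ∀ V W → V ≤ Z → 1 ≤ W → W ≤ V ^ 330 → ⌊log₂ (suc W + 2) ⌋ ≤ 662 * ℓ
  deterministic-log V W V≤Z 1≤W W≤ = begin
    ⌊log₂ (suc W + 2) ⌋          ≤⟨ ⌊log₂⌋-mono-≤ quadruple ⟩
    ⌊log₂ (2 ^ 2 * W) ⌋          ≡⟨ log-double 2 W {{ℕ.>-nonZero 1≤W}} ⟩
    2 + ⌊log₂ W ⌋                ≤⟨ ℕ.+-monoʳ-≤ 2 (⌊log₂⌋-mono-≤ (ℕ.≤-trans W≤ (ℕ.^-monoˡ-≤ 330 V≤Z))) ⟩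
    2 + ⌊log₂ (Z ^ 330) ⌋        ≤⟨ ℕ.+-monoʳ-≤ 2 (log-^ Z 330) ⟩
    2 * 1 + (1 + ℓ) * 330        ≤⟨ ℕ.+-mono-≤ (ℕ.*-monoʳ-≤ 2 1≤ℓ) (ℕ.*-monoˡ-≤ 330 (ℕ.+-monoˡ-≤ ℓ 1≤ℓ)) ⟩
    2 * ℓ + (ℓ + ℓ) * 330        ≡⟨ total ℓ ⟩
    662 * ℓ                      ∎
    where
    open ℕ.≤-Reasoning
    quadruple : suc W + 2 ≤ 2 ^ 2 * W
    quadruple = ℕ.≤-trans (ℕ.≤-reflexive (cong suc (ℕ.+-comm W 2))) (ℕ.≤-trans (ℕ.+-monoˡ-≤ W (ℕ.*-monoʳ-≤ 3 1≤W)) (ℕ.≤-reflexive (four W)))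
      where
      four : ∀ W → 3 * W + W ≡ 4 * W
      four = ℕ-solve-∀
    total : ∀ l → 2 * l + (l + l) * 330 ≡ 662 * l
    total = ℕ-solve-∀

  factor-random : ∀ {L} → L ≤ 5 * ℓ → 230 + c * L ≤ κ₀ * ℓ ^ suc e
  factor-random {L} h = begin
    230 + c * L                           ≤⟨ ℕ.+-mono-≤ (ℕ.*-monoʳ-≤ 230 (1≤ℓ^ (suc e))) (ℕ.*-monoʳ-≤ c (ℕ.≤-trans h (ℕ.*-monoʳ-≤ 5 (ℕ.m≤m*n ℓ (ℓ ^ e) {{ℕ.>-nonZero (1≤ℓ^ e)}})))) ⟩
    230 * ℓ ^ suc e + c * (5 * ℓ ^ suc e) ≡⟨ regroup c (ℓ ^ suc e) ⟩
    (230 + 5 * c) * ℓ ^ suc e             ≤⟨ ℕ.*-monoˡ-≤ (ℓ ^ suc e) (ℕ.m≤m+n (230 + 5 * c) (c * 662 ^ e)) ⟩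
    κ₀ * ℓ ^ suc e                        ∎
    where
    open ℕ.≤-Reasoning
    regroup : ∀ c p → 230 * p + c * (5 * p) ≡ (230 + 5 * c) * p
    regroup = ℕ-solve-∀

  factor-deterministic : ∀ {L} → L ≤ 662 * ℓ → 230 + c * L ^ e ≤ κ₀ * ℓ ^ suc e
  factor-deterministic {L} h = begin
    230 + c * L ^ e                              ≤⟨ ℕ.+-mono-≤ (ℕ.*-monoʳ-≤ 230 (1≤ℓ^ (suc e))) (ℕ.*-monoʳ-≤ c power) ⟩
    230 * ℓ ^ suc e + c * (662 ^ e * ℓ ^ suc e)  ≡⟨ regroup c (662 ^ e) (ℓ ^ suc e) ⟩
    (230 + c * 662 ^ e) * ℓ ^ suc e              ≤⟨ ℕ.*-monoˡ-≤ (ℓ ^ suc e) (ℕ.+-monoˡ-≤ (c * 662 ^ e) (ℕ.m≤m+n 230 (5 * c))) ⟩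
    κ₀ * ℓ ^ suc e                               ∎
    where
    open ℕ.≤-Reasoning
    power : L ^ e ≤ 662 ^ e * ℓ ^ suc e
    power = begin
      L ^ e                 ≤⟨ ℕ.^-monoˡ-≤ e h ⟩
      (662 * ℓ) ^ e         ≡⟨ ^-distribʳ-* 662 ℓ e ⟩
      662 ^ e * ℓ ^ e       ≤⟨ ℕ.*-monoʳ-≤ (662 ^ e) (ℕ.m≤n*m (ℓ ^ e) ℓ {{ℕ.>-nonZero 1≤ℓ}}) ⟩
      662 ^ e * ℓ ^ suc e   ∎
    regroup : ∀ c q p → 230 * p + c * (q * p) ≡ (230 + c * q) * p
    regroup = ℕ-solve-∀

  C E : ℕ
  C = 450 * κ₀
  E = suc (suc e)

  -- 225 is the product of 15 from `program-ok`, 3 from the number of levels and 5 from 1 + 4 (d +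
  -- 1) ≤ 5 (d + 1); it doubles to 450 because N (d + 1) ≤ 2T. The number of levels accounts for the
  -- last unit of the exponent.
  total-cost : ∀ n L′ → suc n ≤ N → 230 + c * L′ ≤ κ₀ * ℓ ^ suc e →
    ℕ→ℚ (15 * ((2 + ⌊log₂ suc n ⌋) * (N * (suc (4 * suc d) * (230 + c * L′))))) ℚ.≤ softO C E U T
  total-cost n L′ n<N factor = begin
    ℕ→ℚ (15 * ((2 + ⌊log₂ suc n ⌋) * (N * (suc (4 * suc d) * (230 + c * L′)))))
      ≤⟨ ℕ→ℚ-mono bound ⟩
    ℕ→ℚ (225 * κ₀ * ℓ ^ E * τ)              ≡⟨ ℕ→ℚ-* (225 * κ₀ * ℓ ^ E) τ ⟩
    ℕ→ℚ (225 * κ₀ * ℓ ^ E) ℚ.* ℕ→ℚ τ        ≤⟨ scale (225 * κ₀ * ℓ ^ E) τ≤2T ⟩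
    ℕ→ℚ (225 * κ₀ * ℓ ^ E) ℚ.* (ℕ→ℚ 2 ℚ.* T) ≡⟨ ℚ.*-assoc (ℕ→ℚ (225 * κ₀ * ℓ ^ E)) (ℕ→ℚ 2) T ⟨
    ℕ→ℚ (225 * κ₀ * ℓ ^ E) ℚ.* ℕ→ℚ 2 ℚ.* T  ≡⟨ cong (λ z → z ℚ.* T) (ℕ→ℚ-* (225 * κ₀ * ℓ ^ E) 2) ⟨
    ℕ→ℚ (225 * κ₀ * ℓ ^ E * 2) ℚ.* T        ≡⟨ cong (λ z → ℕ→ℚ z ℚ.* T) (twice κ₀ (ℓ ^ E)) ⟩
    softO C E U T                           ∎
    where
    open ℚ.≤-Reasoning
    twice : ∀ k p → 225 * k * p * 2 ≡ 450 * k * p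
    twice = ℕ-solve-∀
    rounds : 2 + ⌊log₂ suc n ⌋ ≤ 3 * ℓ
    rounds = ℕ.≤-trans (ℕ.+-mono-≤ (ℕ.*-monoʳ-≤ 2 1≤ℓ) (⌊log₂⌋-mono-≤ {suc n} {Z} (ℕ.≤-trans n<N (ℕ.≤-trans N≤⌈T⌉ (ℕ.≤-trans (ℕ.m≤m+n _ U) (ℕ.m≤m+n _ 2))))))
      (ℕ.≤-reflexive (three ℓ))
      where
      three : ∀ l → 2 * l + l ≡ 3 * l
      three = ℕ-solve-∀
    bound : 15 * ((2 + ⌊log₂ suc n ⌋) * (N * (suc (4 * suc d) * (230 + c * L′)))) ≤ 225 * κ₀ * ℓ ^ E * τ
    bound = ℕ.≤-trans (ℕ.*-monoʳ-≤ 15 (ℕ.*-mono-≤ rounds (ℕ.*-monoʳ-≤ N (ℕ.*-mono-≤ (ℕ.+-monoˡ-≤ (4 * suc d) (s≤s (z≤n {d}))) factor))))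
      (ℕ.≤-reflexive (regroup ℓ N (suc d) κ₀ (ℓ ^ suc e)))
      where
      regroup : ∀ l N d k p → 15 * (3 * l * (N * ((d + 4 * d) * (k * p)))) ≡ 225 * k * (l * p) * (N * d)
      regroup = ℕ-solve-∀

-- Assembling the program, its word size and its cost.

module Solution {n m : ℕ} (f : Vector ℤ (suc n)) (g : Vector ℤ (suc m))
  (F : Vector ℚ (suc n)) (G : Vector ℚ (suc m)) (Δf Δg : ℚ) (M : ℕ)
  (F-convex : Convex F) (G-convex : Convex G)
  (f-approx : ApproximatedBy f F Δf) (g-approx : ApproximatedBy g G Δg)
  (f≤M : BoundedBy M f) (g≤M : BoundedBy M g)
  (W : ℕ) (W≡ : W ≡ (n + m + 2 + M) ^ 330) where

  N V B d d₀ : ℕ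
  N  = n + m + 2
  V  = N + M
  B  = V ^ 11
  d₀ = ∣ ceiling Δf ∣ ℕ.⊔ ∣ ceiling Δg ∣
  d  = d₀ ℕ.⊓ (2 * M)

  D T : ℚ
  D = Δf ℚ.+ Δg
  T = ℕ→ℚ N ℚ.* (D ℚ.+ 1ℚ)

  module f̂ = Arrays f F Δf F-convex f-approx
  module ĝ = Arrays g G Δg G-convex g-approx

  2≤N : 2 ≤ N
  2≤N = ℕ.m≤n+m 2 (n + m)

  2≤V : 2 ≤ V
  2≤V = ℕ.≤-trans 2≤N (ℕ.m≤m+n N M)

  large : 2 * ((2 * N) * suc (4 * (N * (M * M))) + M + N * (M * M)) +
    (16 * (N * suc (3 * M)) + N * suc (4 * suc (2 * M))) ≤ B
  large = large≤V^11 N M V (ℕ.m≤m+n N M) (ℕ.m≤n+m M N) 2≤V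

  4≤B : 4 ≤ B
  4≤B = ℕ.≤-trans (ℕ.^-monoˡ-≤ 2 2≤V) (ℕ.^-monoʳ-≤ V {{ℕ.>-nonZero (ℕ.≤-trans (s≤s z≤n) 2≤V)}} {2} {11} (s≤s (s≤s z≤n)))

  -- The exponent 330 is 11 * 30: 11 for stored numbers, 30 for the size of expressions.
  B^≤W : ∀ k → k ≤ 30 → B ^ k ≤ W
  B^≤W k h = ℕ.≤-trans (ℕ.≤-reflexive (ℕ.^-*-assoc V 11 k))
    (ℕ.≤-trans (ℕ.^-monoʳ-≤ V {{ℕ.>-nonZero (ℕ.≤-trans (s≤s z≤n) 2≤V)}} {11 * k} {330} (ℕ.*-monoʳ-≤ 11 h)) (ℕ.≤-reflexive (sym W≡)))

  -- The value 2M is always admissible for d and keeps the numbers polynomial.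
  near-convex : ∀ {n} (h : ℕ → ℤ) → (∀ i → ∣ h i ∣ ≤ M) → Scan.NearConvex h n d₀ → Scan.NearConvex h n d
  near-convex {n} h small near = [ (λ e → subst (Scan.NearConvex h n) (sym e) near) ,
                                   (λ e → subst (Scan.NearConvex h n) (sym e) (Scan.bounded⇒near h (λ i _ → small i))) ]′ (ℕ.⊓-sel d₀ (2 * M))

  module Run (c L Smax : ℕ) (Nw≤Smax : N * suc (4 * suc d) ≤ Smax) where

    private
      f-bounded : ∀ i → ∣ extend f i ∣ ≤ M
      f-bounded = extend-bounded f f≤M

      g-bounded : ∀ j → ∣ extend g j ∣ ≤ M
      g-bounded = extend-bounded g g≤M

      f-near : Scan.NearConvex (extend f) n d
      f-near = near-convex (extend f) f-bounded
        (f̂.near-convex d₀ (ℚ.≤-trans (proj₁ (∣⌈⌉∣-bounds f̂.Δ≥0)) (ℕ→ℚ-mono (ℕ.m≤m⊔n ∣ ceiling Δf ∣ ∣ ceiling Δg ∣))))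

      g-near : Scan.NearConvex (extend g) m d
      g-near = near-convex (extend g) g-bounded
        (ĝ.near-convex d₀ (ℚ.≤-trans (proj₁ (∣⌈⌉∣-bounds ĝ.Δ≥0)) (ℕ→ℚ-mono (ℕ.m≤n⊔m ∣ ceiling Δf ∣ ∣ ceiling Δg ∣))))

    γ : ℕ
    γ = (2 + ⌊log₂ suc n ⌋) * (N * (suc (4 * suc d) * (230 + c * L)))

    limits : Limits
    limits = record { W = W ; B = B ; c = c ; L = L ; Smax = Smax ; 4≤B = 4≤B ; B^≤W = B^≤W }

    setting : Setting
    setting = record
      { limits = limits ; n = n ; m = m ; M = M ; dev = d ; large = large
      ; fA = extend f ; gA = extend g ; fA≤M = f-bounded ; gA≤M = g-bounded
      ; dev≤2M = ℕ.m⊓n≤n d₀ (2 * M) ; f-near = f-near ; g-near = g-near ; Nw≤Smax = Nw≤Smax }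

    Exec : (State → Set) → ℕ → Config → Set
    Exec = Logic.Exec limits

    Bounded Solved : State → Set
    Bounded = Logic.Bounded limits
    Solved  = Algorithm.Solved setting

    V≤B : ∀ {x} → x ≤ V → x ≤ B
    V≤B h = ℕ.≤-trans h (ℕ.m≤m*n V (V ^ 10) {{ℕ.m^n≢0 V 10 {{ℕ.>-nonZero (ℕ.≤-trans (s≤s z≤n) 2≤V)}}}})

    initially-bounded : Bounded (initial f g)
    initially-bounded = variables , cells
      where
      variables : ∀ x → ∣ vars (initial f g) x ∣ ≤ B
      variables 0             = V≤B (ℕ.≤-trans (ℕ.≤-trans (ℕ.m≤m+n n m) (ℕ.m≤m+n (n + m) 2)) (ℕ.m≤m+n N M))
      variables 1             = V≤B (ℕ.≤-trans (ℕ.≤-trans (ℕ.m≤n+m m n) (ℕ.m≤m+n (n + m) 2)) (ℕ.m≤m+n N M))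
      variables (suc (suc _)) = z≤n
      cells : ∀ a i → ∣ arrays (initial f g) a i ∣ ≤ B
      cells 0             i = V≤B (ℕ.≤-trans (extend-bounded f f≤M i) (ℕ.m≤n+m M N))
      cells 1             i = V≤B (ℕ.≤-trans (extend-bounded g g≤M i) (ℕ.m≤n+m M N))
      cells (suc (suc _)) i = z≤n

    executes : Exec (λ σ → Bounded σ × Solved σ) (15 * γ) (program ∷ [] , initial f g)
    executes = Logic.exec (Algorithm.program-ok setting (refl , refl , refl , refl) refl refl (λ _ → refl) ((λ _ → refl) , λ _ → refl)) initially-bounded

    solution : ∀ {σ} → Solved σ → IsMinPlusConvolution f g (result σ)
    solution {σ} (reached , minimal) k = below , attained
      where
      below : ∀ i j → toℕ i + toℕ j ≡ toℕ k → result σ k ℤ.≤ f i ℤ.+ g j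
      below i j e = subst₂ ℤ._≤_ (cong (arrays σ 2) e) (cong₂ ℤ._+_ (extend-toℕ f i) (extend-toℕ g j))
        (minimal (toℕ i) (toℕ j) (ℕ.≤-pred (Fin.toℕ<n i)) (ℕ.≤-pred (Fin.toℕ<n j)))
      attained : ∃₂ λ i j → toℕ i + toℕ j ≡ toℕ k × result σ k ≡ f i ℤ.+ g j
      attained = convert (reached (toℕ k) (ℕ.≤-pred (Fin.toℕ<n k)))
        where
        convert : (∃₂ λ i j → i ≤ n × j ≤ m × i + j ≡ toℕ k × result σ k ≡ extend f i ℤ.+ extend g j) →
                  ∃₂ λ i j → toℕ i + toℕ j ≡ toℕ k × result σ k ≡ f i ℤ.+ g j
        convert (i , j , i≤n , j≤m , e , eq) = i′ , j′ ,
          trans (cong₂ _+_ ei ej) e ,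
          trans eq (cong₂ ℤ._+_ (trans (cong (extend f) (sym ei)) (extend-toℕ f i′)) (trans (cong (extend g) (sym ej)) (extend-toℕ g j′)))
          where
          i′ = fromℕ< (s≤s i≤n)
          j′ = fromℕ< (s≤s j≤m)
          ei = Fin.toℕ-fromℕ< (s≤s i≤n)
          ej = Fin.toℕ-fromℕ< (s≤s j≤m)

  D≥0 : 0ℚ ℚ.≤ D
  D≥0 = ℚ.+-mono-≤ f̂.Δ≥0 ĝ.Δ≥0

  N≤T : ℕ→ℚ N ℚ.≤ T
  N≤T = ℚ.≤-trans (ℚ.≤-reflexive (sym (ℚ.*-identityʳ (ℕ→ℚ N))))
    (scale N (ℚ.≤-trans (ℚ.≤-reflexive (sym (ℚ.+-identityˡ 1ℚ))) (ℚ.+-monoˡ-≤ 1ℚ D≥0)))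

  -- Both Δ are nonnegative, so each is at most D, and rounding up adds at most 1.
  d≤D+1 : ℕ→ℚ d ℚ.≤ D ℚ.+ 1ℚ
  d≤D+1 = ℚ.≤-trans (ℕ→ℚ-mono (ℕ.m⊓n≤m d₀ (2 * M)))
    ([ (λ e → subst (λ x → ℕ→ℚ x ℚ.≤ D ℚ.+ 1ℚ) (sym e) (ℚ.≤-trans (proj₂ (∣⌈⌉∣-bounds f̂.Δ≥0))
          (ℚ.+-monoˡ-≤ 1ℚ (ℚ.≤-trans (ℚ.≤-reflexive (sym (ℚ.+-identityʳ Δf))) (ℚ.+-monoʳ-≤ Δf ĝ.Δ≥0))))) ,
       (λ e → subst (λ x → ℕ→ℚ x ℚ.≤ D ℚ.+ 1ℚ) (sym e) (ℚ.≤-trans (proj₂ (∣⌈⌉∣-bounds ĝ.Δ≥0))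
          (ℚ.+-monoˡ-≤ 1ℚ (ℚ.≤-trans (ℚ.≤-reflexive (sym (ℚ.+-identityˡ Δg))) (ℚ.+-monoˡ-≤ Δg f̂.Δ≥0))))) ]′ (ℕ.⊔-sel ∣ ceiling Δf ∣ ∣ ceiling Δg ∣))

  τ≤2T : ℕ→ℚ (N * suc d) ℚ.≤ ℕ→ℚ 2 ℚ.* T
  τ≤2T = begin
    ℕ→ℚ (N * suc d)                            ≡⟨ ℕ→ℚ-* N (suc d) ⟩
    ℕ→ℚ N ℚ.* ℕ→ℚ (suc d)                      ≡⟨ cong (λ z → ℕ→ℚ N ℚ.* z) (ℕ→ℚ-+ 1 d) ⟩
    ℕ→ℚ N ℚ.* (1ℚ ℚ.+ ℕ→ℚ d)                   ≤⟨ scale N (ℚ.+-mono-≤ 1≤ d≤D+1) ⟩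
    ℕ→ℚ N ℚ.* ((D ℚ.+ 1ℚ) ℚ.+ (D ℚ.+ 1ℚ))      ≡⟨ ℚ-solve 2 (λ n x → n :* (x :+ x) := (con 1ℚ :+ con 1ℚ) :* (n :* x)) refl (ℕ→ℚ N) (D ℚ.+ 1ℚ) ⟩
    ℕ→ℚ 2 ℚ.* T                                ∎
    where
    open ℚ.≤-Reasoning
    1≤ : 1ℚ ℚ.≤ D ℚ.+ 1ℚ
    1≤ = ℚ.≤-trans (ℚ.≤-reflexive (sym (ℚ.+-identityˡ 1ℚ))) (ℚ.+-monoˡ-≤ 1ℚ D≥0)

  n<N : suc n ≤ N
  n<N = ℕ.≤-trans (s≤s (ℕ.m≤m+n n m)) (ℕ.m<m+n (n + m) (s≤s z≤n))

  open Machine W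

  relax : ∀ {respond Q Q′ b b′ C} → b ℚ.≤ b′ → (∀ {σ} → Q σ → Q′ σ) →
    Randomized.ExpectedRun respond Q b C → Randomized.ExpectedRun respond Q′ b′ C
  relax b≤ h (Randomized.done q 0≤b)      = Randomized.done (h q) (ℚ.≤-trans 0≤b b≤)
  relax b≤ h (Randomized.step s r le)     = Randomized.step s (relax ℚ.≤-refl h r) (ℚ.≤-trans le b≤)
  relax b≤ h (Randomized.call b′ s r le)  = Randomized.call b′ s (λ i → relax ℚ.≤-refl h (r i)) (λ k → ℚ.≤-trans (le k) b≤)

  module _ (c e : ℕ) where

    randomized : (oracle : RandomizedConvolution W c) →
      Randomized.ExpectedRun (RandomizedConvolution.respond oracle)
        (λ σ → IsMinPlusConvolution f g (result σ))
        (softO (450 * (230 + 5 * c + c * 662 ^ e)) (suc (suc e)) 0 T) (program ∷ [] , initial f g)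
    randomized oracle = relax (total-cost n L n<N (factor-random random-log)) (λ {σ} p → solution {σ} (proj₂ p))
      (Transfer.Randomly.expected W B c Smax 4≤B B^≤W oracle executes)
      where
      Smax L : ℕ
      Smax = N * suc (4 * suc d)
      L    = ⌊log₂ (Smax + 2) ⌋
      open Cost c e 0 N d T 2≤N N≤T τ≤2T
      open Run c L Smax ℕ.≤-refl

    deterministic : (oracle : DeterministicConvolution c e) →
      ∃₂ λ (t : ℕ) (σ : State) →
        Deterministic.Run (DeterministicConvolution.respond oracle) t (program ∷ [] , initial f g) σ
        × IsMinPlusConvolution f g (result σ)
        × ℕ→ℚ t ℚ.≤ softO (450 * (230 + 5 * c + c * 662 ^ e)) (suc (suc e)) M T
    deterministic oracle = convert (Transfer.Deterministically.halts W B c Smax 4≤B B^≤W oracle executes)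
      where
      Smax L : ℕ
      Smax = N * suc (4 * suc d)
      L    = ⌊log₂ (suc W + 2) ⌋ ^ e
      open Cost c e M N d T 2≤N N≤T τ≤2T
      open Run c L Smax ℕ.≤-refl
      V≤Z : V ≤ Z
      V≤Z = ℕ.≤-trans (ℕ.+-monoˡ-≤ M N≤⌈T⌉) (ℕ.m≤m+n _ 2)
      convert : (∃₂ λ t σ → Deterministic.Run (DeterministicConvolution.respond oracle) t (program ∷ [] , initial f g) σ ×
                  (Bounded σ × Solved σ) × t ≤ 15 * γ) → _
      convert (t , σ , run , (_ , solved) , t≤) = t , σ , run , solution {σ} solved ,
        ℚ.≤-trans (ℕ→ℚ-mono t≤) (total-cost n L n<N (factor-deterministic (deterministic-log V W V≤Z (B^≤W 0 z≤n) (ℕ.≤-reflexive W≡))))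

theorem23 : ∃₂ λ (P : Cmd) (w : ℕ) →
    ∀ (c e : ℕ) → ∃₂ λ (C E : ℕ) →
    ∀ {n m : ℕ} (f : Vector ℤ (suc n)) (g : Vector ℤ (suc m))
    (F : Vector ℚ (suc n)) (G : Vector ℚ (suc m)) (Δf Δg : ℚ) (M : ℕ) →
    Convex F → Convex G → ApproximatedBy f F Δf → ApproximatedBy g G Δg →
    BoundedBy M f → BoundedBy M g →
    let D = Δf ℚ.+ Δg
        N = n + m + 2
        T = ℕ→ℚ N ℚ.* (D ℚ.+ 1ℚ)
        W = (N + M) ^ w
        open Machine W
    in
    ((conv : RandomizedConvolution W c) →
    Randomized.ExpectedRun (RandomizedConvolution.respond conv)
    (λ σ → IsMinPlusConvolution f g (result σ))
    (softO C E 0 T) (P ∷ [] , initial f g))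
    ×
    ((conv : DeterministicConvolution c e) →
    ∃₂ λ (t : ℕ) (σ : State) →
    Deterministic.Run (DeterministicConvolution.respond conv)
    t (P ∷ [] , initial f g) σ
    × IsMinPlusConvolution f g (result σ)
    × ℕ→ℚ t ℚ.≤ softO C E M T)
theorem23 = program , 330 , λ c e → 450 * (230 + 5 * c + c * 662 ^ e) , suc (suc e) ,
  λ f g F G Δf Δg M F-convex G-convex f-approx g-approx f≤M g≤M →
    let open Solution f g F G Δf Δg M F-convex G-convex f-approx g-approx f≤M g≤M _ refl in
    randomized c e , deterministic c e
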